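{- For integers $r\ge 3$, $n\ge 1$ and $k\ge 2$, let $f^{(r)}(n;(r-2)k+2,k)$ denote the maximum number of edges in an $r$-uniform hypergraph on $n$ vertices in which every $k$ distinct edges span more than $(r-2)k+2$ vertices. Then for every even integer $k\ge 4$ and every integer $r\ge 2+\sqrt{\tfrac{3}{2}k-4}$, the limit $\pi(r,k):=\lim_{n\to\infty} n^{ -2} f^{(r)}(n;(r-2)k+2,k)$ exists and $$\pi(r,k)=\frac{1}{r^2-r}.$$
   Context: An $r$-uniform hypergraph ($r$-graph) consists of a vertex set and a set of $r$-element subsets of it (edges). "Every $k$ distinct edges span more than $s$ vertices" means the union of any $k$ distinct edges has more than $s$ elements. -}

module Defs where

open import Data.Nat using (ℕ; zero; suc; _*_; _≤_; _<_)
open import Data.Fin using (Fin)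
open import Data.Fin.Subset using (Subset; ⋃; ∣_∣)
open import Data.List using (List; length; lookup; map; allFin)
open import Data.List.Relation.Unary.All using (All)
open import Data.List.Relation.Unary.Unique.Propositional using (Unique)
open import Data.Product using (Σ; _×_)
open import Data.Integer using (+_)
open import Data.Rational using (ℚ; _/_; 0ℚ)
open import Relation.Binary.PropositionalEquality using (_≡_)
open import Function.Definitions using (Injective)

record Hypergraph (r n : ℕ) : Set where
  field
    edges   : List (Subset n)
    uniform : All (λ e → ∣ e ∣ ≡ r) edges
    simple  : Unique edges
open Hypergraph public

numEdges : ∀ {r n} → Hypergraph r n → ℕ
numEdges H = length (edges H)

span : ∀ {r n k} (H : Hypergraph r n) → (Fin k → Fin (numEdges H)) → Subset n
span {k = k} H g = ⋃ (map (λ i → lookup (edges H) (g i)) (allFin k))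

KSpanMore : ∀ {r n} → ℕ → ℕ → Hypergraph r n → Set
KSpanMore s k H =
  (g : Fin k → Fin (numEdges H)) → Injective _≡_ _≡_ g → s < ∣ span H g ∣

IsMaxEdges : (r n s k m : ℕ) → Set
IsMaxEdges r n s k m =
  Σ (Hypergraph r n) (λ H → KSpanMore s k H × numEdges H ≡ m)
  × ((H : Hypergraph r n) → KSpanMore s k H → numEdges H ≤ m)

frac : ℕ → ℕ → ℚ
frac a zero    = 0ℚ
frac a (suc d) = (+ a) / suc d

{-# OPTIONS --safe #-}
-- Write a = r - 2, and call a set Q of edges tight if |⋃ Q| ≤ a |Q| + 2 and dense if |⋃ Q| ≤ a |Q| + 1.
--
-- Upper bound. Suppose first that no two or three edges are dense. Two edges sharing two vertices cross in a² pairs of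
-- vertices, and at most k - 3 of these lie in an edge, since otherwise k edges would be tight; as a² ≥ 3k/2 - 4, at least
-- k/2 - 1 crossing pairs are uncovered. Conversely an uncovered pair is crossed at most k/2 - 1 times, again because k edges
-- would be tight. Hence the pairs covered more than once are paid for by uncovered ones, and r (r - 1) |E| ≤ n². In general,
-- enlarge a dense set to a maximal one and remove its vertices: by maximality each edge touching it claims a vertices of
-- its own outside, so the removals cost O(n) edges altogether.
--
-- Lower bound. Select blocks one at a time, avoiding shared pairs and minimal tight configurations of at least three blocks.
-- Every block carries a weight, which drops to 0 when the block is killed and is otherwise multiplied by a factor that
-- compensates for the risk. The random process that selects blocks with probability proportional to the weights is
-- derandomised by a potential built from the weighted numbers of conflicts and of dense configurations, the squared
-- excesses of the degrees of pairs, and minus the total weight. Second-order effects are charged to dense configurations,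
-- of which there are few by a first-moment count.
module Submission where

-- A deletion argument would lose a fixed fraction of the pairs, whereas the limit asks for nearly
-- all of them. The compensated weights keep the total weight near its initial value
-- n(n-1)/(r(r-1)), although ever fewer blocks stay available. The degree of a still uncovered pair
-- must then grow: each step covers the pair with probability degree / total, and the mean is kept
-- by the surviving case. So the degree threshold θ follows θ + θ²ν, like 1 / (1 - t). This blows up
-- at the end, hence the selection stops at the fraction s / (s + 2); all constants depend on a, k,
-- s only, and s is sent to infinity afterwards. Density enters because |⋃ Q| - a |Q| is submodular:
-- a block that kills two blocks at once glues minimal tight configurations into a dense one. In
-- expected weight the dense ones are O(n), the tight ones O(n²). In the upper bound, a² - (k - 3)
-- uncovered crossing pairs reach k/2 - 1 exactly under the hypothesis on r, and evenness lets k/2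
-- crossings of one pair make exactly k edges.

module OrderedFields where
  open import Data.Nat as ℕ using (ℕ; zero; suc)
  import Data.Nat.Properties as ℕₚ
  open import Data.List using (List; []; _∷_; _++_; map; filter; length; concatMap)
  open import Data.List.Membership.Propositional using (_∈_)
  open import Data.List.Relation.Unary.Any using (here; there)
  open import Data.List.Relation.Unary.All as All using ([]; _∷_)
  open import Data.List.Relation.Unary.AllPairs using ([]; _∷_)
  open import Data.List.Relation.Unary.Unique.Propositional using (Unique)
  open import Data.Product using (∃; _×_; _,_)
  open import Data.Sum using (_⊎_; inj₁; inj₂)
  open import Data.Empty using (⊥-elim)
  open import Data.Maybe using (Maybe; just; nothing)
  open import Relation.Nullary using (¬_; Dec; yes; no)
  open import Relation.Binary.PropositionalEquality hiding ([_])
  open import Algebra.Bundles using (CommutativeRing; RawRing)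
  open import Algebra.Structures using (IsCommutativeRing)
  open import Relation.Binary.Structures using (IsTotalOrder)
  import Algebra.Solver.Ring.AlmostCommutativeRing as ACR
  import Algebra.Solver.Ring

  -- Ordered fields, finite sums and products.

  record OrderedField : Set₁ where
    infixl 6 _+_
    infixl 7 _*_
    infix 8 -_
    infix 4 _≤_
    field
      Carrier : Set
      _+_ _*_ : Carrier → Carrier → Carrier
      -_ : Carrier → Carrier
      0# 1# : Carrier
      isCommutativeRing : IsCommutativeRing _≡_ _+_ _*_ -_ 0# 1#
      _≤_ : Carrier → Carrier → Set
      isTotalOrder : IsTotalOrder _≡_ _≤_
      _≤?_ : ∀ x y → Dec (x ≤ y)
      +-monoʳ-≤ : ∀ x {y z} → y ≤ z → x + y ≤ x + z
      *-nonneg : ∀ {x y} → 0# ≤ x → 0# ≤ y → 0# ≤ x * y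
      1≰0 : ¬ (1# ≤ 0#)
      inverse : ∀ {x} → ¬ (x ≤ 0#) → ∃ λ y → x * y ≡ 1#

  module FieldTheory (F : OrderedField) where
    open OrderedField F public
    open IsCommutativeRing isCommutativeRing public
      using (+-assoc; +-comm; +-identityˡ; +-identityʳ; *-assoc; *-comm; *-identityˡ; *-identityʳ;
             zeroˡ; zeroʳ; distribˡ; distribʳ; -‿inverseˡ; -‿inverseʳ)
    open IsTotalOrder isTotalOrder public
      using () renaming (refl to ≤-refl; reflexive to ≤-reflexive; trans to ≤-trans; antisym to ≤-antisym; total to ≤-total)

    commutativeRing : CommutativeRing _ _
    commutativeRing = record { isCommutativeRing = isCommutativeRing }

    infixl 6 _-_
    _-_ : Carrier → Carrier → Carrier
    x - y = x + - y

    -- The separate clause for 1 makes `ι 1` equal to `1#` by definition, so that the solver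
    -- constant `con (1 , 0)` matches a literal `1#`.
    ι : ℕ → Carrier
    ι zero = 0#
    ι (suc zero) = 1#
    ι (suc (suc n)) = 1# + ι (suc n)

    ι-suc : ∀ n → ι (suc n) ≡ 1# + ι n
    ι-suc zero = sym (+-identityʳ 1#)
    ι-suc (suc n) = refl

    open import Algebra.Properties.Ring (CommutativeRing.ring commutativeRing)
      using (-‿distribˡ-*; -‿distribʳ-*; -‿involutive; -0#≈0#; -‿+-comm)
    open import Algebra.Properties.CommutativeSemigroup (CommutativeRing.+-commutativeSemigroup commutativeRing)
      using () renaming (interchange to +-interchange)

    ι-+ : ∀ m n → ι (m ℕ.+ n) ≡ ι m + ι n
    ι-+ zero n = sym (+-identityˡ _)
    ι-+ (suc m) n = trans (ι-suc (m ℕ.+ n)) (trans (cong (1# +_) (ι-+ m n))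
      (trans (sym (+-assoc _ _ _)) (cong (_+ ι n) (sym (ι-suc m)))))

    ι-* : ∀ m n → ι (m ℕ.* n) ≡ ι m * ι n
    ι-* zero n = sym (zeroˡ _)
    ι-* (suc m) n = trans (ι-+ n (m ℕ.* n))
      (trans (cong₂ _+_ (sym (*-identityˡ _)) (ι-* m n)) (trans (sym (distribʳ _ _ _)) (cong (_* ι n) (sym (ι-suc m)))))

    -- Coefficients of the ring solver: (m , n) stands for m - n, with one of m and n equal to 0.
    private
      reduce : ℕ → ℕ → ℕ × ℕ
      reduce (suc m) (suc n) = reduce m n
      reduce m n = (m , n)

      Coeff : RawRing _ _
      Coeff = record
        { Carrier = ℕ × ℕ ; _≈_ = _≡_
        ; _+_ = λ (m , n) (p , q) → reduce (m ℕ.+ p) (n ℕ.+ q)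
        ; _*_ = λ (m , n) (p , q) → reduce (m ℕ.* p ℕ.+ n ℕ.* q) (m ℕ.* q ℕ.+ n ℕ.* p)
        ; -_ = λ (m , n) → (n , m) ; 0# = (0 , 0) ; 1# = (1 , 0) }

      difference : ℕ × ℕ → Carrier
      difference (m , n) = ι m - ι n

      *-difference : ∀ x y z w → (x * z + y * w) - (x * w + y * z) ≡ (x - y) * (z - w)
      *-difference x y z w = begin
        (x * z + y * w) - (x * w + y * z)          ≡⟨ cong ((x * z + y * w) +_) (sym (-‿+-comm _ _)) ⟩
        (x * z + y * w) + (- (x * w) + - (y * z))  ≡⟨ cong ((x * z + y * w) +_) (+-comm _ _) ⟩
        (x * z + y * w) + (- (y * z) + - (x * w))  ≡⟨ +-interchange _ _ _ _ ⟩
        (x * z - y * z) + (y * w - x * w)          ≡⟨ cong₂ _+_ (cong (x * z +_) (-‿distribˡ-* y z)) lemma ⟩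
        (x * z + - y * z) + (x * - w + - y * - w)  ≡⟨ cong₂ _+_ (sym (distribʳ z x (- y))) (sym (distribʳ (- w) x (- y))) ⟩
        (x - y) * z + (x - y) * - w                ≡⟨ sym (distribˡ (x - y) z (- w)) ⟩
        (x - y) * (z - w)                          ∎
        where
        open ≡-Reasoning
        lemma : y * w - x * w ≡ x * - w + - y * - w
        lemma = trans (+-comm _ _) (cong₂ _+_ (-‿distribʳ-* x w)
          (trans (cong (_* w) (sym (-‿involutive y))) (trans (sym (-‿distribˡ-* (- y) w)) (-‿distribʳ-* (- y) w))))

      difference-≡ : ∀ {m n p q} → m ℕ.+ q ≡ p ℕ.+ n → difference (m , n) ≡ difference (p , q)
      difference-≡ {m} {n} {p} {q} eq = begin
        ι m - ι n                      ≡⟨ sym (+-identityʳ _) ⟩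
        (ι m - ι n) + 0#               ≡⟨ cong ((ι m - ι n) +_) (sym (-‿inverseʳ (ι q))) ⟩
        (ι m - ι n) + (ι q - ι q)      ≡⟨ +-interchange _ _ _ _ ⟩
        (ι m + ι q) + (- ι n + - ι q)  ≡⟨ cong₂ _+_ (trans (sym (ι-+ m q)) (trans (cong ι eq) (ι-+ p n))) (+-comm _ _) ⟩
        (ι p + ι n) + (- ι q + - ι n)  ≡⟨ +-interchange _ _ _ _ ⟩
        (ι p - ι q) + (ι n - ι n)      ≡⟨ cong ((ι p - ι q) +_) (-‿inverseʳ (ι n)) ⟩
        (ι p - ι q) + 0#               ≡⟨ +-identityʳ _ ⟩
        ι p - ι q                      ∎
        where open ≡-Reasoning

      -- The value is arranged so that (1 , 0) denotes 1# on the nose.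
      value : ℕ × ℕ → Carrier
      value (m , zero) = ι m
      value (m , suc n) = ι m - ι (suc n)

      value≡difference : ∀ x → value x ≡ difference x
      value≡difference (m , zero) = sym (trans (cong (ι m +_) -0#≈0#) (+-identityʳ _))
      value≡difference (m , suc n) = refl

      value-reduce : ∀ m n → value (reduce m n) ≡ difference (m , n)
      value-reduce zero zero = value≡difference (zero , zero)
      value-reduce zero (suc n) = refl
      value-reduce (suc m) zero = value≡difference (suc m , zero)
      value-reduce (suc m) (suc n) = trans (value-reduce m n) (difference-≡ {m} {n} {suc m} {suc n} (ℕₚ.+-suc m n))

      morphism : Coeff ACR.-Raw-AlmostCommutative⟶ ACR.fromCommutativeRing commutativeRing
      morphism = record
        { ⟦_⟧ = value
        ; +-homo = λ x@(m , n) y@(p , q) → trans (value-reduce (m ℕ.+ p) (n ℕ.+ q))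
            (trans (trans (cong₂ _-_ (ι-+ m p) (ι-+ n q))
              (trans (cong ((ι m + ι p) +_) (sym (-‿+-comm _ _))) (+-interchange _ _ _ _)))
            (sym (cong₂ _+_ (value≡difference x) (value≡difference y))))
        ; *-homo = λ x@(m , n) y@(p , q) → trans (value-reduce (m ℕ.* p ℕ.+ n ℕ.* q) (m ℕ.* q ℕ.+ n ℕ.* p))
            (trans (trans
              (cong₂ _-_ (trans (ι-+ (m ℕ.* p) (n ℕ.* q)) (cong₂ _+_ (ι-* m p) (ι-* n q)))
                         (trans (ι-+ (m ℕ.* q) (n ℕ.* p)) (cong₂ _+_ (ι-* m q) (ι-* n p))))
              (*-difference _ _ _ _))
            (sym (cong₂ _*_ (value≡difference x) (value≡difference y))))
        ; -‿homo = λ x@(m , n) → trans (value≡difference (n , m))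
            (trans (trans (+-comm _ _) (trans (cong (- ι m +_) (sym (-‿involutive _))) (-‿+-comm _ _)))
            (cong -_ (sym (value≡difference x))))
        ; 0-homo = refl
        ; 1-homo = refl }

      coeff≟ : ∀ x y → Maybe (value x ≡ value y)
      coeff≟ x@(m , n) y@(p , q) with m ℕ.+ q ℕ.≟ p ℕ.+ n
      ... | yes eq = just (trans (value≡difference x) (trans (difference-≡ {m} {n} {p} {q} eq) (sym (value≡difference y))))
      ... | no _ = nothing

    open Algebra.Solver.Ring Coeff (ACR.fromCommutativeRing commutativeRing) morphism coeff≟ public
      using (solve; _:=_; _:+_; _:*_; _:-_; :-_; con; Polynomial)


    0≤⇒≤ : ∀ {x y} → 0# ≤ y - x → x ≤ y
    0≤⇒≤ {x} {y} h = subst₂ _≤_ (+-identityʳ x) (solve 2 (λ x y → x :+ (y :- x) := y) refl x y) (+-monoʳ-≤ x h)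

    ≤⇒0≤ : ∀ {x y} → x ≤ y → 0# ≤ y - x
    ≤⇒0≤ {x} {y} h = subst₂ _≤_ (-‿inverseˡ x) (+-comm (- x) y) (+-monoʳ-≤ (- x) h)

    ≤-by : ∀ {x y} z → 0# ≤ z → y - x ≡ z → x ≤ y
    ≤-by z h eq = 0≤⇒≤ (subst (0# ≤_) (sym eq) h)

    +-monoˡ-≤ : ∀ z {x y} → x ≤ y → x + z ≤ y + z
    +-monoˡ-≤ z h = subst₂ _≤_ (+-comm _ _) (+-comm _ _) (+-monoʳ-≤ z h)

    +-mono-≤ : ∀ {x y z w} → x ≤ y → z ≤ w → x + z ≤ y + w
    +-mono-≤ {y = y} {z = z} h h' = ≤-trans (+-monoˡ-≤ z h) (+-monoʳ-≤ y h')

    +-nonneg : ∀ {x y} → 0# ≤ x → 0# ≤ y → 0# ≤ x + y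
    +-nonneg {x} {y} h h' = subst (_≤ x + y) (+-identityʳ 0#) (+-mono-≤ h h')

    x≤x+y : ∀ x {y} → 0# ≤ y → x ≤ x + y
    x≤x+y x {y} h = subst (_≤ x + y) (+-identityʳ x) (+-monoʳ-≤ x h)

    x≤y+x : ∀ x {y} → 0# ≤ y → x ≤ y + x
    x≤y+x x {y} h = subst (_≤ y + x) (+-identityˡ x) (+-monoˡ-≤ x h)

    *-monoʳ-≤ : ∀ {z} → 0# ≤ z → ∀ {x y} → x ≤ y → z * x ≤ z * y
    *-monoʳ-≤ {z} hz {x} {y} h = ≤-by _ (*-nonneg hz (≤⇒0≤ h))
      (solve 3 (λ x y z → z :* y :- z :* x := z :* (y :- x)) refl x y z)

    *-monoˡ-≤ : ∀ {z} → 0# ≤ z → ∀ {x y} → x ≤ y → x * z ≤ y * z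
    *-monoˡ-≤ hz h = subst₂ _≤_ (*-comm _ _) (*-comm _ _) (*-monoʳ-≤ hz h)

    *-mono-≤ : ∀ {x y z w} → 0# ≤ x → x ≤ y → 0# ≤ z → z ≤ w → x * z ≤ y * w
    *-mono-≤ hx h hz h' = ≤-trans (*-monoˡ-≤ hz h) (*-monoʳ-≤ (≤-trans hx h) h')

    neg-mono : ∀ {x y} → x ≤ y → - y ≤ - x
    neg-mono {x} {y} h = ≤-by _ (≤⇒0≤ h) (solve 2 (λ x y → (:- x) :- (:- y) := y :- x) refl x y)

    minus-mono : ∀ {x z w y} → x ≤ z → w ≤ y → x - y ≤ z - w
    minus-mono h h' = +-mono-≤ h (neg-mono h')

    ≰⇒≥ : ∀ {x y} → ¬ (x ≤ y) → y ≤ x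
    ≰⇒≥ {x} {y} h with ≤-total x y
    ... | inj₁ q = ⊥-elim (h q)
    ... | inj₂ q = q

    square-nonneg : ∀ x → 0# ≤ x * x
    square-nonneg x with ≤-total 0# x
    ... | inj₁ h = *-nonneg h h
    ... | inj₂ h = subst (0# ≤_) (solve 1 (λ x → (con (0 , 0) :- x) :* (con (0 , 0) :- x) := x :* x) refl x)
                     (*-nonneg (≤⇒0≤ h) (≤⇒0≤ h))

    0≤1 : 0# ≤ 1#
    0≤1 = ≰⇒≥ 1≰0

    ι-nonneg : ∀ n → 0# ≤ ι n
    ι-nonneg zero = ≤-refl
    ι-nonneg (suc n) = subst (0# ≤_) (sym (ι-suc n)) (+-nonneg 0≤1 (ι-nonneg n))

    ι-mono : ∀ {m n} → m ℕ.≤ n → ι m ≤ ι n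
    ι-mono {n = n} ℕ.z≤n = ι-nonneg n
    ι-mono {suc m} {suc n} (ℕ.s≤s h) = subst₂ _≤_ (sym (ι-suc m)) (sym (ι-suc n)) (+-monoʳ-≤ 1# (ι-mono h))

    1≤ι : ∀ {n} → 1 ℕ.≤ n → 1# ≤ ι n
    1≤ι {n} h = ι-mono {1} {n} h

    pos⇒≰0 : ∀ {x} → 1# ≤ x → ¬ (x ≤ 0#)
    pos⇒≰0 h h' = 1≰0 (≤-trans h h')

    cancel-+ˡ-≤ : ∀ x {y z} → x + y ≤ x + z → y ≤ z
    cancel-+ˡ-≤ x {y} {z} h = ≤-by _ (≤⇒0≤ h) (solve 3 (λ x y z → z :- y := (x :+ z) :- (x :+ y)) refl x y z)

    ι-cancel-≤ : ∀ m n → ι m ≤ ι n → m ℕ.≤ n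
    ι-cancel-≤ zero n h = ℕ.z≤n
    ι-cancel-≤ (suc m) zero h = ⊥-elim (pos⇒≰0 (1≤ι {suc m} (ℕ.s≤s ℕ.z≤n)) h)
    ι-cancel-≤ (suc m) (suc n) h = ℕ.s≤s (ι-cancel-≤ m n (cancel-+ˡ-≤ 1# (subst₂ _≤_ (ι-suc m) (ι-suc n) h)))

    inverse-nonneg : ∀ {x y} → ¬ (x ≤ 0#) → x * y ≡ 1# → 0# ≤ y
    inverse-nonneg {x} {y} hx eq with ≤-total 0# y
    ... | inj₁ h = h
    ... | inj₂ h = ⊥-elim (1≰0 (subst₂ _≤_ eq (zeroʳ x) (*-monoʳ-≤ (≰⇒≥ hx) h)))

    cancel-*-≤0 : ∀ {x y} → ¬ (x ≤ 0#) → x * y ≤ 0# → y ≤ 0#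
    cancel-*-≤0 {x} {y} hx h with inverse hx
    ... | z , eq = subst₂ _≤_ (trans (solve 3 (λ x y z → z :* (x :* y) := (x :* z) :* y) refl x y z)
        (trans (cong (_* y) eq) (*-identityˡ y))) (zeroʳ z) (*-monoʳ-≤ (inverse-nonneg hx eq) h)

    cancel-*-≤ : ∀ {x y z} → ¬ (x ≤ 0#) → x * y ≤ x * z → y ≤ z
    cancel-*-≤ {x} {y} {z} hx h = ≤-by (z - y) (subst (0# ≤_) (solve 2 (λ y z → con (0 , 0) :- (y :- z) := z :- y) refl y z)
        (≤⇒0≤ (cancel-*-≤0 hx (subst (_≤ 0#) (solve 3 (λ x y z → con (0 , 0) :- (x :* z :- x :* y) := x :* (y :- z)) refl x y z)
          (subst (0# - (x * z - x * y) ≤_) (-‿inverseʳ 0#) (minus-mono ≤-refl (≤⇒0≤ h))))))) refl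

    module ≤-Chain where
      infix 1 begin_
      infixr 2 _≤⟨_⟩_ _≡⟨_⟩_
      infix 3 _∎
      begin_ : ∀ {x y} → x ≤ y → x ≤ y
      begin h = h
      _≤⟨_⟩_ : ∀ x {y z} → x ≤ y → y ≤ z → x ≤ z
      x ≤⟨ h ⟩ h' = ≤-trans h h'
      _≡⟨_⟩_ : ∀ x {y z} → x ≡ y → y ≤ z → x ≤ z
      x ≡⟨ refl ⟩ h' = h'
      _∎ : ∀ x → x ≤ x
      x ∎ = ≤-refl

    [_] : ∀ {P : Set} → Dec P → Carrier
    [ yes _ ] = 1#
    [ no _ ] = 0#

    []-nonneg : ∀ {P : Set} (d : Dec P) → 0# ≤ [ d ]
    []-nonneg (yes _) = 0≤1
    []-nonneg (no _) = ≤-refl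

    []≤1 : ∀ {P : Set} (d : Dec P) → [ d ] ≤ 1#
    []≤1 (yes _) = ≤-refl
    []≤1 (no _) = 0≤1

    []-mono : ∀ {P Q : Set} (d : Dec P) (e : Dec Q) → (P → Q) → [ d ] ≤ [ e ]
    []-mono (yes p) (yes _) f = ≤-refl
    []-mono (yes p) (no q) f = ⊥-elim (q (f p))
    []-mono (no _) e f = []-nonneg e

    []-true : ∀ {P : Set} (d : Dec P) → P → [ d ] ≡ 1#
    []-true (yes _) p = refl
    []-true (no q) p = ⊥-elim (q p)

    []-false : ∀ {P : Set} (d : Dec P) → ¬ P → [ d ] ≡ 0#
    []-false (no _) p = refl
    []-false (yes q) p = ⊥-elim (p q)

    []-idem : ∀ {P : Set} (d : Dec P) → [ d ] * [ d ] ≡ [ d ]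
    []-idem (yes _) = *-identityˡ 1#
    []-idem (no _) = zeroˡ 0#

    module _ {A : Set} where

      ∑ : List A → (A → Carrier) → Carrier
      ∑ [] f = 0#
      ∑ (x ∷ xs) f = f x + ∑ xs f

      ∑-cong∈ : ∀ xs {f g : A → Carrier} → (∀ {x} → x ∈ xs → f x ≡ g x) → ∑ xs f ≡ ∑ xs g
      ∑-cong∈ [] h = refl
      ∑-cong∈ (x ∷ xs) h = cong₂ _+_ (h (here refl)) (∑-cong∈ xs (λ p → h (there p)))

      ∑-cong : ∀ xs {f g : A → Carrier} → (∀ x → f x ≡ g x) → ∑ xs f ≡ ∑ xs g
      ∑-cong xs h = ∑-cong∈ xs (λ {x} _ → h x)

      ∑-mono∈ : ∀ xs {f g : A → Carrier} → (∀ {x} → x ∈ xs → f x ≤ g x) → ∑ xs f ≤ ∑ xs g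
      ∑-mono∈ [] h = ≤-refl
      ∑-mono∈ (x ∷ xs) h = +-mono-≤ (h (here refl)) (∑-mono∈ xs (λ p → h (there p)))

      ∑-mono : ∀ xs {f g : A → Carrier} → (∀ x → f x ≤ g x) → ∑ xs f ≤ ∑ xs g
      ∑-mono xs h = ∑-mono∈ xs (λ {x} _ → h x)

      ∑-zero : ∀ xs → ∑ xs (λ _ → 0#) ≡ 0#
      ∑-zero [] = refl
      ∑-zero (x ∷ xs) = trans (+-identityˡ _) (∑-zero xs)

      ∑-nonneg∈ : ∀ xs {f : A → Carrier} → (∀ {x} → x ∈ xs → 0# ≤ f x) → 0# ≤ ∑ xs f
      ∑-nonneg∈ xs {f} h = subst (_≤ ∑ xs f) (∑-zero xs) (∑-mono∈ xs h)

      ∑-nonneg : ∀ xs {f : A → Carrier} → (∀ x → 0# ≤ f x) → 0# ≤ ∑ xs f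
      ∑-nonneg xs h = ∑-nonneg∈ xs (λ {x} _ → h x)

      ∑-+ : ∀ xs (f g : A → Carrier) → ∑ xs (λ x → f x + g x) ≡ ∑ xs f + ∑ xs g
      ∑-+ [] f g = sym (+-identityʳ 0#)
      ∑-+ (x ∷ xs) f g = trans (cong ((f x + g x) +_) (∑-+ xs f g)) (+-interchange _ _ _ _)

      ∑-*ˡ : ∀ xs c (f : A → Carrier) → ∑ xs (λ x → c * f x) ≡ c * ∑ xs f
      ∑-*ˡ [] c f = sym (zeroʳ c)
      ∑-*ˡ (x ∷ xs) c f = trans (cong (c * f x +_) (∑-*ˡ xs c f)) (sym (distribˡ c _ _))

      ∑-*ʳ : ∀ xs c (f : A → Carrier) → ∑ xs (λ x → f x * c) ≡ ∑ xs f * c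
      ∑-*ʳ xs c f = trans (∑-cong xs (λ x → *-comm (f x) c)) (trans (∑-*ˡ xs c f) (*-comm c _))

      ∑-neg : ∀ xs (f : A → Carrier) → ∑ xs (λ x → - f x) ≡ - ∑ xs f
      ∑-neg [] f = sym -0#≈0#
      ∑-neg (x ∷ xs) f = trans (cong (- f x +_) (∑-neg xs f)) (-‿+-comm _ _)

      ∑-minus : ∀ xs (f g : A → Carrier) → ∑ xs (λ x → f x - g x) ≡ ∑ xs f - ∑ xs g
      ∑-minus xs f g = trans (∑-+ xs f (λ x → - g x)) (cong (∑ xs f +_) (∑-neg xs g))

      ∑-const : ∀ xs c → ∑ xs (λ _ → c) ≡ ι (length xs) * c
      ∑-const [] c = sym (zeroˡ c)
      ∑-const (x ∷ xs) c = trans (cong₂ _+_ (sym (*-identityˡ c)) (∑-const xs c))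
        (trans (sym (distribʳ c 1# _)) (cong (_* c) (sym (ι-suc (length xs)))))

      ∑-++ : ∀ xs ys (f : A → Carrier) → ∑ (xs ++ ys) f ≡ ∑ xs f + ∑ ys f
      ∑-++ [] ys f = sym (+-identityˡ _)
      ∑-++ (x ∷ xs) ys f = trans (cong (f x +_) (∑-++ xs ys f)) (sym (+-assoc _ _ _))

      ∑-filter : ∀ {P : A → Set} (P? : ∀ x → Dec (P x)) xs (f : A → Carrier) →
        ∑ (filter P? xs) f ≡ ∑ xs (λ x → [ P? x ] * f x)
      ∑-filter P? [] f = refl
      ∑-filter P? (x ∷ xs) f with P? x
      ... | yes _ = cong₂ _+_ (sym (*-identityˡ _)) (∑-filter P? xs f)
      ... | no _ = trans (∑-filter P? xs f) (trans (sym (+-identityˡ _))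
        (cong (_+ ∑ xs (λ x → [ P? x ] * f x)) (sym (zeroˡ _))))

      ∑-∈ : ∀ {xs x} {f : A → Carrier} → (∀ y → 0# ≤ f y) → x ∈ xs → f x ≤ ∑ xs f
      ∑-∈ {x ∷ xs} {f = f} h (here refl) = x≤x+y (f x) (∑-nonneg xs h)
      ∑-∈ {x ∷ xs} {f = f} h (there p) = ≤-trans (∑-∈ {xs} h p) (x≤y+x (∑ xs f) (h x))

      -- For sums in which at most one term matters, such as the weights of the blocks that can
      -- complete a given conflict.
      ∑-single : ∀ {xs y} {f : A → Carrier} → Unique xs → 0# ≤ f y →
        (∀ {x} → x ∈ xs → x ≢ y → f x ≤ 0#) → (∀ (x y : A) → Dec (x ≡ y)) → ∑ xs f ≤ f y
      ∑-single {[]} _ h _ _ = h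
      ∑-single {x ∷ xs} {y} {f} (x∉ ∷ u) h h0 _≟_ with x ≟ y
      ... | yes refl = subst (f x + ∑ xs f ≤_) (+-identityʳ (f x)) (+-monoʳ-≤ (f x)
              (subst (∑ xs f ≤_) (∑-zero xs) (∑-mono∈ xs (λ p → h0 (there p) (λ { refl → All.lookup x∉ p refl })))))
      ... | no x≢y = subst (f x + ∑ xs f ≤_) (+-identityˡ (f y))
              (+-mono-≤ (h0 (here refl) x≢y) (∑-single {xs} u h (λ p → h0 (there p)) _≟_))

      ∏ : List A → (A → Carrier) → Carrier
      ∏ [] f = 1#
      ∏ (x ∷ xs) f = f x * ∏ xs f

      ∏-cong∈ : ∀ xs {f g : A → Carrier} → (∀ {x} → x ∈ xs → f x ≡ g x) → ∏ xs f ≡ ∏ xs g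
      ∏-cong∈ [] h = refl
      ∏-cong∈ (x ∷ xs) h = cong₂ _*_ (h (here refl)) (∏-cong∈ xs (λ p → h (there p)))

      ∏-nonneg∈ : ∀ xs {f : A → Carrier} → (∀ {x} → x ∈ xs → 0# ≤ f x) → 0# ≤ ∏ xs f
      ∏-nonneg∈ [] h = 0≤1
      ∏-nonneg∈ (x ∷ xs) h = *-nonneg (h (here refl)) (∏-nonneg∈ xs (λ p → h (there p)))

      ∏-nonneg : ∀ xs {f : A → Carrier} → (∀ x → 0# ≤ f x) → 0# ≤ ∏ xs f
      ∏-nonneg xs h = ∏-nonneg∈ xs (λ {x} _ → h x)

      ∏-mono∈ : ∀ xs {f g : A → Carrier} → (∀ {x} → x ∈ xs → 0# ≤ f x) → (∀ {x} → x ∈ xs → f x ≤ g x) → ∏ xs f ≤ ∏ xs g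
      ∏-mono∈ [] h h' = ≤-refl
      ∏-mono∈ (x ∷ xs) h h' = *-mono-≤ (h (here refl)) (h' (here refl)) (∏-nonneg∈ xs (λ p → h (there p)))
        (∏-mono∈ xs (λ p → h (there p)) (λ p → h' (there p)))

      ∏-* : ∀ xs (f g : A → Carrier) → ∏ xs (λ x → f x * g x) ≡ ∏ xs f * ∏ xs g
      ∏-* [] f g = sym (*-identityʳ 1#)
      ∏-* (x ∷ xs) f g = trans (cong ((f x * g x) *_) (∏-* xs f g))
        (solve 4 (λ a b c d → (a :* b) :* (c :* d) := (a :* c) :* (b :* d)) refl (f x) (g x) (∏ xs f) (∏ xs g))

      ∏-++ : ∀ xs ys (f : A → Carrier) → ∏ (xs ++ ys) f ≡ ∏ xs f * ∏ ys f
      ∏-++ [] ys f = sym (*-identityˡ _)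
      ∏-++ (x ∷ xs) ys f = trans (cong (f x *_) (∏-++ xs ys f)) (sym (*-assoc _ _ _))

      ∏-one : ∀ xs {f : A → Carrier} → (∀ {x} → x ∈ xs → f x ≡ 1#) → ∏ xs f ≡ 1#
      ∏-one [] h = refl
      ∏-one (x ∷ xs) h = trans (cong₂ _*_ (h (here refl)) (∏-one xs (λ p → h (there p)))) (*-identityˡ 1#)

    module _ {A B : Set} where

      ∑-swap : ∀ (xs : List A) (ys : List B) (f : A → B → Carrier) →
        ∑ xs (λ x → ∑ ys (f x)) ≡ ∑ ys (λ y → ∑ xs (λ x → f x y))
      ∑-swap [] ys f = sym (∑-zero ys)
      ∑-swap (x ∷ xs) ys f = trans (cong (∑ ys (f x) +_) (∑-swap xs ys f)) (sym (∑-+ ys (f x) _))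

      ∑-map : ∀ (g : B → A) ys (f : A → Carrier) → ∑ (map g ys) f ≡ ∑ ys (λ y → f (g y))
      ∑-map g [] f = refl
      ∑-map g (y ∷ ys) f = cong (f (g y) +_) (∑-map g ys f)

      ∑-concatMap : ∀ (g : B → List A) ys (f : A → Carrier) → ∑ (concatMap g ys) f ≡ ∑ ys (λ y → ∑ (g y) f)
      ∑-concatMap g [] f = refl
      ∑-concatMap g (y ∷ ys) f = trans (∑-++ (g y) _ f) (cong (∑ (g y) f +_) (∑-concatMap g ys f))

    infixr 8 _^_
    _^_ : Carrier → ℕ → Carrier
    x ^ zero = 1#
    x ^ suc n = x * x ^ n

    ^-nonneg : ∀ {x} → 0# ≤ x → ∀ n → 0# ≤ x ^ n
    ^-nonneg h zero = 0≤1
    ^-nonneg h (suc n) = *-nonneg h (^-nonneg h n)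

    ^-mono-≤ : ∀ {x y} → 0# ≤ x → x ≤ y → ∀ n → x ^ n ≤ y ^ n
    ^-mono-≤ h h' zero = ≤-refl
    ^-mono-≤ h h' (suc n) = *-mono-≤ h h' (^-nonneg h n) (^-mono-≤ h h' n)

    1≤^ : ∀ {x} → 1# ≤ x → ∀ n → 1# ≤ x ^ n
    1≤^ h zero = ≤-refl
    1≤^ {x} h (suc n) = ≤-trans (1≤^ h n) (subst (_≤ x * x ^ n) (*-identityˡ _) (*-monoˡ-≤ (^-nonneg (≤-trans 0≤1 h) n) h))

    ^-monoʳ-≤ : ∀ {x} → 1# ≤ x → ∀ {m n} → m ℕ.≤ n → x ^ m ≤ x ^ n
    ^-monoʳ-≤ h {n = n} ℕ.z≤n = 1≤^ h n
    ^-monoʳ-≤ h (ℕ.s≤s p) = *-monoʳ-≤ (≤-trans 0≤1 h) (^-monoʳ-≤ h p)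

    *-^ : ∀ x y n → (x * y) ^ n ≡ x ^ n * y ^ n
    *-^ x y zero = sym (*-identityˡ 1#)
    *-^ x y (suc n) = trans (cong ((x * y) *_) (*-^ x y n))
      (solve 4 (λ a b c d → (a :* b) :* (c :* d) := (a :* c) :* (b :* d)) refl x y (x ^ n) (y ^ n))

    ^-+ : ∀ x m n → x ^ (m ℕ.+ n) ≡ x ^ m * x ^ n
    ^-+ x zero n = sym (*-identityˡ _)
    ^-+ x (suc m) n = trans (cong (x *_) (^-+ x m n)) (sym (*-assoc _ _ _))

    ^-* : ∀ x m n → x ^ (m ℕ.* n) ≡ (x ^ n) ^ m
    ^-* x zero n = refl
    ^-* x (suc m) n = trans (^-+ x n (m ℕ.* n)) (cong (x ^ n *_) (^-* x m n))

    ι-^ : ∀ m n → ι (m ℕ.^ n) ≡ ι m ^ n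
    ι-^ m zero = refl
    ι-^ m (suc n) = trans (ι-* m (m ℕ.^ n)) (cong (ι m *_) (ι-^ m n))

    ∏-const : ∀ {A : Set} (xs : List A) c → ∏ xs (λ _ → c) ≡ c ^ length xs
    ∏-const [] c = refl
    ∏-const (x ∷ xs) c = cong (c *_) (∏-const xs c)

    -- The derandomisation: ∑ w x g x is the expectation of g, up to scaling, for x drawn with probability proportional to w.
    average : ∀ {A : Set} (xs : List A) (w g : A → Carrier) → (∀ x → 0# ≤ w x) → ¬ (∑ xs w ≤ 0#) →
      ∑ xs (λ x → w x * g x) ≤ 0# → ∃ λ x → x ∈ xs × ¬ (w x ≤ 0#) × g x ≤ 0#
    average {A} xs w g hw hW h = search xs hW h
      where
      ≤0-+ : ∀ {x y} → 0# ≤ x → ¬ (y ≤ 0#) → ¬ (x + y ≤ 0#)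
      ≤0-+ {x} {y} hx hy hxy = hy (≤-trans (x≤y+x y hx) hxy)

      -- If every element either has no weight or has `g x` positive, the weighted sum is positive
      -- as soon as some weight is. The first alternative records that no weight has been met so
      -- far.
      positive : ∀ xs → (∀ {x} → x ∈ xs → w x ≤ 0# ⊎ ¬ (g x ≤ 0#)) →
        (∑ xs w ≤ 0# × 0# ≤ ∑ xs (λ x → w x * g x)) ⊎ ¬ (∑ xs (λ x → w x * g x) ≤ 0#)
      positive [] _ = inj₁ (≤-refl , ≤-refl)
      positive (x ∷ xs) bad with w x ≤? 0#
      ... | yes wx≤0 = lift (positive xs (λ p → bad (there p)))
        where
        wg≡0 : w x * g x ≡ 0#
        wg≡0 = trans (cong (_* g x) (≤-antisym wx≤0 (hw x))) (zeroˡ _)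
        lift : _ → _
        lift (inj₁ (p , q)) = inj₁ (subst (w x + ∑ xs w ≤_) (+-identityʳ 0#) (+-mono-≤ wx≤0 p)
                                 , +-nonneg (≤-reflexive (sym wg≡0)) q)
        lift (inj₂ p) = inj₂ (≤0-+ (≤-reflexive (sym wg≡0)) p)
      ... | no wx≰0 with bad (here refl)
      ...   | inj₁ wx≤0 = ⊥-elim (wx≰0 wx≤0)
      ...   | inj₂ gx≰0 = inj₂ (lift (positive xs (λ p → bad (there p))))
        where
        wg≰0 : ¬ (w x * g x ≤ 0#)
        wg≰0 q = gx≰0 (cancel-*-≤0 wx≰0 q)
        lift : _ → _
        lift (inj₁ (_ , q)) r = ≤0-+ q wg≰0 (subst (_≤ 0#) (+-comm _ _) r)
        lift (inj₂ p) = ≤0-+ (≰⇒≥ wg≰0) p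

      find : ∀ xs → (∃ λ x → x ∈ xs × ¬ (w x ≤ 0#) × g x ≤ 0#) ⊎ (∀ {x} → x ∈ xs → w x ≤ 0# ⊎ ¬ (g x ≤ 0#))
      find [] = inj₂ λ ()
      find (x ∷ xs) with find xs
      ... | inj₁ (y , p , q) = inj₁ (y , there p , q)
      ... | inj₂ f with w x ≤? 0# | g x ≤? 0#
      ...   | yes p | _ = inj₂ λ { (here refl) → inj₁ p ; (there q) → f q }
      ...   | no _ | no p = inj₂ λ { (here refl) → inj₂ p ; (there q) → f q }
      ...   | no p | yes q = inj₁ (x , here refl , p , q)

      search : ∀ xs → ¬ (∑ xs w ≤ 0#) → ∑ xs (λ x → w x * g x) ≤ 0# → ∃ λ x → x ∈ xs × ¬ (w x ≤ 0#) × g x ≤ 0#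
      search xs hW h with find xs
      ... | inj₁ r = r
      ... | inj₂ bad with positive xs bad
      ...   | inj₁ (p , _) = ⊥-elim (hW p)
      ...   | inj₂ p = ⊥-elim (p h)

-- Tight and dense configurations; the defect of Q is |⋃ Q| - a |Q|.

module TightConfigurations where
  open import Data.Nat using (ℕ; zero; suc; _+_; _*_; _≤_; _<_; z≤n; s≤s; _≤?_; _<?_)
  open import Data.Nat.Properties
  open import Data.Bool using (true; false)
  import Data.Bool.Properties as Bool
  import Data.Vec as Vec
  import Data.Vec.Properties as Vec
  open import Data.Fin using (Fin)
  open import Data.Fin.Subset as Sub using (Subset; ⋃; ∣_∣; _∪_; _∩_; _⊆_)
  import Data.Fin.Subset.Properties as Sub
  open import Data.List using (List; []; _∷_; _++_; map; filter; length)
  open import Data.List.Properties using (length-++; length-filter; filter-complete)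
  open import Data.List.Membership.Propositional using (_∈_; _∉_)
  open import Data.List.Membership.Propositional.Properties
    using (∈-++⁺ˡ; ∈-++⁺ʳ; ∈-++⁻; ∈-filter⁺; ∈-filter⁻; ∈-map⁺; ∈-map⁻; ∈-∃++)
  import Data.List.Membership.DecPropositional as DecMembership
  open import Data.List.Relation.Unary.Any using (here; there)
  open import Data.List.Relation.Unary.All as All using (All; []; _∷_; all?)
  open import Data.List.Relation.Unary.AllPairs using ([]; _∷_)
  open import Data.List.Relation.Unary.Unique.Propositional using (Unique)
  import Data.List.Relation.Unary.Unique.Propositional.Properties as Unique
  import Data.List.Relation.Unary.Unique.DecPropositional as DecUnique
  open import Data.Product using (∃; _×_; _,_; proj₁; proj₂)
  open import Data.Sum using (_⊎_; inj₁; inj₂; [_,_]′)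
  open import Data.Empty using (⊥-elim)
  open import Function using (_∘_; id)
  open import Relation.Nullary using (¬_; yes; no; ¬?; _×-dec_; _→-dec_)
  open import Relation.Binary.PropositionalEquality
  open import Relation.Binary.Definitions using (DecidableEquality)
  open import Relation.Unary using () renaming (Decidable to Decidable₁)

  _≟ˢ_ : ∀ {n} → DecidableEquality (Subset n)
  _≟ˢ_ = Vec.≡-dec Bool._≟_

  ∣p∪q∣+∣p∩q∣ : ∀ {n} (p q : Subset n) → ∣ p ∪ q ∣ + ∣ p ∩ q ∣ ≡ ∣ p ∣ + ∣ q ∣
  ∣p∪q∣+∣p∩q∣ Vec.[] Vec.[] = refl
  ∣p∪q∣+∣p∩q∣ (true Vec.∷ p) (true Vec.∷ q) =
    cong suc (trans (+-suc _ _) (trans (cong suc (∣p∪q∣+∣p∩q∣ p q)) (sym (+-suc _ _))))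
  ∣p∪q∣+∣p∩q∣ (true Vec.∷ p) (false Vec.∷ q) = cong suc (∣p∪q∣+∣p∩q∣ p q)
  ∣p∪q∣+∣p∩q∣ (false Vec.∷ p) (true Vec.∷ q) = trans (cong suc (∣p∪q∣+∣p∩q∣ p q)) (sym (+-suc _ _))
  ∣p∪q∣+∣p∩q∣ (false Vec.∷ p) (false Vec.∷ q) = ∣p∪q∣+∣p∩q∣ p q

  x∈⋃⁺ : ∀ {n} {x : Fin n} {B Q} → B ∈ Q → x Sub.∈ B → x Sub.∈ ⋃ Q
  x∈⋃⁺ (here refl) x∈B = Sub.x∈p∪q⁺ (inj₁ x∈B)
  x∈⋃⁺ (there B∈Q) x∈B = Sub.x∈p∪q⁺ (inj₂ (x∈⋃⁺ B∈Q x∈B))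

  x∈⋃⁻ : ∀ {n} {x : Fin n} Q → x Sub.∈ ⋃ Q → ∃ λ B → B ∈ Q × x Sub.∈ B
  x∈⋃⁻ [] x∈ = ⊥-elim (Sub.∉⊥ x∈)
  x∈⋃⁻ (B ∷ Q) x∈ with Sub.x∈p∪q⁻ B (⋃ Q) x∈
  ... | inj₁ h = B , here refl , h
  ... | inj₂ h with x∈⋃⁻ Q h
  ...   | B' , B'∈Q , x∈B' = B' , there B'∈Q , x∈B'

  ⋃-mono : ∀ {n} {P Q : List (Subset n)} → (∀ {B} → B ∈ P → B ∈ Q) → ⋃ P ⊆ ⋃ Q
  ⋃-mono {P = P} h x∈ with x∈⋃⁻ P x∈
  ... | B , B∈P , x∈B = x∈⋃⁺ (h B∈P) x∈B

  length-filter-¬ : ∀ {A : Set} {P : A → Set} (P? : Decidable₁ P) xs →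
    length (filter P? xs) + length (filter (¬? ∘ P?) xs) ≡ length xs
  length-filter-¬ P? [] = refl
  length-filter-¬ P? (x ∷ xs) with P? x
  ... | yes _ = cong suc (length-filter-¬ P? xs)
  ... | no _ = trans (+-suc _ _) (cong suc (length-filter-¬ P? xs))

  unique-⊆-length : ∀ {A : Set} {xs ys : List A} → Unique xs → (∀ {x} → x ∈ xs → x ∈ ys) → length xs ≤ length ys
  unique-⊆-length [] h = z≤n
  unique-⊆-length {xs = x ∷ xs} (x∉xs ∷ u) h with ∈-∃++ (h (here refl))
  ... | ys₁ , ys₂ , refl = ≤-trans (s≤s (unique-⊆-length u h')) (≤-reflexive (sym (length-++-∷ ys₁)))
    where
    length-++-∷ : ∀ zs → length (zs ++ x ∷ ys₂) ≡ suc (length (zs ++ ys₂))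
    length-++-∷ [] = refl
    length-++-∷ (_ ∷ zs) = cong suc (length-++-∷ zs)
    h' : ∀ {y} → y ∈ xs → y ∈ ys₁ ++ ys₂
    h' y∈ with ∈-++⁻ ys₁ (h (there y∈))
    ... | inj₁ p = ∈-++⁺ˡ p
    ... | inj₂ (here refl) = ⊥-elim (All.lookup x∉xs y∈ refl)
    ... | inj₂ (there p) = ∈-++⁺ʳ ys₁ p

  sublists : ∀ {A : Set} → List A → List (List A)
  sublists [] = [] ∷ []
  sublists (x ∷ xs) = sublists xs ++ map (x ∷_) (sublists xs)

  filter∈sublists : ∀ {A : Set} {P : A → Set} (P? : Decidable₁ P) xs → filter P? xs ∈ sublists xs
  filter∈sublists P? [] = here refl
  filter∈sublists P? (x ∷ xs) with P? x
  ... | yes _ = ∈-++⁺ʳ (sublists xs) (∈-map⁺ (x ∷_) (filter∈sublists P? xs))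
  ... | no _ = ∈-++⁺ˡ (filter∈sublists P? xs)

  module Sublists {A : Set} where

    sublists-⊆ : ∀ {ys : List A} xs → ys ∈ sublists xs → ∀ {x} → x ∈ ys → x ∈ xs
    sublists-⊆ [] (here refl) ()
    sublists-⊆ (x ∷ xs) p q with ∈-++⁻ (sublists xs) p
    ... | inj₁ p' = there (sublists-⊆ xs p' q)
    ... | inj₂ p' with ∈-map⁻ (x ∷_) p' | q
    ...   | _ , p'' , refl | here refl = here refl
    ...   | _ , p'' , refl | there q' = there (sublists-⊆ xs p'' q')

    sublists-unique : ∀ {ys : List A} xs → ys ∈ sublists xs → Unique xs → Unique ys
    sublists-unique [] (here refl) u = u
    sublists-unique (x ∷ xs) p (x∉ ∷ u) with ∈-++⁻ (sublists xs) p
    ... | inj₁ p' = sublists-unique xs p' u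
    ... | inj₂ p' with ∈-map⁻ (x ∷_) p'
    ...   | ys , p'' , refl = All.tabulate (λ q → All.lookup x∉ (sublists-⊆ xs p'' q)) ∷ sublists-unique xs p'' u

  open Sublists public

  module ListSets {A : Set} (_≟_ : DecidableEquality A) where
    open DecMembership _≟_ using (_∈?_) public

    inter diff union : List A → List A → List A
    inter C D = filter (_∈? C) D
    diff C D = filter (¬? ∘ (_∈? C)) D
    union C D = C ++ diff C D

    length-union : ∀ C D → length (union C D) + length (inter C D) ≡ length C + length D
    length-union C D = begin
      length (union C D) + length (inter C D)            ≡⟨ cong (_+ length (inter C D)) (length-++ C) ⟩
      (length C + length (diff C D)) + length (inter C D) ≡⟨ +-assoc (length C) _ _ ⟩
      length C + (length (diff C D) + length (inter C D)) ≡⟨ cong (length C +_) (+-comm (length (diff C D)) _) ⟩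
      length C + (length (inter C D) + length (diff C D)) ≡⟨ cong (length C +_) (length-filter-¬ (_∈? C) D) ⟩
      length C + length D ∎
      where open ≡-Reasoning

    ∈-union⁺ˡ : ∀ {x} C D → x ∈ C → x ∈ union C D
    ∈-union⁺ˡ C D = ∈-++⁺ˡ

    ∈-union⁺ʳ : ∀ {x} C D → x ∈ D → x ∈ union C D
    ∈-union⁺ʳ {x} C D x∈D with x ∈? C
    ... | yes x∈C = ∈-++⁺ˡ x∈C
    ... | no x∉C = ∈-++⁺ʳ C (∈-filter⁺ (¬? ∘ (_∈? C)) x∈D x∉C)

    ∈-diff⁻ : ∀ {x} C D → x ∈ diff C D → x ∈ D × x ∉ C
    ∈-diff⁻ C D = ∈-filter⁻ (¬? ∘ (_∈? C)) {xs = D}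

    ∈-union⁻ : ∀ {x} C D → x ∈ union C D → x ∈ C ⊎ x ∈ D
    ∈-union⁻ C D x∈ with ∈-++⁻ C x∈
    ... | inj₁ p = inj₁ p
    ... | inj₂ p = inj₂ (proj₁ (∈-diff⁻ C D p))

    ∈-inter⁺ : ∀ {x} C D → x ∈ C → x ∈ D → x ∈ inter C D
    ∈-inter⁺ C D x∈C x∈D = ∈-filter⁺ (_∈? C) x∈D x∈C

    ∈-inter⁻ : ∀ {x} C D → x ∈ inter C D → x ∈ D × x ∈ C
    ∈-inter⁻ C D = ∈-filter⁻ (_∈? C) {xs = D}

    union-unique : ∀ {C D} → Unique C → Unique D → Unique (union C D)
    union-unique {C} {D} uC uD = Unique.++⁺ uC (Unique.filter⁺ (¬? ∘ (_∈? C)) uD)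
      (λ (p , q) → proj₂ (∈-diff⁻ C D q) p)

    inter-proper : ∀ {y} C D → y ∈ D → y ∉ C → length (inter C D) < length D
    inter-proper {y} C D y∈D y∉C = ≤∧≢⇒< (length-filter (_∈? C) D)
      λ eq → y∉C (proj₂ (∈-inter⁻ C D (subst (y ∈_) (sym (filter-complete (_∈? C) eq)) y∈D)))

  module Configurations (a n : ℕ) where
    open ListSets (_≟ˢ_ {n}) public

    Block : Set
    Block = Subset n

    Tight Dense : List Block → Set
    Tight Q = ∣ ⋃ Q ∣ ≤ 2 + a * length Q
    Dense Q = ∣ ⋃ Q ∣ ≤ 1 + a * length Q

    tight? : Decidable₁ Tight
    tight? Q = ∣ ⋃ Q ∣ ≤? 2 + a * length Q

    dense? : Decidable₁ Dense
    dense? Q = ∣ ⋃ Q ∣ ≤? 1 + a * length Q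

    Uniform : List Block → Set
    Uniform = All (λ (B : Block) → ∣ B ∣ ≡ 2 + a)

    -- A single block has `2 + a` vertices and is tight by itself, so minimality can only forbid
    -- tight sublists of at least two blocks. Ranging over the finite list `sublists C` keeps the
    -- notion decidable.
    NoTightSublist : List Block → Set
    NoTightSublist C = All (λ J → 2 ≤ length J × length J < length C → ¬ Tight J) (sublists C)

    record MinTight (C : List Block) : Set where
      constructor minTight
      field
        unique : Unique C
        uniform : Uniform C
        tight : Tight C
        minimal : NoTightSublist C

    open MinTight public

    minTight? : Decidable₁ MinTight
    minTight? C with DecUnique.unique? _≟ˢ_ C
      ×-dec all? (λ B → ∣ B ∣ ≟ 2 + a) C ×-dec tight? C
      ×-dec all? (λ J → (2 ≤? length J ×-dec length J <? length C) →-dec ¬? (tight? J)) (sublists C)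
    ... | yes (u , s , t , m) = yes (minTight u s t m)
    ... | no ¬m = no λ (minTight u s t m) → ¬m (u , s , t , m)

    -- Descent: while some proper sublist of at least two blocks is tight, pass to it. The number
    -- `m` in `go` bounds the length.
    tight⇒minTight : ∀ C → Unique C → Uniform C → 2 ≤ length C → Tight C →
      ∃ λ J → MinTight J × 2 ≤ length J × length J ≤ length C × (∀ {B} → B ∈ J → B ∈ C)
    tight⇒minTight C = go (length C) C ≤-refl
      where
      go : ∀ m C → length C ≤ m → Unique C → Uniform C → 2 ≤ length C → Tight C →
        ∃ λ J → MinTight J × 2 ≤ length J × length J ≤ length C × (∀ {B} → B ∈ J → B ∈ C)
      find : ∀ C xss → (∃ λ J → J ∈ xss × 2 ≤ length J × length J < length C × Tight J) ⊎
        All (λ J → 2 ≤ length J × length J < length C → ¬ Tight J) xss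
      find C [] = inj₂ []
      find C (J ∷ xss) with find C xss
      ... | inj₁ (J' , p , q) = inj₁ (J' , there p , q)
      ... | inj₂ none with 2 ≤? length J | length J <? length C | tight? J
      ...   | yes p | yes q | yes t = inj₁ (J , here refl , p , q , t)
      ...   | no p | _ | _ = inj₂ ((λ (p' , _) _ → p p') ∷ none)
      ...   | yes _ | no q | _ = inj₂ ((λ (_ , q') _ → q q') ∷ none)
      ...   | yes _ | yes _ | no t = inj₂ ((λ _ → t) ∷ none)
      go zero C C≤m u s 2≤C t = ⊥-elim (<⇒≱ (≤-trans (s≤s z≤n) 2≤C) C≤m)
      go (suc m) C C≤m u s 2≤C t with find C (sublists C)
      ... | inj₂ none = C , minTight u s t none , 2≤C , ≤-refl , id
      ... | inj₁ (J , J∈ , 2≤J , J<C , tJ)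
          with go m J (≤-pred (≤-trans J<C C≤m)) (sublists-unique C J∈ u)
                 (All.tabulate (λ p → All.lookup s (sublists-⊆ C J∈ p))) 2≤J tJ
      ...   | J' , mt , 2≤J' , J'≤J , J'⊆J = J' , mt , 2≤J' , ≤-trans J'≤J (<⇒≤ J<C) , sublists-⊆ C J∈ ∘ J'⊆J

    B⊆⋃ : ∀ {B : Block} {Q} → B ∈ Q → B ⊆ ⋃ Q
    B⊆⋃ {B} {Q} B∈Q x∈B = x∈⋃⁺ {B = B} {Q} B∈Q x∈B

    ∣⋃-union∣ : ∀ C D → ∣ ⋃ (union C D) ∣ + ∣ ⋃ C ∩ ⋃ D ∣ ≡ ∣ ⋃ C ∣ + ∣ ⋃ D ∣
    ∣⋃-union∣ C D = trans (cong (λ p → ∣ p ∣ + ∣ ⋃ C ∩ ⋃ D ∣) (Sub.⊆-antisym to from)) (∣p∪q∣+∣p∩q∣ (⋃ C) (⋃ D))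
      where
      to : ⋃ (union C D) ⊆ ⋃ C ∪ ⋃ D
      to x∈ with x∈⋃⁻ (union C D) x∈
      ... | B , B∈ , x∈B = Sub.x∈p∪q⁺ ([ (λ p → inj₁ (x∈⋃⁺ p x∈B)) , (λ p → inj₂ (x∈⋃⁺ p x∈B)) ]′ (∈-union⁻ C D B∈))
      from : ⋃ C ∪ ⋃ D ⊆ ⋃ (union C D)
      from x∈ with Sub.x∈p∪q⁻ (⋃ C) (⋃ D) x∈
      ... | inj₁ h = ⋃-mono (∈-union⁺ˡ C D) h
      ... | inj₂ h = ⋃-mono (∈-union⁺ʳ C D) h

    ⋃-inter : ∀ C D → ⋃ (inter C D) ⊆ ⋃ C ∩ ⋃ D
    ⋃-inter C D x∈ = Sub.x∈p∩q⁺ (⋃-mono (λ {B} p → proj₂ (∈-inter⁻ {B} C D p)) x∈ , ⋃-mono (λ {B} p → proj₁ (∈-inter⁻ {B} C D p)) x∈)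

    -- The defect |⋃ Q| - a |Q| is submodular.
    union-bound : ∀ C D {p q j t} → ∣ ⋃ C ∣ ≤ p + a * length C → ∣ ⋃ D ∣ ≤ q + a * length D →
      length (inter C D) ≤ j → t + a * j ≤ ∣ ⋃ C ∩ ⋃ D ∣ → ∣ ⋃ (union C D) ∣ + t ≤ (p + q) + a * length (union C D)
    union-bound C D {p} {q} {j} {t} hC hD hj ht = +-cancelʳ-≤ (a * j) _ _ (begin
      U + t + a * j                         ≡⟨ +-assoc U t (a * j) ⟩
      U + (t + a * j)                       ≤⟨ +-monoʳ-≤ U ht ⟩
      U + ∣ ⋃ C ∩ ⋃ D ∣                     ≡⟨ ∣⋃-union∣ C D ⟩
      ∣ ⋃ C ∣ + ∣ ⋃ D ∣                     ≤⟨ +-mono-≤ hC hD ⟩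
      p + a * length C + (q + a * length D) ≡⟨ rearrange p (a * length C) q (a * length D) ⟩
      p + q + (a * length C + a * length D) ≡⟨ cong (p + q +_) (sym (*-distribˡ-+ a (length C) (length D))) ⟩
      p + q + a * (length C + length D)     ≡⟨ cong (λ u → p + q + a * u) (sym (length-union C D)) ⟩
      p + q + a * (u + length (inter C D))  ≤⟨ +-monoʳ-≤ (p + q) (*-monoʳ-≤ a (+-monoʳ-≤ u hj)) ⟩
      p + q + a * (u + j)                   ≡⟨ cong (p + q +_) (*-distribˡ-+ a u j) ⟩
      p + q + (a * u + a * j)               ≡⟨ sym (+-assoc (p + q) (a * u) (a * j)) ⟩
      p + q + a * u + a * j ∎)
      where
      open ≤-Reasoning
      U = ∣ ⋃ (union C D) ∣
      u = length (union C D)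
      rearrange : ∀ p x q y → p + x + (q + y) ≡ p + q + (x + y)
      rearrange p x q y = trans (+-assoc p x (q + y)) (trans (cong (p +_) (trans (sym (+-assoc x q y))
        (trans (cong (_+ y) (+-comm x q)) (+-assoc q x y)))) (sym (+-assoc p q (x + y))))

    -- With `t = 3` the hypothesis is the bookkeeping 2 + 2 - 3 = 1: two tight configurations whose
    -- common part has defect at least 3.
    dense-by-≤ : ∀ {U s} t → U + t ≤ (1 + t) + s → U ≤ 1 + s
    dense-by-≤ {U} {s} t h = +-cancelˡ-≤ t U (1 + s) (≤-trans (≤-reflexive (+-comm t U)) (≤-trans h (≤-reflexive (sym (+-suc t s)))))

    -- The common blocks form a sublist of `D` missing `y`; minimality of `D` gives them defect at
    -- least 3, and their span lies in both spans.
    proper-sublist-not-tight : ∀ {C D y} → MinTight D → y ∈ D → y ∉ C → 2 ≤ length (inter C D) → 3 + a * length (inter C D) ≤ ∣ ⋃ C ∩ ⋃ D ∣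
    proper-sublist-not-tight {C} {D} mD y∈D y∉C 2≤j =
      ≤-trans (≰⇒> (All.lookup (minimal mD) (filter∈sublists (_∈? C) D) (2≤j , inter-proper C D y∈D y∉C)))
        (Sub.p⊆q⇒∣p∣≤∣q∣ (⋃-inter C D))

    -- Two common blocks force a common part of defect at least 3, hence density. With only `x` in
    -- common, the spans meet in at least the `2 + a` vertices of `x`, which gives tightness, and
    -- any further common vertex again gives density.
    union-tight : ∀ {C D x y} → MinTight C → MinTight D → x ∈ C → x ∈ D → y ∈ D → y ∉ C →
      Dense (union C D) ⊎ (Tight (union C D) × ⋃ C ∩ ⋃ D ⊆ x × length (inter C D) ≤ 1)
    union-tight {C} {D} {x} mC mD x∈C x∈D y∈D y∉C with 2 ≤? length (inter C D)
    ... | yes 2≤j = inj₁ (dense-by-≤ 3 (union-bound C D (tight mC) (tight mD) ≤-refl (proper-sublist-not-tight mD y∈D y∉C 2≤j)))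
    ... | no 2≰j with (⋃ C ∩ ⋃ D) Sub.⊆? x
    ...   | yes ⊆x = inj₂ (+-cancelʳ-≤ 2 _ _ (≤-trans (union-bound C D (tight mC) (tight mD) (≤-pred (≰⇒> 2≰j))
              (≤-trans (≤-reflexive (trans (cong (2 +_) (*-identityʳ a)) (sym (All.lookup (uniform mC) x∈C))))
                (Sub.p⊆q⇒∣p∣≤∣q∣ (λ h → Sub.x∈p∩q⁺ (B⊆⋃ x∈C h , B⊆⋃ x∈D h)))))
              (≤-reflexive (+-comm 2 (2 + a * length (union C D))))) , ⊆x , ≤-pred (≰⇒> 2≰j))
    ...   | no ⊈x = inj₁ (dense-by-≤ 3 (union-bound C D (tight mC) (tight mD) (≤-pred (≰⇒> 2≰j)) bigger))
      where
      x⊆ : x ⊆ ⋃ C ∩ ⋃ D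
      x⊆ h = Sub.x∈p∩q⁺ (B⊆⋃ x∈C h , B⊆⋃ x∈D h)
      bigger : 3 + a * 1 ≤ ∣ ⋃ C ∩ ⋃ D ∣
      bigger with ∣ ⋃ C ∩ ⋃ D ∣ ≤? ∣ x ∣
      ... | no ≰ = ≤-trans (≤-reflexive (cong suc (trans (cong (2 +_) (*-identityʳ a)) (sym (All.lookup (uniform mC) x∈C))))) (≰⇒> ≰)
      ... | yes le = ⊥-elim (⊈x λ {z} z∈ → [ id , (λ z∉ → ⊥-elim (<⇒≱ (Sub.p⊂q⇒∣p∣<∣q∣ (x⊆ , z , z∈ , z∉)) le)) ]′ (dec z))
        where
        dec : ∀ z → z Sub.∈ x ⊎ z Sub.∉ x
        dec z with z Sub.∈? x
        ... | yes p = inj₁ p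
        ... | no p = inj₂ p

    two≤length : ∀ {x y : Block} {L} → x ∈ L → y ∈ L → x ≢ y → 2 ≤ length L
    two≤length (here refl) (here refl) x≢y = ⊥-elim (x≢y refl)
    two≤length {L = _ ∷ _ ∷ _} (here _) (there _) _ = s≤s (s≤s z≤n)
    two≤length {L = _ ∷ _ ∷ _} (there _) _ _ = s≤s (s≤s z≤n)

    -- Either `E` lies inside `Q`, or the common blocks are a proper sublist of `E` with at least
    -- two members, of defect at least 3, and 1 + 2 - 3 = 0.
    union-dense : ∀ {Q E x y} → Dense Q → MinTight E → x ∈ Q → x ∈ E → y ∈ Q → y ∈ E → x ≢ y → Dense (union Q E)
    union-dense {Q} {E} dQ mE x∈Q x∈E y∈Q y∈E x≢y with all? (_∈? Q) E
    ... | yes E⊆Q = ≤-trans (Sub.p⊆q⇒∣p∣≤∣q∣ (⋃-mono ⊆Q)) (≤-trans dQ (s≤s (*-monoʳ-≤ a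
            (≤-trans (m≤m+n (length Q) _) (≤-reflexive (sym (length-++ Q)))))))
      where
      ⊆Q : ∀ {B} → B ∈ union Q E → B ∈ Q
      ⊆Q p = [ id , All.lookup E⊆Q ]′ (∈-union⁻ Q E p)
    ... | no E⊈Q with find E⊈Q
      where
      find : ∀ {E} → ¬ All (_∈ Q) E → ∃ λ z → z ∈ E × z ∉ Q
      find {[]} ¬all = ⊥-elim (¬all [])
      find {z ∷ E} ¬all with z ∈? Q
      ... | no z∉ = z , here refl , z∉
      ... | yes z∈ with find (λ all → ¬all (z∈ ∷ all))
      ...   | z' , p , q = z' , there p , q
    ...   | z , z∈E , z∉Q = ≤-trans (+-cancelʳ-≤ 3 _ _ (≤-trans
              (union-bound Q E dQ (tight mE) ≤-refl (proper-sublist-not-tight {Q} mE z∈E z∉Q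
                (two≤length (∈-inter⁺ Q E x∈Q x∈E) (∈-inter⁺ Q E y∈Q y∈E) x≢y)))
              (≤-reflexive (+-comm 3 (a * length (union Q E)))))) (n≤1+n _)

    dense-resp : ∀ {P Q} → Unique P → (∀ {B} → B ∈ P → B ∈ Q) → (∀ {B} → B ∈ Q → B ∈ P) → Dense P → Dense Q
    dense-resp u P⊆Q Q⊆P d = ≤-trans (Sub.p⊆q⇒∣p∣≤∣q∣ (⋃-mono Q⊆P)) (≤-trans d (s≤s (*-monoʳ-≤ a (unique-⊆-length u P⊆Q))))

    -- A triangle of minimal tight configurations: `x` joins `C` and `C₁`, `y` joins `C` and `C₂`,
    -- `z` joins `C₁` and `C₂`. In the selection, `z` is the chosen block and kills `x` through `C₁`
    -- and `y` through `C₂`.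
    module _ {C C₁ C₂ x y z} (mC : MinTight C) (m₁ : MinTight C₁) (m₂ : MinTight C₂)
      (x∈C : x ∈ C) (x∈C₁ : x ∈ C₁) (x∉C₂ : x ∉ C₂)
      (y∈C : y ∈ C) (y∉C₁ : y ∉ C₁) (y∈C₂ : y ∈ C₂)
      (z∉C : z ∉ C) (z∈C₁ : z ∈ C₁) (z∈C₂ : z ∈ C₂)
      where

      x≢y : x ≢ y
      x≢y refl = y∉C₁ x∈C₁

      private
        U U₁ U₂ : List Block
        U = union (union C C₁) C₂
        U₁ = union (union C C₂) C₁
        U₂ = union (union C₁ C₂) C

        U⊆ : ∀ {P} → (∀ {B} → B ∈ C → B ∈ P) → (∀ {B} → B ∈ C₁ → B ∈ P) → (∀ {B} → B ∈ C₂ → B ∈ P) → ∀ {B} → B ∈ U → B ∈ P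
        U⊆ f g h p with ∈-union⁻ (union C C₁) C₂ p
        ... | inj₂ q = h q
        ... | inj₁ q = [ f , g ]′ (∈-union⁻ C C₁ q)
        C⊆U : ∀ {B} → B ∈ C → B ∈ U
        C⊆U = ∈-union⁺ˡ (union C C₁) C₂ ∘ ∈-union⁺ˡ C C₁
        C₁⊆U : ∀ {B} → B ∈ C₁ → B ∈ U
        C₁⊆U = ∈-union⁺ˡ (union C C₁) C₂ ∘ ∈-union⁺ʳ C C₁
        C₂⊆U : ∀ {B} → B ∈ C₂ → B ∈ U
        C₂⊆U = ∈-union⁺ʳ (union C C₁) C₂

        from-U₁ : Dense U₁ → Dense U
        from-U₁ = dense-resp (union-unique (union-unique (unique mC) (unique m₂)) (unique m₁))
          (λ p → [ (λ q → [ C⊆U , C₂⊆U ]′ (∈-union⁻ C C₂ q)) , C₁⊆U ]′ (∈-union⁻ (union C C₂) C₁ p))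
          (U⊆ (∈-union⁺ˡ (union C C₂) C₁ ∘ ∈-union⁺ˡ C C₂) (∈-union⁺ʳ (union C C₂) C₁)
              (∈-union⁺ˡ (union C C₂) C₁ ∘ ∈-union⁺ʳ C C₂))
        from-U₂ : Dense U₂ → Dense U
        from-U₂ = dense-resp (union-unique (union-unique (unique m₁) (unique m₂)) (unique mC))
          (λ p → [ (λ q → [ C₁⊆U , C₂⊆U ]′ (∈-union⁻ C₁ C₂ q)) , C⊆U ]′ (∈-union⁻ (union C₁ C₂) C p))
          (U⊆ (∈-union⁺ʳ (union C₁ C₂) C) (∈-union⁺ˡ (union C₁ C₂) C ∘ ∈-union⁺ˡ C₁ C₂)
              (∈-union⁺ˡ (union C₁ C₂) C ∘ ∈-union⁺ʳ C₁ C₂))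

        singleton : ∀ {A B w v} → length (inter A B) ≤ 1 → w ∈ A → w ∈ B → v ∈ A → v ∈ B → v ≡ w
        singleton {A} {B} {w} {v} j≤1 w∈A w∈B v∈A v∈B with v ≟ˢ w
        ... | yes eq = eq
        ... | no v≢w = ⊥-elim (<⇒≱ (two≤length (∈-inter⁺ A B v∈A v∈B) (∈-inter⁺ A B w∈A w∈B) v≢w) j≤1)

      -- If two of the three already have a dense union, the third shares two blocks with it and
      -- `union-dense` applies. Otherwise any two of them have exactly their corner of the triangle
      -- in common.
      triple-dense : (x ∩ y ⊆ z → ∣ x ∩ y ∣ ≤ 1) → Dense (union (union C C₁) C₂)
      triple-dense h with union-tight mC m₁ x∈C x∈C₁ z∈C₁ z∉C
      ... | inj₁ d = union-dense d m₂ (∈-union⁺ˡ C C₁ y∈C) y∈C₂ (∈-union⁺ʳ C C₁ z∈C₁) z∈C₂ (λ { refl → y∉C₁ z∈C₁ })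
      ... | inj₂ (_ , _ , j₁≤1) with union-tight mC m₂ y∈C y∈C₂ z∈C₂ z∉C
      ...   | inj₁ d = from-U₁ (union-dense d m₁ (∈-union⁺ˡ C C₂ x∈C) x∈C₁ (∈-union⁺ʳ C C₂ z∈C₂) z∈C₁ (λ { refl → x∉C₂ z∈C₂ }))
      ...   | inj₂ (_ , _ , j₂≤1) with union-tight m₁ m₂ z∈C₁ z∈C₂ y∈C₂ y∉C₁
      ...     | inj₁ d = from-U₂ (union-dense d mC (∈-union⁺ˡ C₁ C₂ x∈C₁) x∈C (∈-union⁺ʳ C₁ C₂ y∈C₂) y∈C x≢y)
      -- No union of two is dense. The tight union of `C₁` and `C₂` has at most `x` and `y` in
      -- common with `C`, while the spans share `x ∪ y`, of at least 2(2 + a) - 1 = 3 + 2a vertices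
      -- because `x ∩ y` lies in `z`. The defect is at most 2 + 2 - 3.
      ...     | inj₂ (t₁₂ , ⊆z , _) = from-U₂ (dense-by-≤ 3 (union-bound (union C₁ C₂) C t₁₂ (tight mC) common≤2 meet))
        where
        common : ∀ {B} → B ∈ inter (union C₁ C₂) C → B ∈ x ∷ y ∷ []
        common p with ∈-inter⁻ (union C₁ C₂) C p
        ... | B∈C , q with ∈-union⁻ C₁ C₂ q
        ...   | inj₁ B∈C₁ = here (singleton j₁≤1 x∈C x∈C₁ B∈C B∈C₁)
        ...   | inj₂ B∈C₂ = there (here (singleton j₂≤1 y∈C y∈C₂ B∈C B∈C₂))
        common≤2 : length (inter (union C₁ C₂) C) ≤ 2
        common≤2 = unique-⊆-length (Unique.filter⁺ (_∈? union C₁ C₂) (unique mC)) common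
        x∩y≤1 : ∣ x ∩ y ∣ ≤ 1
        x∩y≤1 = h λ p → ⊆z (Sub.x∈p∩q⁺ (B⊆⋃ x∈C₁ (proj₁ (Sub.x∈p∩q⁻ x y p)) , B⊆⋃ y∈C₂ (proj₂ (Sub.x∈p∩q⁻ x y p))))
        meet : 3 + a * 2 ≤ ∣ ⋃ (union C₁ C₂) ∩ ⋃ C ∣
        meet = begin
          3 + a * 2            ≤⟨ +-cancelʳ-≤ 1 _ _ (≤-trans (≤-reflexive total) (+-monoʳ-≤ ∣ x ∪ y ∣ x∩y≤1)) ⟩
          ∣ x ∪ y ∣            ≤⟨ Sub.p⊆q⇒∣p∣≤∣q∣ x∪y⊆ ⟩
          ∣ ⋃ (union C₁ C₂) ∩ ⋃ C ∣ ∎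
          where
          open ≤-Reasoning
          total : 3 + a * 2 + 1 ≡ ∣ x ∪ y ∣ + ∣ x ∩ y ∣
          total = trans (trans (+-comm (3 + a * 2) 1) (trans (cong (4 +_) (trans (*-comm a 2) (cong (a +_) (+-identityʳ a))))
              (sym (cong (2 +_) (trans (+-suc a (suc a)) (cong suc (+-suc a a)))))))
            (sym (trans (∣p∪q∣+∣p∩q∣ x y) (cong₂ _+_ (All.lookup (uniform mC) x∈C) (All.lookup (uniform mC) y∈C))))
          x∪y⊆ : x ∪ y ⊆ ⋃ (union C₁ C₂) ∩ ⋃ C
          x∪y⊆ p with Sub.x∈p∪q⁻ x y p
          ... | inj₁ q = Sub.x∈p∩q⁺ (B⊆⋃ (∈-union⁺ˡ C₁ C₂ x∈C₁) q , B⊆⋃ x∈C q)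
          ... | inj₂ q = Sub.x∈p∩q⁺ (B⊆⋃ (∈-union⁺ʳ C₁ C₂ y∈C₂) q , B⊆⋃ y∈C q)

-- Inequalities for weighted sums and products.

module WeightedLists where
  open OrderedFields
  open import Data.Nat as ℕ using (zero; suc)
  import Data.Nat.Properties as ℕₚ
  open import Data.List using (List; []; _∷_; filter; length)
  open import Data.List.Membership.Propositional using (_∈_)
  open import Data.List.Relation.Unary.Any using (here; there)
  open import Data.List.Relation.Unary.All as All using ([]; _∷_)
  open import Data.List.Relation.Unary.AllPairs using ([]; _∷_)
  open import Data.List.Relation.Unary.Unique.Propositional using (Unique)
  import Data.List.Relation.Unary.Unique.Propositional.Properties as Unique
  open import Data.Product using (∃; ∃₂; _×_; _,_)
  open import Data.Sum using (_⊎_; inj₁; inj₂)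
  open import Data.Empty using (⊥-elim)
  open import Relation.Nullary using (¬_; Dec; yes; no)
  open import Relation.Binary.PropositionalEquality hiding ([_])

  module ListAlgebra (F : OrderedField) where
    open FieldTheory F

    sel : ∀ {P : Set} → Dec P → Carrier → Carrier → Carrier
    sel (yes _) x y = x
    sel (no _) x y = y

    sel-yes : ∀ {P : Set} (d : Dec P) {x y} → P → sel d x y ≡ x
    sel-yes (yes _) p = refl
    sel-yes (no ¬p) p = ⊥-elim (¬p p)

    sel-no : ∀ {P : Set} (d : Dec P) {x y} → ¬ P → sel d x y ≡ y
    sel-no (no _) p = refl
    sel-no (yes p) ¬p = ⊥-elim (¬p p)

    sel-nonneg : ∀ {P : Set} (d : Dec P) {x y} → 0# ≤ x → 0# ≤ y → 0# ≤ sel d x y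
    sel-nonneg (yes _) hx hy = hx
    sel-nonneg (no _) hx hy = hy

    *-cancel-nonpos : ∀ {x} → 0# ≤ x → x ≤ 0# → ∀ y → x * y ≡ 0#
    *-cancel-nonpos h h' y = trans (cong (_* y) (≤-antisym h' h)) (zeroˡ y)

    pos : Carrier → Carrier
    pos x = sel (0# ≤? x) x 0#

    pos-nonneg : ∀ x → 0# ≤ pos x
    pos-nonneg x with 0# ≤? x
    ... | yes h = h
    ... | no _ = ≤-refl

    x≤pos : ∀ x → x ≤ pos x
    x≤pos x with 0# ≤? x
    ... | yes h = ≤-refl
    ... | no h = ≰⇒≥ h

    pos≤ : ∀ {x y} → 0# ≤ y → x ≤ y → pos x ≤ y
    pos≤ {x} hy h with 0# ≤? x
    ... | yes _ = h
    ... | no _ = hy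

    pos-≤0 : ∀ {x} → x ≤ 0# → pos x ≡ 0#
    pos-≤0 {x} h = ≤-antisym (pos≤ ≤-refl h) (pos-nonneg x)

    square-mono : ∀ {x y} → 0# ≤ x → x ≤ y → x * x ≤ y * y
    square-mono h h' = *-mono-≤ h h' h h'

    -- Either the truncation of `y` is 0, or `y` is nonnegative and at most `pos x + h`. Squared
    -- excesses can thus be updated although `pos` is not linear.
    pos²-step : ∀ x h {y} → y ≤ x + h → pos y * pos y ≤ (pos x + h) * (pos x + h)
    pos²-step x h {y} le with 0# ≤? y
    ... | yes 0≤y = square-mono 0≤y (≤-trans le (+-monoˡ-≤ h (x≤pos x)))
    ... | no _ = subst (_≤ (pos x + h) * (pos x + h)) (sym (zeroˡ 0#)) (square-nonneg _)

    -- Factoring the difference of squares leaves a squared excess, the quantity that the potential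
    -- controls.
    pos-* : ∀ x y → pos (x - y) * (x * x - y * y) ≡ pos (x - y) * pos (x - y) * (x + y)
    pos-* x y with 0# ≤? (x - y)
    ... | yes _ = solve 2 (λ x y → (x :- y) :* (x :* x :- y :* y) := (x :- y) :* (x :- y) :* (x :+ y)) refl x y
    ... | no _ = trans (zeroˡ _) (sym (trans (cong (_* (x + y)) (zeroˡ 0#)) (zeroˡ _)))

    square-diff≤ : ∀ {x y} → 0# ≤ x → 0# ≤ y → (x - y) * (x - y) ≤ x * x + y * y
    square-diff≤ {x} {y} hx hy = ≤-by _ (+-nonneg (*-nonneg hx hy) (*-nonneg hx hy))
      (solve 2 (λ x y → (x :* x :+ y :* y) :- (x :- y) :* (x :- y) := x :* y :+ x :* y) refl x y)

    square-diff≤2 : ∀ x y → (x - y) * (x - y) ≤ ι 2 * (x * x) + ι 2 * (y * y)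
    square-diff≤2 x y = ≤-by _ (square-nonneg (x + y))
      (solve 2 (λ x y → (con (2 , 0) :* (x :* x) :+ con (2 , 0) :* (y :* y)) :- (x :- y) :* (x :- y) := (x :+ y) :* (x :+ y)) refl x y)

    module _ {A : Set} where

      ∑-indicator : ∀ {P : A → Set} (P? : ∀ x → Dec (P x)) xs → ∑ xs (λ x → [ P? x ]) ≡ ι (length (filter P? xs))
      ∑-indicator P? [] = refl
      ∑-indicator P? (x ∷ xs) with P? x
      ... | yes _ = trans (cong (1# +_) (∑-indicator P? xs)) (sym (ι-suc (length (filter P? xs))))
      ... | no _ = trans (+-identityˡ _) (∑-indicator P? xs)

      ∑≤length : ∀ xs {f : A → Carrier} → (∀ x → f x ≤ 1#) → ∑ xs f ≤ ι (length xs)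
      ∑≤length xs h = ≤-trans (∑-mono xs h) (≤-reflexive (trans (∑-const xs 1#) (*-identityʳ _)))

      -- Replaces one factor of a product without dividing by it: the products are compared after
      -- cross multiplication with the factors at `z`.
      ∏-change : ∀ (_≟_ : (x y : A) → Dec (x ≡ y)) {xs z} {f g : A → Carrier} → Unique xs → z ∈ xs →
        (∀ {x} → x ∈ xs → x ≢ z → f x ≡ g x) → ∏ xs f * g z ≡ ∏ xs g * f z
      ∏-change _≟_ {x ∷ xs} {z} {f} {g} (x∉ ∷ u) (here refl) h = trans
        (cong (λ p → f x * p * g x) (∏-cong∈ xs (λ p → h (there p) (λ { refl → All.lookup x∉ p refl }))))
        (solve 3 (λ a b c → a :* b :* c := c :* b :* a) refl (f x) (∏ xs g) (g x))
      ∏-change _≟_ {x ∷ xs} {z} {f} {g} (x∉ ∷ u) (there z∈) h = trans (*-assoc _ _ _)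
        (trans (cong₂ _*_ (h (here refl) (λ { refl → All.lookup x∉ z∈ refl })) (∏-change _≟_ u z∈ (λ p → h (there p))))
          (sym (*-assoc _ _ _)))

      ∏-scale : ∀ xs c (f : A → Carrier) → ∏ xs (λ x → c * f x) ≡ c ^ length xs * ∏ xs f
      ∏-scale xs c f = trans (∏-* xs (λ _ → c) f) (cong (_* ∏ xs f) (∏-const xs c))

      -- The second elementary symmetric polynomial of the values of `f`.
      pairSum : List A → (A → Carrier) → Carrier
      pairSum [] f = 0#
      pairSum (x ∷ xs) f = pairSum xs f + f x * ∑ xs f

      pairSum-nonneg : ∀ xs {f : A → Carrier} → (∀ x → 0# ≤ f x) → 0# ≤ pairSum xs f
      pairSum-nonneg [] h = ≤-refl
      pairSum-nonneg (x ∷ xs) h = +-nonneg (pairSum-nonneg xs h) (*-nonneg (h x) (∑-nonneg xs h))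

      pairSum-≤ : ∀ xs {f : A → Carrier} → (∀ x → 0# ≤ f x) → (∀ x → f x ≤ 1#) → pairSum xs f ≤ ι (length xs ℕ.* length xs)
      pairSum-≤ [] h h' = ≤-refl
      pairSum-≤ (x ∷ xs) {f} h h' = begin
        pairSum xs f + f x * ∑ xs f                        ≤⟨ +-mono-≤ (pairSum-≤ xs h h') (*-mono-≤ (h x) (h' x) (∑-nonneg xs h) (∑≤length xs h')) ⟩
        ι (l ℕ.* l) + 1# * ι l                             ≡⟨ cong (ι (l ℕ.* l) +_) (*-identityˡ _) ⟩
        ι (l ℕ.* l) + ι l                                  ≡⟨ sym (ι-+ (l ℕ.* l) l) ⟩
        ι (l ℕ.* l ℕ.+ l)                                  ≤⟨ ι-mono (ℕₚ.≤-trans (ℕₚ.≤-reflexive (ℕₚ.+-comm _ l)) (ℕₚ.≤-trans (ℕₚ.≤-reflexive (sym (ℕₚ.*-suc l l))) (ℕₚ.m≤n+m _ (suc l)))) ⟩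
        ι (suc l ℕ.* suc l) ∎
        where
        open ≤-Chain
        l = length xs

      pairSum-indicator : ∀ {P : A → Set} (P? : ∀ x → Dec (P x)) {xs} → Unique xs →
        (∃₂ λ x y → x ∈ xs × y ∈ xs × x ≢ y × P x × P y) ⊎ pairSum xs (λ x → [ P? x ]) ≡ 0#
      pairSum-indicator P? {[]} _ = inj₂ refl
      pairSum-indicator P? {x ∷ xs} (x∉ ∷ u) with pairSum-indicator P? u
      ... | inj₁ (y , z , p , q , r) = inj₁ (y , z , there p , there q , r)
      ... | inj₂ eq with P? x
      ...   | no _ = inj₂ (trans (cong₂ _+_ eq (zeroˡ _)) (+-identityʳ 0#))
      ...   | yes px with search xs
        where
        search : ∀ xs → (∃ λ y → y ∈ xs × _) ⊎ ∑ xs (λ x → [ P? x ]) ≡ 0#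
        search [] = inj₂ refl
        search (y ∷ ys) with P? y | search ys
        ... | yes py | _ = inj₁ (y , here refl , py)
        ... | no _ | inj₁ (z , p , q) = inj₁ (z , there p , q)
        ... | no _ | inj₂ e = inj₂ (trans (+-identityˡ _) e)
      ...     | inj₁ (y , y∈ , py) = inj₁ (x , y , here refl , there y∈ , All.lookup x∉ y∈ , px , py)
      ...     | inj₂ e = inj₂ (trans (cong₂ _+_ eq (trans (*-identityˡ _) e)) (+-identityʳ 0#))

      -- With `∏-upper`, the first two Bonferroni inequalities. The second is proved by induction
      -- from the first.
      ∏-lower : ∀ xs {f : A → Carrier} → (∀ x → 0# ≤ f x) → (∀ x → f x ≤ 1#) → 1# - ∑ xs f ≤ ∏ xs (λ x → 1# - f x)
      ∏-lower [] h h' = ≤-reflexive (solve 0 (con (1 , 0) :- con (0 , 0) := con (1 , 0)) refl)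
      ∏-lower (x ∷ xs) {f} h h' = ≤-trans
        (≤-by _ (*-nonneg (h x) (∑-nonneg xs h))
          (solve 2 (λ f s → (con (1 , 0) :- f) :* (con (1 , 0) :- s) :- (con (1 , 0) :- (f :+ s)) := f :* s) refl (f x) (∑ xs f)))
        (*-monoʳ-≤ (≤⇒0≤ (h' x)) (∏-lower xs h h'))

      ∏-upper : ∀ xs {f : A → Carrier} → (∀ x → 0# ≤ f x) → (∀ x → f x ≤ 1#) → ∏ xs (λ x → 1# - f x) ≤ 1# - ∑ xs f + pairSum xs f
      ∏-upper [] h h' = ≤-reflexive (solve 0 (con (1 , 0) := con (1 , 0) :- con (0 , 0) :+ con (0 , 0)) refl)
      ∏-upper (x ∷ xs) {f} h h' = ≤-by _ (+-nonneg (≤⇒0≤ (∏-upper xs h h')) (*-nonneg (h x) (≤⇒0≤ (∏-lower xs h h'))))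
        (solve 4 (λ f s e p → (con (1 , 0) :- (f :+ s) :+ (e :+ f :* s)) :- (con (1 , 0) :- f) :* p :=
            ((con (1 , 0) :- s :+ e) :- p) :+ f :* (p :- (con (1 , 0) :- s))) refl (f x) (∑ xs f) (pairSum xs f) (∏ xs (λ x → 1# - f x)))

      -- One factor at a time: (1 + y)(1 - y - s) ≤ 1 - s, with gap y(y + s). Compensating growth
      -- never exceeds the first-order loss that it answers.
      ∏[1+y][1-∑y]≤1 : ∀ xs {y : A → Carrier} → (∀ x → 0# ≤ y x) → ∏ xs (λ x → 1# + y x) * (1# - ∑ xs y) ≤ 1#
      ∏[1+y][1-∑y]≤1 [] h = ≤-reflexive (solve 0 (con (1 , 0) :* (con (1 , 0) :- con (0 , 0)) := con (1 , 0)) refl)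
      ∏[1+y][1-∑y]≤1 (x ∷ xs) {y} h = ≤-trans
        (≤-by _ (*-nonneg P≥0 (*-nonneg (h x) (+-nonneg (h x) (∑-nonneg xs h))))
          (solve 3 (λ y s p → p :* (con (1 , 0) :- s) :- (con (1 , 0) :+ y) :* p :* (con (1 , 0) :- (y :+ s)) := p :* (y :* (y :+ s)))
            refl (y x) (∑ xs y) P))
        (∏[1+y][1-∑y]≤1 xs h)
        where
        P = ∏ xs (λ x → 1# + y x)
        P≥0 : 0# ≤ P
        P≥0 = ∏-nonneg xs (λ x → +-nonneg 0≤1 (h x))

    -- Stands for (1 + x)^j ≤ 1 / (1 - jx), without division and without a condition on the sign of
    -- 1 - jx.
    [1+x]^j*[1-jx]≤1 : ∀ {x} → 0# ≤ x → ∀ j → (1# + x) ^ j * (1# - ι j * x) ≤ 1#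
    [1+x]^j*[1-jx]≤1 {x} h zero = ≤-reflexive (solve 1 (λ x → con (1 , 0) :* (con (1 , 0) :- con (0 , 0) :* x) := con (1 , 0)) refl x)
    [1+x]^j*[1-jx]≤1 {x} h (suc j) = ≤-trans
      (≤-by _ (*-nonneg (^-nonneg (+-nonneg 0≤1 h) j) (*-nonneg h (*-nonneg (+-nonneg 0≤1 (ι-nonneg j)) h)))
        (trans (cong (λ i → p * (1# - ι j * x) - (1# + x) * p * (1# - i * x)) (ι-suc j))
         (solve 3 (λ x i p → p :* (con (1 , 0) :- i :* x) :- (con (1 , 0) :+ x) :* p :* (con (1 , 0) :- (con (1 , 0) :+ i) :* x) :=
            p :* (x :* ((con (1 , 0) :+ i) :* x))) refl x (ι j) p)))
      ([1+x]^j*[1-jx]≤1 h j)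
      where p = (1# + x) ^ j

    bernoulli : ∀ {x} → 0# ≤ x → ∀ m → 1# + ι m * x ≤ (1# + x) ^ m
    bernoulli {x} h zero = ≤-reflexive (solve 1 (λ x → con (1 , 0) :+ con (0 , 0) :* x := con (1 , 0)) refl x)
    bernoulli {x} h (suc m) = ≤-trans
      (≤-by _ (*-nonneg (*-nonneg (ι-nonneg m) h) h)
        (trans (cong (λ i → (1# + x) * (1# + ι m * x) - (1# + i * x)) (ι-suc m))
         (solve 2 (λ x i → (con (1 , 0) :+ x) :* (con (1 , 0) :+ i :* x) :- (con (1 , 0) :+ (con (1 , 0) :+ i) :* x) := i :* x :* x) refl x (ι m))))
      (*-monoʳ-≤ (+-nonneg 0≤1 h) (bernoulli h m))

-- The greedy selection: one step and its expected effect.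

module RandomGreedy where
  open OrderedFields
  open TightConfigurations using (unique-⊆-length)
  open WeightedLists
  open import Data.Nat as ℕ using (ℕ; zero; suc)
  import Data.Nat.Properties as ℕₚ
  open import Data.List using (List; []; _∷_; filter; length)
  open import Data.List.Membership.Propositional using (_∈_; _∉_)
  open import Data.List.Membership.Propositional.Properties using (∈-filter⁻; ∈-filter⁺)
  import Data.List.Membership.DecPropositional as DecMembership
  open import Data.List.Relation.Unary.Any as Any using (Any; here; there; any?)
  open import Data.List.Relation.Unary.All as All using (All; []; _∷_; all?)
  open import Data.List.Relation.Unary.AllPairs using ([]; _∷_)
  open import Data.List.Relation.Unary.Unique.Propositional using (Unique)
  import Data.List.Relation.Unary.Unique.Propositional.Properties as Unique
  open import Data.Product using (∃; _×_; _,_; proj₂)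
  open import Data.Sum using (_⊎_; inj₁; inj₂)
  open import Data.Empty using (⊥-elim)
  open import Function using (_∘_)
  open import Relation.Nullary using (¬_; Dec; yes; no; ¬?; _×-dec_; _⊎-dec_)
  open import Relation.Binary.PropositionalEquality hiding ([_])
  open import Relation.Binary.Definitions using (DecidableEquality)

  -- No two selected blocks may share a pair from `𝔓`, and no member of `𝒯` may be selected
  -- entirely. The members of `𝒟` are not forbidden: they only absorb error terms.
  record BlockSystem : Set₁ where
    field
      Blk Pr : Set
      _≟_ : DecidableEquality Blk
      𝔅 : List Blk
      𝔓 : List Pr
      Inc : Blk → Pr → Set
      inc? : ∀ B e → Dec (Inc B e)
      𝒯 𝒟 : List (List Blk)

  module ConflictSystem (system : BlockSystem) where
    open BlockSystem system

    abstract
      _∈?_ : ∀ x (xs : List Blk) → Dec (x ∈ xs)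
      _∈?_ = DecMembership._∈?_ _≟_

    Share : Blk → Blk → Set
    Share B B' = Any (λ e → Inc B e × Inc B' e) 𝔓

    abstract
      share? : ∀ B B' → Dec (Share B B')
      share? B B' = any? (λ e → inc? B e ×-dec inc? B' e) 𝔓

    -- After the selection of `B'` only `B` would be missing from the conflict `C`, so `B` has to be
    -- given up.
    Completes : List Blk → Blk → Blk → List Blk → Set
    Completes S B B' C = B ∈ C × B' ∈ C × All (λ x → x ≡ B ⊎ x ≡ B' ⊎ x ∈ S) C

    abstract
      completes? : ∀ S B B' C → Dec (Completes S B B' C)
      completes? S B B' C = (B ∈? C) ×-dec (B' ∈? C) ×-dec all? (λ x → (x ≟ B) ⊎-dec (x ≟ B') ⊎-dec (x ∈? S)) C

    Kill : List Blk → Blk → Blk → Set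
    Kill S B B' = Share B B' ⊎ Any (Completes S B B') 𝒯

    abstract
      kill? : ∀ S B B' → Dec (Kill S B B')
      kill? S B B' = share? B B' ⊎-dec any? (completes? S B B') 𝒯

    record Available (S : List Blk) (B : Blk) : Set where
      constructor available
      field
        in𝔅 : B ∈ 𝔅
        unselected : B ∉ S
        apart : ∀ {x} → x ∈ S → ¬ Share x B
        conflictless : ∀ {C} → C ∈ 𝒯 → B ∈ C → ¬ All (λ x → x ≡ B ⊎ x ∈ S) C

    open Available public

    -- A conflict that `B` would finish after the selection of `z` either contains `z`, and then `z`
    -- kills `B`, or omits it, and then `B` would have finished it before.
    available-∷ : ∀ {S B z} → B ≢ z → Available S B → Available S z → ¬ Kill S B z → Available (z ∷ S) B
    available-∷ {S} {B} {z} B≢z av av' nk = available (in𝔅 av)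
      (λ { (here p) → B≢z p ; (there p) → unselected av p })
      (λ { (here refl) s → nk (inj₁ (Any.map (λ (p , q) → q , p) s)) ; (there p) → apart av p })
      λ {C} C∈ B∈C all → conflict C∈ B∈C all
      where
      conflict : ∀ {C} → C ∈ 𝒯 → B ∈ C → ¬ All (λ x → x ≡ B ⊎ x ∈ z ∷ S) C
      conflict {C} C∈ B∈C all with z ∈? C
      ... | yes z∈C = nk (inj₂ (Any.map (λ { refl → B∈C , z∈C , All.map shift all }) C∈))
        where
        shift : ∀ {x} → x ≡ B ⊎ x ∈ z ∷ S → x ≡ B ⊎ x ≡ z ⊎ x ∈ S
        shift (inj₁ p) = inj₁ p
        shift (inj₂ (here p)) = inj₂ (inj₁ p)
        shift (inj₂ (there p)) = inj₂ (inj₂ p)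
      ... | no z∉C = conflictless av C∈ B∈C (All.tabulate λ p → drop p (All.lookup all p))
        where
        drop : ∀ {x} → x ∈ C → x ≡ B ⊎ x ∈ z ∷ S → x ≡ B ⊎ x ∈ S
        drop p (inj₁ q) = inj₁ q
        drop p (inj₂ (here refl)) = ⊥-elim (z∉C p)
        drop p (inj₂ (there q)) = inj₂ q

    record Good (S : List Blk) : Set where
      constructor good
      field
        selected-in𝔅 : ∀ {B} → B ∈ S → B ∈ 𝔅
        distinct : Unique S
        disjoint : ∀ {x y} → x ∈ S → y ∈ S → x ≢ y → ¬ Share x y
        no-conflict : ∀ {C} → C ∈ 𝒯 → ¬ All (_∈ S) C

    open Good public

    good-∷ : ∀ {S z} → (∀ {C} → C ∈ 𝒯 → Unique C) → Good S → Available S z → Good (z ∷ S)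
    good-∷ {S} {z} _ g av = good
      (λ { (here refl) → in𝔅 av ; (there p) → selected-in𝔅 g p })
      (All.tabulate (λ { p refl → unselected av p }) ∷ distinct g)
      (λ { (here refl) (here refl) x≢y → ⊥-elim (x≢y refl)
         ; (here refl) (there q) _ s → apart av q (Any.map (λ (p , q) → q , p) s)
         ; (there p) (here refl) _ → apart av p
         ; (there p) (there q) → disjoint g p q })
      conflict
      where
      conflict : ∀ {C} → C ∈ 𝒯 → ¬ All (_∈ z ∷ S) C
      conflict {C} C∈ all with z ∈? C
      ... | yes z∈C = conflictless av C∈ z∈C (All.map (λ { (here p) → inj₁ p ; (there p) → inj₂ p }) all)
      ... | no z∉C = no-conflict g C∈ (All.tabulate λ p → drop p (All.lookup all p))
        where
        drop : ∀ {x} → x ∈ C → x ∈ z ∷ S → x ∈ S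
        drop p (here refl) = ⊥-elim (z∉C p)
        drop p (there q) = q

  record Parameters (system : BlockSystem) : Set where
    open BlockSystem system
    open ConflictSystem system
    field
      𝔅-unique : Unique 𝔅
      c k m : ℕ
      pairs-of-block : ∀ {B} → B ∈ 𝔅 → length (filter (inc? B) 𝔓) ℕ.≤ c
      𝒯-unique : ∀ {C} → C ∈ 𝒯 → Unique C
      𝒯-length : ∀ {C} → C ∈ 𝒯 → length C ℕ.≤ k
      𝒯⊆𝔅 : ∀ {C B} → C ∈ 𝒯 → B ∈ C → B ∈ 𝔅
      𝒟-unique : ∀ {Q} → Q ∈ 𝒟 → Unique Q
      𝒟-length : ∀ {Q} → Q ∈ 𝒟 → length Q ℕ.≤ 3 ℕ.* k
      multiplicity : ∀ {Q} → Q ∈ 𝒟 → length (filter (λ C → all? (_∈? Q) C) 𝒯) ℕ.≤ m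
      -- Blocks z that kill two blocks of C at once would spoil the expected drift; they only arise inside dense configurations, which are rare.
      closure : ∀ {S C x y z} →
        C ∈ 𝒯 ⊎ (C ≡ x ∷ y ∷ [] × ∃ λ e → e ∈ 𝔓 × Inc x e × Inc y e × ¬ Inc z e) →
        Available S x → Available S y → Available S z → x ∈ C → y ∈ C → x ≢ y → z ∉ C →
        Kill S x z → Kill S y z →
        ∃ λ Q → Q ∈ 𝒟 × All (_∈ Q) C × z ∈ Q × All (λ B → B ∈ C ⊎ B ≡ z ⊎ B ∈ S) Q

  module Nibble (F : OrderedField) (system : BlockSystem) (parameters : Parameters system) where

    open FieldTheory F public
    open ListAlgebra F public
    open BlockSystem system public
    open ConflictSystem system public
    open Parameters parameters public

    [∈]-count : ∀ Q → ∑ 𝔅 (λ z → [ z ∈? Q ]) ≤ ι (length Q)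
    [∈]-count Q = ≤-trans (≤-reflexive (∑-indicator (_∈? Q) 𝔅))
      (ι-mono (unique-⊆-length (Unique.filter⁺ (_∈? Q) 𝔅-unique) (proj₂ ∘ ∈-filter⁻ (_∈? Q) {xs = 𝔅})))

    -- Selected blocks count as 1, so the product over a configuration is the weight of what it
    -- still lacks: heuristically, its chance of being completed.
    α : List Blk → (Blk → Carrier) → Blk → Carrier
    α S w x = sel (x ∈? S) 1# (w x)

    α-nonneg : ∀ {S w} → (∀ x → 0# ≤ w x) → ∀ x → 0# ≤ α S w x
    α-nonneg {S} hw x = sel-nonneg (x ∈? S) 0≤1 (hw x)

    configWeight : List (List Blk) → List Blk → (Blk → Carrier) → Carrier
    configWeight 𝒞 S w = ∑ 𝒞 (λ C → ∏ C (α S w))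

    configWeight-nonneg : ∀ 𝒞 {S w} → (∀ x → 0# ≤ w x) → 0# ≤ configWeight 𝒞 S w
    configWeight-nonneg 𝒞 hw = ∑-nonneg 𝒞 (λ C → ∏-nonneg C (α-nonneg hw))

    degree : (Blk → Carrier) → Pr → Carrier
    degree w e = ∑ 𝔅 (λ B → [ inc? B e ] * w B)

    total : (Blk → Carrier) → Carrier
    total w = ∑ 𝔅 w

    -- One-sided, because only large degrees do harm: they raise the rate at which blocks are
    -- killed.
    excess : (Blk → Carrier) → Carrier → Pr → Carrier
    excess w θ e = pos (degree w e - θ)

    irregularity : (Blk → Carrier) → Carrier → Carrier
    irregularity w θ = ∑ 𝔓 (λ e → excess w θ e * excess w θ e)

    -- The partial derivative of `configWeight 𝒯 S w` in the weight of an unselected block `B`.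
    conflictLoad : List Blk → (Blk → Carrier) → Blk → Carrier
    conflictLoad S w B = ∑ 𝒯 (λ C → [ B ∈? C ] * ∏ C (λ x → sel (x ≟ B) 1# (α S w x)))

    -- Here `u` is the reciprocal of the current total weight and `ν` a bound for it that will serve
    -- all steps; `Λd` and `Λc` bound degrees and loads. By `has-pair` a selected block kills
    -- itself.
    record StepData : Set where
      field
        S : List Blk
        w : Blk → Carrier
        ρ ν Λd Λc θ u : Carrier
        w-nonneg : ∀ B → 0# ≤ w B
        support : ∀ {B} → ¬ (w B ≤ 0#) → Available S B
        w≤ρ : ∀ B → w B ≤ ρ
        ρ≤1 : ρ ≤ 1#
        0≤ρ : 0# ≤ ρ
        0≤Λd : 0# ≤ Λd
        0≤Λc : 0# ≤ Λc
        degree≤ : ∀ {e} → e ∈ 𝔓 → degree w e ≤ Λd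
        load≤ : ∀ {B} → B ∈ 𝔅 → ¬ (w B ≤ 0#) → conflictLoad S w B ≤ Λc
        Wu≡1 : total w * u ≡ 1#
        0≤u : 0# ≤ u
        u≤ν : u ≤ ν
        has-pair : ∀ {B} → B ∈ 𝔅 → Share B B

    module Step (stepData : StepData) where
      open StepData stepData

      W Λ : Carrier
      W = total w
      Λ = ι c * Λd + Λc

      0≤Λ : 0# ≤ Λ
      0≤Λ = +-nonneg (*-nonneg (ι-nonneg c) 0≤Λd) 0≤Λc

      0≤ν : 0# ≤ ν
      0≤ν = ≤-trans 0≤u u≤ν

      W-nonneg : 0# ≤ W
      W-nonneg = ∑-nonneg 𝔅 w-nonneg

      κ : Blk → Blk → Carrier
      κ B z = [ kill? S B z ]

      killRate : Blk → Carrier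
      killRate B = ∑ 𝔅 (λ z → w z * κ B z)

      killRate-nonneg : ∀ B → 0# ≤ killRate B
      killRate-nonneg B = ∑-nonneg 𝔅 (λ z → *-nonneg (w-nonneg z) ([]-nonneg (kill? S B z)))

      -- Compensates, to first order in u, for the chance killRate B * u that B becomes unavailable.
      growth : Blk → Carrier
      growth B = 1# + killRate B * u

      growth-nonneg : ∀ B → 0# ≤ growth B
      growth-nonneg B = +-nonneg 0≤1 (*-nonneg (killRate-nonneg B) 0≤u)

      w⁺ : Blk → Blk → Carrier
      w⁺ z B = w B * growth B * (1# - κ B z)

      1-κ-nonneg : ∀ B z → 0# ≤ 1# - κ B z
      1-κ-nonneg B z = ≤⇒0≤ ([]≤1 (kill? S B z))

      1-κ≤1 : ∀ B z → 1# - κ B z ≤ 1#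
      1-κ≤1 B z = ≤-by _ ([]-nonneg (kill? S B z)) (solve 1 (λ x → con (1 , 0) :- (con (1 , 0) :- x) := x) refl (κ B z))

      w⁺-nonneg : ∀ z B → 0# ≤ w⁺ z B
      w⁺-nonneg z B = *-nonneg (*-nonneg (w-nonneg B) (growth-nonneg B)) (1-κ-nonneg B z)

      -- Availability is known only for blocks of positive weight; elsewhere the term on the left
      -- vanishes.
      onSupport : ∀ (f g : Blk → Carrier) → (∀ z → 0# ≤ g z) → (∀ {z} → z ∈ 𝔅 → ¬ (w z ≤ 0#) → w z * f z ≤ g z) →
        ∑ 𝔅 (λ z → w z * f z) ≤ ∑ 𝔅 g
      onSupport f g hg h = ∑-mono∈ 𝔅 pointwise
        where
        pointwise : ∀ {z} → z ∈ 𝔅 → w z * f z ≤ g z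
        pointwise {z} z∈ with w z ≤? 0#
        ... | yes w≤0 = ≤-trans (≤-reflexive (*-cancel-nonpos (w-nonneg z) w≤0 (f z))) (hg z)
        ... | no w≰0 = h z∈ w≰0

      ∏-single : ∀ {C z} {f : Blk → Carrier} → Unique C → z ∈ C → (∀ {x} → x ∈ C → x ≢ z → f x ≡ 1#) → ∏ C f ≡ f z
      ∏-single {C} {z} {f} uC z∈C h = trans (sym (*-identityʳ _)) (trans (∏-change _≟_ {g = λ _ → 1#} uC z∈C h)
        (trans (cong (_* f z) (∏-one C (λ _ → refl))) (*-identityˡ _)))

      -- For a fixed `C`, at most one block `z` other than `B` has positive weight and completes it:
      -- the last unselected one. All remaining factors are 1, so `w z` is the product that occurs
      -- in the load.
      conflictRate≤ : ∀ B → ¬ (w B ≤ 0#) → ∑ 𝔅 (λ z → w z * ∑ 𝒯 (λ C → [ ¬? (z ≟ B) ×-dec completes? S B z C ])) ≤ conflictLoad S w B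
      conflictRate≤ B wB≰0 = begin
        ∑ 𝔅 (λ z → w z * ∑ 𝒯 (λ C → q z C))    ≡⟨ ∑-cong 𝔅 (λ z → sym (∑-*ˡ 𝒯 (w z) _)) ⟩
        ∑ 𝔅 (λ z → ∑ 𝒯 (λ C → w z * q z C))    ≡⟨ ∑-swap 𝔅 𝒯 _ ⟩
        ∑ 𝒯 (λ C → ∑ 𝔅 (λ z → w z * q z C))    ≤⟨ ∑-mono∈ 𝒯 each ⟩
        conflictLoad S w B ∎
        where
        open ≤-Chain
        q : Blk → List Blk → Carrier
        q z C = [ ¬? (z ≟ B) ×-dec completes? S B z C ]
        p : List Blk → Carrier
        p C = ∏ C (λ x → sel (x ≟ B) 1# (α S w x))
        p-nonneg : ∀ C → 0# ≤ p C
        p-nonneg C = ∏-nonneg C (λ x → sel-nonneg (x ≟ B) 0≤1 (α-nonneg w-nonneg x))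
        each : ∀ {C} → C ∈ 𝒯 → ∑ 𝔅 (λ z → w z * q z C) ≤ [ B ∈? C ] * p C
        each {C} C∈ with any? (λ z → ¬? (w z ≤? 0#) ×-dec (¬? (z ≟ B) ×-dec completes? S B z C)) 𝔅
        ... | no none = ≤-trans (≤-reflexive (trans (∑-cong∈ 𝔅 zero-term) (∑-zero 𝔅)))
                          (*-nonneg ([]-nonneg (B ∈? C)) (p-nonneg C))
          where
          zero-term : ∀ {z} → z ∈ 𝔅 → w z * q z C ≡ 0#
          zero-term {z} z∈ with w z ≤? 0#
          ... | yes w≤0 = *-cancel-nonpos (w-nonneg z) w≤0 _
          ... | no w≰0 = trans (cong (w z *_) ([]-false (¬? (z ≟ B) ×-dec completes? S B z C)
                  (λ r → none (Any.map (λ { refl → w≰0 , r }) z∈)))) (zeroʳ _)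
        ... | yes some with Any.satisfied some
        ...   | z , wz≰0 , z≢B , B∈C , z∈C , all = begin
          ∑ 𝔅 (λ z' → w z' * q z' C)  ≤⟨ ∑-single {xs = 𝔅} {z} {λ z' → w z' * q z' C} 𝔅-unique
                                           (*-nonneg (w-nonneg z) ([]-nonneg (¬? (z ≟ B) ×-dec completes? S B z C))) others _≟_ ⟩
          w z * q z C                 ≤⟨ *-monoʳ-≤ (w-nonneg z) ([]≤1 (¬? (z ≟ B) ×-dec completes? S B z C)) ⟩
          w z * 1#                    ≡⟨ *-identityʳ _ ⟩
          w z                         ≡⟨ sym (trans (sel-no (z ≟ B) z≢B) (sel-no (z ∈? S) (unselected (support wz≰0)))) ⟩
          sel (z ≟ B) 1# (α S w z)    ≡⟨ sym (∏-single (𝒯-unique C∈) z∈C rest) ⟩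
          p C                         ≡⟨ sym (trans (cong (_* p C) ([]-true (B ∈? C) B∈C)) (*-identityˡ _)) ⟩
          [ B ∈? C ] * p C ∎
          where
          rest : ∀ {x} → x ∈ C → x ≢ z → sel (x ≟ B) 1# (α S w x) ≡ 1#
          rest {x} x∈C x≢z with x ≟ B | All.lookup all x∈C
          ... | yes _ | _ = refl
          ... | no x≢B | inj₁ eq = ⊥-elim (x≢B eq)
          ... | no _ | inj₂ (inj₁ eq) = ⊥-elim (x≢z eq)
          ... | no _ | inj₂ (inj₂ x∈S) = sel-yes (x ∈? S) x∈S
          others : ∀ {z'} → z' ∈ 𝔅 → z' ≢ z → w z' * q z' C ≤ 0#
          others {z'} _ z'≢z = ≤-reflexive (trans (cong (w z' *_) ([]-false (¬? (z' ≟ B) ×-dec completes? S B z' C) impossible)) (zeroʳ _))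
            where
            impossible : ¬ (z' ≢ B × Completes S B z' C)
            impossible (_ , _ , _ , all') with All.lookup all' z∈C
            ... | inj₁ eq = z≢B eq
            ... | inj₂ (inj₁ eq) = z'≢z (sym eq)
            ... | inj₂ (inj₂ z∈S) = unselected (support wz≰0) z∈S

      -- A kill through a shared pair is charged to one of the at most `c` pairs of `B`, each of
      -- degree at most `Λd`; a kill through a conflict is charged to the load of `B`.
      killRate≤Λ : ∀ {B} → ¬ (w B ≤ 0#) → killRate B ≤ Λ
      killRate≤Λ {B} wB≰0 = begin
        ∑ 𝔅 (λ z → w z * κ B z)
          ≤⟨ ∑-mono∈ 𝔅 (λ {z} z∈ → *-monoʳ-≤ (w-nonneg z) (split z)) ⟩
        ∑ 𝔅 (λ z → w z * (∑ 𝔓 (λ e → [ inc? B e ] * [ inc? z e ]) + conf z))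
          ≡⟨ trans (∑-cong 𝔅 (λ z → distribˡ (w z) _ _)) (∑-+ 𝔅 _ _) ⟩
        ∑ 𝔅 (λ z → w z * ∑ 𝔓 (λ e → [ inc? B e ] * [ inc? z e ])) + ∑ 𝔅 (λ z → w z * conf z)
          ≤⟨ +-mono-≤ pairs (≤-trans (conflictRate≤ B wB≰0) (load≤ B∈𝔅 wB≰0)) ⟩
        Λ ∎
        where
        open ≤-Chain
        B∈𝔅 : B ∈ 𝔅
        B∈𝔅 = in𝔅 (support wB≰0)
        conf : Blk → Carrier
        conf z = ∑ 𝒯 (λ C → [ ¬? (z ≟ B) ×-dec completes? S B z C ])
        conf-nonneg : ∀ z → 0# ≤ conf z
        conf-nonneg z = ∑-nonneg 𝒯 (λ C → []-nonneg (¬? (z ≟ B) ×-dec completes? S B z C))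
        inc-nonneg : ∀ z e → 0# ≤ [ inc? B e ] * [ inc? z e ]
        inc-nonneg z e = *-nonneg ([]-nonneg (inc? B e)) ([]-nonneg (inc? z e))
        common : ∀ {z} → Share B z → 1# ≤ ∑ 𝔓 (λ e → [ inc? B e ] * [ inc? z e ])
        common {z} s = through s
          where
          through : ∀ {es} → Any (λ e → Inc B e × Inc z e) es → 1# ≤ ∑ es (λ e → [ inc? B e ] * [ inc? z e ])
          through {e ∷ es} (here (p , q)) = ≤-trans (≤-reflexive (sym (trans (cong₂ _*_ ([]-true (inc? B e) p) ([]-true (inc? z e) q)) (*-identityˡ 1#))))
            (x≤x+y _ (∑-nonneg es (inc-nonneg z)))
          through {e ∷ es} (there r) = ≤-trans (through r) (x≤y+x _ (inc-nonneg z e))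
        split : ∀ z → κ B z ≤ ∑ 𝔓 (λ e → [ inc? B e ] * [ inc? z e ]) + conf z
        split z with kill? S B z
        ... | no _ = +-nonneg (∑-nonneg 𝔓 (inc-nonneg z)) (conf-nonneg z)
        ... | yes (inj₁ s) = ≤-trans (common s) (x≤x+y _ (conf-nonneg z))
        ... | yes (inj₂ t) with z ≟ B
        -- For `z = B` the kill is booked under the shared pairs, so that the conflict count may
        -- leave this case out.
        ...   | yes refl = ≤-trans (common (has-pair B∈𝔅)) (x≤x+y _ (∑-nonneg 𝒯 (λ C → []-nonneg (¬? (yes (refl {A = Blk} {x = B})) ×-dec completes? S B B C))))
        ...   | no z≢B = ≤-trans (through t) (x≤y+x _ (∑-nonneg 𝔓 (inc-nonneg z)))
          where
          through : ∀ {Cs} → Any (Completes S B z) Cs → 1# ≤ ∑ Cs (λ C → [ ¬? (no z≢B) ×-dec completes? S B z C ])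
          through {C ∷ Cs} (here r) = ≤-trans (≤-reflexive (sym ([]-true (¬? (no z≢B) ×-dec completes? S B z C) (z≢B , r))))
            (x≤x+y _ (∑-nonneg Cs (λ C → []-nonneg (¬? (no z≢B) ×-dec completes? S B z C))))
          through {C ∷ Cs} (there r) = ≤-trans (through r) (x≤y+x _ ([]-nonneg (¬? (no z≢B) ×-dec completes? S B z C)))
        pairs : ∑ 𝔅 (λ z → w z * ∑ 𝔓 (λ e → [ inc? B e ] * [ inc? z e ])) ≤ ι c * Λd
        pairs = begin
          ∑ 𝔅 (λ z → w z * ∑ 𝔓 (λ e → [ inc? B e ] * [ inc? z e ]))
            ≡⟨ ∑-cong 𝔅 (λ z → sym (∑-*ˡ 𝔓 (w z) _)) ⟩
          ∑ 𝔅 (λ z → ∑ 𝔓 (λ e → w z * ([ inc? B e ] * [ inc? z e ])))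
            ≡⟨ ∑-swap 𝔅 𝔓 _ ⟩
          ∑ 𝔓 (λ e → ∑ 𝔅 (λ z → w z * ([ inc? B e ] * [ inc? z e ])))
            ≡⟨ ∑-cong 𝔓 (λ e → trans (∑-cong 𝔅 (λ z → solve 3 (λ a b d → a :* (b :* d) := b :* (d :* a)) refl (w z) [ inc? B e ] [ inc? z e ])) (∑-*ˡ 𝔅 _ _)) ⟩
          ∑ 𝔓 (λ e → [ inc? B e ] * degree w e)
            ≤⟨ ∑-mono∈ 𝔓 (λ {e} e∈ → *-monoʳ-≤ ([]-nonneg (inc? B e)) (degree≤ e∈)) ⟩
          ∑ 𝔓 (λ e → [ inc? B e ] * Λd)
            ≡⟨ trans (∑-*ʳ 𝔓 Λd _) (cong (_* Λd) (∑-indicator (inc? B) 𝔓)) ⟩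
          ι (length (filter (inc? B) 𝔓)) * Λd
            ≤⟨ *-monoˡ-≤ 0≤Λd (ι-mono (pairs-of-block B∈𝔅)) ⟩
          ι c * Λd ∎

      w*killRate≤ : ∀ B → w B * killRate B ≤ w B * Λ
      w*killRate≤ B with w B ≤? 0#
      ... | yes w≤0 = ≤-reflexive (trans (*-cancel-nonpos (w-nonneg B) w≤0 _) (sym (*-cancel-nonpos (w-nonneg B) w≤0 _)))
      ... | no w≰0 = *-monoʳ-≤ (w-nonneg B) (killRate≤Λ w≰0)

      ∑w[1-κ] : ∀ B → ∑ 𝔅 (λ z → w z * (1# - κ B z)) ≡ W - killRate B
      ∑w[1-κ] B = trans (∑-cong 𝔅 (λ z → solve 2 (λ a b → a :* (con (1 , 0) :- b) := a :- a :* b) refl (w z) (κ B z))) (∑-minus 𝔅 w _)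

      -- Summed over `z`, a block `B` of kill rate κ receives w(1 + κu)(W - κ), which is w(W - κ²u)
      -- because Wu = 1. The first-order terms cancel and only a quadratic loss remains.
      total-step : ∑ 𝔅 (λ z → w z * (W - total (w⁺ z))) ≤ Λ * Λ
      total-step = begin
        ∑ 𝔅 (λ z → w z * (W - total (w⁺ z)))
          ≡⟨ trans (∑-cong 𝔅 (λ z → solve 3 (λ a b d → a :* (b :- d) := a :* b :- a :* d) refl (w z) W (total (w⁺ z)))) (∑-minus 𝔅 _ _) ⟩
        ∑ 𝔅 (λ z → w z * W) - ∑ 𝔅 (λ z → w z * total (w⁺ z))
          ≡⟨ cong₂ _-_ (∑-*ʳ 𝔅 W w) selected ⟩
        W * W - ∑ 𝔅 (λ B → w B * growth B * (W - killRate B))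
          ≡⟨ cong (_- ∑ 𝔅 (λ B → w B * growth B * (W - killRate B))) (sym (∑-*ʳ 𝔅 W w)) ⟩
        ∑ 𝔅 (λ B → w B * W) - ∑ 𝔅 (λ B → w B * growth B * (W - killRate B))
          ≡⟨ sym (∑-minus 𝔅 _ _) ⟩
        ∑ 𝔅 (λ B → w B * W - w B * growth B * (W - killRate B))
          ≤⟨ ∑-mono 𝔅 each ⟩
        ∑ 𝔅 (λ B → w B * (Λ * Λ * u))
          ≡⟨ trans (∑-*ʳ 𝔅 (Λ * Λ * u) w) (trans (solve 3 (λ a l u → a :* (l :* l :* u) := l :* l :* (a :* u)) refl W Λ u)
               (trans (cong (Λ * Λ *_) Wu≡1) (*-identityʳ _))) ⟩
        Λ * Λ ∎
        where
        open ≤-Chain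
        selected : ∑ 𝔅 (λ z → w z * total (w⁺ z)) ≡ ∑ 𝔅 (λ B → w B * growth B * (W - killRate B))
        selected = trans (∑-cong 𝔅 (λ z → sym (∑-*ˡ 𝔅 (w z) _))) (trans (∑-swap 𝔅 𝔅 _) (∑-cong 𝔅 (λ B →
          trans (∑-cong 𝔅 (λ z → solve 3 (λ a b d → a :* (b :* d) := b :* (a :* d)) refl (w z) (w B * growth B) (1# - κ B z)))
            (trans (∑-*ˡ 𝔅 _ _) (cong (w B * growth B *_) (∑w[1-κ] B))))))
        each : ∀ B → w B * W - w B * growth B * (W - killRate B) ≤ w B * (Λ * Λ * u)
        each B = ≤-trans (≤-reflexive (trans (solve 4 (λ b W k u → b :* W :- b :* (con (1 , 0) :+ k :* u) :* (W :- k) :=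
              b :* (k :* (con (1 , 0) :- W :* u) :+ k :* k :* u)) refl (w B) W (killRate B) u)
            (cong (λ t → w B * (killRate B * (1# - t) + killRate B * killRate B * u)) Wu≡1)))
          (≤-trans (≤-reflexive (solve 3 (λ b k u → b :* (k :* (con (1 , 0) :- con (1 , 0)) :+ k :* k :* u) := (b :* k) :* (k :* u)) refl (w B) (killRate B) u))
            (≤-trans (*-monoˡ-≤ (*-nonneg (killRate-nonneg B) 0≤u) (w*killRate≤ B))
              (≤-trans (≤-reflexive (solve 4 (λ b k l u → (b :* l) :* (k :* u) := (b :* k) :* (l :* u)) refl (w B) (killRate B) Λ u))
                (≤-trans (*-monoˡ-≤ (*-nonneg 0≤Λ 0≤u) (w*killRate≤ B))
                  (≤-reflexive (solve 3 (λ b l u → (b :* l) :* (l :* u) := b :* (l :* l :* u)) refl (w B) Λ u))))))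

      S⁺ : Blk → List Blk
      S⁺ z = z ∷ S

      -- Dense configurations are weighed with the uniform bound `ρ` instead of the actual weights,
      -- so their weight changes only when one of their blocks is selected.
      β : List Blk → Blk → Carrier
      β S = α S (λ _ → ρ)

      β-nonneg : ∀ S x → 0# ≤ β S x
      β-nonneg S = α-nonneg (λ _ → 0≤ρ)

      α-∷-≢ : ∀ {z x} v → x ≢ z → α (z ∷ S) v x ≡ α S v x
      α-∷-≢ {z} {x} v x≢z = by-cases (x ∈? S)
        where
        by-cases : Dec (x ∈ S) → α (z ∷ S) v x ≡ α S v x
        by-cases (yes q) = trans (sel-yes (x ∈? (z ∷ S)) (there q)) (sym (sel-yes (x ∈? S) q))
        by-cases (no q) = trans (sel-no (x ∈? (z ∷ S)) (λ { (here p) → x≢z p ; (there p) → q p })) (sym (sel-no (x ∈? S) q))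

      α-∷-≡ : ∀ z v → α (z ∷ S) v z ≡ 1#
      α-∷-≡ z v = sel-yes (z ∈? (z ∷ S)) (here refl)

      -- Selecting a block `z` of `Q` raises its factor from `ρ` to 1, but this comes with weight
      -- `w z ≤ ρ`. Each of the at most 3k blocks of `Q` therefore adds no more than the present
      -- product.
      dense-step : ∑ 𝔅 (λ z → w z * configWeight 𝒟 (S⁺ z) (λ _ → ρ)) ≤ (W + ι (3 ℕ.* k)) * configWeight 𝒟 S (λ _ → ρ)
      dense-step = begin
        ∑ 𝔅 (λ z → w z * ∑ 𝒟 (λ Q → ∏ Q (β (S⁺ z))))
          ≡⟨ ∑-cong 𝔅 (λ z → sym (∑-*ˡ 𝒟 (w z) _)) ⟩
        ∑ 𝔅 (λ z → ∑ 𝒟 (λ Q → w z * ∏ Q (β (S⁺ z))))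
          ≡⟨ ∑-swap 𝔅 𝒟 _ ⟩
        ∑ 𝒟 (λ Q → ∑ 𝔅 (λ z → w z * ∏ Q (β (S⁺ z))))
          ≤⟨ ∑-mono∈ 𝒟 each ⟩
        ∑ 𝒟 (λ Q → (W + ι (3 ℕ.* k)) * ∏ Q (β S))
          ≡⟨ ∑-*ˡ 𝒟 _ _ ⟩
        (W + ι (3 ℕ.* k)) * ∑ 𝒟 (λ Q → ∏ Q (β S)) ∎
        where
        open ≤-Chain
        each : ∀ {Q} → Q ∈ 𝒟 → ∑ 𝔅 (λ z → w z * ∏ Q (β (S⁺ z))) ≤ (W + ι (3 ℕ.* k)) * ∏ Q (β S)
        each {Q} Q∈ = begin
          ∑ 𝔅 (λ z → w z * ∏ Q (β (S⁺ z)))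
            ≤⟨ onSupport _ _ (λ z → +-nonneg (*-nonneg (w-nonneg z) p-nonneg) (*-nonneg ([]-nonneg (z ∈? Q)) p-nonneg)) (λ {z} _ → change z) ⟩
          ∑ 𝔅 (λ z → w z * p + [ z ∈? Q ] * p)
            ≡⟨ trans (∑-+ 𝔅 _ _) (trans (cong₂ _+_ (∑-*ʳ 𝔅 p w) (∑-*ʳ 𝔅 p _)) (sym (distribʳ p _ _))) ⟩
          (W + ∑ 𝔅 (λ z → [ z ∈? Q ])) * p
            ≤⟨ *-monoˡ-≤ p-nonneg (+-monoʳ-≤ W (≤-trans ([∈]-count Q) (ι-mono (𝒟-length Q∈)))) ⟩
          (W + ι (3 ℕ.* k)) * p ∎
          where
          p = ∏ Q (β S)
          p-nonneg : 0# ≤ p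
          p-nonneg = ∏-nonneg Q (β-nonneg S)
          change : ∀ z → ¬ (w z ≤ 0#) → w z * ∏ Q (β (S⁺ z)) ≤ w z * p + [ z ∈? Q ] * p
          change z wz≰0 with z ∈? Q
          ... | no z∉Q = ≤-trans (≤-reflexive (cong (w z *_) (∏-cong∈ Q (λ {x} x∈ → α-∷-≢ {z} {x} (λ _ → ρ) (λ { refl → z∉Q x∈ })))))
                           (x≤x+y _ (*-nonneg ≤-refl p-nonneg))
          ... | yes z∈Q = ≤-trans (*-monoˡ-≤ (∏-nonneg Q (β-nonneg (S⁺ z))) (w≤ρ z))
              (≤-trans (≤-reflexive changed) (x≤y+x _ (*-nonneg (w-nonneg z) p-nonneg)))
            where
            changed : ρ * ∏ Q (β (S⁺ z)) ≡ 1# * p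
            changed = trans (*-comm ρ _) (trans (cong (∏ Q (β (S⁺ z)) *_) (sym (sel-no (z ∈? S) (unselected (support wz≰0)))))
              (trans (∏-change _≟_ (𝒟-unique Q∈) z∈Q (λ {x} _ x≢z → α-∷-≢ {z} {x} (λ _ → ρ) x≢z))
                (trans (cong (p *_) (α-∷-≡ z (λ _ → ρ))) (*-comm p 1#))))

      openCount : List Blk → ℕ
      openCount Q = length (filter (λ x → ¬? (x ∈? S)) Q)

      ∏β : ∀ Q → ∏ Q (β S) ≡ ρ ^ openCount Q
      ∏β [] = refl
      ∏β (x ∷ Q) with x ∈? S
      ... | yes _ = trans (*-identityˡ _) (∏β Q)
      ... | no _ = cong (ρ *_) (∏β Q)

      ^-antitone : ∀ {m n} → m ℕ.≤ n → ρ ^ n ≤ ρ ^ m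
      ^-antitone {n = zero} ℕ.z≤n = ≤-refl
      ^-antitone {n = suc n} ℕ.z≤n = ≤-trans (*-mono-≤ 0≤ρ ρ≤1 (^-nonneg 0≤ρ n) (^-antitone {zero} {n} ℕ.z≤n)) (≤-reflexive (*-identityˡ 1#))
      ^-antitone (ℕ.s≤s h) = *-monoʳ-≤ 0≤ρ (^-antitone h)

      -- Since `ρ ≤ 1`, fewer unselected blocks mean a larger product, and those of `Q` all occur in
      -- `L`.
      ∏β-⊆ : ∀ {Q L} → Unique Q → (∀ {x} → x ∈ Q → x ∈ L ⊎ x ∈ S) → ∏ L (β S) ≤ ∏ Q (β S)
      ∏β-⊆ {Q} {L} uQ h = ≤-trans (≤-reflexive (∏β L)) (≤-trans (^-antitone
          (unique-⊆-length (Unique.filter⁺ (λ x → ¬? (x ∈? S)) uQ) sub)) (≤-reflexive (sym (∏β Q))))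
        where
        sub : ∀ {x} → x ∈ filter (λ x → ¬? (x ∈? S)) Q → x ∈ filter (λ x → ¬? (x ∈? S)) L
        sub p with ∈-filter⁻ (λ x → ¬? (x ∈? S)) {xs = Q} p
        ... | x∈Q , x∉S with h x∈Q
        ...   | inj₁ x∈L = ∈-filter⁺ (λ x → ¬? (x ∈? S)) x∈L x∉S
        ...   | inj₂ x∈S = ⊥-elim (x∉S x∈S)

      Dens : Carrier
      Dens = configWeight 𝒟 S (λ _ → ρ)

      w≤1 : ∀ z → w z ≤ 1#
      w≤1 z = ≤-trans (w≤ρ z) ρ≤1

      -- Expected change of the conflict weight.

      Open : Blk → Set
      Open x = ¬ (w x ≤ 0#)

      open? : ∀ x → Dec (Open x)
      open? x = ¬? (w x ≤? 0#)

      killed? : ∀ z x → Dec (Open x × Kill S x z)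
      killed? z x = open? x ×-dec kill? S x z

      -- Unlike `κ`, it vanishes at blocks of weight 0, in particular at selected ones, so that
      -- these contribute the factor 1 to the products below.
      K : Blk → Blk → Carrier
      K z x = [ killed? z x ]

      K-nonneg : ∀ z x → 0# ≤ K z x
      K-nonneg z x = []-nonneg (killed? z x)

      K≤1 : ∀ z x → K z x ≤ 1#
      K≤1 z x = []≤1 (killed? z x)

      rate : Blk → Carrier
      rate x = ∑ 𝔅 (λ z → w z * K z x)

      rate-nonneg : ∀ x → 0# ≤ rate x
      rate-nonneg x = ∑-nonneg 𝔅 (λ z → *-nonneg (w-nonneg z) (K-nonneg z x))

      K-open : ∀ {x} z → Open x → K z x ≡ κ x z
      K-open {x} z ox with w x ≤? 0# | kill? S x z
      ... | yes p | _ = ⊥-elim (ox p)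
      ... | no _ | yes _ = refl
      ... | no _ | no _ = refl

      K-closed : ∀ {x} z → w x ≤ 0# → K z x ≡ 0#
      K-closed {x} z p = []-false (killed? z x) (λ (q , _) → q p)

      rate-open : ∀ {x} → Open x → rate x ≡ killRate x
      rate-open ox = ∑-cong 𝔅 (λ z → cong (w z *_) (K-open z ox))

      rate≤Λ : ∀ x → rate x ≤ Λ
      rate≤Λ x = by-cases (w x ≤? 0#)
        where
        by-cases : Dec (w x ≤ 0#) → rate x ≤ Λ
        by-cases (yes p) = ≤-trans (≤-reflexive (trans (∑-cong 𝔅 (λ z → trans (cong (w z *_) (K-closed z p)) (zeroʳ _))) (∑-zero 𝔅))) 0≤Λ
        by-cases (no p) = ≤-trans (≤-reflexive (rate-open p)) (killRate≤Λ p)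

      conflicts : Carrier
      conflicts = configWeight 𝒯 S w

      2^k : Carrier
      2^k = ι 2 ^ k

      0≤2^k : 0# ≤ 2^k
      0≤2^k = ^-nonneg (ι-nonneg 2) k

      module _ (Λν≤1 : Λ * ν ≤ 1#) where

        growth≤2 : ∀ {x} → Open x → growth x ≤ ι 2
        growth≤2 ox = +-monoʳ-≤ 1# (≤-trans (*-mono-≤ (killRate-nonneg _) (killRate≤Λ ox) 0≤u u≤ν) Λν≤1)

        w⁺≤2w : ∀ z x → w⁺ z x ≤ ι 2 * w x
        w⁺≤2w z x with w x ≤? 0#
        ... | yes p = ≤-reflexive (trans (trans (*-assoc _ _ _) (*-cancel-nonpos (w-nonneg x) p _))
                        (sym (trans (*-comm _ _) (*-cancel-nonpos (w-nonneg x) p _))))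
        ... | no p = ≤-trans (*-monoʳ-≤ (*-nonneg (w-nonneg x) (growth-nonneg x)) (1-κ≤1 x z))
                       (≤-trans (≤-reflexive (trans (*-identityʳ _) (*-comm _ _))) (*-monoˡ-≤ (w-nonneg x) (growth≤2 p)))

        module _ {C : List Blk} (C∈ : C ∈ 𝒯) where

          p : Carrier
          p = ∏ C (α S w)

          p-nonneg : 0# ≤ p
          p-nonneg = ∏-nonneg C (α-nonneg w-nonneg)

          -- The factor at `z` becomes 1, and the `w z` in front takes its place; every other factor
          -- at most doubles.
          selected-inside : ∀ {z} → ¬ (w z ≤ 0#) → z ∈ C → w z * ∏ C (α (S⁺ z) (w⁺ z)) ≤ 2^k * p
          selected-inside {z} wz≰0 z∈C = begin
            w z * ∏ C a⁺                    ≡⟨ sym (trans (sym (*-identityʳ _)) (trans (cong (∏ C f *_) (sym (α-∷-≡ z (w⁺ z)))) (trans changed (*-comm _ _)))) ⟩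
            ∏ C f                           ≤⟨ ∏-mono∈ C (λ {x} _ → f-nonneg x) (λ {x} _ → f≤ x) ⟩
            ∏ C (λ x → ι 2 * α S w x)       ≡⟨ ∏-scale C (ι 2) (α S w) ⟩
            ι 2 ^ length C * p              ≤⟨ *-monoˡ-≤ p-nonneg (^-monoʳ-≤ (x≤x+y 1# 0≤1) (𝒯-length C∈)) ⟩
            2^k * p ∎
            where
            open ≤-Chain
            a⁺ : Blk → Carrier
            a⁺ = α (S⁺ z) (w⁺ z)
            f : Blk → Carrier
            f x = sel (x ≟ z) (w z) (a⁺ x)
            f-nonneg : ∀ x → 0# ≤ f x
            f-nonneg x = sel-nonneg (x ≟ z) (w-nonneg z) (α-nonneg (w⁺-nonneg z) x)
            changed : ∏ C f * a⁺ z ≡ ∏ C a⁺ * w z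
            changed = trans (∏-change _≟_ (𝒯-unique C∈) z∈C (λ {x} _ x≢z → sel-no (x ≟ z) x≢z)) (cong (∏ C a⁺ *_) (sel-yes (z ≟ z) refl))
            1≤2 : 1# ≤ ι 2
            1≤2 = x≤x+y 1# 0≤1
            f≤ : ∀ x → f x ≤ ι 2 * α S w x
            f≤ x with x ≟ z
            ... | yes refl = ≤-trans (≤-trans (≤-reflexive (sym (*-identityˡ _))) (*-monoˡ-≤ (w-nonneg z) 1≤2))
                    (≤-reflexive (cong (ι 2 *_) (sym (sel-no (z ∈? S) (unselected (support wz≰0))))))
            ... | no x≢z = ≤-trans (≤-reflexive (α-∷-≢ (w⁺ z) x≢z)) (two x)
              where
              two : ∀ x → α S (w⁺ z) x ≤ ι 2 * α S w x
              two x with x ∈? S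
              ... | yes _ = ≤-trans 1≤2 (≤-reflexive (sym (*-identityʳ _)))
              ... | no _ = w⁺≤2w z x

          selected-outside : ∀ {z} → z ∉ C → ∏ C (α (S⁺ z) (w⁺ z)) ≡ p * (∏ C (λ x → 1# + rate x * u) * ∏ C (λ x → 1# - K z x))
          selected-outside {z} z∉C = trans (∏-cong∈ C (λ {x} x∈C → trans (α-∷-≢ (w⁺ z) (λ { refl → z∉C x∈C })) (factor x)))
            (trans (∏-* C _ _) (cong (p *_) (∏-* C _ _)))
            where
            closed-factor : ∀ x → w x ≤ 0# → (1# + rate x * u) * (1# - K z x) ≡ 1#
            closed-factor x h = trans (cong₂ (λ r s → (1# + r * u) * (1# - s))
                (trans (∑-cong 𝔅 (λ y → trans (cong (w y *_) (K-closed y h)) (zeroʳ _))) (∑-zero 𝔅)) (K-closed z h))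
              (solve 1 (λ u → (con (1 , 0) :+ con (0 , 0) :* u) :* (con (1 , 0) :- con (0 , 0)) := con (1 , 0)) refl u)
            selected-closed : ∀ {x} → x ∈ S → w x ≤ 0#
            selected-closed {x} x∈S with w x ≤? 0#
            ... | yes h = h
            ... | no h = ⊥-elim (unselected (support h) x∈S)
            factor : ∀ x → α S (w⁺ z) x ≡ α S w x * ((1# + rate x * u) * (1# - K z x))
            factor x = by-cases (x ∈? S) (w x ≤? 0#)
              where
              f : Carrier
              f = (1# + rate x * u) * (1# - K z x)
              by-cases : Dec (x ∈ S) → Dec (w x ≤ 0#) → α S (w⁺ z) x ≡ α S w x * f
              by-cases (yes x∈S) _ = trans (sel-yes (x ∈? S) x∈S)
                (sym (trans (cong₂ _*_ (sel-yes (x ∈? S) x∈S) (closed-factor x (selected-closed x∈S))) (*-identityˡ 1#)))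
              by-cases (no x∉S) (yes h) = trans (sel-no (x ∈? S) x∉S) (trans (trans (*-assoc _ _ _) (*-cancel-nonpos (w-nonneg x) h _))
                (sym (trans (cong (_* f) (sel-no (x ∈? S) x∉S)) (*-cancel-nonpos (w-nonneg x) h _))))
              by-cases (no x∉S) (no h) = trans (sel-no (x ∈? S) x∉S) (trans (*-assoc _ _ _)
                (cong₂ _*_ (sym (sel-no (x ∈? S) x∉S)) (cong₂ (λ r s → (1# + r * u) * (1# - s)) (sym (rate-open h)) (sym (K-open z h)))))

          doubleKill : Blk → Carrier
          doubleKill z = pairSum C (K z)

          killedPair : Blk → Carrier
          killedPair z = ∑ 𝒟 (λ Q → [ all? (_∈? Q) C ] * [ z ∈? Q ] * ∏ Q (β S))

          killedPair-nonneg : ∀ z → 0# ≤ killedPair z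
          killedPair-nonneg z = ∑-nonneg 𝒟 (λ Q → *-nonneg (*-nonneg ([]-nonneg (all? (_∈? Q) C)) ([]-nonneg (z ∈? Q))) (∏-nonneg Q (β-nonneg S)))

          -- If `z` outside `C` kills two blocks of `C`, then `closure` yields a `Q` in `𝒟` whose
          -- unselected blocks lie in `z ∷ C`; as weights are at most `ρ`, its weight dominates
          -- `w z * p`. For `z` inside `C` the crude bound by the square of `k` is enough, since
          -- there are at most `k` such blocks.
          doubleKill-≤ : ∀ {z} → z ∈ 𝔅 → ¬ (w z ≤ 0#) → w z * (p * doubleKill z) ≤ ι (k ℕ.* k) * ([ z ∈? C ] * p + killedPair z)
          doubleKill-≤ {z} z∈𝔅 wz≰0 with z ∈? C
          ... | yes z∈C = ≤-trans (*-mono-≤ (w-nonneg z) (w≤1 z) (*-nonneg p-nonneg (pairSum-nonneg C (K-nonneg z)))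
                  (*-monoʳ-≤ p-nonneg (≤-trans (pairSum-≤ C (K-nonneg z) (K≤1 z)) (ι-mono (ℕₚ.*-mono-≤ (𝒯-length C∈) (𝒯-length C∈))))))
                (≤-trans (≤-reflexive (solve 2 (λ p k → con (1 , 0) :* (p :* k) := k :* (con (1 , 0) :* p)) refl p (ι (k ℕ.* k))))
                  (*-monoʳ-≤ (ι-nonneg (k ℕ.* k)) (x≤x+y (1# * p) (killedPair-nonneg z))))
          ... | no z∉C with pairSum-indicator (killed? z) (𝒯-unique C∈)
          ...   | inj₂ eq = ≤-trans (≤-reflexive (trans (cong (λ t → w z * (p * t)) eq) (trans (cong (w z *_) (zeroʳ p)) (zeroʳ _))))
                  (*-nonneg (ι-nonneg (k ℕ.* k)) (+-nonneg (*-nonneg ≤-refl p-nonneg) (killedPair-nonneg z)))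
          ...   | inj₁ (x , y , x∈C , y∈C , x≢y , (ox , kx) , (oy , ky))
              with closure (inj₁ C∈) (support ox) (support oy) (support wz≰0) x∈C y∈C x≢y z∉C kx ky
          ...     | Q , Q∈ , C⊆Q , z∈Q , Q⊆ = begin
              w z * (p * doubleKill z)
                ≤⟨ *-mono-≤ (w-nonneg z) (w≤ρ z) (*-nonneg p-nonneg (pairSum-nonneg C (K-nonneg z)))
                    (*-mono-≤ p-nonneg (∏-mono∈ C (λ {x} _ → α-nonneg w-nonneg x) (λ {x} _ → α≤β x)) (pairSum-nonneg C (K-nonneg z))
                      (≤-trans (pairSum-≤ C (K-nonneg z) (K≤1 z)) (ι-mono (ℕₚ.*-mono-≤ (𝒯-length C∈) (𝒯-length C∈))))) ⟩
              ρ * (∏ C (β S) * ι (k ℕ.* k))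
                ≡⟨ trans (cong (λ t → t * (∏ C (β S) * ι (k ℕ.* k))) (sym (sel-no (z ∈? S) (unselected (support wz≰0)))))
                     (solve 3 (λ a b d → a :* (b :* d) := d :* (a :* b)) refl (β S z) (∏ C (β S)) (ι (k ℕ.* k))) ⟩
              ι (k ℕ.* k) * ∏ (z ∷ C) (β S)
                ≤⟨ *-monoʳ-≤ (ι-nonneg (k ℕ.* k)) (∏β-⊆ {Q} {z ∷ C} (𝒟-unique Q∈) (λ q → place (All.lookup Q⊆ q))) ⟩
              ι (k ℕ.* k) * ∏ Q (β S)
                ≤⟨ *-monoʳ-≤ (ι-nonneg (k ℕ.* k)) (≤-trans (≤-reflexive (sym (trans (cong₂ (λ s t → s * t * ∏ Q (β S)) ([]-true (all? (_∈? Q) C) C⊆Q) ([]-true (z ∈? Q) z∈Q))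
                      (trans (cong (_* ∏ Q (β S)) (*-identityˡ 1#)) (*-identityˡ _)))))
                    (∑-∈ (λ Q → *-nonneg (*-nonneg ([]-nonneg (all? (_∈? Q) C)) ([]-nonneg (z ∈? Q))) (∏-nonneg Q (β-nonneg S))) Q∈)) ⟩
              ι (k ℕ.* k) * killedPair z
                ≤⟨ *-monoʳ-≤ (ι-nonneg (k ℕ.* k)) (x≤y+x (killedPair z) (*-nonneg ≤-refl p-nonneg)) ⟩
              ι (k ℕ.* k) * (0# * p + killedPair z) ∎
              where
              open ≤-Chain
              place : ∀ {B} → B ∈ C ⊎ B ≡ z ⊎ B ∈ S → B ∈ z ∷ C ⊎ B ∈ S
              place (inj₁ q) = inj₁ (there q)
              place (inj₂ (inj₁ q)) = inj₁ (here q)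
              place (inj₂ (inj₂ q)) = inj₂ q
              α≤β : ∀ x → α S w x ≤ β S x
              α≤β x with x ∈? S
              ... | yes _ = ≤-refl
              ... | no _ = w≤ρ x

          G : Carrier
          G = ∏ C (λ x → 1# + rate x * u)

          G-nonneg : 0# ≤ G
          G-nonneg = ∏-nonneg C (λ x → +-nonneg 0≤1 (*-nonneg (rate-nonneg x) 0≤u))

          G≤2^k : G ≤ 2^k
          G≤2^k = ≤-trans (∏-mono∈ C (λ {x} _ → +-nonneg 0≤1 (*-nonneg (rate-nonneg x) 0≤u))
              (λ {x} _ → +-monoʳ-≤ 1# (≤-trans (*-mono-≤ (rate-nonneg x) (rate≤Λ x) 0≤u u≤ν) Λν≤1)))
            (≤-trans (≤-reflexive (∏-const C (ι 2))) (^-monoʳ-≤ (x≤x+y 1# 0≤1) (𝒯-length C∈)))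

          -- `∏[1+y][1-∑y]≤1` scaled by `W`, with `W * u` equal to 1: the growth factors make up for
          -- the first-order chance that some block of `C` is killed.
          G[W-∑rate]≤W : G * (W - ∑ C rate) ≤ W
          G[W-∑rate]≤W = begin
            G * (W - ∑ C rate)                  ≡⟨ cong (λ t → G * (W - t)) (sym (trans (cong (W *_) (∑-*ʳ C u rate))
                                                     (trans (solve 3 (λ W r u → W :* (r :* u) := r :* (W :* u)) refl W (∑ C rate) u)
                                                       (trans (cong (∑ C rate *_) Wu≡1) (*-identityʳ _))))) ⟩
            G * (W - W * ∑ C (λ x → rate x * u)) ≡⟨ solve 3 (λ g w s → g :* (w :- w :* s) := w :* (g :* (con (1 , 0) :- s))) refl G W (∑ C (λ x → rate x * u)) ⟩
            W * (G * (1# - ∑ C (λ x → rate x * u))) ≤⟨ *-monoʳ-≤ W-nonneg (∏[1+y][1-∑y]≤1 C (λ x → *-nonneg (rate-nonneg x) 0≤u)) ⟩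
            W * 1#                              ≡⟨ *-identityʳ W ⟩
            W ∎
            where open ≤-Chain

          -- To first order a conflict keeps its weight `p` on average. The errors come from double
          -- kills, left by the second Bonferroni inequality, and from the at most `k` choices of
          -- `z` in `C`.
          conflict-each : ∑ 𝔅 (λ z → w z * ∏ C (α (S⁺ z) (w⁺ z))) ≤
            p * W + 2^k * ∑ 𝔅 (λ z → w z * (p * doubleKill z)) + (2^k * p) * ι k
          conflict-each = begin
            ∑ 𝔅 (λ z → w z * ∏ C (α (S⁺ z) (w⁺ z)))
              ≤⟨ onSupport _ _ (λ z → +-nonneg (main-nonneg z) (*-nonneg ([]-nonneg (z ∈? C)) (*-nonneg 0≤2^k p-nonneg))) (λ {z} _ → each z) ⟩
            ∑ 𝔅 (λ z → p * G * (w z * ∏ C (λ x → 1# - K z x)) + [ z ∈? C ] * (2^k * p))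
              ≡⟨ trans (∑-+ 𝔅 _ _) (cong₂ _+_ (∑-*ˡ 𝔅 (p * G) _) (trans (∑-*ʳ 𝔅 (2^k * p) _) (*-comm _ _))) ⟩
            p * G * ∑ 𝔅 (λ z → w z * ∏ C (λ x → 1# - K z x)) + (2^k * p) * ∑ 𝔅 (λ z → [ z ∈? C ])
              ≤⟨ +-mono-≤ (*-monoʳ-≤ (*-nonneg p-nonneg G-nonneg) survive)
                   (*-monoʳ-≤ (*-nonneg 0≤2^k p-nonneg) (≤-trans ([∈]-count C) (ι-mono (𝒯-length C∈)))) ⟩
            p * G * (W - ∑ C rate + ∑ 𝔅 (λ z → w z * doubleKill z)) + (2^k * p) * ι k
              ≡⟨ cong (_+ (2^k * p) * ι k) (solve 4 (λ p g a b → p :* g :* (a :+ b) := p :* (g :* a) :+ g :* (p :* b)) refl p G (W - ∑ C rate) ov) ⟩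
            p * (G * (W - ∑ C rate)) + G * (p * ov) + (2^k * p) * ι k
              ≤⟨ +-monoˡ-≤ _ (+-mono-≤ (*-monoʳ-≤ p-nonneg G[W-∑rate]≤W) (*-monoˡ-≤ (*-nonneg p-nonneg ov-nonneg) G≤2^k)) ⟩
            p * W + 2^k * (p * ov) + (2^k * p) * ι k
              ≡⟨ cong (λ t → p * W + 2^k * t + (2^k * p) * ι k) (trans (sym (∑-*ˡ 𝔅 p _))
                   (∑-cong 𝔅 (λ z → solve 3 (λ a b d → a :* (b :* d) := b :* (a :* d)) refl p (w z) (doubleKill z)))) ⟩
            p * W + 2^k * ∑ 𝔅 (λ z → w z * (p * doubleKill z)) + (2^k * p) * ι k ∎
            where
            open ≤-Chain
            ov : Carrier
            ov = ∑ 𝔅 (λ z → w z * doubleKill z)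
            ov-nonneg : 0# ≤ ov
            ov-nonneg = ∑-nonneg 𝔅 (λ z → *-nonneg (w-nonneg z) (pairSum-nonneg C (K-nonneg z)))
            1-K-nonneg : ∀ z x → 0# ≤ 1# - K z x
            1-K-nonneg z x = ≤⇒0≤ (K≤1 z x)
            main-nonneg : ∀ z → 0# ≤ p * G * (w z * ∏ C (λ x → 1# - K z x))
            main-nonneg z = *-nonneg (*-nonneg p-nonneg G-nonneg) (*-nonneg (w-nonneg z) (∏-nonneg C (1-K-nonneg z)))
            each : ∀ z → ¬ (w z ≤ 0#) → w z * ∏ C (α (S⁺ z) (w⁺ z)) ≤ p * G * (w z * ∏ C (λ x → 1# - K z x)) + [ z ∈? C ] * (2^k * p)
            each z wz≰0 with z ∈? C
            ... | yes z∈C = ≤-trans (selected-inside wz≰0 z∈C) (≤-trans (≤-reflexive (sym (*-identityˡ _))) (x≤y+x _ (main-nonneg z)))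
            ... | no z∉C = ≤-trans (≤-reflexive (trans (cong (w z *_) (selected-outside z∉C))
                  (solve 4 (λ a b d e → a :* (b :* (d :* e)) := b :* d :* (a :* e)) refl (w z) p G (∏ C (λ x → 1# - K z x)))))
                (x≤x+y _ (*-nonneg ≤-refl (*-nonneg 0≤2^k p-nonneg)))
            survive : ∑ 𝔅 (λ z → w z * ∏ C (λ x → 1# - K z x)) ≤ W - ∑ C rate + ov
            survive = begin
              ∑ 𝔅 (λ z → w z * ∏ C (λ x → 1# - K z x))
                ≤⟨ ∑-mono 𝔅 (λ z → *-monoʳ-≤ (w-nonneg z) (∏-upper C (K-nonneg z) (K≤1 z))) ⟩
              ∑ 𝔅 (λ z → w z * (1# - ∑ C (K z) + doubleKill z))
                ≡⟨ ∑-cong 𝔅 (λ z → solve 3 (λ a b d → a :* (con (1 , 0) :- b :+ d) := a :- a :* b :+ a :* d) refl (w z) (∑ C (K z)) (doubleKill z)) ⟩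
              ∑ 𝔅 (λ z → w z - w z * ∑ C (K z) + w z * doubleKill z)
                ≡⟨ trans (∑-+ 𝔅 _ _) (cong (_+ ov) (∑-minus 𝔅 _ _)) ⟩
              W - ∑ 𝔅 (λ z → w z * ∑ C (K z)) + ov
                ≡⟨ cong (λ t → W - t + ov) (trans (∑-cong 𝔅 (λ z → sym (∑-*ˡ C (w z) _))) (∑-swap 𝔅 C _)) ⟩
              W - ∑ C rate + ov ∎

        k² : ℕ
        k² = k ℕ.* k

        C₁ C₂ : Carrier
        C₁ = 2^k * ι k + 2^k * (ι k² * ι k)
        C₂ = 2^k * (ι k² * (ι m * ι (3 ℕ.* k)))

        -- When the double kills are summed over all conflicts, each `Q` in `𝒟` is charged by at
        -- most `m` conflicts inside it and at most 3k blocks `z`; this is `C₂`.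
        conflict-step : ∑ 𝔅 (λ z → w z * configWeight 𝒯 (S⁺ z) (w⁺ z)) ≤ (W + C₁) * conflicts + C₂ * Dens
        conflict-step = begin
          ∑ 𝔅 (λ z → w z * ∑ 𝒯 (λ C → ∏ C (α (S⁺ z) (w⁺ z))))
            ≡⟨ trans (∑-cong 𝔅 (λ z → sym (∑-*ˡ 𝒯 (w z) _))) (∑-swap 𝔅 𝒯 _) ⟩
          ∑ 𝒯 (λ C → ∑ 𝔅 (λ z → w z * ∏ C (α (S⁺ z) (w⁺ z))))
            ≤⟨ ∑-mono∈ 𝒯 (λ {C} C∈ → ≤-trans (conflict-each C∈) (+-monoˡ-≤ _ (+-monoʳ-≤ _ (*-monoʳ-≤ 0≤2^k (doubleKill-sum C∈))))) ⟩
          ∑ 𝒯 (λ C → P C * W + 2^k * (ι k² * (ι k * P C + ∑ 𝒟 (λ Q → [ all? (_∈? Q) C ] * (ι (3 ℕ.* k) * ∏ Q (β S))))) + (2^k * P C) * ι k)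
            ≡⟨ ∑-cong 𝒯 (λ C → solve 6 (λ p W t kk k q → p :* W :+ t :* (kk :* (k :* p :+ q)) :+ (t :* p) :* k :=
                 (W :+ (t :* k :+ t :* (kk :* k))) :* p :+ (t :* kk) :* q) refl (P C) W 2^k (ι k²) (ι k) _) ⟩
          ∑ 𝒯 (λ C → (W + C₁) * P C + (2^k * ι k²) * ∑ 𝒟 (λ Q → [ all? (_∈? Q) C ] * (ι (3 ℕ.* k) * ∏ Q (β S))))
            ≡⟨ trans (∑-+ 𝒯 _ _) (cong₂ _+_ (∑-*ˡ 𝒯 (W + C₁) P) (trans (∑-*ˡ 𝒯 (2^k * ι k²) _) (cong (2^k * ι k² *_) (trans (∑-swap 𝒯 𝒟 _)
                 (∑-cong 𝒟 (λ Q → ∑-*ʳ 𝒯 _ _)))))) ⟩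
          (W + C₁) * conflicts + (2^k * ι k²) * ∑ 𝒟 (λ Q → ∑ 𝒯 (λ C → [ all? (_∈? Q) C ]) * (ι (3 ℕ.* k) * ∏ Q (β S)))
            ≤⟨ +-monoʳ-≤ _ (*-monoʳ-≤ (*-nonneg 0≤2^k (ι-nonneg k²)) (∑-mono∈ 𝒟 (λ {Q} Q∈ → *-monoˡ-≤ (*-nonneg (ι-nonneg (3 ℕ.* k)) (∏-nonneg Q (β-nonneg S)))
                 (≤-trans (≤-reflexive (∑-indicator (λ C → all? (_∈? Q) C) 𝒯)) (ι-mono (multiplicity Q∈)))))) ⟩
          (W + C₁) * conflicts + (2^k * ι k²) * ∑ 𝒟 (λ Q → ι m * (ι (3 ℕ.* k) * ∏ Q (β S)))
            ≡⟨ cong ((W + C₁) * conflicts +_) (trans (cong (2^k * ι k² *_) (trans (∑-*ˡ 𝒟 (ι m) _) (cong (ι m *_) (∑-*ˡ 𝒟 _ _))))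
                 (solve 5 (λ t kk m k d → (t :* kk) :* (m :* (k :* d)) := t :* (kk :* (m :* k)) :* d) refl 2^k (ι k²) (ι m) (ι (3 ℕ.* k)) Dens)) ⟩
          (W + C₁) * conflicts + C₂ * Dens ∎
          where
          open ≤-Chain
          P : List Blk → Carrier
          P C = ∏ C (α S w)
          P-nonneg : ∀ C → 0# ≤ P C
          P-nonneg C = ∏-nonneg C (α-nonneg w-nonneg)
          doubleKill-sum : ∀ {C} (C∈ : C ∈ 𝒯) → ∑ 𝔅 (λ z → w z * (P C * doubleKill C∈ z)) ≤
            ι k² * (ι k * P C + ∑ 𝒟 (λ Q → [ all? (_∈? Q) C ] * (ι (3 ℕ.* k) * ∏ Q (β S))))
          doubleKill-sum {C} C∈ = begin
            ∑ 𝔅 (λ z → w z * (P C * doubleKill C∈ z))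
              ≤⟨ onSupport _ _ (λ z → *-nonneg (ι-nonneg k²) (+-nonneg (*-nonneg ([]-nonneg (z ∈? C)) (P-nonneg C)) (killedPair-nonneg C∈ z))) (doubleKill-≤ C∈) ⟩
            ∑ 𝔅 (λ z → ι k² * ([ z ∈? C ] * P C + killedPair C∈ z))
              ≡⟨ trans (∑-*ˡ 𝔅 (ι k²) _) (cong (ι k² *_) (trans (∑-+ 𝔅 _ _) (cong₂ _+_ (∑-*ʳ 𝔅 (P C) _) (∑-swap 𝔅 𝒟 _)))) ⟩
            ι k² * (∑ 𝔅 (λ z → [ z ∈? C ]) * P C + ∑ 𝒟 (λ Q → ∑ 𝔅 (λ z → [ all? (_∈? Q) C ] * [ z ∈? Q ] * ∏ Q (β S))))
              ≤⟨ *-monoʳ-≤ (ι-nonneg k²) (+-mono-≤ (*-monoˡ-≤ (P-nonneg C) (≤-trans ([∈]-count C) (ι-mono (𝒯-length C∈)))) (∑-mono∈ 𝒟 per-Q)) ⟩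
            ι k² * (ι k * P C + ∑ 𝒟 (λ Q → [ all? (_∈? Q) C ] * (ι (3 ℕ.* k) * ∏ Q (β S)))) ∎
            where
            per-Q : ∀ {Q} → Q ∈ 𝒟 → ∑ 𝔅 (λ z → [ all? (_∈? Q) C ] * [ z ∈? Q ] * ∏ Q (β S)) ≤ [ all? (_∈? Q) C ] * (ι (3 ℕ.* k) * ∏ Q (β S))
            per-Q {Q} Q∈ = ≤-trans (≤-reflexive (trans (∑-cong 𝔅 (λ z → *-assoc _ _ _)) (trans (∑-*ˡ 𝔅 _ _) (cong ([ all? (_∈? Q) C ] *_) (∑-*ʳ 𝔅 _ _)))))
              (*-monoʳ-≤ ([]-nonneg (all? (_∈? Q) C)) (*-monoˡ-≤ (∏-nonneg Q (β-nonneg S)) (≤-trans ([∈]-count Q) (ι-mono (𝒟-length Q∈)))))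

      count-𝒟 : ∀ {g : List Blk → Carrier} → (∀ Q → 0# ≤ g Q) →
        ∑ 𝔅 (λ z → ∑ 𝒟 (λ Q → [ z ∈? Q ] * g Q)) ≤ ι (3 ℕ.* k) * ∑ 𝒟 g
      count-𝒟 {g} hg = ≤-trans (≤-reflexive (∑-swap 𝔅 𝒟 _)) (≤-trans (∑-mono∈ 𝒟 (λ {Q} Q∈ → ≤-trans (≤-reflexive (∑-*ʳ 𝔅 (g Q) _))
        (*-monoˡ-≤ (hg Q) (≤-trans ([∈]-count Q) (ι-mono (𝒟-length Q∈)))))) (≤-reflexive (∑-*ˡ 𝒟 _ g)))

      -- Expected change of the degrees of pairs.

      module _ (0≤θ : 0# ≤ θ) (θ≤Λd : θ ≤ Λd) where

        -- The weight through a pair is nearly preserved on average, while with probability d / W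
        -- the pair is covered and its degree d drops to 0. Otherwise the degree has to rise by
        -- about d² / W, and the threshold is raised to match.
        τ θ⁺ : Carrier
        τ = θ * θ * ν
        θ⁺ = θ + τ

        0≤τ : 0# ≤ τ
        0≤τ = *-nonneg (*-nonneg 0≤θ 0≤θ) 0≤ν

        module Pair {e : Pr} (e∈ : e ∈ 𝔓) where

          -- `κe * u` bounds the growth of the degree and `X z` below is the weight lost when `z` is
          -- selected; `b` is the growth net of the rise of the threshold.
          d ex κe b : Carrier
          d = degree w e
          ex = excess w θ e
          κe = ∑ 𝔅 (λ B → [ inc? B e ] * w B * killRate B)
          b = κe * u - τ

          i : Blk → Carrier
          i z = [ inc? z e ]

          i-nonneg : ∀ z → 0# ≤ i z
          i-nonneg z = []-nonneg (inc? z e)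

          1-i-nonneg : ∀ z → 0# ≤ 1# - i z
          1-i-nonneg z = ≤⇒0≤ ([]≤1 (inc? z e))

          x : Blk → Blk → Carrier
          x z B = i B * w B * κ B z

          x-nonneg : ∀ z B → 0# ≤ x z B
          x-nonneg z B = *-nonneg (*-nonneg (i-nonneg B) (w-nonneg B)) ([]-nonneg (kill? S B z))

          X : Blk → Carrier
          X z = ∑ 𝔅 (x z)

          ex-nonneg' : 0# ≤ ex
          ex-nonneg' = pos-nonneg _

          d-nonneg : 0# ≤ d
          d-nonneg = ∑-nonneg 𝔅 (λ B → *-nonneg (i-nonneg B) (w-nonneg B))

          d≤Λd : d ≤ Λd
          d≤Λd = degree≤ e∈

          ex≤Λd : ex ≤ Λd
          ex≤Λd = pos≤ 0≤Λd (≤-trans (≤-by θ 0≤θ (solve 2 (λ d θ → d :- (d :- θ) := θ) refl d θ)) d≤Λd)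

          κe-nonneg : 0# ≤ κe
          κe-nonneg = ∑-nonneg 𝔅 (λ B → *-nonneg (*-nonneg (i-nonneg B) (w-nonneg B)) (killRate-nonneg B))

          κe≤ : κe ≤ Λd * Λ
          κe≤ = ≤-trans (∑-mono 𝔅 (λ B → ≤-trans (≤-reflexive (*-assoc _ _ _)) (≤-trans (*-monoʳ-≤ (i-nonneg B) (w*killRate≤ B)) (≤-reflexive (sym (*-assoc _ _ _))))))
            (≤-trans (≤-reflexive (∑-*ʳ 𝔅 Λ _)) (*-monoˡ-≤ 0≤Λ d≤Λd))

          -- The mixed term of growth and loss is dropped; it only lowers the degree.
          degree-step : ∀ z → degree (w⁺ z) e ≤ d + (κe * u - X z)
          degree-step z = ≤-trans (∑-mono 𝔅 each) (≤-reflexive (trans (∑-+ 𝔅 _ _) (cong (d +_) (trans (∑-minus 𝔅 _ _) (cong (_- X z) (∑-*ʳ 𝔅 u _))))))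
            where
            each : ∀ B → i B * w⁺ z B ≤ i B * w B + (i B * w B * killRate B * u - x z B)
            each B = ≤-by _ (*-nonneg (*-nonneg (*-nonneg (i-nonneg B) (w-nonneg B)) (*-nonneg (killRate-nonneg B) 0≤u)) ([]-nonneg (kill? S B z)))
              (solve 5 (λ i w k u c → (i :* w :+ (i :* w :* k :* u :- i :* w :* c)) :- i :* (w :* (con (1 , 0) :+ k :* u) :* (con (1 , 0) :- c)) :=
                i :* w :* (k :* u) :* c) refl (i B) (w B) (killRate B) u (κ B z))

          share⇒κ : ∀ {B z} → Inc B e → Inc z e → κ B z ≡ 1#
          share⇒κ {B} {z} iB iz = []-true (kill? S B z) (inj₁ (Any.map (λ { refl → iB , iz }) e∈))

          covered : ∀ {z} → Inc z e → degree (w⁺ z) e ≡ 0#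
          covered {z} iz = trans (∑-cong 𝔅 each) (∑-zero 𝔅)
            where
            each : ∀ B → i B * w⁺ z B ≡ 0#
            each B with inc? B e
            ... | no _ = zeroˡ _
            ... | yes iB = trans (*-identityˡ _) (trans (cong (λ t → w B * growth B * (1# - t)) (share⇒κ iB iz))
                  (trans (cong (w B * growth B *_) (-‿inverseʳ 1#)) (zeroʳ _)))

          noise : Carrier
          noise = ∑ 𝔅 (λ z → w z * ((1# - i z) * (X z * X z)))

          expand : Blk → Carrier
          expand z = (1# - i z) * (ex * ex + ι 2 * ex * (b - X z) + (ι 2 * (b * b) + ι 2 * (X z * X z)))

          -- If `z` contains the pair, every block through the pair dies and the new excess is 0,
          -- whence the factor `1# - i z`. Otherwise the excess moves by at most `b - X z`, whose
          -- square is split between the two terms.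
          next : ∀ {z} → w z * (excess (w⁺ z) θ⁺ e * excess (w⁺ z) θ⁺ e) ≤ w z * expand z
          next {z} = *-monoʳ-≤ (w-nonneg z) (≤-trans (square (inc? z e)) (*-monoʳ-≤ (1-i-nonneg z) (≤-trans
              (≤-reflexive (solve 3 (λ ex b X → (ex :+ (b :- X)) :* (ex :+ (b :- X)) := ex :* ex :+ con (2 , 0) :* ex :* (b :- X) :+ (b :- X) :* (b :- X)) refl ex b (X z)))
              (+-monoʳ-≤ _ (square-diff≤2 b (X z))))))
            where
            square : Dec (Inc z e) → excess (w⁺ z) θ⁺ e * excess (w⁺ z) θ⁺ e ≤ (1# - i z) * ((ex + (b - X z)) * (ex + (b - X z)))
            square (yes iz) = ≤-trans (≤-reflexive (trans (cong (λ t → t * t) (pos-≤0 (≤-trans (≤-reflexive (cong (_- θ⁺) (covered iz)))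
                (≤-by _ (+-nonneg 0≤θ 0≤τ) (solve 1 (λ t → con (0 , 0) :- (con (0 , 0) :- t) := t) refl θ⁺))))) (zeroˡ 0#)))
              (*-nonneg (1-i-nonneg z) (square-nonneg _))
            square (no ¬iz) = ≤-trans (pos²-step (d - θ) (b - X z) (≤-trans (+-monoˡ-≤ (- θ⁺) (degree-step z))
                (≤-reflexive (solve 5 (λ d k X θ t → (d :+ (k :- X)) :- (θ :+ t) := (d :- θ) :+ ((k :- t) :- X)) refl d (κe * u) (X z) θ τ))))
              (≤-reflexive (sym (trans (cong (_* ((ex + (b - X z)) * (ex + (b - X z)))) (trans (cong (λ s → 1# - s) ([]-false (inc? z e) ¬iz)) (solve 0 (con (1 , 0) :- con (0 , 0) := con (1 , 0)) refl))) (*-identityˡ _))))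

          ∑w[1-i] : ∑ 𝔅 (λ z → w z * (1# - i z)) ≡ W - d
          ∑w[1-i] = trans (∑-cong 𝔅 (λ z → solve 2 (λ w i → w :* (con (1 , 0) :- i) := w :- i :* w) refl (w z) (i z))) (∑-minus 𝔅 w _)

          -- A block through `e` kills every block through `e`, so `X z` is `d` for all of them;
          -- together they account for `d * d` of the whole sum `κe`.
          ∑w[1-i]X : ∑ 𝔅 (λ z → w z * (1# - i z) * X z) ≡ κe - d * d
          ∑w[1-i]X = trans (∑-cong 𝔅 (λ z → solve 3 (λ w i X → w :* (con (1 , 0) :- i) :* X := w :* X :- i :* w :* X) refl (w z) (i z) (X z)))
            (trans (∑-minus 𝔅 _ _) (cong₂ _-_ all-z through-e))
            where
            all-z : ∑ 𝔅 (λ z → w z * X z) ≡ κe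
            all-z = trans (∑-cong 𝔅 (λ z → sym (∑-*ˡ 𝔅 (w z) (x z)))) (trans (∑-swap 𝔅 𝔅 _) (∑-cong 𝔅 (λ B →
              trans (∑-cong 𝔅 (λ z → solve 3 (λ a b d → a :* (b :* d) := b :* (a :* d)) refl (w z) (i B * w B) (κ B z))) (∑-*ˡ 𝔅 (i B * w B) _))))
            inner : ∀ z → i z * w z * X z ≡ i z * w z * d
            inner z with inc? z e
            ... | no _ = trans (cong (_* X z) (zeroˡ (w z))) (trans (zeroˡ _) (sym (trans (cong (_* d) (zeroˡ (w z))) (zeroˡ d))))
            ... | yes iz = cong (1# * w z *_) (∑-cong 𝔅 each)
              where
              each : ∀ B → i B * w B * κ B z ≡ i B * w B
              each B with inc? B e
              ... | no _ = trans (cong (_* κ B z) (zeroˡ (w B))) (trans (zeroˡ _) (sym (zeroˡ (w B))))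
              ... | yes iB = trans (cong (1# * w B *_) (share⇒κ iB iz)) (*-identityʳ _)
            through-e : ∑ 𝔅 (λ z → i z * w z * X z) ≡ d * d
            through-e = trans (∑-cong 𝔅 inner) (∑-*ʳ 𝔅 d _)

          ∑expand : ∑ 𝔅 (λ z → w z * expand z) ≡ (W - d) * (ex * ex + ι 2 * ex * b + ι 2 * (b * b)) - ι 2 * ex * (κe - d * d) + ι 2 * noise
          ∑expand = trans (∑-cong 𝔅 (λ z → solve 5 (λ w i ex b X →
                w :* ((con (1 , 0) :- i) :* (ex :* ex :+ con (2 , 0) :* ex :* (b :- X) :+ (con (2 , 0) :* (b :* b) :+ con (2 , 0) :* (X :* X)))) :=
                w :* (con (1 , 0) :- i) :* (ex :* ex :+ con (2 , 0) :* ex :* b :+ con (2 , 0) :* (b :* b)) :- (con (2 , 0) :* ex) :* (w :* (con (1 , 0) :- i) :* X) :+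
                con (2 , 0) :* (w :* ((con (1 , 0) :- i) :* (X :* X)))) refl (w z) (i z) ex b (X z)))
            (trans (∑-+ 𝔅 _ _) (cong₂ _+_ (trans (∑-minus 𝔅 _ _) (cong₂ _-_ (trans (∑-*ʳ 𝔅 _ _) (cong (_* (ex * ex + ι 2 * ex * b + ι 2 * (b * b))) ∑w[1-i]))
              (trans (∑-*ˡ 𝔅 (ι 2 * ex) _) (cong (ι 2 * ex *_) ∑w[1-i]X)))) (∑-*ˡ 𝔅 (ι 2) _)))

          b² : b * b ≤ (Λd * Λ * ν) * (Λd * Λ * ν) + (Λd * Λd * ν) * (Λd * Λd * ν)
          b² = ≤-trans (square-diff≤ (*-nonneg κe-nonneg 0≤u) 0≤τ) (+-mono-≤
            (square-mono (*-nonneg κe-nonneg 0≤u) (*-mono-≤ κe-nonneg κe≤ 0≤u u≤ν))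
            (square-mono 0≤τ (*-monoˡ-≤ 0≤ν (square-mono 0≤θ θ≤Λd))))

          1≤Wν : 1# ≤ W * ν
          1≤Wν = ≤-trans (≤-reflexive (sym Wu≡1)) (*-monoʳ-≤ W-nonneg u≤ν)

          -- As `W * u` is 1, the terms linear in `κe` cancel. There remains `d * d` against
          -- `W * τ`, which is at least `θ * θ`; by `pos-*` their difference times `ex` is a
          -- multiple of `ex * ex`.
          drift : ex * ((W - d) * b - (κe - d * d)) ≤ ι 2 * Λd * (ex * ex) + Λd * Λd * (Λd * Λd * ν)
          drift = begin
            ex * ((W - d) * b - (κe - d * d))
              ≡⟨ cong (ex *_) (trans (solve 5 (λ W d k u t → (W :- d) :* (k :* u :- t) :- (k :- d :* d) :=
                    k :* (W :* u :- con (1 , 0)) :- d :* (k :* u) :- W :* t :+ d :* t :+ d :* d) refl W d κe u τ)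
                  (trans (cong (λ s → κe * (s - 1#) - d * (κe * u) - W * τ + d * τ + d * d) Wu≡1)
                    (solve 5 (λ W d k u t → k :* (con (1 , 0) :- con (1 , 0)) :- d :* (k :* u) :- W :* t :+ d :* t :+ d :* d :=
                      d :* d :+ d :* t :- (W :* t :+ d :* (k :* u))) refl W d κe u τ))) ⟩
            ex * (d * d + d * τ - (W * τ + d * (κe * u)))
              ≤⟨ *-monoʳ-≤ ex-nonneg' (minus-mono ≤-refl (≤-trans θ²≤Wτ (x≤x+y (W * τ) (*-nonneg d-nonneg (*-nonneg κe-nonneg 0≤u))))) ⟩
            ex * (d * d + d * τ - θ * θ)
              ≡⟨ solve 4 (λ ex d t θ → ex :* (d :* d :+ d :* t :- θ :* θ) := ex :* (d :* d :- θ :* θ) :+ ex :* (d :* t)) refl ex d τ θ ⟩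
            ex * (d * d - θ * θ) + ex * (d * τ)
              ≡⟨ cong (_+ ex * (d * τ)) (pos-* d θ) ⟩
            ex * ex * (d + θ) + ex * (d * τ)
              ≤⟨ +-mono-≤ (*-monoʳ-≤ (*-nonneg ex-nonneg' ex-nonneg') (+-mono-≤ d≤Λd θ≤Λd))
                   (*-mono-≤ ex-nonneg' ex≤Λd (*-nonneg d-nonneg 0≤τ) (*-mono-≤ d-nonneg d≤Λd 0≤τ (*-monoˡ-≤ 0≤ν (square-mono 0≤θ θ≤Λd)))) ⟩
            ex * ex * (Λd + Λd) + Λd * (Λd * (Λd * Λd * ν))
              ≡⟨ solve 3 (λ ex l v → ex :* ex :* (l :+ l) :+ l :* (l :* (l :* l :* v)) := con (2 , 0) :* l :* (ex :* ex) :+ l :* l :* (l :* l :* v)) refl ex Λd ν ⟩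
            ι 2 * Λd * (ex * ex) + Λd * Λd * (Λd * Λd * ν) ∎
            where
            open ≤-Chain
            θ²≤Wτ : θ * θ ≤ W * τ
            θ²≤Wτ = ≤-trans (≤-reflexive (sym (*-identityʳ _))) (≤-trans (*-monoʳ-≤ (*-nonneg 0≤θ 0≤θ) 1≤Wν)
              (≤-reflexive (solve 3 (λ t W v → t :* (W :* v) := W :* (t :* v)) refl (θ * θ) W ν)))

          each-pair : ∑ 𝔅 (λ z → w z * (excess (w⁺ z) θ⁺ e * excess (w⁺ z) θ⁺ e)) ≤
            (W + ι 4 * Λd) * (ex * ex) + (ι 2 * (Λd * Λd * (Λd * Λd * ν)) + ι 2 * W * (b * b)) + ι 2 * noise
          each-pair = begin
            ∑ 𝔅 (λ z → w z * (excess (w⁺ z) θ⁺ e * excess (w⁺ z) θ⁺ e))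
              ≤⟨ ∑-mono 𝔅 (λ z → next {z}) ⟩
            ∑ 𝔅 (λ z → w z * expand z)
              ≡⟨ ∑expand ⟩
            (W - d) * (ex * ex + ι 2 * ex * b + ι 2 * (b * b)) - ι 2 * ex * (κe - d * d) + ι 2 * noise
              ≡⟨ cong (_+ ι 2 * noise) (solve 5 (λ W d ex b k → (W :- d) :* (ex :* ex :+ con (2 , 0) :* ex :* b :+ con (2 , 0) :* (b :* b)) :- con (2 , 0) :* ex :* (k :- d :* d) :=
                   W :* (ex :* ex) :+ con (2 , 0) :* (ex :* ((W :- d) :* b :- (k :- d :* d))) :+ con (2 , 0) :* W :* (b :* b) :- d :* (ex :* ex :+ con (2 , 0) :* (b :* b))) refl W d ex b κe) ⟩
            W * (ex * ex) + ι 2 * (ex * ((W - d) * b - (κe - d * d))) + ι 2 * W * (b * b) - d * (ex * ex + ι 2 * (b * b)) + ι 2 * noise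
              ≤⟨ +-monoˡ-≤ _ (≤-by _ (+-nonneg (*-nonneg (ι-nonneg 2) (≤⇒0≤ drift)) (*-nonneg d-nonneg (+-nonneg (square-nonneg ex) (*-nonneg (ι-nonneg 2) (square-nonneg b)))))
                   (solve 7 (λ W P D l v B dd → ((W :+ con (4 , 0) :* l) :* P :+ (con (2 , 0) :* v :+ con (2 , 0) :* W :* B)) :-
                        (W :* P :+ con (2 , 0) :* D :+ con (2 , 0) :* W :* B :- dd) := con (2 , 0) :* ((con (2 , 0) :* l :* P :+ v) :- D) :+ dd)
                      refl W (ex * ex) (ex * ((W - d) * b - (κe - d * d))) Λd (Λd * Λd * (Λd * Λd * ν)) (b * b) (d * (ex * ex + ι 2 * (b * b))))) ⟩
            (W + ι 4 * Λd) * (ex * ex) + (ι 2 * (Λd * Λd * (Λd * Λd * ν)) + ι 2 * W * (b * b)) + ι 2 * noise ∎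
            where open ≤-Chain

          triples : Blk → Carrier
          triples B₁ = ∑ 𝔅 (λ z → ∑ 𝔅 (λ B₂ → ∑ 𝒟 (λ Q → [ B₂ ∈? Q ] * ([ z ∈? Q ] * ([ B₁ ∈? Q ] * ∏ Q (β S))))))

          -- The square of `X z` is expanded over two blocks through `e`. Equal blocks cost a factor
          -- `ρ`. Two different ones killed by a `z` that does not contain `e` lie with `z` in a
          -- dense configuration, by the second case of `closure`.
          noise≤ : noise ≤ ρ * (Λd * Λ) + ∑ 𝔅 (λ B₁ → i B₁ * triples B₁)
          noise≤ = begin
            ∑ 𝔅 (λ z → w z * ((1# - i z) * (X z * X z)))
              ≡⟨ ∑-cong 𝔅 (λ z → trans (solve 3 (λ w i X → w :* (i :* (X :* X)) := (w :* i :* X) :* X) refl (w z) (1# - i z) (X z))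
                   (trans (sym (∑-*ˡ 𝔅 (w z * (1# - i z) * X z) (x z))) (∑-cong 𝔅 (λ B₁ → trans
                      (solve 4 (λ w i X x → (w :* i :* X) :* x := (w :* i :* x) :* X) refl (w z) (1# - i z) (X z) (x z B₁)) (sym (∑-*ˡ 𝔅 (w z * (1# - i z) * x z B₁) (x z))))))) ⟩
            ∑ 𝔅 (λ z → ∑ 𝔅 (λ B₁ → ∑ 𝔅 (λ B₂ → w z * (1# - i z) * x z B₁ * x z B₂)))
              ≡⟨ ∑-swap 𝔅 𝔅 _ ⟩
            ∑ 𝔅 (λ B₁ → ∑ 𝔅 (λ z → ∑ 𝔅 (λ B₂ → w z * (1# - i z) * x z B₁ * x z B₂)))
              ≤⟨ ∑-mono 𝔅 (λ B₁ → ∑-mono 𝔅 (λ z → ∑-mono 𝔅 (λ B₂ → pointwise B₁ z B₂))) ⟩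
            ∑ 𝔅 (λ B₁ → ∑ 𝔅 (λ z → ∑ 𝔅 (λ B₂ → [ B₂ ∈? (B₁ ∷ []) ] * (ρ * (w z * x z B₁)) + i B₁ * t B₁ z B₂)))
              ≡⟨ ∑-cong 𝔅 (λ B₁ → trans (∑-cong 𝔅 (λ z → trans (∑-+ 𝔅 _ _) (cong₂ _+_ (∑-*ʳ 𝔅 _ _) (∑-*ˡ 𝔅 (i B₁) _))))
                   (trans (∑-+ 𝔅 _ _) (cong (∑ 𝔅 (λ z → ∑ 𝔅 (λ B₂ → [ B₂ ∈? (B₁ ∷ []) ]) * (ρ * (w z * x z B₁))) +_) (∑-*ˡ 𝔅 (i B₁) _)))) ⟩
            ∑ 𝔅 (λ B₁ → ∑ 𝔅 (λ z → ∑ 𝔅 (λ B₂ → [ B₂ ∈? (B₁ ∷ []) ]) * (ρ * (w z * x z B₁))) + i B₁ * triples B₁)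
              ≡⟨ ∑-+ 𝔅 _ _ ⟩
            ∑ 𝔅 (λ B₁ → ∑ 𝔅 (λ z → ∑ 𝔅 (λ B₂ → [ B₂ ∈? (B₁ ∷ []) ]) * (ρ * (w z * x z B₁)))) + ∑ 𝔅 (λ B₁ → i B₁ * triples B₁)
              ≤⟨ +-monoˡ-≤ _ (∑-mono 𝔅 (λ B₁ → ≤-trans (∑-mono 𝔅 (λ z → ≤-trans
                   (*-monoˡ-≤ (*-nonneg 0≤ρ (*-nonneg (w-nonneg z) (x-nonneg z B₁))) ([∈]-count (B₁ ∷ []))) (≤-reflexive (*-identityˡ _))))
                   (≤-reflexive (trans (∑-*ˡ 𝔅 ρ _) (cong (ρ *_) (trans (∑-cong 𝔅 (λ z → solve 3 (λ a b d → a :* (b :* d) := b :* (a :* d)) refl (w z) (i B₁ * w B₁) (κ B₁ z)))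
                      (∑-*ˡ 𝔅 (i B₁ * w B₁) _))))))) ⟩
            ∑ 𝔅 (λ B₁ → ρ * (i B₁ * w B₁ * killRate B₁)) + ∑ 𝔅 (λ B₁ → i B₁ * triples B₁)
              ≤⟨ +-monoˡ-≤ _ (≤-trans (≤-reflexive (∑-*ˡ 𝔅 ρ _)) (*-monoʳ-≤ 0≤ρ κe≤)) ⟩
            ρ * (Λd * Λ) + ∑ 𝔅 (λ B₁ → i B₁ * triples B₁) ∎
            where
            open ≤-Chain
            g : Blk → Blk → List Blk → Carrier
            g B₁ z Q = [ z ∈? Q ] * ([ B₁ ∈? Q ] * ∏ Q (β S))
            g-nonneg : ∀ B₁ z Q → 0# ≤ g B₁ z Q
            g-nonneg B₁ z Q = *-nonneg ([]-nonneg (z ∈? Q)) (*-nonneg ([]-nonneg (B₁ ∈? Q)) (∏-nonneg Q (β-nonneg S)))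
            t : Blk → Blk → Blk → Carrier
            t B₁ z B₂ = ∑ 𝒟 (λ Q → [ B₂ ∈? Q ] * g B₁ z Q)
            t-nonneg : ∀ B₁ z B₂ → 0# ≤ t B₁ z B₂
            t-nonneg B₁ z B₂ = ∑-nonneg 𝒟 (λ Q → *-nonneg ([]-nonneg (B₂ ∈? Q)) (g-nonneg B₁ z Q))
            rhs-nonneg : ∀ B₁ z B₂ → 0# ≤ [ B₂ ∈? (B₁ ∷ []) ] * (ρ * (w z * x z B₁)) + i B₁ * t B₁ z B₂
            rhs-nonneg B₁ z B₂ = +-nonneg (*-nonneg ([]-nonneg (B₂ ∈? (B₁ ∷ []))) (*-nonneg 0≤ρ (*-nonneg (w-nonneg z) (x-nonneg z B₁))))
              (*-nonneg (i-nonneg B₁) (t-nonneg B₁ z B₂))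
            x≤ρ : ∀ z B → x z B ≤ ρ
            x≤ρ z B = ≤-trans (*-mono-≤ (*-nonneg (i-nonneg B) (w-nonneg B)) (*-mono-≤ (i-nonneg B) ([]≤1 (inc? B e)) (w-nonneg B) (w≤ρ B)) ([]-nonneg (kill? S B z)) ([]≤1 (kill? S B z)))
              (≤-reflexive (trans (*-identityʳ _) (*-identityˡ _)))
            pointwise : ∀ B₁ z B₂ → w z * (1# - i z) * x z B₁ * x z B₂ ≤ [ B₂ ∈? (B₁ ∷ []) ] * (ρ * (w z * x z B₁)) + i B₁ * t B₁ z B₂
            pointwise B₁ z B₂ = by-cases (w z ≤? 0#) (inc? z e) (B₂ ≟ B₁) (killed? z B₁ ×-dec inc? B₁ e) (killed? z B₂ ×-dec inc? B₂ e)
              where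
              by-zero : ∀ {v} → v ≡ 0# → v ≤ [ B₂ ∈? (B₁ ∷ []) ] * (ρ * (w z * x z B₁)) + i B₁ * t B₁ z B₂
              by-zero eq = ≤-trans (≤-reflexive eq) (rhs-nonneg B₁ z B₂)
              x≡0 : ∀ {B} → ¬ ((Open B × Kill S B z) × Inc B e) → x z B ≡ 0#
              x≡0 {B} h with inc? B e
              ... | no _ = trans (cong (_* κ B z) (zeroˡ (w B))) (zeroˡ _)
              ... | yes iB with kill? S B z
              ...   | no _ = zeroʳ _
              ...   | yes kB with w B ≤? 0#
              ...     | yes q = trans (cong (λ s → 1# * s * 1#) (≤-antisym q (w-nonneg B))) (trans (*-identityʳ _) (*-identityˡ _))
              ...     | no q = ⊥-elim (h ((q , kB) , iB))
              by-cases : Dec (w z ≤ 0#) → Dec (Inc z e) → Dec (B₂ ≡ B₁) → Dec ((Open B₁ × Kill S B₁ z) × Inc B₁ e) → Dec ((Open B₂ × Kill S B₂ z) × Inc B₂ e) →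
                w z * (1# - i z) * x z B₁ * x z B₂ ≤ [ B₂ ∈? (B₁ ∷ []) ] * (ρ * (w z * x z B₁)) + i B₁ * t B₁ z B₂
              by-cases (yes h) _ _ _ _ = by-zero (trans (solve 4 (λ a b d e → a :* b :* d :* e := a :* (b :* d :* e)) refl (w z) (1# - i z) (x z B₁) (x z B₂)) (*-cancel-nonpos (w-nonneg z) h _))
              by-cases (no _) (yes iz) _ _ _ = by-zero (trans (cong (λ s → w z * (1# - s) * x z B₁ * x z B₂) ([]-true (inc? z e) iz))
                (solve 3 (λ a d e → a :* (con (1 , 0) :- con (1 , 0)) :* d :* e := con (0 , 0)) refl (w z) (x z B₁) (x z B₂)))
              by-cases (no _) (no _) _ (no h) _ = by-zero (trans (cong (λ s → w z * (1# - i z) * s * x z B₂) (x≡0 h))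
                (solve 3 (λ a d e → a :* d :* con (0 , 0) :* e := con (0 , 0)) refl (w z) (1# - i z) (x z B₂)))
              by-cases (no _) (no _) _ (yes _) (no h) = by-zero (trans (cong (w z * (1# - i z) * x z B₁ *_) (x≡0 h)) (zeroʳ _))
              by-cases (no _) (no _) (yes refl) (yes _) (yes _) = ≤-trans
                (*-mono-≤ (*-nonneg (*-nonneg (w-nonneg z) (1-i-nonneg z)) (x-nonneg z B₁))
                  (*-monoˡ-≤ (x-nonneg z B₁) (*-monoʳ-≤ (w-nonneg z) (≤-by (i z) (i-nonneg z) (solve 1 (λ s → con (1 , 0) :- (con (1 , 0) :- s) := s) refl (i z)))))
                  (x-nonneg z B₁) (x≤ρ z B₁))
                (≤-trans (≤-reflexive (trans (solve 3 (λ a d r → a :* con (1 , 0) :* d :* r := con (1 , 0) :* (r :* (a :* d))) refl (w z) (x z B₁) ρ)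
                    (cong (_* (ρ * (w z * x z B₁))) (sym ([]-true (B₁ ∈? (B₁ ∷ [])) (here refl))))))
                  (x≤x+y _ (*-nonneg (i-nonneg B₁) (t-nonneg B₁ z B₁))))
              by-cases (no oz) (no ¬iz) (no B₂≢B₁) (yes ((o₁ , k₁) , i₁)) (yes ((o₂ , k₂) , i₂))
                with closure {C = B₁ ∷ B₂ ∷ []} (inj₂ (refl , e , e∈ , i₁ , i₂ , ¬iz)) (support o₁) (support o₂) (support oz) (here refl) (there (here refl))
                       (λ eq → B₂≢B₁ (sym eq)) (λ { (here refl) → ¬iz i₁ ; (there (here refl)) → ¬iz i₂ }) k₁ k₂
              ... | Q , Q∈ , (B₁∈Q ∷ B₂∈Q ∷ []) , z∈Q , Q⊆ = begin
                w z * (1# - i z) * x z B₁ * x z B₂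
                  ≤⟨ *-mono-≤ (*-nonneg (*-nonneg (w-nonneg z) (1-i-nonneg z)) (x-nonneg z B₁))
                       (*-mono-≤ (*-nonneg (w-nonneg z) (1-i-nonneg z))
                         (*-mono-≤ (w-nonneg z) (w≤ρ z) (1-i-nonneg z) (≤-by (i z) (i-nonneg z) (solve 1 (λ s → con (1 , 0) :- (con (1 , 0) :- s) := s) refl (i z))))
                         (x-nonneg z B₁) (x≤ρ z B₁)) (x-nonneg z B₂) (x≤ρ z B₂) ⟩
                ρ * 1# * ρ * ρ
                  ≡⟨ trans (solve 1 (λ r → r :* con (1 , 0) :* r :* r := r :* (r :* (r :* con (1 , 0)))) refl ρ)
                       (cong₂ (λ s t → s * t) (sym (outside oz)) (cong₂ (λ s t → s * (t * 1#)) (sym (outside o₁)) (sym (outside o₂)))) ⟩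
                ∏ (z ∷ B₁ ∷ B₂ ∷ []) (β S)
                  ≤⟨ ∏β-⊆ {Q} {z ∷ B₁ ∷ B₂ ∷ []} (𝒟-unique Q∈) (λ q → place (All.lookup Q⊆ q)) ⟩
                ∏ Q (β S)
                  ≡⟨ sym (trans (cong₂ (λ s t → s * (t * ([ B₁ ∈? Q ] * ∏ Q (β S)))) ([]-true (B₂ ∈? Q) B₂∈Q) ([]-true (z ∈? Q) z∈Q))
                       (trans (*-identityˡ _) (trans (*-identityˡ _) (trans (cong (_* ∏ Q (β S)) ([]-true (B₁ ∈? Q) B₁∈Q)) (*-identityˡ _))))) ⟩
                [ B₂ ∈? Q ] * g B₁ z Q
                  ≤⟨ ∑-∈ (λ Q → *-nonneg ([]-nonneg (B₂ ∈? Q)) (g-nonneg B₁ z Q)) Q∈ ⟩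
                t B₁ z B₂
                  ≡⟨ sym (trans (cong (_* t B₁ z B₂) ([]-true (inc? B₁ e) i₁)) (*-identityˡ _)) ⟩
                i B₁ * t B₁ z B₂
                  ≤⟨ x≤y+x _ (*-nonneg ([]-nonneg (B₂ ∈? (B₁ ∷ []))) (*-nonneg 0≤ρ (*-nonneg (w-nonneg z) (x-nonneg z B₁)))) ⟩
                [ B₂ ∈? (B₁ ∷ []) ] * (ρ * (w z * x z B₁)) + i B₁ * t B₁ z B₂ ∎
                where
                outside : ∀ {B} → Open B → β S B ≡ ρ
                outside {B} o = sel-no (B ∈? S) (unselected (support o))
                place : ∀ {B} → B ∈ B₁ ∷ B₂ ∷ [] ⊎ B ≡ z ⊎ B ∈ S → B ∈ z ∷ B₁ ∷ B₂ ∷ [] ⊎ B ∈ S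
                place (inj₁ q) = inj₁ (there q)
                place (inj₂ (inj₁ q)) = inj₁ (here q)
                place (inj₂ (inj₂ q)) = inj₂ q

        open Pair using (noise; triples; noise≤; each-pair; b²; i-nonneg)

        ι3k : Carrier
        ι3k = ι (3 ℕ.* k)

        0≤ι3k : 0# ≤ ι3k
        0≤ι3k = ι-nonneg (3 ℕ.* k)

        quadratic : Carrier
        quadratic = ι 2 * (Λd * Λd * (Λd * Λd * ν)) + ι 2 * W * ((Λd * Λ * ν) * (Λd * Λ * ν) + (Λd * Λd * ν) * (Λd * Λd * ν))

        -- A dense configuration is charged for each choice of three of its blocks and each pair in
        -- the first of them, which gives the factor `c` and the three factors 3k.
        irregularity-step : ∑ 𝔅 (λ z → w z * irregularity (w⁺ z) θ⁺) ≤
          (W + ι 4 * Λd) * irregularity w θ + ι (length 𝔓) * (quadratic + ι 2 * (ρ * (Λd * Λ))) + ι 2 * (ι c * (ι3k * (ι3k * (ι3k * Dens))))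
        irregularity-step = begin
          ∑ 𝔅 (λ z → w z * irregularity (w⁺ z) θ⁺)
            ≡⟨ trans (∑-cong 𝔅 (λ z → sym (∑-*ˡ 𝔓 (w z) _))) (∑-swap 𝔅 𝔓 _) ⟩
          ∑ 𝔓 (λ e → ∑ 𝔅 (λ z → w z * (excess (w⁺ z) θ⁺ e * excess (w⁺ z) θ⁺ e)))
            ≤⟨ ∑-mono∈ 𝔓 (λ {e} e∈ → ≤-trans (each-pair e∈) (+-mono-≤ (+-monoʳ-≤ _ (+-monoʳ-≤ _ (*-monoʳ-≤ (*-nonneg (ι-nonneg 2) W-nonneg) (b² e∈))))
                  (≤-trans (*-monoʳ-≤ (ι-nonneg 2) (noise≤ e∈)) (≤-reflexive (distribˡ _ _ _))))) ⟩
          ∑ 𝔓 (λ e → (W + ι 4 * Λd) * (excess w θ e * excess w θ e) + quadratic + (ι 2 * (ρ * (Λd * Λ)) + ι 2 * ∑ 𝔅 (λ B → [ inc? B e ] * tr B)))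
            ≡⟨ trans (∑-cong 𝔓 (λ e → trans (+-assoc _ _ _) (cong ((W + ι 4 * Λd) * (excess w θ e * excess w θ e) +_) (sym (+-assoc quadratic _ _))))) (trans (∑-+ 𝔓 _ _)
                 (cong₂ _+_ (∑-*ˡ 𝔓 _ _) (trans (∑-+ 𝔓 _ _) (cong₂ _+_ (∑-const 𝔓 _) (∑-*ˡ 𝔓 (ι 2) _))))) ⟩
          (W + ι 4 * Λd) * irregularity w θ + (ι (length 𝔓) * (quadratic + ι 2 * (ρ * (Λd * Λ))) + ι 2 * ∑ 𝔓 (λ e → ∑ 𝔅 (λ B → [ inc? B e ] * tr B)))
            ≤⟨ +-monoʳ-≤ _ (+-monoʳ-≤ _ (*-monoʳ-≤ (ι-nonneg 2) all-triples)) ⟩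
          (W + ι 4 * Λd) * irregularity w θ + (ι (length 𝔓) * (quadratic + ι 2 * (ρ * (Λd * Λ))) + ι 2 * (ι c * (ι3k * (ι3k * (ι3k * Dens)))))
            ≡⟨ sym (+-assoc _ _ _) ⟩
          (W + ι 4 * Λd) * irregularity w θ + ι (length 𝔓) * (quadratic + ι 2 * (ρ * (Λd * Λ))) + ι 2 * (ι c * (ι3k * (ι3k * (ι3k * Dens)))) ∎
          where
          open ≤-Chain
          tr : Blk → Carrier
          tr B₁ = ∑ 𝔅 (λ z → ∑ 𝔅 (λ B₂ → ∑ 𝒟 (λ Q → [ B₂ ∈? Q ] * ([ z ∈? Q ] * ([ B₁ ∈? Q ] * ∏ Q (β S))))))
          tr-nonneg : ∀ B₁ → 0# ≤ tr B₁
          tr-nonneg B₁ = ∑-nonneg 𝔅 (λ z → ∑-nonneg 𝔅 (λ B₂ → ∑-nonneg 𝒟 (λ Q → *-nonneg ([]-nonneg (B₂ ∈? Q)) (*-nonneg ([]-nonneg (z ∈? Q)) (*-nonneg ([]-nonneg (B₁ ∈? Q)) (∏-nonneg Q (β-nonneg S)))))))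
          all-triples : ∑ 𝔓 (λ e → ∑ 𝔅 (λ B → [ inc? B e ] * tr B)) ≤ ι c * (ι3k * (ι3k * (ι3k * Dens)))
          all-triples = begin
            ∑ 𝔓 (λ e → ∑ 𝔅 (λ B → [ inc? B e ] * tr B))
              ≡⟨ trans (∑-swap 𝔓 𝔅 _) (∑-cong 𝔅 (λ B → ∑-*ʳ 𝔓 (tr B) _)) ⟩
            ∑ 𝔅 (λ B → ∑ 𝔓 (λ e → [ inc? B e ]) * tr B)
              ≤⟨ ∑-mono∈ 𝔅 (λ {B} B∈ → *-monoˡ-≤ (tr-nonneg B) (≤-trans (≤-reflexive (∑-indicator (inc? B) 𝔓)) (ι-mono (pairs-of-block B∈)))) ⟩
            ∑ 𝔅 (λ B → ι c * tr B)
              ≡⟨ ∑-*ˡ 𝔅 (ι c) tr ⟩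
            ι c * ∑ 𝔅 tr
              ≤⟨ *-monoʳ-≤ (ι-nonneg c) (≤-trans (∑-mono 𝔅 (λ B₁ → ≤-trans (∑-mono 𝔅 (λ z → count-𝒟 (λ Q → *-nonneg ([]-nonneg (z ∈? Q)) (*-nonneg ([]-nonneg (B₁ ∈? Q)) (∏-nonneg Q (β-nonneg S))))))
                   (≤-trans (≤-reflexive (∑-*ˡ 𝔅 ι3k _)) (*-monoʳ-≤ 0≤ι3k (count-𝒟 (λ Q → *-nonneg ([]-nonneg (B₁ ∈? Q)) (∏-nonneg Q (β-nonneg S))))))))
                 (≤-trans (≤-reflexive (trans (∑-*ˡ 𝔅 ι3k _) (cong (ι3k *_) (∑-*ˡ 𝔅 ι3k _)))) (*-monoʳ-≤ 0≤ι3k (*-monoʳ-≤ 0≤ι3k (count-𝒟 (λ Q → ∏-nonneg Q (β-nonneg S))))))) ⟩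
            ι c * (ι3k * (ι3k * (ι3k * Dens))) ∎

-- Iterating the selection under a potential.

module GreedyIteration where
  open OrderedFields
  open WeightedLists
  open RandomGreedy
  open import Data.Nat as ℕ using (ℕ; zero; suc)
  import Data.Nat.Properties as ℕₚ
  open import Data.List using (List; []; _∷_; length)
  open import Data.List.Membership.Propositional using (_∈_)
  open import Data.List.Relation.Unary.Any using (here; there)
  open import Data.List.Relation.Unary.All as All using (All; []; _∷_)
  open import Data.List.Relation.Unary.AllPairs using ([]; _∷_)
  open import Data.Product using (∃; _×_; _,_; proj₁; proj₂)
  open import Data.Sum using (_⊎_; inj₁; inj₂; [_,_]′)
  open import Data.Empty using (⊥-elim)
  open import Relation.Nullary using (¬_; Dec; yes; no)
  open import Relation.Binary.PropositionalEquality hiding ([_])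

  module Iteration (F : OrderedField) (system : BlockSystem) (parameters : Parameters system) where

    open Nibble F system parameters

    conflictGrowth conflictTransfer pairTransfer : Carrier
    conflictGrowth = ι 2 ^ k * ι k + ι 2 ^ k * (ι (k ℕ.* k) * ι k)
    conflictTransfer = ι 2 ^ k * (ι (k ℕ.* k) * (ι m * ι (3 ℕ.* k)))
    pairTransfer = ι 2 * (ι c * (ι (3 ℕ.* k) * (ι (3 ℕ.* k) * ι (3 ℕ.* k))))

    maxRate : Carrier → Carrier → Carrier
    maxRate Λd Λc = ι c * Λd + Λc

    mainGrowth : Carrier → Carrier
    mainGrowth Λd = ι 4 * Λd + pairTransfer + ι (3 ℕ.* k) + conflictTransfer + conflictGrowth

    -- The additive error of `irregularity-step` for one pair, divided by the total weight, whose
    -- reciprocal is bounded by `ν`.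
    pairNoise : (Λd Λc ν ρ : Carrier) → Carrier
    pairNoise Λd Λc ν ρ = ι 2 * (Λd * Λd * (Λd * Λd * ν)) * ν +
      ι 2 * ((Λd * maxRate Λd Λc * ν) * (Λd * maxRate Λd Λc * ν) + (Λd * Λd * ν) * (Λd * Λd * ν)) + ι 2 * (ρ * (Λd * maxRate Λd Λc)) * ν

    -- `L` is the number of steps, `N` a floor for the total weight with reciprocal `ν`, and `μ`
    -- bounds the threshold until the end. The field `initial` says that the starting potential plus
    -- `L` increments `δ` stays at most -N.
    record Constants (L : ℕ) : Set where
      field
        N ν Λd Λc γ ρ δ μ w₀ : Carrier
        Nν≡1 : N * ν ≡ 1#
        0≤ν : 0# ≤ ν
        N≰0 : ¬ (N ≤ 0#)
        ζμ≥1 : 1# ≤ (1# - ι L * ν) * μ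
        0≤μ : 0# ≤ μ
        μ+1≤Λd : μ + 1# ≤ Λd
        0≤Λc : 0# ≤ Λc
        γΛc≡1 : γ * Λc ≡ 1#
        0≤γ : 0# ≤ γ
        γ≤1 : γ ≤ 1#
        Λν≤1 : maxRate Λd Λc * ν ≤ 1#
        0≤ρ : 0# ≤ ρ
        ρ≤1 : ρ ≤ 1#
        0≤w₀ : 0# ≤ w₀
        w₀≤ρ : w₀ * (1# + maxRate Λd Λc * ν) ^ L ≤ ρ
        0≤δ : 0# ≤ δ
        noise≤δ : (1# + mainGrowth Λd * ν) ^ L * (ι (length 𝔓) * pairNoise Λd Λc ν ρ) + maxRate Λd Λc * maxRate Λd Λc * ν ≤ δ
        has-pair : ∀ {B} → B ∈ 𝔅 → Share B B
        𝒯-long : ∀ {C} → C ∈ 𝒯 → 2 ℕ.≤ length C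
        degree₀ : ∀ {e} → e ∈ 𝔓 → ∑ 𝔅 (λ B → [ inc? B e ]) * w₀ ≤ 1#
        initial : γ * (1# + conflictGrowth * ν) ^ L * ∑ 𝒯 (λ C → w₀ ^ length C) +
          (1# + mainGrowth Λd * ν) ^ L * ∑ 𝒟 (λ Q → ρ ^ length Q) + N + ι L * δ ≤ ι (length 𝔅) * w₀

    module Process {L : ℕ} (constants : Constants L) where
      open Constants constants

      Λ ζ g₁ g₂ G C₁ C₂ Cʸ : Carrier
      Λ = maxRate Λd Λc
      ζ = 1# - ι L * ν
      C₁ = conflictGrowth
      C₂ = conflictTransfer
      Cʸ = mainGrowth Λd
      g₁ = 1# + C₁ * ν
      g₂ = 1# + Cʸ * ν
      G = 1# + Λ * ν

      1≤Λd : 1# ≤ Λd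
      1≤Λd = ≤-trans (x≤y+x 1# 0≤μ) μ+1≤Λd

      0≤Λd : 0# ≤ Λd
      0≤Λd = ≤-trans 0≤1 1≤Λd

      0≤Λ : 0# ≤ Λ
      0≤Λ = +-nonneg (*-nonneg (ι-nonneg c) 0≤Λd) 0≤Λc

      0≤2^k : 0# ≤ ι 2 ^ k
      0≤2^k = ^-nonneg (ι-nonneg 2) k

      0≤C₁ : 0# ≤ C₁
      0≤C₁ = +-nonneg (*-nonneg 0≤2^k (ι-nonneg k)) (*-nonneg 0≤2^k (*-nonneg (ι-nonneg (k ℕ.* k)) (ι-nonneg k)))

      0≤C₂ : 0# ≤ C₂
      0≤C₂ = *-nonneg 0≤2^k (*-nonneg (ι-nonneg (k ℕ.* k)) (*-nonneg (ι-nonneg m) (ι-nonneg (3 ℕ.* k))))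

      0≤pairTransfer : 0# ≤ pairTransfer
      0≤pairTransfer = *-nonneg (ι-nonneg 2) (*-nonneg (ι-nonneg c) (*-nonneg (ι-nonneg (3 ℕ.* k)) (*-nonneg (ι-nonneg (3 ℕ.* k)) (ι-nonneg (3 ℕ.* k)))))

      0≤rest : 0# ≤ ι 4 * Λd + pairTransfer + ι (3 ℕ.* k) + C₂
      0≤rest = +-nonneg (+-nonneg (+-nonneg (*-nonneg (ι-nonneg 4) 0≤Λd) 0≤pairTransfer) (ι-nonneg (3 ℕ.* k))) 0≤C₂

      1≤g₁ : 1# ≤ g₁
      1≤g₁ = x≤x+y 1# (*-nonneg 0≤C₁ 0≤ν)

      g₁≤g₂ : g₁ ≤ g₂
      g₁≤g₂ = +-monoʳ-≤ 1# (*-monoˡ-≤ 0≤ν (x≤y+x C₁ 0≤rest))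

      1≤g₂ : 1# ≤ g₂
      1≤g₂ = ≤-trans 1≤g₁ g₁≤g₂

      0≤g₁^ : ∀ j → 0# ≤ g₁ ^ j
      0≤g₁^ = ^-nonneg (≤-trans 0≤1 1≤g₁)

      0≤g₂^ : ∀ j → 0# ≤ g₂ ^ j
      0≤g₂^ = ^-nonneg (≤-trans 0≤1 1≤g₂)

      1≤G : 1# ≤ G
      1≤G = x≤x+y 1# (*-nonneg 0≤Λ 0≤ν)

      density : List Blk → Carrier
      density S = configWeight 𝒟 S (λ _ → ρ)

      -- On average over the next block the potential grows by at most δ. Since the total weight enters with a negative sign,
      -- keeping it at most -N keeps that weight above N, so that the selection can go on.
      potential : ℕ → List Blk → (Blk → Carrier) → Carrier → Carrier
      potential j S w θ = γ * g₁ ^ j * configWeight 𝒯 S w + g₂ ^ j * (irregularity w θ + density S) - total w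

      -- The factor `G ^ j` in `bound` reserves room for the growth of the weights in the `j` steps
      -- still to come.
      record Weighting (j : ℕ) (S : List Blk) (w : Blk → Carrier) : Set where
        constructor weighting
        field
          w-nonneg : ∀ B → 0# ≤ w B
          support : ∀ {B} → ¬ (w B ≤ 0#) → Available S B
          bound : ∀ B → w B * G ^ j ≤ ρ

      open Weighting

      w≤ρ : ∀ {j S w} → Weighting j S w → ∀ B → w B ≤ ρ
      w≤ρ {j} v B = ≤-trans (≤-trans (≤-reflexive (sym (*-identityʳ _))) (*-monoʳ-≤ (w-nonneg v B) (1≤^ 1≤G j))) (bound v B)

      degree-mono : ∀ {v w} → (∀ B → v B ≤ w B) → ∀ e → degree v e ≤ degree w e
      degree-mono h e = ∑-mono 𝔅 (λ B → *-monoʳ-≤ ([]-nonneg (inc? B e)) (h B))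

      α-mono : ∀ S {v w} → (∀ B → v B ≤ w B) → ∀ x → α S v x ≤ α S w x
      α-mono S h x with x ∈? S
      ... | yes _ = ≤-refl
      ... | no _ = h x

      load-mono : ∀ S {v w} → (∀ B → 0# ≤ v B) → (∀ B → v B ≤ w B) → ∀ B → conflictLoad S v B ≤ conflictLoad S w B
      load-mono S {v} {w} hv h B = ∑-mono 𝒯 (λ C → *-monoʳ-≤ ([]-nonneg (B ∈? C))
        (∏-mono∈ C (λ {x} _ → sel-nonneg (x ≟ B) 0≤1 (α-nonneg hv x)) (λ {x} _ → each x)))
        where
        each : ∀ x → sel (x ≟ B) 1# (α S v x) ≤ sel (x ≟ B) 1# (α S w x)
        each x with x ≟ B
        ... | yes _ = ≤-refl
        ... | no _ = α-mono S h x

      excess-mono : ∀ {v w θ} → (∀ B → v B ≤ w B) → ∀ e → excess v θ e ≤ excess w θ e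
      excess-mono {θ = θ} h e = pos≤ (pos-nonneg _) (≤-trans (+-monoˡ-≤ (- θ) (degree-mono h e)) (x≤pos _))

      irregularity-mono : ∀ {v w θ} → (∀ B → v B ≤ w B) → irregularity v θ ≤ irregularity w θ
      irregularity-mono h = ∑-mono 𝔓 (λ e → square-mono (pos-nonneg _) (excess-mono h e))

      Fine : List Blk → (Blk → Carrier) → Blk → Set
      Fine S w B = conflictLoad S w B ≤ Λc × All (λ e → Inc B e → degree w e ≤ Λd) 𝔓

      module Discard {j S w θ} (v : Weighting j S w) (θ+1≤Λd : θ + 1# ≤ Λd) {B : Blk} (B∈ : B ∈ 𝔅) (wB≰0 : ¬ (w B ≤ 0#)) where

        w⁻ : Blk → Carrier
        w⁻ x = sel (x ≟ B) 0# (w x)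

        w⁻≤w : ∀ x → w⁻ x ≤ w x
        w⁻≤w x with x ≟ B
        ... | yes _ = w-nonneg v x
        ... | no _ = ≤-refl

        w⁻-nonneg : ∀ x → 0# ≤ w⁻ x
        w⁻-nonneg x = sel-nonneg (x ≟ B) ≤-refl (w-nonneg v x)

        weighting⁻ : Weighting j S w⁻
        weighting⁻ = weighting w⁻-nonneg (λ {x} p → support v (λ q → p (≤-trans (w⁻≤w x) q)))
          (λ x → ≤-trans (*-monoˡ-≤ (^-nonneg (≤-trans 0≤1 1≤G) j) (w⁻≤w x)) (bound v x))

        total⁻ : total w - w B ≤ total w⁻
        total⁻ = ≤-by _ (≤⇒0≤ (≤-trans (∑-single {xs = 𝔅} {B} {λ x → w x - w⁻ x} 𝔅-unique (≤⇒0≤ (w⁻≤w B)) others _≟_)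
            (≤-by (w⁻ B) (w⁻-nonneg B) (solve 2 (λ a b → a :- (a :- b) := b) refl (w B) (w⁻ B)))))
          (trans (solve 3 (λ W b W' → W' :- (W :- b) := b :- (W :- W')) refl (total w) (w B) (total w⁻))
            (cong (λ t → w B - t) (sym (∑-minus 𝔅 w w⁻))))
          where
          others : ∀ {x} → x ∈ 𝔅 → x ≢ B → w x - w⁻ x ≤ 0#
          others {x} _ x≢B = ≤-reflexive (trans (cong (λ t → w x - t) (sel-no (x ≟ B) x≢B)) (-‿inverseʳ _))

        -- A product over distinct blocks is linear in the weight of `B`: the value at weight 0 plus
        -- `w B` times the derivative.
        weight-split : ∀ {C} → C ∈ 𝒯 → ∏ C (α S w) ≡ ∏ C (α S w⁻) + w B * ([ B ∈? C ] * ∏ C (λ x → sel (x ≟ B) 1# (α S w x)))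
        weight-split {C} C∈ = by-cases (B ∈? C)
          where
          P : Carrier
          P = ∏ C (λ x → sel (x ≟ B) 1# (α S w x))
          α-off : ∀ {x} → x ≢ B → α S w⁻ x ≡ α S w x
          α-off {x} x≢B with x ∈? S
          ... | yes _ = refl
          ... | no _ = sel-no (x ≟ B) x≢B
          αB : α S w B ≡ w B
          αB = sel-no (B ∈? S) (unselected (support v wB≰0))
          α⁻B : α S w⁻ B ≡ 0#
          α⁻B = trans (sel-no (B ∈? S) (unselected (support v wB≰0))) (sel-yes (B ≟ B) refl)
          αB-one : sel (B ≟ B) 1# (α S w B) ≡ 1#
          αB-one = sel-yes (B ≟ B) refl
          by-cases : Dec (B ∈ C) → ∏ C (α S w) ≡ ∏ C (α S w⁻) + w B * ([ B ∈? C ] * P)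
          by-cases (no B∉C) = trans (∏-cong∈ C (λ {x} x∈ → sym (α-off (λ { refl → B∉C x∈ }))))
            (trans (sym (+-identityʳ _)) (cong (∏ C (α S w⁻) +_) (sym (trans (cong (λ t → w B * (t * P)) ([]-false (B ∈? C) B∉C))
              (trans (cong (w B *_) (zeroˡ P)) (zeroʳ _))))))
          by-cases (yes B∈C) = trans (trans (sym (*-identityʳ _)) (trans (cong (∏ C (α S w) *_) (sym αB-one))
              (trans (∏-change _≟_ (𝒯-unique C∈) B∈C (λ {x} _ x≢B → sym (sel-no (x ≟ B) x≢B))) (trans (cong (P *_) αB) (*-comm P (w B))))))
            (trans (sym (+-identityˡ _)) (cong₂ _+_ (sym zero-product) (cong (w B *_) (sym (trans (cong (_* P) ([]-true (B ∈? C) B∈C)) (*-identityˡ P))))))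
            where
            zero-product : ∏ C (α S w⁻) ≡ 0#
            zero-product = trans (sym (*-identityʳ _)) (trans (cong (∏ C (α S w⁻) *_) (sym αB-one))
              (trans (∏-change _≟_ (𝒯-unique C∈) B∈C (λ {x} _ x≢B → trans (α-off x≢B) (sym (sel-no (x ≟ B) x≢B)))) (trans (cong (P *_) α⁻B) (zeroʳ P))))

        conflicts⁻ : configWeight 𝒯 S w ≡ configWeight 𝒯 S w⁻ + w B * conflictLoad S w B
        conflicts⁻ = trans (∑-cong∈ 𝒯 weight-split) (trans (∑-+ 𝒯 _ _) (cong (configWeight 𝒯 S w⁻ +_) (∑-*ˡ 𝒯 (w B) _)))

        conflicts⁻≤ : configWeight 𝒯 S w⁻ ≤ configWeight 𝒯 S w
        conflicts⁻≤ = ≤-trans (x≤x+y _ (*-nonneg (w-nonneg v B) (∑-nonneg 𝒯 (λ C → *-nonneg ([]-nonneg (B ∈? C))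
          (∏-nonneg C (λ x → sel-nonneg (x ≟ B) 0≤1 (α-nonneg (w-nonneg v) x))))))) (≤-reflexive (sym conflicts⁻))

        degree⁻ : ∀ {e} → Inc B e → degree w⁻ e ≤ degree w e - w B
        degree⁻ {e} iB = ≤-by _ (≤⇒0≤ (≤-trans (≤-reflexive (trans (sym gapB) (sym (*-identityʳ _)))) (≤-trans (≤-reflexive (*-identityʳ _))
            (∑-∈ {xs = 𝔅} {B} {gap} (λ x → *-nonneg ([]-nonneg (inc? x e)) (≤⇒0≤ (w⁻≤w x))) B∈))))
          (trans (solve 3 (λ d b d' → (d :- b) :- d' := (d :- d') :- b) refl (degree w e) (w B) (degree w⁻ e))
            (cong (_- w B) (trans (sym (∑-minus 𝔅 _ _)) (∑-cong 𝔅 (λ x → solve 3 (λ i a b → i :* a :- i :* b := i :* (a :- b)) refl [ inc? x e ] (w x) (w⁻ x))))))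
          where
          gap : Blk → Carrier
          gap x = [ inc? x e ] * (w x - w⁻ x)
          gapB : gap B ≡ w B
          gapB = trans (cong₂ (λ s t → s * (w B - t)) ([]-true (inc? B e) iB) (sel-yes (B ≟ B) refl))
            (solve 1 (λ b → con (1 , 0) :* (b :- con (0 , 0)) := b) refl (w B))

        -- With y the degree minus `θ`, discarding turns y² into at most (y - w)², a drop of w(2y -
        -- w), which is at least w because y ≥ 1 ≥ w. This is why `Λd` exceeds every threshold by 1.
        irregularity⁻ : ∀ {e} → e ∈ 𝔓 → Inc B e → ¬ (degree w e ≤ Λd) → irregularity w⁻ θ + w B ≤ irregularity w θ
        irregularity⁻ {e} e∈ iB d≰ = ≤-by _ (≤⇒0≤ (≤-trans single
            (∑-∈ {xs = 𝔓} {e} {λ e → sq w e - sq w⁻ e} (λ e → ≤⇒0≤ (square-mono (pos-nonneg _) (excess-mono {w⁻} {w} {θ} w⁻≤w e))) e∈)))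
          (trans (solve 3 (λ y y' b → y :- (y' :+ b) := (y :- y') :- b) refl (irregularity w θ) (irregularity w⁻ θ) (w B))
            (cong (_- w B) (sym (∑-minus 𝔓 (sq w) (sq w⁻)))))
          where
          sq : (Blk → Carrier) → Pr → Carrier
          sq w e = excess w θ e * excess w θ e
          y : Carrier
          y = degree w e - θ
          1≤y : 1# ≤ y
          1≤y = ≤-by _ (≤⇒0≤ (≤-trans θ+1≤Λd (≰⇒≥ d≰))) (solve 2 (λ d θ → (d :- θ) :- con (1 , 0) := d :- (θ :+ con (1 , 0))) refl (degree w e) θ)
          w≤1 : w B ≤ 1#
          w≤1 = ≤-trans (w≤ρ v B) ρ≤1
          0≤y-w : 0# ≤ y - w B
          0≤y-w = ≤⇒0≤ (≤-trans w≤1 1≤y)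
          excess⁻ : excess w⁻ θ e ≤ y - w B
          excess⁻ = pos≤ 0≤y-w (≤-trans (+-monoˡ-≤ (- θ) (degree⁻ iB)) (≤-reflexive (solve 3 (λ d b θ → (d :- b) :- θ := (d :- θ) :- b) refl (degree w e) (w B) θ)))
          single : w B ≤ sq w e - sq w⁻ e
          single = ≤-trans (≤-by _ (*-nonneg (w-nonneg v B) (+-nonneg (+-nonneg (≤⇒0≤ 1≤y) (≤⇒0≤ 1≤y)) (≤⇒0≤ w≤1)))
              (solve 2 (λ y b → (y :* y :- (y :- b) :* (y :- b)) :- b := b :* (((y :- con (1 , 0)) :+ (y :- con (1 , 0))) :+ (con (1 , 0) :- b))) refl y (w B)))
            (minus-mono (square-mono (≤-trans 0≤1 1≤y) (x≤pos y)) (square-mono (pos-nonneg _) excess⁻))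

        Φ Φ⁻ : Carrier
        Φ = potential j S w θ
        Φ⁻ = potential j S w⁻ θ

        0≤p₁ : 0# ≤ γ * g₁ ^ j
        0≤p₁ = *-nonneg 0≤γ (0≤g₁^ j)

        -- Discarding costs `w B` of total weight but frees `w B` times the load of conflict weight,
        -- and `γ * Λc` is 1: overloaded blocks are worth giving up.
        discard-loaded : ¬ (conflictLoad S w B ≤ Λc) → Φ⁻ ≤ Φ
        discard-loaded l≰ = begin
          γ * g₁ ^ j * T⁻ + g₂ ^ j * (irregularity w⁻ θ + density S) - total w⁻
            ≤⟨ minus-mono (+-monoʳ-≤ _ (*-monoʳ-≤ (0≤g₂^ j) (+-monoˡ-≤ (density S) (irregularity-mono {w⁻} {w} {θ} w⁻≤w)))) total⁻ ⟩
          γ * g₁ ^ j * T⁻ + Y - (total w - w B)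
            ≤⟨ ≤-by _ (≤⇒0≤ enough) (trans (cong (λ t → (γ * g₁ ^ j * t + Y - total w) - (γ * g₁ ^ j * T⁻ + Y - (total w - w B))) conflicts⁻)
                 (solve 6 (λ a T b l Y W → (a :* (T :+ b :* l) :+ Y :- W) :- (a :* T :+ Y :- (W :- b)) := b :* (a :* l) :- b) refl
                   (γ * g₁ ^ j) T⁻ (w B) (conflictLoad S w B) Y (total w))) ⟩
          Φ ∎
          where
          open ≤-Chain
          T⁻ = configWeight 𝒯 S w⁻
          Y = g₂ ^ j * (irregularity w θ + density S)
          enough : w B ≤ w B * (γ * g₁ ^ j * conflictLoad S w B)
          enough = ≤-trans (≤-reflexive (sym (*-identityʳ _))) (*-monoʳ-≤ (w-nonneg v B) (≤-trans (≤-reflexive (sym γΛc≡1))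
            (*-mono-≤ 0≤γ (≤-trans (≤-reflexive (sym (*-identityʳ γ))) (*-monoʳ-≤ 0≤γ (1≤^ 1≤g₁ j))) 0≤Λc (≰⇒≥ l≰))))

        discard-irregular : ∀ {e} → e ∈ 𝔓 → Inc B e → ¬ (degree w e ≤ Λd) → Φ⁻ ≤ Φ
        discard-irregular {e} e∈ iB d≰ = begin
          γ * g₁ ^ j * configWeight 𝒯 S w⁻ + g₂ ^ j * (irregularity w⁻ θ + density S) - total w⁻
            ≤⟨ minus-mono (+-monoˡ-≤ _ (*-monoʳ-≤ 0≤p₁ conflicts⁻≤)) total⁻ ⟩
          γ * g₁ ^ j * configWeight 𝒯 S w + g₂ ^ j * (irregularity w⁻ θ + density S) - (total w - w B)
            ≤⟨ ≤-by _ (+-nonneg (*-nonneg (0≤g₂^ j) (≤⇒0≤ (irregularity⁻ e∈ iB d≰))) (*-nonneg (w-nonneg v B) (≤⇒0≤ (1≤^ 1≤g₂ j))))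
                 (solve 7 (λ T g y y' D W b → (T :+ g :* (y :+ D) :- W) :- (T :+ g :* (y' :+ D) :- (W :- b)) :=
                    g :* (y :- (y' :+ b)) :+ b :* (g :- con (1 , 0))) refl
                   (γ * g₁ ^ j * configWeight 𝒯 S w) (g₂ ^ j) (irregularity w θ) (irregularity w⁻ θ) (density S) (total w) (w B)) ⟩
          Φ ∎
          where open ≤-Chain

      fine? : ∀ S w B → Fine S w B ⊎ (¬ (conflictLoad S w B ≤ Λc)) ⊎ (∃ λ e → e ∈ 𝔓 × Inc B e × ¬ (degree w e ≤ Λd))
      fine? S w B with conflictLoad S w B ≤? Λc
      ... | no l≰ = inj₂ (inj₁ l≰)
      ... | yes l≤ with search 𝔓
        where
        search : ∀ es → All (λ e → Inc B e → degree w e ≤ Λd) es ⊎ (∃ λ e → e ∈ es × Inc B e × ¬ (degree w e ≤ Λd))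
        search [] = inj₁ []
        search (e ∷ es) with search es | inc? B e | degree w e ≤? Λd
        ... | inj₂ (e' , p , q) | _ | _ = inj₂ (e' , there p , q)
        ... | inj₁ _ | yes iB | no d≰ = inj₂ (e , here refl , iB , d≰)
        ... | inj₁ all | yes _ | yes d≤ = inj₁ ((λ _ → d≤) ∷ all)
        ... | inj₁ all | no ¬iB | _ = inj₁ ((λ iB → ⊥-elim (¬iB iB)) ∷ all)
      ...   | inj₁ all = inj₁ (l≤ , all)
      ...   | inj₂ bad = inj₂ (inj₂ bad)

      fine-mono : ∀ {S v w B} → (∀ B → 0# ≤ v B) → (∀ B → v B ≤ w B) → Fine S w B → Fine S v B
      fine-mono {S} {v} {w} {B} hv h (l , d) = ≤-trans (load-mono S hv h B) l , All.map (λ {e} f iB → ≤-trans (degree-mono h e) (f iB)) d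

      -- Discarding a block never spoils another one, so a single pass suffices.
      prune : ∀ {j S w θ} → Weighting j S w → θ + 1# ≤ Λd →
        ∃ λ v → Weighting j S v × potential j S v θ ≤ potential j S w θ × (∀ {B} → B ∈ 𝔅 → ¬ (v B ≤ 0#) → Fine S v B)
      prune {j} {S} {w} {θ} wt hθ = pass 𝔅 (λ p → p)
        where
        Result : List Blk → Set
        Result xs = ∃ λ v → Weighting j S v × potential j S v θ ≤ potential j S w θ × (∀ {B} → B ∈ xs → ¬ (v B ≤ 0#) → Fine S v B)
        pass : ∀ xs → (∀ {x} → x ∈ xs → x ∈ 𝔅) → Result xs
        pass [] _ = w , wt , ≤-refl , λ ()
        pass (x ∷ xs) sub with pass xs (λ p → sub (there p))
        ... | v , vt , le , fine with v x ≤? 0#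
        ...   | yes vx≤0 = v , vt , le , λ { (here refl) v≰0 → ⊥-elim (v≰0 vx≤0) ; (there p) → fine p }
        ...   | no vx≰0 with fine? S v x
        ...     | inj₁ ok = v , vt , le , λ { (here refl) _ → ok ; (there p) → fine p }
        ...     | inj₂ bad = w⁻ , weighting⁻ , ≤-trans smaller le ,
                    λ { (here refl) v≰0 → ⊥-elim (v≰0 (≤-reflexive (sel-yes (x ≟ x) refl)))
                      ; {B} (there p) v≰0 → fine-mono w⁻-nonneg w⁻≤w (fine p (λ q → v≰0 (≤-trans (w⁻≤w B) q))) }
          where
          open Discard {θ = θ} vt hθ (sub (here refl)) vx≰0
          smaller : potential j S w⁻ θ ≤ potential j S v θ
          smaller = [ discard-loaded , (λ (e , e∈ , iB , d≰) → discard-irregular e∈ iB d≰) ]′ bad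

      -- The index counts the steps still to come. `θ-bound` encodes θ ≤ 1 / (1 - iν) after i = L -
      -- j steps, the solution of the recursion for the threshold; `Φ-bound` reserves `δ` for each
      -- remaining step.
      record State (j : ℕ) : Set where
        field
          S : List Blk
          w : Blk → Carrier
          θ : Carrier
          is-good : Good S
          size : length S ℕ.+ j ≡ L
          wt : Weighting j S w
          fine : ∀ {B} → B ∈ 𝔅 → ¬ (w B ≤ 0#) → Fine S w B
          0≤θ : 0# ≤ θ
          θ-bound : θ * (ζ + ι j * ν) ≤ 1#
          Φ-bound : potential j S w θ + ι j * δ + N ≤ 0#

      θ+1≤Λd : ∀ {j θ} → 0# ≤ θ → θ * (ζ + ι j * ν) ≤ 1# → θ + 1# ≤ Λd
      θ+1≤Λd {j} {θ} 0≤θ h = ≤-trans (+-monoˡ-≤ 1# θ≤μ) μ+1≤Λd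
        where
        θζ≤1 : θ * ζ ≤ 1#
        θζ≤1 = ≤-trans (*-monoʳ-≤ 0≤θ (x≤x+y ζ (*-nonneg (ι-nonneg j) 0≤ν))) h
        θ≤μ : θ ≤ μ
        θ≤μ = ≤-trans (≤-trans (≤-reflexive (sym (*-identityʳ θ))) (*-monoʳ-≤ 0≤θ ζμ≥1))
          (≤-trans (≤-reflexive (sym (*-assoc θ ζ μ))) (≤-trans (*-monoˡ-≤ 0≤μ θζ≤1) (≤-reflexive (*-identityˡ μ))))

      module Advance {j : ℕ} {S : List Blk} {w : Blk → Carrier} {θ u : Carrier} (j≤L : j ℕ.≤ L)
        (wt : Weighting (suc j) S w) (0≤θ : 0# ≤ θ) (θ≤Λd : θ ≤ Λd)
        (degree≤ : ∀ {e} → e ∈ 𝔓 → degree w e ≤ Λd)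
        (load≤ : ∀ {B} → B ∈ 𝔅 → ¬ (w B ≤ 0#) → conflictLoad S w B ≤ Λc)
        (Wu≡1 : total w * u ≡ 1#) (0≤u : 0# ≤ u) (u≤ν : u ≤ ν) (N≤W : N ≤ total w) where

        stepData : StepData
        stepData = record
          { S = S ; w = w ; ρ = ρ ; ν = ν ; Λd = Λd ; Λc = Λc ; θ = θ ; u = u ; w-nonneg = w-nonneg wt ; support = support wt ; w≤ρ = w≤ρ wt ; ρ≤1 = ρ≤1 ; 0≤ρ = 0≤ρ
          ; 0≤Λd = 0≤Λd ; 0≤Λc = 0≤Λc ; degree≤ = degree≤ ; load≤ = load≤ ; Wu≡1 = Wu≡1 ; 0≤u = 0≤u ; u≤ν = u≤ν ; has-pair = has-pair }

        open Step stepData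
          using (w⁺; w⁺-nonneg; growth; growth-nonneg; killRate; killRate≤Λ; killRate-nonneg; κ; 1-κ-nonneg; 1-κ≤1; total-step; dense-step; conflict-step; irregularity-step; quadratic) public

        Φ : Carrier
        Φ = potential (suc j) S w θ

        T Y D W : Carrier
        T = configWeight 𝒯 S w
        Y = irregularity w θ
        D = density S
        W = total w

        T-nonneg : 0# ≤ T
        T-nonneg = configWeight-nonneg 𝒯 (w-nonneg wt)
        Y-nonneg : 0# ≤ Y
        Y-nonneg = ∑-nonneg 𝔓 (λ e → square-nonneg _)
        D-nonneg : 0# ≤ D
        D-nonneg = configWeight-nonneg 𝒟 (λ _ → 0≤ρ)

        0≤W : 0# ≤ W
        0≤W = ∑-nonneg 𝔅 (w-nonneg wt)
        1≤Wν : 1# ≤ W * ν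
        1≤Wν = ≤-trans (≤-reflexive (sym Nν≡1)) (*-monoˡ-≤ 0≤ν N≤W)

        θ⁺ : Carrier
        θ⁺ = θ + θ * θ * ν
        0≤θ⁺ : 0# ≤ θ⁺
        0≤θ⁺ = +-nonneg 0≤θ (*-nonneg (*-nonneg 0≤θ 0≤θ) 0≤ν)

        next : Blk → Carrier
        next z = potential j (z ∷ S) (w⁺ z) θ⁺

        g₁ʲ g₂ʲ A : Carrier
        g₁ʲ = g₁ ^ j
        g₂ʲ = g₂ ^ j
        A = ι (length 𝔓) * pairNoise Λd Λc ν ρ

        a b X P t l : Carrier
        a = γ * g₁ʲ
        b = g₂ʲ
        X = ι (length 𝔓) * (quadratic 0≤θ θ≤Λd + ι 2 * (ρ * (Λd * Λ)))
        P = pairTransfer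
        t = ι (3 ℕ.* k)
        l = ι 4 * Λd

        0≤a : 0# ≤ a
        0≤a = *-nonneg 0≤γ (0≤g₁^ j)

        a≤b : a ≤ b
        a≤b = ≤-trans (*-mono-≤ 0≤γ γ≤1 (0≤g₁^ j) (^-mono-≤ (≤-trans 0≤1 1≤g₁) g₁≤g₂ j)) (≤-reflexive (*-identityˡ _))

        -- By `1# ≤ W * ν` the additive growth `W + C₁` is at most `W * g₁`, which is paid by one
        -- power of `g₁`. The part owed to dense configurations passes to the larger coefficient
        -- `b`.
        conflict-part : a * ((W + C₁) * T + C₂ * D) ≤ W * (γ * g₁ ^ suc j * T) + b * (C₂ * D)
        conflict-part = ≤-by _ (+-nonneg (*-nonneg (*-nonneg 0≤a T-nonneg) (*-nonneg 0≤C₁ (≤⇒0≤ 1≤Wν))) (*-nonneg (≤⇒0≤ a≤b) (*-nonneg 0≤C₂ D-nonneg)))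
          (solve 9 (λ W γ g C ν T C₂ D b → (W :* (γ :* ((con (1 , 0) :+ C :* ν) :* g) :* T) :+ b :* (C₂ :* D)) :- γ :* g :* ((W :+ C) :* T :+ C₂ :* D) :=
            γ :* g :* T :* (C :* (W :* ν :- con (1 , 0))) :+ (b :- γ :* g) :* (C₂ :* D)) refl W γ g₁ʲ C₁ ν T C₂ D b)

        -- `mainGrowth` adds up all rates, so one power of `g₂` pays for irregularity and density
        -- together, including what is charged to the density from outside.
        main-part : b * ((W + l) * Y + X + P * D) + b * ((W + t) * D) + b * (C₂ * D) ≤ W * (g₂ ^ suc j * (Y + D)) + b * X
        main-part = ≤-trans (≤-by _ (*-nonneg (0≤g₂^ j) (+-nonneg (*-nonneg rest-nonneg Y-nonneg) (*-nonneg (+-nonneg (*-nonneg (ι-nonneg 4) 0≤Λd) 0≤C₁) D-nonneg)))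
            (solve 10 (λ W l Y X P D t C₂ C₁ b → (b :* ((W :+ (l :+ P :+ t :+ C₂ :+ C₁)) :* (Y :+ D)) :+ b :* X) :-
                (b :* ((W :+ l) :* Y :+ X :+ P :* D) :+ b :* ((W :+ t) :* D) :+ b :* (C₂ :* D)) :=
                b :* ((P :+ t :+ C₂ :+ C₁) :* Y :+ (l :+ C₁) :* D)) refl W l Y X P D t C₂ C₁ b))
          (+-monoˡ-≤ (b * X) (≤-by _ (*-nonneg (*-nonneg (0≤g₂^ j) (+-nonneg Y-nonneg D-nonneg)) (*-nonneg 0≤Cʸ (≤⇒0≤ 1≤Wν)))
            (solve 5 (λ W C v b Z → W :* ((con (1 , 0) :+ C :* v) :* b :* Z) :- b :* ((W :+ C) :* Z) := b :* Z :* (C :* (W :* v :- con (1 , 0)))) refl W Cʸ ν b (Y + D))))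
          where
          rest-nonneg : 0# ≤ P + t + C₂ + C₁
          rest-nonneg = +-nonneg (+-nonneg (+-nonneg 0≤pairTransfer (ι-nonneg (3 ℕ.* k))) 0≤C₂) 0≤C₁
          0≤Cʸ : 0# ≤ Cʸ
          0≤Cʸ = +-nonneg 0≤rest 0≤C₁

        X≤WA : X ≤ W * A
        X≤WA = ≤-trans (*-monoʳ-≤ (ι-nonneg (length 𝔓)) (≤-by _ (*-nonneg (*-nonneg (ι-nonneg 2) (+-nonneg (*-nonneg (*-nonneg 0≤Λd 0≤Λd) (*-nonneg (*-nonneg 0≤Λd 0≤Λd) 0≤ν))
              (*-nonneg 0≤ρ (*-nonneg 0≤Λd 0≤Λ)))) (≤⇒0≤ 1≤Wν))
            (solve 5 (λ W v Q B R → W :* (con (2 , 0) :* Q :* v :+ con (2 , 0) :* B :+ con (2 , 0) :* R :* v) :- (con (2 , 0) :* Q :+ con (2 , 0) :* W :* B :+ con (2 , 0) :* R) :=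
               con (2 , 0) :* (Q :+ R) :* (W :* v :- con (1 , 0))) refl W ν (Λd * Λd * (Λd * Λd * ν)) ((Λd * Λ * ν) * (Λd * Λ * ν) + (Λd * Λd * ν) * (Λd * Λd * ν)) (ρ * (Λd * Λ)))))
          (≤-reflexive (solve 3 (λ i W n → i :* (W :* n) := W :* (i :* n)) refl (ι (length 𝔓)) W (pairNoise Λd Λc ν ρ)))

        noise-part : b * X + Λ * Λ ≤ W * δ
        noise-part = ≤-trans (+-mono-≤ (*-mono-≤ (0≤g₂^ j) (^-monoʳ-≤ 1≤g₂ j≤L) X-nonneg X≤WA)
            (≤-trans (≤-reflexive (sym (*-identityʳ _))) (*-monoʳ-≤ (*-nonneg 0≤Λ 0≤Λ) 1≤Wν)))
          (≤-trans (≤-reflexive (solve 5 (λ g W A l v → g :* (W :* A) :+ l :* (W :* v) := W :* (g :* A :+ l :* v)) refl (g₂ ^ L) W A (Λ * Λ) ν))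
            (*-monoʳ-≤ 0≤W noise≤δ))
          where
          X-nonneg : 0# ≤ X
          X-nonneg = *-nonneg (ι-nonneg (length 𝔓)) (+-nonneg (+-nonneg
            (*-nonneg (ι-nonneg 2) (*-nonneg (*-nonneg 0≤Λd 0≤Λd) (*-nonneg (*-nonneg 0≤Λd 0≤Λd) 0≤ν)))
            (*-nonneg (*-nonneg (ι-nonneg 2) 0≤W) (+-nonneg (square-nonneg _) (square-nonneg _)))) (*-nonneg (ι-nonneg 2) (*-nonneg 0≤ρ (*-nonneg 0≤Λd 0≤Λ))))

        ∑next : ∑ 𝔅 (λ z → w z * next z) ≤ W * (Φ + δ)
        ∑next = begin
          ∑ 𝔅 (λ z → w z * next z)
            ≡⟨ trans (∑-cong 𝔅 (λ z → solve 8 (λ w a t b y d W' W → w :* (a :* t :+ b :* (y :+ d) :- W') :=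
                 a :* (w :* t) :+ (b :* (w :* y) :+ b :* (w :* d)) :+ (w :* (W :- W') :- w :* W)) refl
                   (w z) a (configWeight 𝒯 (z ∷ S) (w⁺ z)) b (irregularity (w⁺ z) θ⁺) (density (z ∷ S)) (total (w⁺ z)) W))
               (trans (∑-+ 𝔅 _ _) (cong₂ _+_ (trans (∑-+ 𝔅 _ _) (cong₂ _+_ (∑-*ˡ 𝔅 a _) (trans (∑-+ 𝔅 _ _) (cong₂ _+_ (∑-*ˡ 𝔅 b _) (∑-*ˡ 𝔅 b _)))))
                 (trans (∑-minus 𝔅 _ _) (cong (λ s → ∑ 𝔅 (λ z → w z * (W - total (w⁺ z))) - s) (∑-*ʳ 𝔅 W w))))) ⟩
          a * ∑ 𝔅 (λ z → w z * configWeight 𝒯 (z ∷ S) (w⁺ z)) + (b * ∑ 𝔅 (λ z → w z * irregularity (w⁺ z) θ⁺) + b * ∑ 𝔅 (λ z → w z * density (z ∷ S))) +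
            (∑ 𝔅 (λ z → w z * (W - total (w⁺ z))) - W * W)
            ≤⟨ +-mono-≤ (+-mono-≤ (*-monoʳ-≤ 0≤a (conflict-step Λν≤1)) (+-mono-≤ (*-monoʳ-≤ (0≤g₂^ j) (≤-trans (irregularity-step 0≤θ θ≤Λd) (≤-reflexive
                 (cong (((W + l) * Y + X) +_) (solve 3 (λ c t D → con (2 , 0) :* (c :* (t :* (t :* (t :* D)))) := con (2 , 0) :* (c :* (t :* (t :* t))) :* D) refl (ι c) t D)))))
                 (*-monoʳ-≤ (0≤g₂^ j) dense-step))) (minus-mono total-step ≤-refl) ⟩
          a * ((W + C₁) * T + C₂ * D) + (b * ((W + l) * Y + X + P * D) + b * ((W + t) * D)) + (Λ * Λ - W * W)
            ≤⟨ ≤-by _ (+-nonneg (+-nonneg (≤⇒0≤ conflict-part) (≤⇒0≤ main-part)) (≤⇒0≤ noise-part))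
                 (solve 11 (λ c R b₁ b₂ bC M N bX LL W δ → W :* (R :+ M :- W :+ δ) :- (c :+ (b₁ :+ b₂) :+ (LL :- W :* W)) :=
                    (((W :* R :+ bC) :- c) :+ ((W :* M :+ bX) :- (b₁ :+ b₂ :+ bC))) :+ (W :* δ :- (bX :+ LL))) refl
                    (a * ((W + C₁) * T + C₂ * D)) (γ * g₁ ^ suc j * T) (b * ((W + l) * Y + X + P * D)) (b * ((W + t) * D)) (b * (C₂ * D)) (g₂ ^ suc j * (Y + D)) W (b * X) (Λ * Λ) W δ) ⟩
          W * (Φ + δ) ∎
          where open ≤-Chain

        module _ {z : Blk} (wz≰0 : ¬ (w z ≤ 0#)) where

          w⁺≤ : ∀ B → w⁺ z B ≤ w B * G
          w⁺≤ B with w B ≤? 0#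
          ... | yes q = ≤-reflexive (trans (trans (*-assoc _ _ _) (*-cancel-nonpos (w-nonneg wt B) q _)) (sym (*-cancel-nonpos (w-nonneg wt B) q _)))
          ... | no q = ≤-trans (*-monoʳ-≤ (*-nonneg (w-nonneg wt B) (growth-nonneg B)) (1-κ≤1 B z)) (≤-trans (≤-reflexive (*-identityʳ _))
                  (*-monoʳ-≤ (w-nonneg wt B) (+-monoʳ-≤ 1# (*-mono-≤ (killRate-nonneg B) (killRate≤Λ q) 0≤u u≤ν))))

          dead : ∀ {B} → Kill S B z → w⁺ z B ≡ 0#
          dead {B} kB = trans (cong (λ s → w B * growth B * (1# - s)) ([]-true (kill? S B z) kB)) (trans (cong (w B * growth B *_) (-‿inverseʳ 1#)) (zeroʳ _))

          wt⁺ : Weighting j (z ∷ S) (w⁺ z)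
          wt⁺ = weighting (w⁺-nonneg z) support⁺ (λ B → ≤-trans (*-monoˡ-≤ (^-nonneg (≤-trans 0≤1 1≤G) j) (w⁺≤ B)) (≤-trans (≤-reflexive (*-assoc _ _ _)) (bound wt B)))
            where
            support⁺ : ∀ {B} → ¬ (w⁺ z B ≤ 0#) → Available (z ∷ S) B
            support⁺ {B} h = available-∷ (λ { refl → h (≤-reflexive (dead (inj₁ (has-pair (in𝔅 (support wt wz≰0)))))) })
              (support wt (λ q → h (≤-reflexive (trans (*-assoc _ _ _) (*-cancel-nonpos (w-nonneg wt B) q _)))))
              (support wt wz≰0) (λ kB → h (≤-reflexive (dead kB)))

      advance : ∀ {j} → State (suc j) → State j
      advance {j} s = record
        { S = z ∷ S ; w = v ; θ = θ⁺ ; is-good = good-∷ 𝒯-unique is-good (support wt wz≰0)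
        ; size = trans (sym (ℕₚ.+-suc (length S) j)) size
        ; wt = vt ; fine = v-fine ; 0≤θ = 0≤θ⁺ ; θ-bound = θ⁺-bound
        ; Φ-bound = ≤-trans (+-monoˡ-≤ N (+-monoˡ-≤ (ι j * δ) (≤-trans v≤ chosen≤))) (≤-trans (≤-reflexive
            (trans (solve 4 (λ Φ i d N → Φ :+ d :+ i :* d :+ N := Φ :+ (con (1 , 0) :+ i) :* d :+ N) refl Φ (ι j) δ N)
              (cong (λ t → Φ + t * δ + N) (sym (ι-suc j))))) Φ-bound) }
        where
        open State s
        W : Carrier
        W = total w

        T-nonneg : 0# ≤ configWeight 𝒯 S w
        T-nonneg = configWeight-nonneg 𝒯 (w-nonneg wt)
        Y-nonneg : 0# ≤ irregularity w θ
        Y-nonneg = ∑-nonneg 𝔓 (λ e → square-nonneg _)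
        D-nonneg : 0# ≤ density S
        D-nonneg = configWeight-nonneg 𝒟 (λ _ → 0≤ρ)

        -- Apart from the total weight, every term of the potential and the reserve for the
        -- remaining steps is nonnegative.
        N≤W : N ≤ W
        N≤W = ≤-by _ (+-nonneg (≤⇒0≤ Φ-bound) (+-nonneg (*-nonneg (*-nonneg 0≤γ (0≤g₁^ (suc j))) T-nonneg)
            (+-nonneg (*-nonneg (0≤g₂^ (suc j)) (+-nonneg Y-nonneg D-nonneg)) (*-nonneg (ι-nonneg (suc j)) 0≤δ))))
          (solve 5 (λ a b W i N → W :- N := (con (0 , 0) :- (a :+ b :- W :+ i :+ N)) :+ (a :+ (b :+ i))) refl
            (γ * g₁ ^ suc j * configWeight 𝒯 S w) (g₂ ^ suc j * (irregularity w θ + density S)) W (ι (suc j) * δ) N)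

        W≰0 : ¬ (W ≤ 0#)
        W≰0 q = N≰0 (≤-trans N≤W q)

        u : Carrier
        u = proj₁ (inverse W≰0)
        Wu≡1 : W * u ≡ 1#
        Wu≡1 = proj₂ (inverse W≰0)
        0≤u : 0# ≤ u
        0≤u = inverse-nonneg W≰0 Wu≡1
        u≤ν : u ≤ ν
        u≤ν = ≤-trans (≤-reflexive (trans (sym (*-identityʳ u)) (cong (u *_) (sym Nν≡1)))) (≤-trans
          (*-monoʳ-≤ 0≤u (*-monoˡ-≤ 0≤ν N≤W)) (≤-reflexive (trans (solve 3 (λ u W v → u :* (W :* v) := W :* u :* v) refl u W ν)
            (trans (cong (_* ν) Wu≡1) (*-identityˡ ν)))))
        degree≤ : ∀ {e} → e ∈ 𝔓 → degree w e ≤ Λd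
        degree≤ {e} e∈ with degree w e ≤? Λd
        ... | yes d≤ = d≤
        -- A pair of degree above `Λd` can carry no block of positive weight, all of these being
        -- fine; its degree is then 0, a contradiction in disguise.
        ... | no d≰ = ≤-trans (≤-reflexive (trans (∑-cong∈ 𝔅 none) (∑-zero 𝔅))) 0≤Λd
          where
          none : ∀ {B} → B ∈ 𝔅 → [ inc? B e ] * w B ≡ 0#
          none {B} B∈ with inc? B e | w B ≤? 0#
          ... | no _ | _ = zeroˡ _
          ... | yes _ | yes q = trans (*-identityˡ _) (≤-antisym q (w-nonneg wt B))
          ... | yes iB | no q = ⊥-elim (d≰ (All.lookup (proj₂ (fine B∈ q)) e∈ iB))

        θ≤Λd : θ ≤ Λd
        θ≤Λd = ≤-trans (x≤x+y θ 0≤1) (θ+1≤Λd {suc j} 0≤θ θ-bound)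

        j≤L : j ℕ.≤ L
        j≤L = subst (j ℕ.≤_) size (ℕₚ.≤-trans (ℕₚ.n≤1+n j) (ℕₚ.m≤n+m (suc j) (length S)))

        open Advance j≤L wt 0≤θ θ≤Λd degree≤ (λ B∈ w≰0 → proj₁ (fine B∈ w≰0)) Wu≡1 0≤u u≤ν N≤W
          using (Φ; θ⁺; 0≤θ⁺; next; ∑next; w⁺; wt⁺)

        -- With y the left side of `θ-bound`, the gap is (1 - y)(1 + θν) + (θν)².
        θ⁺-bound : θ⁺ * (ζ + ι j * ν) ≤ 1#
        θ⁺-bound = ≤-by _ (+-nonneg (≤⇒0≤ θ-bound) (+-nonneg (*-nonneg (*-nonneg 0≤θ 0≤ν) (≤⇒0≤ θ-bound)) (square-nonneg (θ * ν))))
          (trans (solve 4 (λ θ ν ζ i → con (1 , 0) :- (θ :+ θ :* θ :* ν) :* (ζ :+ i :* ν) :=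
               (con (1 , 0) :- θ :* (ζ :+ (con (1 , 0) :+ i) :* ν)) :+ (θ :* ν :* (con (1 , 0) :- θ :* (ζ :+ (con (1 , 0) :+ i) :* ν)) :+ θ :* ν :* (θ :* ν)))
               refl θ ν ζ (ι j))
            (cong (λ t → (1# - θ * (ζ + t * ν)) + (θ * ν * (1# - θ * (ζ + t * ν)) + θ * ν * (θ * ν))) (sym (ι-suc j))))

        chosen : ∃ λ z → z ∈ 𝔅 × ¬ (w z ≤ 0#) × next z - (Φ + δ) ≤ 0#
        chosen = average 𝔅 w (λ z → next z - (Φ + δ)) (w-nonneg wt) W≰0 (≤-trans (≤-reflexive
          (trans (∑-cong 𝔅 (λ z → solve 3 (λ w a b → w :* (a :- b) := w :* a :- w :* b) refl (w z) (next z) (Φ + δ)))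
            (trans (∑-minus 𝔅 _ _) (cong (λ t → ∑ 𝔅 (λ z → w z * next z) - t) (∑-*ʳ 𝔅 (Φ + δ) w)))))
          (≤-trans (minus-mono ∑next ≤-refl) (≤-reflexive (-‿inverseʳ _))))
        z : Blk
        z = proj₁ chosen
        wz≰0 : ¬ (w z ≤ 0#)
        wz≰0 = proj₁ (proj₂ (proj₂ chosen))
        chosen≤ : next z ≤ Φ + δ
        chosen≤ = ≤-by _ (≤⇒0≤ (proj₂ (proj₂ (proj₂ chosen)))) (solve 2 (λ x y → y :- x := con (0 , 0) :- (x :- y)) refl (next z) (Φ + δ))

        pruned : ∃ λ v → Weighting j (z ∷ S) v × potential j (z ∷ S) v θ⁺ ≤ next z × (∀ {B} → B ∈ 𝔅 → ¬ (v B ≤ 0#) → Fine (z ∷ S) v B)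
        pruned = prune (wt⁺ wz≰0) (θ+1≤Λd {j} 0≤θ⁺ θ⁺-bound)
        v : Blk → Carrier
        v = proj₁ pruned
        vt : Weighting j (z ∷ S) v
        vt = proj₁ (proj₂ pruned)
        v≤ : potential j (z ∷ S) v θ⁺ ≤ next z
        v≤ = proj₁ (proj₂ (proj₂ pruned))
        v-fine : ∀ {B} → B ∈ 𝔅 → ¬ (v B ≤ 0#) → Fine (z ∷ S) v B
        v-fine = proj₂ (proj₂ (proj₂ pruned))

      -- The uniform weight `w₀` gives every pair degree at most 1, which is the first threshold, so
      -- the irregularity starts at 0. The first pruning can only lower the potential.
      start : State L
      start = record
        { S = [] ; w = v ; θ = 1# ; is-good = good (λ ()) [] (λ ()) no-conflict₀ ; size = refl ; wt = vt ; fine = v-fine ; 0≤θ = 0≤1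
        ; θ-bound = θ-bound₀
        ; Φ-bound = ≤-trans (+-monoˡ-≤ N (+-monoˡ-≤ (ι L * δ) (≤-trans v≤ Φ₀≤))) (≤-by _ (≤⇒0≤ initial)
            (solve 5 (λ a b W d N → con (0 , 0) :- (a :+ b :- W :+ d :+ N) := W :- (a :+ b :+ N :+ d)) refl
              (γ * g₁ ^ L * ∑ 𝒯 (λ C → w₀ ^ length C)) (g₂ ^ L * ∑ 𝒟 (λ Q → ρ ^ length Q)) (ι (length 𝔅) * w₀) (ι L * δ) N)) }
        where
        w : Blk → Carrier
        w B = [ B ∈? 𝔅 ] * w₀
        w≤w₀ : ∀ B → w B ≤ w₀
        w≤w₀ B = ≤-trans (*-monoˡ-≤ 0≤w₀ ([]≤1 (B ∈? 𝔅))) (≤-reflexive (*-identityˡ w₀))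
        w-nonneg₀ : ∀ B → 0# ≤ w B
        w-nonneg₀ B = *-nonneg ([]-nonneg (B ∈? 𝔅)) 0≤w₀
        no-conflict₀ : ∀ {C} → C ∈ 𝒯 → ¬ All (_∈ []) C
        no-conflict₀ {[]} C∈ _ with 𝒯-long C∈
        ... | ()
        no-conflict₀ {_ ∷ _} _ (() ∷ _)
        conflictless₀ : ∀ {B C} → C ∈ 𝒯 → B ∈ C → ¬ All (λ x → x ≡ B ⊎ x ∈ []) C
        conflictless₀ {B} {C} C∈ _ all with C | 𝒯-long C∈ | 𝒯-unique C∈ | all
        ... | _ ∷ _ ∷ _ | _ | (x≢y ∷ _) ∷ _ | inj₁ refl ∷ inj₁ refl ∷ _ = x≢y refl
        ... | _ ∷ [] | ℕ.s≤s () | _ | _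
        wt₀ : Weighting L [] w
        wt₀ = weighting w-nonneg₀ support₀ (λ B → ≤-trans (*-monoˡ-≤ (^-nonneg (≤-trans 0≤1 1≤G) L) (w≤w₀ B)) w₀≤ρ)
          where
          support₀ : ∀ {B} → ¬ (w B ≤ 0#) → Available [] B
          support₀ {B} h with B ∈? 𝔅
          ... | yes B∈ = available B∈ (λ ()) (λ ()) conflictless₀
          ... | no _ = ⊥-elim (h (≤-reflexive (zeroˡ w₀)))
        θ-bound₀ : 1# * (ζ + ι L * ν) ≤ 1#
        θ-bound₀ = ≤-reflexive (solve 1 (λ x → con (1 , 0) :* ((con (1 , 0) :- x) :+ x) := con (1 , 0)) refl (ι L * ν))
        pruned : ∃ λ v → Weighting L [] v × potential L [] v 1# ≤ potential L [] w 1# × (∀ {B} → B ∈ 𝔅 → ¬ (v B ≤ 0#) → Fine [] v B)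
        pruned = prune wt₀ (θ+1≤Λd {L} 0≤1 θ-bound₀)
        v : Blk → Carrier
        v = proj₁ pruned
        vt : Weighting L [] v
        vt = proj₁ (proj₂ pruned)
        v≤ : potential L [] v 1# ≤ potential L [] w 1#
        v≤ = proj₁ (proj₂ (proj₂ pruned))
        v-fine : ∀ {B} → B ∈ 𝔅 → ¬ (v B ≤ 0#) → Fine [] v B
        v-fine = proj₂ (proj₂ (proj₂ pruned))
        α[] : ∀ u x → α [] u x ≡ u x
        α[] u x = sel-no (x ∈? []) (λ ())
        regular : irregularity w 1# ≡ 0#
        regular = trans (∑-cong∈ 𝔓 (λ {e} e∈ → trans (cong (λ t → t * t) (pos-≤0 (≤-trans (+-monoˡ-≤ (- 1#) (degree≤1 e∈)) (≤-reflexive (-‿inverseʳ 1#))))) (zeroˡ 0#))) (∑-zero 𝔓)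
          where
          degree≤1 : ∀ {e} → e ∈ 𝔓 → degree w e ≤ 1#
          degree≤1 {e} e∈ = ≤-trans (∑-mono 𝔅 (λ B → *-monoʳ-≤ ([]-nonneg (inc? B e)) (w≤w₀ B))) (≤-trans (≤-reflexive (∑-*ʳ 𝔅 w₀ _)) (degree₀ e∈))
        Φ₀≤ : potential L [] w 1# ≤ γ * g₁ ^ L * ∑ 𝒯 (λ C → w₀ ^ length C) + g₂ ^ L * ∑ 𝒟 (λ Q → ρ ^ length Q) - ι (length 𝔅) * w₀
        Φ₀≤ = minus-mono (+-mono-≤ (*-monoʳ-≤ (*-nonneg 0≤γ (0≤g₁^ L)) (∑-mono 𝒯 (λ C → ≤-trans
              (∏-mono∈ C (λ {x} _ → α-nonneg w-nonneg₀ x) (λ {x} _ → ≤-trans (≤-reflexive (α[] w x)) (w≤w₀ x))) (≤-reflexive (∏-const C w₀)))))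
            (*-monoʳ-≤ (0≤g₂^ L) (≤-reflexive (trans (cong (_+ density []) regular) (trans (+-identityˡ _) (∑-cong 𝒟 (λ Q →
              trans (∏-cong∈ Q (λ {x} _ → α[] (λ _ → ρ) x)) (∏-const Q ρ))))))))
          (≤-reflexive (trans (sym (∑-const 𝔅 w₀)) (∑-cong∈ 𝔅 (λ {B} B∈ → sym (trans (cong (_* w₀) ([]-true (B ∈? 𝔅) B∈)) (*-identityˡ w₀))))))

      descend : ∀ j → State j → State 0
      descend zero s = s
      descend (suc j) s = descend j (advance s)

      large-good-set : ∃ λ S → Good S × length S ≡ L
      large-good-set = State.S end , State.is-good end , trans (sym (ℕₚ.+-identityʳ _)) (State.size end)
        where
        end : State 0
        end = descend L start

-- Enumerating blocks, pairs and configurations.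

module BlockConflicts where
  open OrderedFields
  open TightConfigurations
  open WeightedLists
  open RandomGreedy
  open import Data.Nat as ℕ using (ℕ; zero; suc)
  import Data.Nat.Properties as ℕₚ
  open import Data.Bool using (true; false)
  import Data.Vec as Vec
  import Data.Vec.Properties as Vecₚ
  open import Data.Fin as Fin using (Fin)
  import Data.Fin.Properties as Finₚ
  open import Data.Fin.Subset as Sub using (Subset; ⋃; ∣_∣; _∪_; _∩_; _⊆_; ⁅_⁆)
  import Data.Fin.Subset.Properties as Sub
  open import Data.List using (List; []; _∷_; _++_; map; filter; length; concatMap; allFin; cartesianProduct)
  open import Data.List.Properties using (length-++; length-map)
  open import Data.List.Membership.Propositional using (_∈_; _∉_)
  open import Data.List.Membership.Propositional.Properties
    using (∈-++⁺ˡ; ∈-++⁺ʳ; ∈-++⁻; ∈-filter⁺; ∈-filter⁻; ∈-map⁺; ∈-map⁻; ∈-concatMap⁺; ∈-allFin; ∈-cartesianProduct⁺)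
  open import Data.List.Relation.Unary.Any as Any using (Any; here; there)
  open import Data.List.Relation.Unary.All as All using (All; []; _∷_)
  import Data.List.Relation.Unary.All.Properties as Allₚ
  open import Data.List.Relation.Unary.AllPairs using ([]; _∷_)
  open import Data.List.Relation.Unary.Unique.Propositional using (Unique)
  import Data.List.Relation.Unary.Unique.Propositional.Properties as Unique
  import Data.List.Relation.Unary.Unique.DecPropositional as DecUnique
  open import Data.Product using (∃; ∃₂; _×_; _,_; proj₁; proj₂)
  open import Data.Sum using (_⊎_; inj₁; inj₂; [_,_]′)
  open import Data.Empty using (⊥; ⊥-elim)
  open import Function using (_∘_; id)
  open import Relation.Nullary using (¬_; Dec; yes; no; ¬?; _×-dec_)
  open import Relation.Binary.PropositionalEquality hiding ([_]; J)

  -- Ordered and with repetition, so that sums of products factor into powers. A configuration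
  -- occurs in all its orders, which affects constants only.
  tuples : ∀ {A : Set} → ℕ → List A → List (List A)
  tuples zero xs = [] ∷ []
  tuples (suc q) xs = concatMap (λ x → map (x ∷_) (tuples q xs)) xs

  tuples-length : ∀ {A : Set} q (xs : List A) {C} → C ∈ tuples q xs → length C ≡ q
  tuples-length zero xs (here refl) = refl
  tuples-length (suc q) xs C∈ = go xs C∈
    where
    go : ∀ {C} ys → C ∈ concatMap (λ x → map (x ∷_) (tuples q xs)) ys → length C ≡ suc q
    go (y ∷ ys) C∈ with ∈-++⁻ (map (y ∷_) (tuples q xs)) C∈
    ... | inj₂ p = go ys p
    ... | inj₁ p with ∈-map⁻ (y ∷_) p
    ...   | D , D∈ , refl = cong suc (tuples-length q xs D∈)

  tuples-⊆ : ∀ {A : Set} q (xs : List A) {C} → C ∈ tuples q xs → ∀ {x} → x ∈ C → x ∈ xs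
  tuples-⊆ zero xs (here refl) ()
  tuples-⊆ (suc q) xs C∈ = go xs id C∈
    where
    go : ∀ {C} ys → (∀ {y} → y ∈ ys → y ∈ xs) → C ∈ concatMap (λ x → map (x ∷_) (tuples q xs)) ys → ∀ {x} → x ∈ C → x ∈ xs
    go (y ∷ ys) sub C∈ x∈ with ∈-++⁻ (map (y ∷_) (tuples q xs)) C∈
    ... | inj₂ p = go ys (sub ∘ there) p x∈
    ... | inj₁ p with ∈-map⁻ (y ∷_) p | x∈
    ...   | D , D∈ , refl | here refl = sub (here refl)
    ...   | D , D∈ , refl | there q' = tuples-⊆ q xs D∈ q'

  ∈-tuples : ∀ {A : Set} (xs : List A) {C} → All (_∈ xs) C → C ∈ tuples (length C) xs
  ∈-tuples xs [] = here refl
  ∈-tuples xs {x ∷ C} (x∈ ∷ all) = ∈-concatMap⁺ (λ x → map (x ∷_) (tuples (length C) xs)) (Any.map (λ { refl → ∈-map⁺ (x ∷_) (∈-tuples xs all) }) x∈)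

  listsUpTo : ∀ {A : Set} → ℕ → List A → List (List A)
  listsUpTo zero xs = tuples zero xs
  listsUpTo (suc q) xs = tuples (suc q) xs ++ listsUpTo q xs

  ∈-listsUpTo : ∀ {A : Set} q (xs : List A) {C} → All (_∈ xs) C → length C ℕ.≤ q → C ∈ listsUpTo q xs
  ∈-listsUpTo zero xs {[]} _ _ = here refl
  ∈-listsUpTo (suc q) xs {C} all h with ℕₚ.m≤n⇒m<n∨m≡n h
  ... | inj₁ (ℕ.s≤s h') = ∈-++⁺ʳ (tuples (suc q) xs) (∈-listsUpTo q xs all h')
  ... | inj₂ eq = ∈-++⁺ˡ (subst (λ l → C ∈ tuples l xs) eq (∈-tuples xs all))

  listsUpTo-length : ∀ {A : Set} q (xs : List A) {C} → C ∈ listsUpTo q xs → length C ℕ.≤ q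
  listsUpTo-length zero xs C∈ = ℕₚ.≤-reflexive (tuples-length zero xs C∈)
  listsUpTo-length (suc q) xs C∈ with ∈-++⁻ (tuples (suc q) xs) C∈
  ... | inj₁ p = ℕₚ.≤-reflexive (tuples-length (suc q) xs p)
  ... | inj₂ p = ℕₚ.≤-trans (listsUpTo-length q xs p) (ℕₚ.n≤1+n q)

  listsUpTo-⊆ : ∀ {A : Set} q (xs : List A) {C} → C ∈ listsUpTo q xs → ∀ {x} → x ∈ C → x ∈ xs
  listsUpTo-⊆ zero xs C∈ = tuples-⊆ zero xs C∈
  listsUpTo-⊆ (suc q) xs C∈ with ∈-++⁻ (tuples (suc q) xs) C∈
  ... | inj₁ p = tuples-⊆ (suc q) xs p
  ... | inj₂ p = listsUpTo-⊆ q xs p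

  x∈p⇒1≤∣p∣ : ∀ {n} {p : Subset n} {x} → x Sub.∈ p → 1 ℕ.≤ ∣ p ∣
  x∈p⇒1≤∣p∣ {p = p} {x} x∈p = subst (ℕ._≤ ∣ p ∣) (Sub.∣⁅x⁆∣≡1 x) (Sub.p⊆q⇒∣p∣≤∣q∣ (λ y∈ → subst (Sub._∈ p) (sym (Sub.x∈⁅y⁆⇒x≡y x y∈)) x∈p))

  two-elements⁻ : ∀ {n} {p : Subset n} {x y} → x Sub.∈ p → y Sub.∈ p → x ≢ y → 2 ℕ.≤ ∣ p ∣
  two-elements⁻ {p = p} {x} x∈p y∈p x≢y = ℕₚ.≤-trans (ℕ.s≤s (x∈p⇒1≤∣p∣ (Sub.x∈p∧x≢y⇒x∈p-y {p = p} y∈p (x≢y ∘ sym)))) (Sub.x∈p⇒∣p-x∣<∣p∣ x∈p)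

  one-element : ∀ {n} (p : Subset n) → 1 ℕ.≤ ∣ p ∣ → ∃ λ x → x Sub.∈ p
  one-element (true Vec.∷ p) _ = Fin.zero , Vec.here
  one-element (false Vec.∷ p) h with one-element p h
  ... | x , x∈ = Fin.suc x , Vec.there x∈

  two-elements : ∀ {n} (p : Subset n) → 2 ℕ.≤ ∣ p ∣ → ∃₂ λ x y → x ≢ y × x Sub.∈ p × y Sub.∈ p
  two-elements (true Vec.∷ p) (ℕ.s≤s h) with one-element p h
  ... | x , x∈ = Fin.zero , Fin.suc x , (λ ()) , Vec.here , Vec.there x∈
  two-elements (false Vec.∷ p) h with two-elements p h
  ... | x , y , x≢y , x∈ , y∈ = Fin.suc x , Fin.suc y , (λ { refl → x≢y refl }) , Vec.there x∈ , Vec.there y∈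

  blocks : ∀ (n r : ℕ) → List (Subset n)
  blocks zero zero = Vec.[] ∷ []
  blocks zero (suc r) = []
  blocks (suc n) zero = map (false Vec.∷_) (blocks n zero)
  blocks (suc n) (suc r) = map (false Vec.∷_) (blocks n (suc r)) ++ map (true Vec.∷_) (blocks n r)

  blocks-size : ∀ n r {B} → B ∈ blocks n r → ∣ B ∣ ≡ r
  blocks-size zero zero (here refl) = refl
  blocks-size (suc n) zero B∈ with ∈-map⁻ (false Vec.∷_) B∈
  ... | B , B∈' , refl = blocks-size n zero B∈'
  blocks-size (suc n) (suc r) B∈ with ∈-++⁻ (map (false Vec.∷_) (blocks n (suc r))) B∈
  ... | inj₁ p with ∈-map⁻ (false Vec.∷_) p
  ...   | B , B∈' , refl = blocks-size n (suc r) B∈'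
  blocks-size (suc n) (suc r) B∈ | inj₂ p with ∈-map⁻ (true Vec.∷_) p
  ...   | B , B∈' , refl = cong suc (blocks-size n r B∈')

  blocks-unique : ∀ n r → Unique (blocks n r)
  blocks-unique zero zero = [] ∷ []
  blocks-unique zero (suc r) = []
  blocks-unique (suc n) zero = Unique.map⁺ Vecₚ.∷-injectiveʳ (blocks-unique n zero)
  blocks-unique (suc n) (suc r) = Unique.++⁺ (Unique.map⁺ Vecₚ.∷-injectiveʳ (blocks-unique n (suc r)))
    (Unique.map⁺ Vecₚ.∷-injectiveʳ (blocks-unique n r)) λ (p , q) → absurd (∈-map⁻ (false Vec.∷_) p) (∈-map⁻ (true Vec.∷_) q)
    where
    absurd : ∀ {B : Subset (suc n)} {P Q : Subset n → Set} → ∃ (λ y → P y × B ≡ false Vec.∷ y) → ∃ (λ y → Q y × B ≡ true Vec.∷ y) → ⊥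
    absurd (_ , _ , refl) (_ , _ , ())

  -- Ordered pairs: a block contains exactly (2 + a)(1 + a) of them, and no halves appear.
  pairs : ∀ n → List (Fin n × Fin n)
  pairs n = filter (λ (u , v) → ¬? (u Finₚ.≟ v)) (cartesianProduct (allFin n) (allFin n))

  ∈-pairs : ∀ {n} {u v : Fin n} → u ≢ v → (u , v) ∈ pairs n
  ∈-pairs {u = u} {v} u≢v = ∈-filter⁺ (λ (u , v) → ¬? (u Finₚ.≟ v)) (∈-cartesianProduct⁺ (∈-allFin u) (∈-allFin v)) u≢v

  pairs-≢ : ∀ {n} {u v : Fin n} → (u , v) ∈ pairs n → u ≢ v
  pairs-≢ {n} = proj₂ ∘ ∈-filter⁻ (λ (u , v) → ¬? (u Finₚ.≟ v)) {xs = cartesianProduct (allFin n) (allFin n)}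

  Inc : ∀ {n} → Subset n → Fin n × Fin n → Set
  Inc B (u , v) = u Sub.∈ B × v Sub.∈ B

  inc? : ∀ {n} (B : Subset n) e → Dec (Inc B e)
  inc? B (u , v) = (u Sub.∈? B) ×-dec (v Sub.∈? B)

  fromList : ∀ {n} → List (Fin n) → Subset n
  fromList xs = ⋃ (map ⁅_⁆ xs)

  ∈-fromList⁺ : ∀ {n} {x : Fin n} {xs} → x ∈ xs → x Sub.∈ fromList xs
  ∈-fromList⁺ {x = x} x∈ = x∈⋃⁺ (∈-map⁺ ⁅_⁆ x∈) (Sub.x∈⁅x⁆ x)

  ∈-fromList⁻ : ∀ {n} {x : Fin n} xs → x Sub.∈ fromList xs → x ∈ xs
  ∈-fromList⁻ xs x∈ with x∈⋃⁻ (map ⁅_⁆ xs) x∈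
  ... | _ , B∈ , x∈B with ∈-map⁻ ⁅_⁆ B∈
  ...   | y , y∈ , refl = subst (_∈ xs) (sym (Sub.x∈⁅y⁆⇒x≡y y x∈B)) y∈

  elements : ∀ {n} → Subset n → List (Fin n)
  elements Vec.[] = []
  elements (true Vec.∷ p) = Fin.zero ∷ map Fin.suc (elements p)
  elements (false Vec.∷ p) = map Fin.suc (elements p)

  length-elements : ∀ {n} (p : Subset n) → length (elements p) ≡ ∣ p ∣
  length-elements Vec.[] = refl
  length-elements (true Vec.∷ p) = cong suc (trans (length-map Fin.suc (elements p)) (length-elements p))
  length-elements (false Vec.∷ p) = trans (length-map Fin.suc (elements p)) (length-elements p)

  ∈-elements : ∀ {n} {x : Fin n} {p} → x Sub.∈ p → x ∈ elements p
  ∈-elements {p = true Vec.∷ p} Vec.here = here refl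
  ∈-elements {p = true Vec.∷ p} (Vec.there x∈) = there (∈-map⁺ Fin.suc (∈-elements x∈))
  ∈-elements {p = false Vec.∷ p} (Vec.there x∈) = ∈-map⁺ Fin.suc (∈-elements x∈)

  length-sublists : ∀ {A : Set} (xs : List A) → length (sublists xs) ≡ 2 ℕ.^ length xs
  length-sublists [] = refl
  length-sublists (x ∷ xs) = trans (length-++ (sublists xs)) (cong₂ ℕ._+_ (length-sublists xs)
    (trans (length-map (x ∷_) (sublists xs)) (trans (length-sublists xs) (sym (ℕₚ.+-identityʳ _)))))

  -- The conflict system of minimal tight configurations.

  module ConcreteSystem (a k n : ℕ) where
    open Configurations a n public

    𝔅 : List Block
    𝔅 = blocks n (2 ℕ.+ a)

    𝔓 : List (Fin n × Fin n)
    𝔓 = pairs n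

    conflict? : ∀ C → Dec (3 ℕ.≤ length C × MinTight C)
    conflict? C = (3 ℕₚ.≤? length C) ×-dec minTight? C

    denseUnique? : ∀ Q → Dec (Unique Q × Dense Q)
    denseUnique? Q = DecUnique.unique? _≟ˢ_ Q ×-dec dense? Q

    𝒯 𝒟 : List (List Block)
    𝒯 = filter conflict? (listsUpTo k 𝔅)
    𝒟 = filter denseUnique? (listsUpTo (3 ℕ.* k) 𝔅)

    blockSystem : BlockSystem
    blockSystem = record { _≟_ = _≟ˢ_ ; 𝔅 = 𝔅 ; 𝔓 = 𝔓 ; Inc = Inc ; inc? = inc? ; 𝒯 = 𝒯 ; 𝒟 = 𝒟 }

    open ConflictSystem blockSystem public hiding (_∈?_)

    ∈𝒯⁻ : ∀ {C} → C ∈ 𝒯 → C ∈ listsUpTo k 𝔅 × 3 ℕ.≤ length C × MinTight C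
    ∈𝒯⁻ = ∈-filter⁻ conflict? {xs = listsUpTo k 𝔅}

    ∈𝒟⁻ : ∀ {Q} → Q ∈ 𝒟 → Q ∈ listsUpTo (3 ℕ.* k) 𝔅 × Unique Q × Dense Q
    ∈𝒟⁻ = ∈-filter⁻ denseUnique? {xs = listsUpTo (3 ℕ.* k) 𝔅}

    size : ∀ {B} → B ∈ 𝔅 → ∣ B ∣ ≡ 2 ℕ.+ a
    size = blocks-size n (2 ℕ.+ a)

    share⇒2≤ : ∀ {B B'} → Share B B' → 2 ℕ.≤ ∣ B ∩ B' ∣
    share⇒2≤ s = through s (λ p → p)
      where
      through : ∀ {B B' es} → Any (λ e → Inc B e × Inc B' e) es → (∀ {e} → e ∈ es → e ∈ 𝔓) → 2 ℕ.≤ ∣ B ∩ B' ∣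
      through (here ((u∈ , v∈) , (u∈' , v∈'))) sub =
        two-elements⁻ (Sub.x∈p∩q⁺ (u∈ , u∈')) (Sub.x∈p∩q⁺ (v∈ , v∈')) (pairs-≢ (sub (here refl)))
      through (there s) sub = through s (sub ∘ there)

    2≤⇒share : ∀ {B B'} → 2 ℕ.≤ ∣ B ∩ B' ∣ → Share B B'
    2≤⇒share {B} {B'} h with two-elements (B ∩ B') h
    ... | u , v , u≢v , u∈ , v∈ with Sub.x∈p∩q⁻ B B' u∈ | Sub.x∈p∩q⁻ B B' v∈
    ...   | uB , uB' | vB , vB' = Any.map (λ { refl → (uB , vB) , (uB' , vB') }) (∈-pairs u≢v)

    has-pair : ∀ {B} → B ∈ 𝔅 → Share B B
    has-pair {B} B∈ = 2≤⇒share (subst (2 ℕ.≤_) (sym (trans (cong ∣_∣ (Sub.∩-idem B)) (size B∈))) (ℕ.s≤s (ℕ.s≤s ℕ.z≤n)))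

    ∪-tight : ∀ (x y : Block) → ∣ x ∣ ≡ 2 ℕ.+ a → ∣ y ∣ ≡ 2 ℕ.+ a → 2 ℕ.≤ ∣ x ∩ y ∣ → ∣ x ∪ y ∣ ℕ.≤ 2 ℕ.+ a ℕ.* 2
    ∪-tight x y sx sy h = ℕₚ.+-cancelʳ-≤ 2 _ _ (begin
      ∣ x ∪ y ∣ ℕ.+ 2             ≤⟨ ℕₚ.+-monoʳ-≤ ∣ x ∪ y ∣ h ⟩
      ∣ x ∪ y ∣ ℕ.+ ∣ x ∩ y ∣     ≡⟨ trans (∣p∪q∣+∣p∩q∣ x y) (cong₂ ℕ._+_ sx sy) ⟩
      2 ℕ.+ a ℕ.+ (2 ℕ.+ a)       ≡⟨ cong (2 ℕ.+_) (trans (sym (ℕₚ.+-assoc a 2 a)) (trans (cong (ℕ._+ a) (ℕₚ.+-comm a 2)) (ℕₚ.+-comm (2 ℕ.+ a) a))) ⟩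
      2 ℕ.+ (a ℕ.+ (2 ℕ.+ a))     ≡⟨ cong (2 ℕ.+_) (trans (cong (a ℕ.+_) (ℕₚ.+-comm 2 a)) (trans (sym (ℕₚ.+-assoc a a 2)) (cong (λ t → a ℕ.+ t ℕ.+ 2) (sym (ℕₚ.+-identityʳ a))))) ⟩
      2 ℕ.+ (2 ℕ.* a ℕ.+ 2)       ≡⟨ cong (λ t → 2 ℕ.+ (t ℕ.+ 2)) (ℕₚ.*-comm 2 a) ⟩
      2 ℕ.+ a ℕ.* 2 ℕ.+ 2 ∎)
      where open ℕₚ.≤-Reasoning

    -- For two blocks minimality is vacuous. Sharing a pair thus becomes a minimal tight
    -- configuration like the members of `𝒯`.
    pair-minTight : ∀ {x y} → x ≢ y → x ∈ 𝔅 → y ∈ 𝔅 → 2 ℕ.≤ ∣ x ∩ y ∣ → MinTight (x ∷ y ∷ [])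
    pair-minTight {x} {y} x≢y x∈ y∈ h = minTight ((x≢y ∷ []) ∷ [] ∷ []) (size x∈ ∷ size y∈ ∷ [])
      (ℕₚ.≤-trans (Sub.p⊆q⇒∣p∣≤∣q∣ sub) (∪-tight x y (size x∈) (size y∈) h)) (All.tabulate λ _ (2≤J , J<2) → ⊥-elim (ℕₚ.<⇒≱ J<2 2≤J))
      where
      sub : ⋃ (x ∷ y ∷ []) ⊆ x ∪ y
      sub p with x∈⋃⁻ (x ∷ y ∷ []) p
      ... | _ , here refl , q = Sub.x∈p∪q⁺ (inj₁ q)
      ... | _ , there (here refl) , q = Sub.x∈p∪q⁺ (inj₂ q)

    -- Two blocks sharing two vertices are tight by themselves, and here they would be a proper
    -- sublist.
    minTight-linear : ∀ {C x y} → MinTight C → 3 ℕ.≤ length C → x ∈ C → y ∈ C → x ≢ y → ∣ x ∩ y ∣ ℕ.≤ 1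
    minTight-linear {C} {x} {y} mt 3≤C x∈C y∈C x≢y with ∣ x ∩ y ∣ ℕₚ.≤? 1
    ... | yes h = h
    ... | no h = ⊥-elim (All.lookup (minimal mt) (filter∈sublists (_∈? (x ∷ y ∷ [])) C) (2≤J , ℕₚ.≤-trans (ℕ.s≤s J≤2) 3≤C) tightJ)
      where
      J : List Block
      J = filter (_∈? (x ∷ y ∷ [])) C
      2≤J : 2 ℕ.≤ length J
      2≤J = two≤length (∈-filter⁺ (_∈? (x ∷ y ∷ [])) x∈C (here refl)) (∈-filter⁺ (_∈? (x ∷ y ∷ [])) y∈C (there (here refl))) x≢y
      J⊆ : ∀ {B} → B ∈ J → B ∈ x ∷ y ∷ []
      J⊆ = proj₂ ∘ ∈-filter⁻ (_∈? (x ∷ y ∷ [])) {xs = C}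
      J≤2 : length J ℕ.≤ 2
      J≤2 = unique-⊆-length (Unique.filter⁺ (_∈? (x ∷ y ∷ [])) (unique mt)) J⊆
      sub : ⋃ J ⊆ x ∪ y
      sub p with x∈⋃⁻ J p
      ... | B , B∈ , q with J⊆ B∈
      ...   | here refl = Sub.x∈p∪q⁺ (inj₁ q)
      ...   | there (here refl) = Sub.x∈p∪q⁺ (inj₂ q)
      tightJ : Tight J
      tightJ = ℕₚ.≤-trans (Sub.p⊆q⇒∣p∣≤∣q∣ sub) (ℕₚ.≤-trans (∪-tight x y (All.lookup (uniform mt) x∈C) (All.lookup (uniform mt) y∈C) (ℕₚ.≰⇒> h))
        (ℕ.s≤s (ℕ.s≤s (ℕₚ.*-monoʳ-≤ a 2≤J))))

    module _ (2≤k : 2 ℕ.≤ k) where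

      -- A common form for both ways of being killed: a minimal tight configuration through `x` and
      -- `z` whose other blocks are selected.
      record Witness (S : List Block) (x z : Block) : Set where
        constructor witness
        field
          C : List Block
          mt : MinTight C
          x∈ : x ∈ C
          z∈ : z ∈ C
          inside : ∀ {B} → B ∈ C → B ≡ x ⊎ B ≡ z ⊎ B ∈ S
          ⊆𝔅 : ∀ {B} → B ∈ C → B ∈ 𝔅
          len : length C ℕ.≤ k

      kill⇒witness : ∀ {S x z} → x ≢ z → x ∈ 𝔅 → z ∈ 𝔅 → Kill S x z → Witness S x z
      kill⇒witness {x = x} {z} x≢z x∈ z∈ (inj₁ s) = witness (x ∷ z ∷ []) (pair-minTight x≢z x∈ z∈ (share⇒2≤ s)) (here refl) (there (here refl))
        (λ { (here eq) → inj₁ eq ; (there (here eq)) → inj₂ (inj₁ eq) }) (λ { (here refl) → x∈ ; (there (here refl)) → z∈ }) 2≤k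
      kill⇒witness {S} {x} {z} x≢z x∈ z∈ (inj₂ t) = through t (λ p → p)
        where
        through : ∀ {Cs} → Any (Completes S x z) Cs → (∀ {C} → C ∈ Cs → C ∈ 𝒯) → Witness S x z
        through (there t) sub = through t (sub ∘ there)
        through {C ∷ _} (here (x∈C , z∈C , all)) sub with ∈𝒯⁻ (sub (here refl))
        ... | C∈ , _ , mt = witness C mt x∈C z∈C (All.lookup all) (listsUpTo-⊆ k 𝔅 C∈) (listsUpTo-length k 𝔅 C∈)

      -- The witnesses of the two kills complete `C` to the triangle of `triple-dense`: `x` is not
      -- in the second one, whose blocks are `y`, `z` or selected, and likewise for `y`. The
      -- condition on `x ∩ y` holds since blocks of a conflict share at most one vertex,
      -- respectively since `e` lies in `x ∩ y` but not in `z`.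
      closure : ∀ {S C x y z} →
        C ∈ 𝒯 ⊎ (C ≡ x ∷ y ∷ [] × ∃ λ e → e ∈ 𝔓 × Inc x e × Inc y e × ¬ Inc z e) →
        Available S x → Available S y → Available S z → x ∈ C → y ∈ C → x ≢ y → z ∉ C →
        Kill S x z → Kill S y z →
        ∃ λ Q → Q ∈ 𝒟 × All (_∈ Q) C × z ∈ Q × All (λ B → B ∈ C ⊎ B ≡ z ⊎ B ∈ S) Q
      closure {S} {C} {x} {y} {z} kind ax ay az x∈C y∈C x≢y z∉C kx ky = Q , Q∈𝒟 , All.tabulate (∈-union⁺ˡ (union C C₁) C₂ ∘ ∈-union⁺ˡ C C₁) ,
          ∈-union⁺ʳ (union C C₁) C₂ (Witness.z∈ W₂) , All.tabulate inside
        where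
        x≢z : x ≢ z
        x≢z refl = z∉C x∈C
        y≢z : y ≢ z
        y≢z refl = z∉C y∈C
        W₁ : Witness S x z
        W₁ = kill⇒witness x≢z (in𝔅 ax) (in𝔅 az) kx
        W₂ : Witness S y z
        W₂ = kill⇒witness y≢z (in𝔅 ay) (in𝔅 az) ky
        C₁ C₂ Q : List Block
        C₁ = Witness.C W₁
        C₂ = Witness.C W₂
        Q = union (union C C₁) C₂
        describe : C ∈ 𝒯 ⊎ (C ≡ x ∷ y ∷ [] × ∃ λ e → e ∈ 𝔓 × Inc x e × Inc y e × ¬ Inc z e) →
          MinTight C × (∀ {B} → B ∈ C → B ∈ 𝔅) × length C ℕ.≤ k × (x ∩ y ⊆ z → ∣ x ∩ y ∣ ℕ.≤ 1)
        describe (inj₁ C∈𝒯) with ∈𝒯⁻ C∈𝒯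
        ... | C∈ , 3≤C , mt = mt , listsUpTo-⊆ k 𝔅 C∈ , listsUpTo-length k 𝔅 C∈ , λ _ → minTight-linear mt 3≤C x∈C y∈C x≢y
        describe (inj₂ (refl , (u , v) , e∈ , (ux , vx) , (uy , vy) , ¬iz)) =
          pair-minTight x≢y (in𝔅 ax) (in𝔅 ay) (two-elements⁻ (Sub.x∈p∩q⁺ (ux , uy)) (Sub.x∈p∩q⁺ (vx , vy)) (pairs-≢ e∈)) ,
          (λ { (here refl) → in𝔅 ax ; (there (here refl)) → in𝔅 ay }) , 2≤k ,
          λ sub → ⊥-elim (¬iz (sub (Sub.x∈p∩q⁺ (ux , uy)) , sub (Sub.x∈p∩q⁺ (vx , vy))))
        data-C : MinTight C × (∀ {B} → B ∈ C → B ∈ 𝔅) × length C ℕ.≤ k × (x ∩ y ⊆ z → ∣ x ∩ y ∣ ℕ.≤ 1)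
        data-C = describe kind
        mC : MinTight C
        mC = proj₁ data-C
        x∉C₂ : x ∉ C₂
        x∉C₂ p with Witness.inside W₂ p
        ... | inj₁ eq = x≢y eq
        ... | inj₂ (inj₁ eq) = x≢z eq
        ... | inj₂ (inj₂ x∈S) = unselected ax x∈S
        y∉C₁ : y ∉ C₁
        y∉C₁ p with Witness.inside W₁ p
        ... | inj₁ eq = x≢y (sym eq)
        ... | inj₂ (inj₁ eq) = y≢z eq
        ... | inj₂ (inj₂ y∈S) = unselected ay y∈S
        Q-unique : Unique Q
        Q-unique = union-unique (union-unique (unique mC) (unique (Witness.mt W₁))) (unique (Witness.mt W₂))
        Q-dense : Dense Q
        Q-dense = triple-dense mC (Witness.mt W₁) (Witness.mt W₂) x∈C (Witness.x∈ W₁) x∉C₂ y∈C y∉C₁ (Witness.x∈ W₂) z∉C (Witness.z∈ W₁) (Witness.z∈ W₂)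
          (proj₂ (proj₂ (proj₂ data-C)))
        union-length : ∀ A B → length (union A B) ℕ.≤ length A ℕ.+ length B
        union-length A B = ℕₚ.≤-trans (ℕₚ.m≤m+n _ _) (ℕₚ.≤-reflexive (length-union A B))
        Q-length : length Q ℕ.≤ 3 ℕ.* k
        Q-length = ℕₚ.≤-trans (union-length (union C C₁) C₂) (ℕₚ.≤-trans (ℕₚ.+-mono-≤ (ℕₚ.≤-trans (union-length C C₁)
            (ℕₚ.+-mono-≤ (proj₁ (proj₂ (proj₂ data-C))) (Witness.len W₁))) (Witness.len W₂))
          (ℕₚ.≤-reflexive (trans (ℕₚ.+-assoc k k k) (cong (λ t → k ℕ.+ (k ℕ.+ t)) (sym (ℕₚ.+-identityʳ k))))))
        Q⊆𝔅 : ∀ {B} → B ∈ Q → B ∈ 𝔅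
        Q⊆𝔅 p with ∈-union⁻ (union C C₁) C₂ p
        ... | inj₂ q = Witness.⊆𝔅 W₂ q
        ... | inj₁ q = [ proj₁ (proj₂ data-C) , Witness.⊆𝔅 W₁ ]′ (∈-union⁻ C C₁ q)
        Q∈𝒟 : Q ∈ 𝒟
        Q∈𝒟 = ∈-filter⁺ denseUnique? (∈-listsUpTo (3 ℕ.* k) 𝔅 (All.tabulate Q⊆𝔅) Q-length) (Q-unique , Q-dense)
        inside : ∀ {B} → B ∈ Q → B ∈ C ⊎ B ≡ z ⊎ B ∈ S
        inside p with ∈-union⁻ (union C C₁) C₂ p
        ... | inj₂ q with Witness.inside W₂ q
        ...   | inj₁ refl = inj₁ y∈C
        ...   | inj₂ r = inj₂ r
        inside p | inj₁ q with ∈-union⁻ C C₁ q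
        ...   | inj₁ r = inj₁ r
        ...   | inj₂ r with Witness.inside W₁ r
        ...     | inj₁ refl = inj₁ x∈C
        ...     | inj₂ s = inj₂ s

      -- A tight set of `k` blocks contains a minimal tight one. With at least three blocks this is
      -- a forbidden conflict; with two, its blocks share a pair.
      good⇒no-tight : ∀ {S Q} → Good S → (∀ {B} → B ∈ Q → B ∈ S) → Unique Q → length Q ≡ k → ¬ Tight Q
      good⇒no-tight {S} {Q} g Q⊆S uQ len t
        with tight⇒minTight Q uQ (All.tabulate (λ p → size (selected-in𝔅 g (Q⊆S p)))) (subst (2 ℕ.≤_) (sym len) 2≤k) t
      ... | J , mt , 2≤J , J≤Q , J⊆Q with 3 ℕₚ.≤? length J
      ...   | yes 3≤J = no-conflict g (∈-filter⁺ conflict? (∈-listsUpTo k 𝔅 (All.tabulate (λ p → selected-in𝔅 g (Q⊆S (J⊆Q p)))) (subst (length J ℕ.≤_) len J≤Q)) (3≤J , mt))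
                (All.tabulate (λ p → Q⊆S (J⊆Q p)))
      ...   | no 3≰J = two J mt (ℕₚ.≤-antisym (ℕₚ.≤-pred (ℕₚ.≰⇒> 3≰J)) 2≤J) (λ p → Q⊆S (J⊆Q p))
        where
        two : ∀ J → MinTight J → length J ≡ 2 → (∀ {B} → B ∈ J → B ∈ S) → ⊥
        two (x ∷ y ∷ []) mt refl J⊆S with unique mt
        ... | (x≢y ∷ []) ∷ _ = disjoint g (J⊆S (here refl)) (J⊆S (there (here refl))) x≢y (2≤⇒share (ℕₚ.+-cancelˡ-≤ (∣ x ∪ y ∣) _ _ (begin
          ∣ x ∪ y ∣ ℕ.+ 2          ≤⟨ ℕₚ.+-monoˡ-≤ 2 (ℕₚ.≤-trans (Sub.p⊆q⇒∣p∣≤∣q∣ sub) (tight mt)) ⟩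
          2 ℕ.+ a ℕ.* 2 ℕ.+ 2      ≡⟨ ℕₚ.+-comm (2 ℕ.+ a ℕ.* 2) 2 ⟩
          2 ℕ.+ (2 ℕ.+ a ℕ.* 2)    ≡⟨ cong (λ t → 2 ℕ.+ (2 ℕ.+ t)) (trans (ℕₚ.*-comm a 2) (cong (a ℕ.+_) (ℕₚ.+-identityʳ a))) ⟩
          2 ℕ.+ (2 ℕ.+ (a ℕ.+ a))  ≡⟨ cong (2 ℕ.+_) (sym (trans (ℕₚ.+-suc a (suc a)) (cong suc (ℕₚ.+-suc a a)))) ⟩
          2 ℕ.+ a ℕ.+ (2 ℕ.+ a)    ≡⟨ sym (trans (∣p∪q∣+∣p∩q∣ x y) (cong₂ ℕ._+_ (All.lookup (uniform mt) (here refl)) (All.lookup (uniform mt) (there (here refl))))) ⟩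
          ∣ x ∪ y ∣ ℕ.+ ∣ x ∩ y ∣ ∎)))
          where
          open ℕₚ.≤-Reasoning
          sub : x ∪ y ⊆ ⋃ (x ∷ y ∷ [])
          sub p with Sub.x∈p∪q⁻ x y p
          ... | inj₁ q = x∈⋃⁺ {Q = x ∷ y ∷ []} (here refl) q
          ... | inj₂ q = x∈⋃⁺ {Q = x ∷ y ∷ []} (there (here refl)) q

-- Counting blocks and configurations.

module FirstMoment where
  open OrderedFields
  open TightConfigurations
  open WeightedLists
  open RandomGreedy
  open BlockConflicts
  open import Data.Nat as ℕ using (ℕ; zero; suc; _!)
  import Data.Nat.Properties as ℕₚ
  import Data.Nat.Solver as ℕSolver
  open import Data.Bool using (true; false)
  import Data.Vec as Vec
  open import Data.Fin as Fin using (Fin)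
  import Data.Fin.Properties as Finₚ
  open import Data.Fin.Subset as Sub using (Subset; ⋃; ∣_∣; _∪_; _∩_; _⊆_; ⁅_⁆)
  import Data.Fin.Subset.Properties as Sub
  open import Data.List using (List; []; _∷_; _++_; map; filter; length; allFin; cartesianProduct; replicate)
  open import Data.List.Properties using (length-++; length-map; map-tabulate; length-replicate; length-tabulate; filter-all)
  open import Data.List.Membership.Propositional using (_∈_)
  open import Data.List.Membership.Propositional.Properties
    using (∈-++⁺ˡ; ∈-++⁺ʳ; ∈-++⁻; ∈-filter⁺; ∈-filter⁻; ∈-map⁺; ∈-map⁻; ∈-allFin)
  open import Data.List.Relation.Unary.All as All using (All; []; _∷_; all?)
  open import Data.List.Relation.Unary.Unique.Propositional using (Unique)
  import Data.List.Relation.Unary.Unique.Propositional.Properties as Unique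
  open import Data.Product using (_×_; _,_; proj₂)
  open import Data.Sum using (inj₁; inj₂)
  open import Data.Empty using (⊥; ⊥-elim)
  open import Function using (_∘_; id)
  open import Relation.Nullary using (Dec; yes; no; ¬?)
  open import Relation.Binary.PropositionalEquality hiding ([_]; J)

  binom : ℕ → ℕ → ℕ
  binom n zero = 1
  binom zero (suc k) = 0
  binom (suc n) (suc k) = binom n (suc k) ℕ.+ binom n k

  binom-one : ∀ n → binom n 1 ≡ n
  binom-one zero = refl
  binom-one (suc n) = trans (ℕₚ.+-comm (binom n 1) 1) (cong suc (binom-one n))

  binom-absorb : ∀ n k → suc k ℕ.* binom (suc n) (suc k) ≡ suc n ℕ.* binom n k
  binom-absorb n zero = trans (ℕₚ.*-identityˡ (binom (suc n) 1)) (trans (binom-one (suc n)) (sym (ℕₚ.*-identityʳ (suc n))))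
  binom-absorb zero (suc k) = ℕₚ.*-zeroʳ (suc (suc k))
  binom-absorb (suc n) (suc k) = begin
    suc (suc k) ℕ.* (binom (suc n) (suc (suc k)) ℕ.+ binom (suc n) (suc k))
      ≡⟨ ℕₚ.*-distribˡ-+ (suc (suc k)) (binom (suc n) (suc (suc k))) _ ⟩
    suc (suc k) ℕ.* binom (suc n) (suc (suc k)) ℕ.+ (binom (suc n) (suc k) ℕ.+ suc k ℕ.* binom (suc n) (suc k))
      ≡⟨ cong₂ (λ x y → x ℕ.+ (binom (suc n) (suc k) ℕ.+ y)) (binom-absorb n (suc k)) (binom-absorb n k) ⟩
    suc n ℕ.* binom n (suc k) ℕ.+ (binom (suc n) (suc k) ℕ.+ suc n ℕ.* binom n k)
      ≡⟨ solve 4 (λ s x b y → s :* x :+ (b :+ s :* y) := b :+ s :* (x :+ y)) refl (suc n) (binom n (suc k)) (binom (suc n) (suc k)) (binom n k) ⟩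
    suc (suc n) ℕ.* binom (suc n) (suc k) ∎
    where
    open ≡-Reasoning
    open ℕSolver.+-*-Solver

  -- The right side is (m + 1)(m + 2)...(m + a).
  power≤binom : ∀ m a → m ℕ.^ a ℕ.≤ binom (m ℕ.+ a) a ℕ.* (a !)
  power≤binom m zero = ℕₚ.≤-refl
  power≤binom m (suc a) = begin
    m ℕ.* m ℕ.^ a                                        ≤⟨ ℕₚ.*-mono-≤ (ℕₚ.≤-trans (ℕₚ.m≤m+n m a) (ℕₚ.n≤1+n _)) (power≤binom m a) ⟩
    suc (m ℕ.+ a) ℕ.* (binom (m ℕ.+ a) a ℕ.* (a !))      ≡⟨ sym (ℕₚ.*-assoc (suc (m ℕ.+ a)) (binom (m ℕ.+ a) a) (a !)) ⟩
    suc (m ℕ.+ a) ℕ.* binom (m ℕ.+ a) a ℕ.* (a !)        ≡⟨ cong (ℕ._* (a !)) (sym (binom-absorb (m ℕ.+ a) a)) ⟩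
    suc a ℕ.* binom (suc (m ℕ.+ a)) (suc a) ℕ.* (a !)    ≡⟨ trans (cong (ℕ._* (a !)) (ℕₚ.*-comm (suc a) (binom (suc (m ℕ.+ a)) (suc a)))) (ℕₚ.*-assoc (binom (suc (m ℕ.+ a)) (suc a)) (suc a) (a !)) ⟩
    binom (suc (m ℕ.+ a)) (suc a) ℕ.* (suc a !)          ≡⟨ cong (λ t → binom t (suc a) ℕ.* (suc a !)) (sym (ℕₚ.+-suc m a)) ⟩
    binom (m ℕ.+ suc a) (suc a) ℕ.* (suc a !) ∎
    where open ℕₚ.≤-Reasoning

  co : ∀ {n} → Subset n → ℕ
  co Vec.[] = 0
  co (true Vec.∷ p) = co p
  co (false Vec.∷ p) = suc (co p)

  size+co : ∀ {n} (p : Subset n) → ∣ p ∣ ℕ.+ co p ≡ n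
  size+co Vec.[] = refl
  size+co (true Vec.∷ p) = cong suc (size+co p)
  size+co (false Vec.∷ p) = trans (ℕₚ.+-suc ∣ p ∣ (co p)) (cong suc (size+co p))

  sumUpTo : (ℕ → ℕ) → ℕ → ℕ
  sumUpTo h zero = h zero
  sumUpTo h (suc K) = h (suc K) ℕ.+ sumUpTo h K

  -- In the term for `q`, the first factor bounds the weight against the number of vertex sets, the
  -- second counts `q`-tuples of subsets of d + aq points.
  momentBound : (a d K R : ℕ) → ℕ
  momentBound a d K R = sumUpTo (λ q → R ℕ.^ q ℕ.* (2 ℕ.^ (d ℕ.+ a ℕ.* q)) ℕ.^ q) K

  module Counting (F : OrderedField) where
    open FieldTheory F
    open ListAlgebra F

    []-cong : ∀ {P Q : Set} (d : Dec P) (e : Dec Q) → (P → Q) → (Q → P) → [ d ] ≡ [ e ]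
    []-cong d e f g = ≤-antisym ([]-mono d e f) ([]-mono e d g)

    ∑-tuples : ∀ {A : Set} q (xs : List A) (f : A → Carrier) → ∑ (tuples q xs) (λ C → ∏ C f) ≡ ∑ xs f ^ q
    ∑-tuples zero xs f = +-identityʳ 1#
    ∑-tuples (suc q) xs f = trans (∑-concatMap _ xs _) (trans (∑-cong xs (λ x → trans (∑-map (x ∷_) (tuples q xs) _)
      (trans (∑-*ˡ (tuples q xs) (f x) _) (cong (f x *_) (∑-tuples q xs f))))) (∑-*ʳ xs _ f))

    ∏-indicator : ∀ {A : Set} {P : A → Set} (P? : ∀ x → Dec (P x)) C → ∏ C (λ x → [ P? x ]) ≡ [ all? P? C ]
    ∏-indicator P? C = go C (all? P? C)
      where
      go : ∀ C (d : Dec (All _ C)) → ∏ C (λ x → [ P? x ]) ≡ [ d ]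
      go C (yes all) = ∏-one C (λ {x} x∈ → []-true (P? x) (All.lookup all x∈))
      go [] (no ¬all) = ⊥-elim (¬all [])
      go (x ∷ C) (no ¬all) with P? x
      ... | no _ = zeroˡ _
      ... | yes px = trans (*-identityˡ _) (go C (no (λ all → ¬all (px ∷ all))))

    ∑-filter-≤ : ∀ {A : Set} {P : A → Set} (P? : ∀ x → Dec (P x)) xs {f : A → Carrier} → (∀ x → 0# ≤ f x) → ∑ (filter P? xs) f ≤ ∑ xs f
    ∑-filter-≤ P? xs {f} h = ≤-trans (≤-reflexive (∑-filter P? xs f)) (∑-mono xs (λ x → ≤-trans (*-monoˡ-≤ (h x) ([]≤1 (P? x))) (≤-reflexive (*-identityˡ _))))

    ∑-listsUpTo : ∀ {A : Set} K (xs : List A) {f : List A → Carrier} {h : ℕ → ℕ} c → (∀ q → ∑ (tuples q xs) f ≤ c * ι (h q)) → ∑ (listsUpTo K xs) f ≤ c * ι (sumUpTo h K)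
    ∑-listsUpTo zero xs c b = b zero
    ∑-listsUpTo (suc K) xs {f} {h} c b = ≤-trans (≤-reflexive (∑-++ (tuples (suc K) xs) _ f)) (≤-trans (+-mono-≤ (b (suc K)) (∑-listsUpTo K xs {h = h} c b))
      (≤-reflexive (trans (sym (distribˡ c _ _)) (cong (c *_) (sym (ι-+ (h (suc K)) (sumUpTo h K)))))))

    ∑-allFin-suc : ∀ n (f : Fin (suc n) → Carrier) → ∑ (allFin (suc n)) f ≡ f Fin.zero + ∑ (allFin n) (λ i → f (Fin.suc i))
    ∑-allFin-suc n f = cong (f Fin.zero +_) (trans (cong (λ l → ∑ l f) (sym (map-tabulate id Fin.suc))) (∑-map Fin.suc (allFin n) f))

    ∑-∈ˢ : ∀ {n} (p : Subset n) → ∑ (allFin n) (λ u → [ u Sub.∈? p ]) ≡ ι ∣ p ∣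
    ∑-∈ˢ Vec.[] = refl
    ∑-∈ˢ {suc n} (s Vec.∷ p) = trans (∑-allFin-suc n _) (trans (cong₂ _+_ refl (trans (∑-cong (allFin n) (λ u →
        []-cong (Fin.suc u Sub.∈? (s Vec.∷ p)) (u Sub.∈? p) Sub.drop-there Vec.there)) (∑-∈ˢ p))) (head s))
      where
      head : ∀ s → [ Fin.zero Sub.∈? (s Vec.∷ p) ] + ι ∣ p ∣ ≡ ι ∣ s Vec.∷ p ∣
      head true = sym (ι-suc ∣ p ∣)
      head false = +-identityˡ _

    ∑-≟ : ∀ {n} (u : Fin n) → ∑ (allFin n) (λ v → [ u Finₚ.≟ v ]) ≡ 1#
    ∑-≟ {n} u = trans (∑-cong (allFin n) (λ v → []-cong (u Finₚ.≟ v) (v Sub.∈? ⁅ u ⁆) (λ { refl → Sub.x∈⁅x⁆ u }) (λ p → sym (Sub.x∈⁅y⁆⇒x≡y u p))))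
      (trans (∑-∈ˢ ⁅ u ⁆) (cong ι (Sub.∣⁅x⁆∣≡1 u)))

    ∑-cartesian : ∀ {A B : Set} (xs : List A) (ys : List B) (f : A × B → Carrier) → ∑ (cartesianProduct xs ys) f ≡ ∑ xs (λ x → ∑ ys (λ y → f (x , y)))
    ∑-cartesian [] ys f = refl
    ∑-cartesian (x ∷ xs) ys f = trans (∑-++ (map (x ,_) ys) _ f) (cong₂ _+_ (∑-map (x ,_) ys f) (∑-cartesian xs ys f))

    -- The diagonal completes the ordered pairs of distinct points to the full square.
    ∑-inc : ∀ {n} (p : Subset n) → ∑ (pairs n) (λ e → [ inc? p e ]) + ι ∣ p ∣ ≡ ι ∣ p ∣ * ι ∣ p ∣
    ∑-inc {n} p = begin
      ∑ (pairs n) (λ e → [ inc? p e ]) + ι ∣ p ∣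
        ≡⟨ cong₂ _+_ (trans (∑-filter (λ (u , v) → ¬? (u Finₚ.≟ v)) (cartesianProduct (allFin n) (allFin n)) _) (∑-cartesian (allFin n) (allFin n) _))
             (sym (trans (∑-cong (allFin n) (λ u → trans (∑-*ʳ (allFin n) [ u Sub.∈? p ] _) (trans (cong (_* [ u Sub.∈? p ]) (∑-≟ u)) (*-identityˡ _)))) (∑-∈ˢ p))) ⟩
      ∑ (allFin n) (λ u → ∑ (allFin n) (λ v → [ ¬? (u Finₚ.≟ v) ] * [ inc? p (u , v) ])) + ∑ (allFin n) (λ u → ∑ (allFin n) (λ v → [ u Finₚ.≟ v ] * [ u Sub.∈? p ]))
        ≡⟨ sym (trans (∑-cong (allFin n) (λ u → ∑-+ (allFin n) _ _)) (∑-+ (allFin n) _ _)) ⟩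
      ∑ (allFin n) (λ u → ∑ (allFin n) (λ v → [ ¬? (u Finₚ.≟ v) ] * [ inc? p (u , v) ] + [ u Finₚ.≟ v ] * [ u Sub.∈? p ]))
        ≡⟨ ∑-cong (allFin n) (λ u → trans (∑-cong (allFin n) (each u)) (∑-*ˡ (allFin n) [ u Sub.∈? p ] _)) ⟩
      ∑ (allFin n) (λ u → [ u Sub.∈? p ] * ∑ (allFin n) (λ v → [ v Sub.∈? p ]))
        ≡⟨ trans (∑-*ʳ (allFin n) _ _) (cong₂ _*_ (∑-∈ˢ p) (∑-∈ˢ p)) ⟩
      ι ∣ p ∣ * ι ∣ p ∣ ∎
      where
      open ≡-Reasoning
      each : ∀ u v → [ ¬? (u Finₚ.≟ v) ] * [ inc? p (u , v) ] + [ u Finₚ.≟ v ] * [ u Sub.∈? p ] ≡ [ u Sub.∈? p ] * [ v Sub.∈? p ]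
      each u v with u Finₚ.≟ v
      ... | yes refl = trans (cong₂ _+_ (zeroˡ _) (*-identityˡ _)) (trans (+-identityˡ _) (sym ([]-idem (u Sub.∈? p))))
      ... | no _ with u Sub.∈? p | v Sub.∈? p
      ...   | yes _ | yes _ = solve 0 (con (1 , 0) :* con (1 , 0) :+ con (0 , 0) :* con (1 , 0) := con (1 , 0) :* con (1 , 0)) refl
      ...   | yes _ | no _ = solve 0 (con (1 , 0) :* con (0 , 0) :+ con (0 , 0) :* con (1 , 0) := con (1 , 0) :* con (0 , 0)) refl
      ...   | no _ | yes _ = solve 0 (con (1 , 0) :* con (0 , 0) :+ con (0 , 0) :* con (0 , 0) := con (0 , 0) :* con (1 , 0)) refl
      ...   | no _ | no _ = solve 0 (con (1 , 0) :* con (0 , 0) :+ con (0 , 0) :* con (0 , 0) := con (0 , 0) :* con (0 , 0)) refl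

    ι-injective : ∀ {m n} → ι m ≡ ι n → m ≡ n
    ι-injective {m} {n} eq = ℕₚ.≤-antisym (ι-cancel-≤ m n (≤-reflexive eq)) (ι-cancel-≤ n m (≤-reflexive (sym eq)))

    pairs-in : ∀ {n} (p : Subset n) → length (filter (inc? p) (pairs n)) ℕ.+ ∣ p ∣ ≡ ∣ p ∣ ℕ.* ∣ p ∣
    pairs-in {n} p = ι-injective (trans (ι-+ (length (filter (inc? p) (pairs n))) ∣ p ∣) (trans (cong (_+ ι ∣ p ∣) (sym (∑-indicator (inc? p) (pairs n)))) (trans (∑-inc p) (sym (ι-* ∣ p ∣ ∣ p ∣)))))

    length-pairs : ∀ n → length (pairs n) ℕ.+ n ≡ n ℕ.* n
    length-pairs n = subst (λ t → length (pairs n) ℕ.+ t ≡ t ℕ.* t) (Sub.∣⊤∣≡n n)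
      (trans (cong (λ l → length l ℕ.+ ∣ Sub.⊤ {n} ∣) (sym (filter-all (inc? (Sub.⊤ {n})) {xs = pairs n} (All.tabulate (λ _ → Sub.∈⊤ , Sub.∈⊤))))) (pairs-in (Sub.⊤ {n})))

    no-supersets : ∀ {n} (p : Subset n) {r} → r ℕ.< ∣ p ∣ → ∑ (blocks n r) (λ B → [ p Sub.⊆? B ]) ≡ 0#
    no-supersets {n} p {r} h = trans (∑-cong∈ (blocks n r) (λ {B} B∈ → []-false (p Sub.⊆? B) (λ p⊆B →
      ℕₚ.<⇒≱ h (subst (∣ p ∣ ℕ.≤_) (blocks-size n r B∈) (Sub.p⊆q⇒∣p∣≤∣q∣ p⊆B))))) (∑-zero (blocks n r))

    -- Pascal's rule at each vertex outside `p`; a vertex of `p` leaves no choice.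
    supersets : ∀ {n} (p : Subset n) t → ∑ (blocks n (∣ p ∣ ℕ.+ t)) (λ B → [ p Sub.⊆? B ]) ≡ ι (binom (co p) t)
    supersets Vec.[] zero = +-identityʳ 1#
    supersets Vec.[] (suc t) = refl
    supersets {suc n} (true Vec.∷ p) t = trans (∑-++ (map (false Vec.∷_) (blocks n (suc (∣ p ∣ ℕ.+ t)))) _ _)
      (trans (cong₂ _+_ (trans (∑-map _ (blocks n (suc (∣ p ∣ ℕ.+ t))) _) (trans (∑-cong (blocks n (suc (∣ p ∣ ℕ.+ t))) (λ B →
          []-false ((true Vec.∷ p) Sub.⊆? (false Vec.∷ B)) (λ h → absurd (h Vec.here)))) (∑-zero (blocks n (suc (∣ p ∣ ℕ.+ t))))))
        (trans (∑-map _ (blocks n (∣ p ∣ ℕ.+ t)) _) (trans (∑-cong (blocks n (∣ p ∣ ℕ.+ t)) (λ B →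
          []-cong ((true Vec.∷ p) Sub.⊆? (true Vec.∷ B)) (p Sub.⊆? B) Sub.drop-∷-⊆ Sub.in⊆in)) (supersets p t)))) (+-identityˡ _))
      where
      absurd : ∀ {B : Subset n} → Fin.zero Sub.∈ (false Vec.∷ B) → ⊥
      absurd ()
    supersets {suc n} (false Vec.∷ p) t = go (∣ p ∣ ℕ.+ t) t refl
      where
      out : ∀ r → ∑ (map (false Vec.∷_) (blocks n r)) (λ B → [ (false Vec.∷ p) Sub.⊆? B ]) ≡ ∑ (blocks n r) (λ B → [ p Sub.⊆? B ])
      out r = trans (∑-map _ (blocks n r) _) (∑-cong (blocks n r) (λ B → []-cong ((false Vec.∷ p) Sub.⊆? (false Vec.∷ B)) (p Sub.⊆? B) Sub.drop-∷-⊆ Sub.out⊆))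
      inn : ∀ r → ∑ (map (true Vec.∷_) (blocks n r)) (λ B → [ (false Vec.∷ p) Sub.⊆? B ]) ≡ ∑ (blocks n r) (λ B → [ p Sub.⊆? B ])
      inn r = trans (∑-map _ (blocks n r) _) (∑-cong (blocks n r) (λ B → []-cong ((false Vec.∷ p) Sub.⊆? (true Vec.∷ B)) (p Sub.⊆? B) Sub.drop-∷-⊆ Sub.out⊆))
      go : ∀ r t → r ≡ ∣ p ∣ ℕ.+ t → ∑ (blocks (suc n) r) (λ B → [ (false Vec.∷ p) Sub.⊆? B ]) ≡ ι (binom (suc (co p)) t)
      go zero zero eq = trans (out zero) (trans (cong (λ r → ∑ (blocks n r) (λ B → [ p Sub.⊆? B ])) eq) (supersets p zero))
      go zero (suc t) eq = ⊥-elim (ℕₚ.0≢1+n (trans eq (ℕₚ.+-suc ∣ p ∣ t)))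
      go (suc r) zero eq = trans (∑-++ (map (false Vec.∷_) (blocks n (suc r))) _ _) (trans (cong₂ _+_ (trans (out (suc r))
          (trans (cong (λ r → ∑ (blocks n r) (λ B → [ p Sub.⊆? B ])) eq) (supersets p zero)))
        (trans (inn r) (no-supersets p (subst (r ℕ.<_) (trans eq (ℕₚ.+-identityʳ _)) ℕₚ.≤-refl)))) (+-identityʳ _))
      go (suc r) (suc t) eq = trans (∑-++ (map (false Vec.∷_) (blocks n (suc r))) _ _) (trans (cong₂ _+_ (trans (out (suc r))
          (trans (cong (λ r → ∑ (blocks n r) (λ B → [ p Sub.⊆? B ])) eq) (supersets p (suc t))))
        (trans (inn r) (trans (cong (λ r → ∑ (blocks n r) (λ B → [ p Sub.⊆? B ])) (ℕₚ.suc-injective (trans eq (ℕₚ.+-suc ∣ p ∣ t)))) (supersets p t))))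
        (sym (ι-+ (binom (co p) (suc t)) (binom (co p) t))))

    ∣⁅u⁆∪⁅v⁆∣ : ∀ {n} {u v : Fin n} → u ≢ v → ∣ ⁅ u ⁆ ∪ ⁅ v ⁆ ∣ ≡ 2
    ∣⁅u⁆∪⁅v⁆∣ {n} {u} {v} u≢v = trans (sym (ℕₚ.+-identityʳ _)) (trans (cong (∣ ⁅ u ⁆ ∪ ⁅ v ⁆ ∣ ℕ.+_) (sym (trans (cong ∣_∣ (Sub.Empty-unique empty)) (Sub.∣⊥∣≡0 n))))
      (trans (∣p∪q∣+∣p∩q∣ ⁅ u ⁆ ⁅ v ⁆) (cong₂ ℕ._+_ (Sub.∣⁅x⁆∣≡1 u) (Sub.∣⁅x⁆∣≡1 v))))
      where
      empty : Sub.Empty (⁅ u ⁆ ∩ ⁅ v ⁆)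
      empty (x , x∈) with Sub.x∈p∩q⁻ ⁅ u ⁆ ⁅ v ⁆ x∈
      ... | p , q = u≢v (trans (sym (Sub.x∈⁅y⁆⇒x≡y u p)) (Sub.x∈⁅y⁆⇒x≡y v q))

    blocks-through : ∀ {n a} {e} → e ∈ pairs (2 ℕ.+ n) → ∑ (blocks (2 ℕ.+ n) (2 ℕ.+ a)) (λ B → [ inc? B e ]) ≡ ι (binom n a)
    blocks-through {n} {a} {u , v} e∈ = trans (∑-cong (blocks (2 ℕ.+ n) (2 ℕ.+ a)) (λ B → []-cong (inc? B (u , v)) (p Sub.⊆? B) (to B) (from B)))
      (trans (cong (λ r → ∑ (blocks (2 ℕ.+ n) (r ℕ.+ a)) (λ B → [ p Sub.⊆? B ])) (sym p≡2)) (trans (supersets p a)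
        (cong (λ t → ι (binom t a)) (ℕₚ.+-cancelˡ-≡ 2 _ _ (trans (cong (ℕ._+ co p) (sym p≡2)) (size+co p))))))
      where
      p : Subset (2 ℕ.+ n)
      p = ⁅ u ⁆ ∪ ⁅ v ⁆
      p≡2 : ∣ p ∣ ≡ 2
      p≡2 = ∣⁅u⁆∪⁅v⁆∣ (pairs-≢ e∈)
      to : ∀ B → Inc B (u , v) → p ⊆ B
      to B (u∈ , v∈) x∈ with Sub.x∈p∪q⁻ ⁅ u ⁆ ⁅ v ⁆ x∈
      ... | inj₁ q = subst (Sub._∈ B) (sym (Sub.x∈⁅y⁆⇒x≡y u q)) u∈
      ... | inj₂ q = subst (Sub._∈ B) (sym (Sub.x∈⁅y⁆⇒x≡y v q)) v∈
      from : ∀ B → p ⊆ B → Inc B (u , v)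
      from B h = h (Sub.x∈p∪q⁺ (inj₁ (Sub.x∈⁅x⁆ u))) , h (Sub.x∈p∪q⁺ (inj₂ (Sub.x∈⁅x⁆ v)))

    module _ (a k n : ℕ) where
      open ConcreteSystem a k n hiding (_∈?_)
      open Configurations a n using (_∈?_)

      𝔅-unique : Unique 𝔅
      𝔅-unique = blocks-unique n (2 ℕ.+ a)

      count-∈ : ∀ Q → ∑ 𝔅 (λ z → [ z ∈? Q ]) ≤ ι (length Q)
      count-∈ Q = ≤-trans (≤-reflexive (∑-indicator (_∈? Q) 𝔅))
        (ι-mono (unique-⊆-length (Unique.filter⁺ (_∈? Q) 𝔅-unique) (proj₂ ∘ ∈-filter⁻ (_∈? Q) {xs = 𝔅})))

      count-tuples-inside : ∀ q Q → ∑ (tuples q 𝔅) (λ C → [ all? (_∈? Q) C ]) ≤ ι (length Q ℕ.^ q)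
      count-tuples-inside q Q = ≤-trans (≤-reflexive (trans (∑-cong (tuples q 𝔅) (λ C → sym (∏-indicator (_∈? Q) C))) (∑-tuples q 𝔅 _)))
        (≤-trans (^-mono-≤ (∑-nonneg 𝔅 (λ z → []-nonneg (z ∈? Q))) (count-∈ Q) q) (≤-reflexive (sym (ι-^ (length Q) q))))

      count-sublists : ∀ {Q} → length Q ℕ.≤ 3 ℕ.* k → ∀ {P : List Block → Set} (P? : ∀ C → Dec (P C)) → (∀ {C} → P C → All (_∈ Q) C) →
        length (filter P? 𝒯) ℕ.≤ sumUpTo (λ q → (3 ℕ.* k) ℕ.^ q) k
      count-sublists {Q} h P? f = ι-cancel-≤ _ _ (begin
        ι (length (filter P? 𝒯))          ≡⟨ sym (∑-indicator P? 𝒯) ⟩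
        ∑ 𝒯 (λ C → [ P? C ])              ≤⟨ ∑-mono 𝒯 (λ C → []-mono (P? C) (all? (_∈? Q) C) f) ⟩
        ∑ 𝒯 (λ C → [ all? (_∈? Q) C ])    ≤⟨ ∑-filter-≤ conflict? (listsUpTo k 𝔅) (λ C → []-nonneg (all? (_∈? Q) C)) ⟩
        ∑ (listsUpTo k 𝔅) (λ C → [ all? (_∈? Q) C ])
          ≤⟨ ∑-listsUpTo k 𝔅 {h = λ q → (3 ℕ.* k) ℕ.^ q} 1# (λ q → ≤-trans (count-tuples-inside q Q) (≤-trans (ι-mono (ℕₚ.^-monoˡ-≤ q h)) (≤-reflexive (sym (*-identityˡ _))))) ⟩
        1# * ι (sumUpTo (λ q → (3 ℕ.* k) ℕ.^ q) k) ≡⟨ *-identityˡ _ ⟩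
        ι (sumUpTo (λ q → (3 ℕ.* k) ℕ.^ q) k) ∎)
        where open ≤-Chain

      -- A configuration spanning at most v points lives on the image of some v-tuple of points.
      count-spanning : 1 ℕ.≤ n → ∀ q v → ∑ (tuples q 𝔅) (λ Q → [ ∣ ⋃ Q ∣ ℕₚ.≤? v ]) ≤ ι (n ℕ.^ v ℕ.* (2 ℕ.^ v) ℕ.^ q)
      count-spanning 1≤n q v = begin
        ∑ (tuples q 𝔅) (λ Q → [ ∣ ⋃ Q ∣ ℕₚ.≤? v ])
          ≤⟨ ∑-mono (tuples q 𝔅) covered ⟩
        ∑ (tuples q 𝔅) (λ Q → ∑ (tuples v (allFin n)) (λ X → ∏ Q (λ B → [ B ∈? subsetsOf X ])))
          ≡⟨ trans (∑-swap (tuples q 𝔅) (tuples v (allFin n)) _) (∑-cong (tuples v (allFin n)) (λ X → ∑-tuples q 𝔅 _)) ⟩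
        ∑ (tuples v (allFin n)) (λ X → ∑ 𝔅 (λ B → [ B ∈? subsetsOf X ]) ^ q)
          ≤⟨ ∑-mono∈ (tuples v (allFin n)) (λ {X} X∈ → ^-mono-≤ (∑-nonneg 𝔅 (λ B → []-nonneg (B ∈? subsetsOf X))) (≤-trans (count-∈ (subsetsOf X))
               (≤-reflexive (cong ι (trans (length-map fromList (sublists X)) (trans (length-sublists X) (cong (2 ℕ.^_) (tuples-length v (allFin n) X∈))))))) q) ⟩
        ∑ (tuples v (allFin n)) (λ X → ι (2 ℕ.^ v) ^ q)
          ≡⟨ ∑-cong (tuples v (allFin n)) (λ X → trans (sym (*-identityˡ _)) (cong (_* ι (2 ℕ.^ v) ^ q) (sym (∏-one X (λ _ → refl))))) ⟩
        ∑ (tuples v (allFin n)) (λ X → ∏ X (λ _ → 1#) * ι (2 ℕ.^ v) ^ q)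
          ≡⟨ trans (∑-*ʳ (tuples v (allFin n)) _ _) (cong₂ _*_ (trans (∑-tuples v (allFin n) _) (cong (_^ v) (trans (∑-const (allFin n) 1#) (trans (*-identityʳ _) (cong ι {length (allFin n)} {n} (length-tabulate id))))))
               (sym (ι-^ (2 ℕ.^ v) q))) ⟩
        ι n ^ v * ι ((2 ℕ.^ v) ℕ.^ q)
          ≡⟨ trans (cong (_* ι ((2 ℕ.^ v) ℕ.^ q)) (sym (ι-^ n v))) (sym (ι-* (n ℕ.^ v) _)) ⟩
        ι (n ℕ.^ v ℕ.* (2 ℕ.^ v) ℕ.^ q) ∎
        where
        open ≤-Chain
        subsetsOf : List (Fin n) → List Block
        subsetsOf X = map fromList (sublists X)
        point : Fin n
        point = Fin.fromℕ< 1≤n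
        covered : ∀ Q → [ ∣ ⋃ Q ∣ ℕₚ.≤? v ] ≤ ∑ (tuples v (allFin n)) (λ X → ∏ Q (λ B → [ B ∈? subsetsOf X ]))
        covered Q with ∣ ⋃ Q ∣ ℕₚ.≤? v
        ... | no _ = ∑-nonneg (tuples v (allFin n)) (λ X → ∏-nonneg Q (λ B → []-nonneg (B ∈? subsetsOf X)))
        ... | yes h = ≤-trans (≤-reflexive (sym (∏-one Q (λ {B} B∈ → []-true (B ∈? subsetsOf X) (inside B∈)))))
                (∑-∈ {xs = tuples v (allFin n)} {X} {λ X → ∏ Q (λ B → [ B ∈? subsetsOf X ])} (λ X → ∏-nonneg Q (λ B → []-nonneg (B ∈? subsetsOf X))) X∈)
          where
          X : List (Fin n)
          X = elements (⋃ Q) ++ replicate (v ℕ.∸ ∣ ⋃ Q ∣) point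
          X-length : length X ≡ v
          X-length = trans (length-++ (elements (⋃ Q))) (trans (cong₂ ℕ._+_ (length-elements (⋃ Q)) (length-replicate (v ℕ.∸ ∣ ⋃ Q ∣))) (ℕₚ.m+[n∸m]≡n h))
          X∈ : X ∈ tuples v (allFin n)
          X∈ = subst (λ l → X ∈ tuples l (allFin n)) X-length (∈-tuples (allFin n) (All.tabulate (λ {x} _ → ∈-allFin x)))
          inside : ∀ {B} → B ∈ Q → B ∈ subsetsOf X
          inside {B} B∈ = subst (_∈ subsetsOf X) (Sub.⊆-antisym
              (λ p → proj₂ (∈-filter⁻ (Sub._∈? B) {xs = X} (∈-fromList⁻ (filter (Sub._∈? B) X) p)))
              (λ p → ∈-fromList⁺ (∈-filter⁺ (Sub._∈? B) (∈-++⁺ˡ (∈-elements (x∈⋃⁺ B∈ p))) p)))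
            (∈-map⁺ fromList (filter∈sublists (Sub._∈? B) X))

      -- Up to constants there are n^(d + aq) such configurations of q blocks, each of weight x^q
      -- with x of order n^(-a), so n^d remains. Tight ones have d = 2 and dense ones d = 1, whence
      -- the latter are negligible.
      moment : 1 ℕ.≤ n → ∀ d K R {x} {P : List Block → Set} (P? : ∀ Q → Dec (P Q)) → (∀ {Q} → P Q → ∣ ⋃ Q ∣ ℕ.≤ d ℕ.+ a ℕ.* length Q) →
        0# ≤ x → x * ι (n ℕ.^ a) ≤ ι R → ∑ (filter P? (listsUpTo K 𝔅)) (λ Q → x ^ length Q) ≤ ι (n ℕ.^ d) * ι (momentBound a d K R)
      moment 1≤n d K R {x} P? span 0≤x xn≤R = ≤-trans (≤-reflexive (∑-filter P? (listsUpTo K 𝔅) _))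
        (∑-listsUpTo K 𝔅 {h = λ q → R ℕ.^ q ℕ.* (2 ℕ.^ (d ℕ.+ a ℕ.* q)) ℕ.^ q} (ι (n ℕ.^ d)) per-length)
        where
        open ≤-Chain
        per-length : ∀ q → ∑ (tuples q 𝔅) (λ Q → [ P? Q ] * x ^ length Q) ≤ ι (n ℕ.^ d) * ι (R ℕ.^ q ℕ.* (2 ℕ.^ (d ℕ.+ a ℕ.* q)) ℕ.^ q)
        per-length q = begin
          ∑ (tuples q 𝔅) (λ Q → [ P? Q ] * x ^ length Q)
            ≤⟨ ∑-mono∈ (tuples q 𝔅) (λ {Q} Q∈ → each Q (tuples-length q 𝔅 Q∈)) ⟩
          ∑ (tuples q 𝔅) (λ Q → [ ∣ ⋃ Q ∣ ℕₚ.≤? v ] * x ^ q)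
            ≡⟨ ∑-*ʳ (tuples q 𝔅) _ _ ⟩
          ∑ (tuples q 𝔅) (λ Q → [ ∣ ⋃ Q ∣ ℕₚ.≤? v ]) * x ^ q
            ≤⟨ *-monoˡ-≤ (^-nonneg 0≤x q) (count-spanning 1≤n q v) ⟩
          ι (n ℕ.^ v ℕ.* c) * x ^ q
            ≡⟨ trans (cong (_* x ^ q) (trans (ι-* (n ℕ.^ v) c) (cong (_* ι c) (trans (cong ι (trans (ℕₚ.^-distribˡ-+-* n d (a ℕ.* q)) (cong (n ℕ.^ d ℕ.*_) (sym (ℕₚ.^-*-assoc n a q)))))
                 (trans (ι-* (n ℕ.^ d) ((n ℕ.^ a) ℕ.^ q)) (cong (ι (n ℕ.^ d) *_) (ι-^ (n ℕ.^ a) q)))))))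
               (trans (solve 4 (λ N A c x → N :* A :* c :* x := N :* (x :* A :* c)) refl (ι (n ℕ.^ d)) (ι (n ℕ.^ a) ^ q) (ι c) (x ^ q))
                 (cong (λ t → ι (n ℕ.^ d) * (t * ι c)) (sym (*-^ x (ι (n ℕ.^ a)) q)))) ⟩
          ι (n ℕ.^ d) * ((x * ι (n ℕ.^ a)) ^ q * ι c)
            ≤⟨ *-monoʳ-≤ (ι-nonneg (n ℕ.^ d)) (*-monoˡ-≤ (ι-nonneg c) (^-mono-≤ (*-nonneg 0≤x (ι-nonneg (n ℕ.^ a))) xn≤R q)) ⟩
          ι (n ℕ.^ d) * (ι R ^ q * ι c)
            ≡⟨ cong (ι (n ℕ.^ d) *_) (trans (cong (_* ι c) (sym (ι-^ R q))) (sym (ι-* (R ℕ.^ q) c))) ⟩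
          ι (n ℕ.^ d) * ι (R ℕ.^ q ℕ.* c) ∎
          where
          v c : ℕ
          v = d ℕ.+ a ℕ.* q
          c = (2 ℕ.^ v) ℕ.^ q
          each : ∀ Q → length Q ≡ q → [ P? Q ] * x ^ length Q ≤ [ ∣ ⋃ Q ∣ ℕₚ.≤? v ] * x ^ q
          each Q refl = *-monoˡ-≤ (^-nonneg 0≤x (length Q)) ([]-mono (P? Q) (∣ ⋃ Q ∣ ℕₚ.≤? v) span)

-- The lower bound: choice of the constants.

module LowerBounds where
  open OrderedFields
  open TightConfigurations
  open WeightedLists
  open RandomGreedy
  open GreedyIteration
  open BlockConflicts
  open FirstMoment
  open import Data.Nat as ℕ using (ℕ; zero; suc; _!)
  import Data.Nat.Properties as ℕₚ
  import Data.Nat.DivMod as DivMod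
  import Data.Nat.Solver as ℕSolver
  open import Data.Fin.Subset using (Subset; ⋃; ∣_∣)
  open import Data.List using (List; filter; length)
  open import Data.List.Membership.Propositional using (_∈_)
  open import Data.List.Relation.Unary.All as All using (All; all?)
  open import Data.List.Relation.Unary.Unique.Propositional using (Unique)
  open import Data.Product using (∃; _×_; _,_; proj₁; proj₂)
  open import Data.Empty using (⊥-elim)
  open import Function using (id)
  open import Relation.Nullary using (¬_)
  open import Relation.Binary.PropositionalEquality hiding ([_]; J)

  private module NS = ℕSolver.+-*-Solver

  -- In the last clause `m` is n(n - 1), written without subtraction. It says that |S| + 1 exceeds
  -- the fraction s / (s + 2) of n(n - 1) / (r(r - 1)), so `s` sets the precision.
  LargeConfigurationFree : (a k s n : ℕ) → Set
  LargeConfigurationFree a k s n = ∃ λ (S : List (Subset n)) → Unique S × All (λ B → ∣ B ∣ ≡ 2 ℕ.+ a) S ×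
    (∀ Q → (∀ {B} → B ∈ Q → B ∈ S) → Unique Q → length Q ≡ k → ¬ (∣ ⋃ Q ∣ ℕ.≤ 2 ℕ.+ a ℕ.* length Q)) ×
    (∀ m → m ℕ.+ n ≡ n ℕ.* n → m ℕ.* s ℕ.< suc (length S) ℕ.* ((2 ℕ.+ a) ℕ.* (1 ℕ.+ a) ℕ.* (2 ℕ.+ s)))

  module LowerBound (F : OrderedField) (a k s : ℕ) (2≤a : 2 ℕ.≤ a) (2≤k : 2 ℕ.≤ k) where

    -- Relative to the initial total weight M / c, the selection runs for about s/μ steps and the
    -- total weight is kept above t/μ. The spare 1/μ pays for all errors.
    t μ : ℕ
    t = 1 ℕ.+ s
    μ = 2 ℕ.+ s

    -- Unfolding these numbers is infeasible.
    abstract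
      c C λd mult c₁ c₂ R₀ K𝒯 X ℓ λΛ R K𝒟 P₁ P₂ Kδ : ℕ
      c = (2 ℕ.+ a) ℕ.* (1 ℕ.+ a)
      C = c ℕ.* μ
      λd = μ ℕ.+ 1
      mult = sumUpTo (λ q → (3 ℕ.* k) ℕ.^ q) k
      c₁ = 2 ℕ.^ k ℕ.* k ℕ.+ 2 ℕ.^ k ℕ.* (k ℕ.* k ℕ.* k)
      c₂ = 4 ℕ.* λd ℕ.+ 2 ℕ.* (c ℕ.* (3 ℕ.* k ℕ.* (3 ℕ.* k ℕ.* (3 ℕ.* k)))) ℕ.+ 3 ℕ.* k ℕ.+ 2 ℕ.^ k ℕ.* (k ℕ.* k ℕ.* (mult ℕ.* (3 ℕ.* k))) ℕ.+ c₁
      R₀ = 2 ℕ.^ a ℕ.* (a !)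
      K𝒯 = momentBound a 2 k R₀
      X = C ℕ.* (μ ℕ.^ c₁ ℕ.* K𝒯)
      -- The cap on conflict loads. It makes 4X / ℓ at most 1, which keeps the initial conflict term
      -- of the potential below n² / 4C.
      ℓ = suc (4 ℕ.* X)
      λΛ = c ℕ.* λd ℕ.+ ℓ
      R = R₀ ℕ.* μ ℕ.^ λΛ
      K𝒟 = momentBound a 1 (3 ℕ.* k) R
      P₁ = 2 ℕ.* (λd ℕ.* λd ℕ.* (λd ℕ.* λd)) ℕ.+ 2 ℕ.* (λd ℕ.* λΛ ℕ.* (λd ℕ.* λΛ) ℕ.+ λd ℕ.* λd ℕ.* (λd ℕ.* λd))
      P₂ = 2 ℕ.* (λd ℕ.* λΛ)
      Kδ = μ ℕ.^ c₂ ℕ.* (2 ℕ.* c ℕ.* P₁ ℕ.+ R ℕ.* P₂) ℕ.+ λΛ ℕ.* λΛ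

      c≡ : c ≡ (2 ℕ.+ a) ℕ.* (1 ℕ.+ a)
      c≡ = refl
      C≡ : C ≡ c ℕ.* μ
      C≡ = refl
      λd≡ : λd ≡ μ ℕ.+ 1
      λd≡ = refl
      mult≡ : mult ≡ sumUpTo (λ q → (3 ℕ.* k) ℕ.^ q) k
      mult≡ = refl
      c₁≡ : c₁ ≡ 2 ℕ.^ k ℕ.* k ℕ.+ 2 ℕ.^ k ℕ.* (k ℕ.* k ℕ.* k)
      c₁≡ = refl
      c₂≡ : c₂ ≡ 4 ℕ.* λd ℕ.+ 2 ℕ.* (c ℕ.* (3 ℕ.* k ℕ.* (3 ℕ.* k ℕ.* (3 ℕ.* k)))) ℕ.+ 3 ℕ.* k ℕ.+ 2 ℕ.^ k ℕ.* (k ℕ.* k ℕ.* (mult ℕ.* (3 ℕ.* k))) ℕ.+ c₁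
      c₂≡ = refl
      R₀≡ : R₀ ≡ 2 ℕ.^ a ℕ.* (a !)
      R₀≡ = refl
      K𝒯≡ : K𝒯 ≡ momentBound a 2 k R₀
      K𝒯≡ = refl
      X≡ : X ≡ C ℕ.* (μ ℕ.^ c₁ ℕ.* K𝒯)
      X≡ = refl
      ℓ≡ : ℓ ≡ suc (4 ℕ.* X)
      ℓ≡ = refl
      λΛ≡ : λΛ ≡ c ℕ.* λd ℕ.+ ℓ
      λΛ≡ = refl
      R≡ : R ≡ R₀ ℕ.* μ ℕ.^ λΛ
      R≡ = refl
      K𝒟≡ : K𝒟 ≡ momentBound a 1 (3 ℕ.* k) R
      K𝒟≡ = refl
      P₁≡ : P₁ ≡ 2 ℕ.* (λd ℕ.* λd ℕ.* (λd ℕ.* λd)) ℕ.+ 2 ℕ.* (λd ℕ.* λΛ ℕ.* (λd ℕ.* λΛ) ℕ.+ λd ℕ.* λd ℕ.* (λd ℕ.* λd))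
      P₁≡ = refl
      P₂≡ : P₂ ≡ 2 ℕ.* (λd ℕ.* λΛ)
      P₂≡ = refl
      Kδ≡ : Kδ ≡ μ ℕ.^ c₂ ℕ.* (2 ℕ.* c ℕ.* P₁ ℕ.+ R ℕ.* P₂) ℕ.+ λΛ ℕ.* λΛ
      Kδ≡ = refl

    threshold : ℕ
    threshold = R ℕ.+ λΛ ℕ.* C ℕ.+ 4 ℕ.* (C ℕ.* (μ ℕ.^ c₂ ℕ.* K𝒟 ℕ.+ Kδ)) ℕ.+ 2 ℕ.* (2 ℕ.+ a)

    module _ (n' : ℕ) (large : threshold ℕ.≤ 2 ℕ.+ n') where

      n M L g : ℕ
      n = 2 ℕ.+ n'
      M = length (pairs n)
      g = binom n' a

      instance
        C-nonZero : ℕ.NonZero C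
        C-nonZero = ℕ.>-nonZero (subst (1 ℕ.≤_) (sym C≡) (ℕₚ.*-mono-≤ {1} {c} {1} {μ} (subst (1 ℕ.≤_) (sym c≡) (ℕ.s≤s ℕ.z≤n)) (ℕ.s≤s ℕ.z≤n)))

      L = (M ℕ.* s) DivMod./ C

      L*C≤ : L ℕ.* C ℕ.≤ M ℕ.* s
      L*C≤ = DivMod.m/n*n≤m (M ℕ.* s) C

      open FieldTheory F
      open ListAlgebra F using ([1+x]^j*[1-jx]≤1; bernoulli)
      open Counting F

      R≤n : R ℕ.≤ n
      R≤n = ℕₚ.≤-trans (ℕₚ.≤-trans (ℕₚ.m≤m+n R _) (ℕₚ.≤-trans (ℕₚ.m≤m+n (R ℕ.+ λΛ ℕ.* C) _) (ℕₚ.m≤m+n _ _))) large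

      λC≤n : λΛ ℕ.* C ℕ.≤ n
      λC≤n = ℕₚ.≤-trans (ℕₚ.≤-trans (ℕₚ.m≤n+m (λΛ ℕ.* C) R) (ℕₚ.≤-trans (ℕₚ.m≤m+n (R ℕ.+ λΛ ℕ.* C) _) (ℕₚ.m≤m+n _ _))) large

      error≤n : 4 ℕ.* (C ℕ.* (μ ℕ.^ c₂ ℕ.* K𝒟 ℕ.+ Kδ)) ℕ.≤ n
      error≤n = ℕₚ.≤-trans (ℕₚ.≤-trans (ℕₚ.m≤n+m _ (R ℕ.+ λΛ ℕ.* C)) (ℕₚ.m≤m+n _ (2 ℕ.* (2 ℕ.+ a)))) large

      2[2+a]≤n : 2 ℕ.* (2 ℕ.+ a) ℕ.≤ n
      2[2+a]≤n = ℕₚ.≤-trans (ℕₚ.m≤n+m _ _) large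

      M+n≡n² : M ℕ.+ n ≡ n ℕ.* n
      M+n≡n² = length-pairs n

      2n≤n² : n ℕ.+ n ℕ.≤ n ℕ.* n
      2n≤n² = ℕₚ.≤-trans (ℕₚ.≤-reflexive (cong (n ℕ.+_) (sym (ℕₚ.+-identityʳ n)))) (ℕₚ.*-monoˡ-≤ n {2} {n} (ℕ.s≤s (ℕ.s≤s ℕ.z≤n)))

      n≤M : n ℕ.≤ M
      n≤M = ℕₚ.+-cancelʳ-≤ n n M (ℕₚ.≤-trans 2n≤n² (ℕₚ.≤-reflexive (sym M+n≡n²)))

      n²≤2M : n ℕ.* n ℕ.≤ 2 ℕ.* M
      n²≤2M = ℕₚ.≤-trans (ℕₚ.≤-reflexive (sym M+n≡n²)) (ℕₚ.≤-trans (ℕₚ.+-monoʳ-≤ M n≤M) (ℕₚ.≤-reflexive (cong (M ℕ.+_) (sym (ℕₚ.+-identityʳ M)))))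

      -- From `2 ≤ a`. It keeps `ι M * ρ`, and with it the noise of the degrees, bounded as n grows.
      M≤n^a : M ℕ.≤ n ℕ.^ a
      M≤n^a = ℕₚ.≤-trans (ℕₚ.m≤m+n M n) (ℕₚ.≤-trans (ℕₚ.≤-reflexive (trans M+n≡n² (cong (n ℕ.*_) (sym (ℕₚ.*-identityʳ n))))) (ℕₚ.^-monoʳ-≤ n 2≤a))

      n≤n^a : n ℕ.≤ n ℕ.^ a
      n≤n^a = ℕₚ.≤-trans n≤M M≤n^a

      -- For n ≥ 2(2 + a) one has n ≤ 2m with `m = n' ∸ a`, and `power≤binom` applies to `m`. This
      -- is the origin of `R₀`.
      n^a≤R₀g : n ℕ.^ a ℕ.≤ R₀ ℕ.* g
      n^a≤R₀g = begin
        n ℕ.^ a                          ≤⟨ ℕₚ.^-monoˡ-≤ a n≤2m ⟩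
        (2 ℕ.* m) ℕ.^ a                  ≡⟨ ^-distribʳ 2 m a ⟩
        2 ℕ.^ a ℕ.* m ℕ.^ a              ≤⟨ ℕₚ.*-monoʳ-≤ (2 ℕ.^ a) (power≤binom m a) ⟩
        2 ℕ.^ a ℕ.* (binom (m ℕ.+ a) a ℕ.* (a !)) ≡⟨ cong (λ v → 2 ℕ.^ a ℕ.* (binom v a ℕ.* (a !))) (ℕₚ.m∸n+n≡m a≤n') ⟩
        2 ℕ.^ a ℕ.* (g ℕ.* (a !))        ≡⟨ trans (cong (2 ℕ.^ a ℕ.*_) (ℕₚ.*-comm g (a !))) (trans (sym (ℕₚ.*-assoc (2 ℕ.^ a) (a !) g)) (cong (ℕ._* g) (sym R₀≡))) ⟩
        R₀ ℕ.* g ∎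
        where
        open ℕₚ.≤-Reasoning
        ^-distribʳ : ∀ x y a → (x ℕ.* y) ℕ.^ a ≡ x ℕ.^ a ℕ.* y ℕ.^ a
        ^-distribʳ x y zero = refl
        ^-distribʳ x y (suc a) = trans (cong (x ℕ.* y ℕ.*_) (^-distribʳ x y a))
          (NS.solve 4 (λ x y p q → x NS.:* y NS.:* (p NS.:* q) NS.:= x NS.:* p NS.:* (y NS.:* q)) refl x y (x ℕ.^ a) (y ℕ.^ a))
        m : ℕ
        m = n' ℕ.∸ a
        double : 2 ℕ.+ a ℕ.+ (2 ℕ.+ a) ℕ.≤ n
        double = ℕₚ.≤-trans (ℕₚ.≤-reflexive (cong (2 ℕ.+ a ℕ.+_) (sym (ℕₚ.+-identityʳ (2 ℕ.+ a))))) 2[2+a]≤n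
        a≤n' : a ℕ.≤ n'
        a≤n' = ℕₚ.+-cancelˡ-≤ 2 a n' (ℕₚ.≤-trans (ℕₚ.m≤m+n (2 ℕ.+ a) _) double)
        n≤2m : n ℕ.≤ 2 ℕ.* m
        n≤2m = ℕₚ.+-cancelʳ-≤ (2 ℕ.+ a ℕ.+ (2 ℕ.+ a)) n (2 ℕ.* m) (begin
          n ℕ.+ (2 ℕ.+ a ℕ.+ (2 ℕ.+ a))      ≤⟨ ℕₚ.+-monoʳ-≤ n double ⟩
          n ℕ.+ n                            ≡⟨ cong (λ v → (2 ℕ.+ v) ℕ.+ (2 ℕ.+ v)) (sym (ℕₚ.m∸n+n≡m a≤n')) ⟩
          (2 ℕ.+ (m ℕ.+ a)) ℕ.+ (2 ℕ.+ (m ℕ.+ a)) ≡⟨ NS.solve 2 (λ m a → (NS.con 2 NS.:+ (m NS.:+ a)) NS.:+ (NS.con 2 NS.:+ (m NS.:+ a)) NS.:= NS.con 2 NS.:* m NS.:+ (NS.con 2 NS.:+ a NS.:+ (NS.con 2 NS.:+ a))) refl m a ⟩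
          2 ℕ.* m ℕ.+ (2 ℕ.+ a ℕ.+ (2 ℕ.+ a)) ∎)

      ι≰0 : ∀ {m} → 1 ℕ.≤ m → ¬ (ι m ≤ 0#)
      ι≰0 {m} h = pos⇒≰0 (1≤ι {m} h)

      1≤g : 1 ℕ.≤ g
      1≤g with g | n^a≤R₀g
      ... | suc _ | _ = ℕ.s≤s ℕ.z≤n
      ... | zero | h = ⊥-elim (ℕₚ.<⇒≱ (ℕₚ.≤-trans (ℕ.s≤s ℕ.z≤n) n≤n^a) (ℕₚ.≤-trans h (ℕₚ.≤-reflexive (ℕₚ.*-zeroʳ R₀))))

      4X≤ℓ : 4 ℕ.* X ℕ.≤ ℓ
      4X≤ℓ = subst (4 ℕ.* X ℕ.≤_) (sym ℓ≡) (ℕₚ.n≤1+n (4 ℕ.* X))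

      1≤ℓ : 1 ℕ.≤ ℓ
      1≤ℓ = subst (1 ℕ.≤_) (sym ℓ≡) (ℕ.s≤s ℕ.z≤n)

      1≤C : 1 ℕ.≤ C
      1≤C = ℕ.>-nonZero⁻¹ C

      1≤Mt : 1 ℕ.≤ M ℕ.* t
      1≤Mt = ℕₚ.*-mono-≤ (ℕₚ.≤-trans (ℕ.s≤s ℕ.z≤n) n≤M) (ℕ.s≤s ℕ.z≤n)

      iMt iC w₀ γ ν N Λ Λd ρ : Carrier
      iMt = proj₁ (inverse (ι≰0 1≤Mt))
      iC = proj₁ (inverse (ι≰0 1≤C))
      w₀ = proj₁ (inverse (ι≰0 1≤g))
      γ = proj₁ (inverse (ι≰0 {ℓ} 1≤ℓ))
      ν = ι C * iMt
      N = ι (M ℕ.* t) * iC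
      Λ = ι λΛ
      Λd = ι λd
      ρ = w₀ * ι (μ ℕ.^ λΛ)

      Mt*iMt : ι (M ℕ.* t) * iMt ≡ 1#
      Mt*iMt = proj₂ (inverse (ι≰0 1≤Mt))
      C*iC : ι C * iC ≡ 1#
      C*iC = proj₂ (inverse (ι≰0 1≤C))
      g*w₀ : ι g * w₀ ≡ 1#
      g*w₀ = proj₂ (inverse (ι≰0 1≤g))
      ℓ*γ : ι ℓ * γ ≡ 1#
      ℓ*γ = proj₂ (inverse (ι≰0 {ℓ} 1≤ℓ))
      0≤iMt : 0# ≤ iMt
      0≤iMt = inverse-nonneg (ι≰0 1≤Mt) Mt*iMt
      0≤w₀ : 0# ≤ w₀
      0≤w₀ = inverse-nonneg (ι≰0 1≤g) g*w₀
      0≤γ : 0# ≤ γ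
      0≤γ = inverse-nonneg (ι≰0 {ℓ} 1≤ℓ) ℓ*γ
      0≤ν : 0# ≤ ν
      0≤ν = *-nonneg (ι-nonneg C) 0≤iMt

      Nν≡1 : N * ν ≡ 1#
      Nν≡1 = trans (solve 4 (λ m i c j → m :* i :* (c :* j) := (c :* i) :* (m :* j)) refl (ι (M ℕ.* t)) iC (ι C) iMt)
        (trans (cong₂ _*_ C*iC Mt*iMt) (*-identityˡ 1#))

      N≰0 : ¬ (N ≤ 0#)
      N≰0 h = 1≰0 (≤-trans (≤-reflexive (sym Nν≡1)) (≤-trans (*-monoˡ-≤ 0≤ν h) (≤-reflexive (zeroˡ ν))))

      *ν≤ : ∀ p q → p ℕ.* C ℕ.≤ q ℕ.* (M ℕ.* t) → ι p * ν ≤ ι q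
      *ν≤ p q h = begin
        ι p * (ι C * iMt)          ≡⟨ trans (sym (*-assoc _ _ _)) (cong (_* iMt) (sym (ι-* p C))) ⟩
        ι (p ℕ.* C) * iMt          ≤⟨ *-monoˡ-≤ 0≤iMt (ι-mono h) ⟩
        ι (q ℕ.* (M ℕ.* t)) * iMt  ≡⟨ trans (cong (_* iMt) (ι-* q (M ℕ.* t))) (trans (*-assoc _ _ _) (trans (cong (ι q *_) Mt*iMt) (*-identityʳ _))) ⟩
        ι q ∎
        where open ≤-Chain

      Lν≤1 : ι L * ν ≤ 1#
      Lν≤1 = *ν≤ L 1 (ℕₚ.≤-trans L*C≤ (ℕₚ.≤-trans (ℕₚ.*-monoʳ-≤ M (ℕₚ.n≤1+n s)) (ℕₚ.≤-reflexive (sym (ℕₚ.+-identityʳ _)))))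

      Mν≤2c : ι M * ν ≤ ι (2 ℕ.* c)
      Mν≤2c = *ν≤ M (2 ℕ.* c) (begin
        M ℕ.* C                     ≡⟨ cong (M ℕ.*_) C≡ ⟩
        M ℕ.* (c ℕ.* μ)             ≤⟨ ℕₚ.*-monoʳ-≤ M (ℕₚ.*-monoʳ-≤ c (ℕ.s≤s (ℕ.s≤s (ℕₚ.m≤m+n s (s ℕ.+ 0))))) ⟩
        M ℕ.* (c ℕ.* (2 ℕ.+ (s ℕ.+ (s ℕ.+ 0)))) ≡⟨ NS.solve 3 (λ M c s → M NS.:* (c NS.:* (NS.con 2 NS.:+ (s NS.:+ (s NS.:+ NS.con 0)))) NS.:= NS.con 2 NS.:* c NS.:* (M NS.:* (NS.con 1 NS.:+ s))) refl M c s ⟩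
        2 ℕ.* c ℕ.* (M ℕ.* t) ∎)
        where
        open ℕₚ.≤-Reasoning

      -- It comes down to s(s + 2) ≤ (s + 1)², as L ν is at most s / (s + 1).
      ζμ≥1 : 1# ≤ (1# - ι L * ν) * ι μ
      ζμ≥1 = ≤-by _ (≤⇒0≤ Lμν≤t) (trans (cong (λ v → (1# - ι L * ν) * v - 1#) (ι-suc t))
          (trans (solve 3 (λ l v t → (con (1 , 0) :- l :* v) :* (con (1 , 0) :+ t) :- con (1 , 0) := t :- l :* (con (1 , 0) :+ t) :* v) refl (ι L) ν (ι t))
            (cong (λ v → ι t - v * ν) (trans (cong (ι L *_) (sym (ι-suc t))) (sym (ι-* L μ))))))
        where
        Lμν≤t : ι (L ℕ.* μ) * ν ≤ ι t
        Lμν≤t = *ν≤ (L ℕ.* μ) t (begin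
          L ℕ.* μ ℕ.* C        ≡⟨ NS.solve 3 (λ l m c → l NS.:* m NS.:* c NS.:= l NS.:* c NS.:* m) refl L μ C ⟩
          L ℕ.* C ℕ.* μ        ≤⟨ ℕₚ.*-monoˡ-≤ μ L*C≤ ⟩
          M ℕ.* s ℕ.* (2 ℕ.+ s) ≤⟨ ℕₚ.m≤m+n _ M ⟩
          M ℕ.* s ℕ.* (2 ℕ.+ s) ℕ.+ M ≡⟨ NS.solve 2 (λ M s → M NS.:* s NS.:* (NS.con 2 NS.:+ s) NS.:+ M NS.:= (NS.con 1 NS.:+ s) NS.:* (M NS.:* (NS.con 1 NS.:+ s))) refl M s ⟩
          t ℕ.* (M ℕ.* t) ∎)
          where
          open ℕₚ.≤-Reasoning


      -- Bernoulli gives 1 + pν ≤ (1 + ν)^p, and (1 + ν)^L ≤ 1 / (1 - Lν) ≤ μ. The accumulated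
      -- growth is therefore bounded independently of n.
      growth≤ : ∀ p → (1# + ι p * ν) ^ L ≤ ι (μ ℕ.^ p)
      growth≤ p = begin
        (1# + ι p * ν) ^ L      ≤⟨ ^-mono-≤ (+-nonneg 0≤1 (*-nonneg (ι-nonneg p) 0≤ν)) (bernoulli 0≤ν p) L ⟩
        ((1# + ν) ^ p) ^ L      ≡⟨ trans (sym (^-* (1# + ν) L p)) (trans (cong ((1# + ν) ^_) (ℕₚ.*-comm L p)) (^-* (1# + ν) p L)) ⟩
        ((1# + ν) ^ L) ^ p      ≤⟨ ^-mono-≤ (^-nonneg 0≤1+ν L) base p ⟩
        ι μ ^ p                 ≡⟨ sym (ι-^ μ p) ⟩
        ι (μ ℕ.^ p) ∎
        where
        open ≤-Chain
        0≤1+ν : 0# ≤ 1# + ν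
        0≤1+ν = +-nonneg 0≤1 0≤ν
        base : (1# + ν) ^ L ≤ ι μ
        base = begin
          (1# + ν) ^ L                               ≡⟨ sym (*-identityʳ _) ⟩
          (1# + ν) ^ L * 1#                          ≤⟨ *-monoʳ-≤ (^-nonneg 0≤1+ν L) ζμ≥1 ⟩
          (1# + ν) ^ L * ((1# - ι L * ν) * ι μ)      ≡⟨ sym (*-assoc _ _ _) ⟩
          (1# + ν) ^ L * (1# - ι L * ν) * ι μ        ≤⟨ *-monoˡ-≤ (ι-nonneg μ) ([1+x]^j*[1-jx]≤1 0≤ν L) ⟩
          1# * ι μ                                   ≡⟨ *-identityˡ _ ⟩
          ι μ ∎

      w₀n^a≤R₀ : w₀ * ι (n ℕ.^ a) ≤ ι R₀
      w₀n^a≤R₀ = begin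
        w₀ * ι (n ℕ.^ a)   ≤⟨ *-monoʳ-≤ 0≤w₀ (ι-mono n^a≤R₀g) ⟩
        w₀ * ι (R₀ ℕ.* g)  ≡⟨ trans (cong (w₀ *_) (ι-* R₀ g)) (trans (solve 3 (λ w r g → w :* (r :* g) := r :* (g :* w)) refl w₀ (ι R₀) (ι g))
                                (trans (cong (ι R₀ *_) g*w₀) (*-identityʳ _))) ⟩
        ι R₀ ∎
        where open ≤-Chain

      0≤ρ : 0# ≤ ρ
      0≤ρ = *-nonneg 0≤w₀ (ι-nonneg (μ ℕ.^ λΛ))

      ρn^a≤R : ρ * ι (n ℕ.^ a) ≤ ι R
      ρn^a≤R = ≤-trans (≤-reflexive (solve 3 (λ w m n → w :* m :* n := w :* n :* m) refl w₀ (ι (μ ℕ.^ λΛ)) (ι (n ℕ.^ a))))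
        (≤-trans (*-monoˡ-≤ (ι-nonneg (μ ℕ.^ λΛ)) w₀n^a≤R₀) (≤-reflexive (trans (sym (ι-* R₀ (μ ℕ.^ λΛ))) (cong ι (sym R≡)))))

      ρ≤1 : ρ ≤ 1#
      ρ≤1 = cancel-*-≤ (ι≰0 {n ℕ.^ a} (ℕₚ.≤-trans (ℕ.s≤s ℕ.z≤n) n≤n^a)) (≤-trans (≤-reflexive (*-comm _ _)) (≤-trans ρn^a≤R
        (≤-trans (ι-mono (ℕₚ.≤-trans R≤n n≤n^a)) (≤-reflexive (sym (*-identityʳ _))))))

      open ConcreteSystem a k n

      parameters : Parameters blockSystem
      parameters = record
        { 𝔅-unique = 𝔅-unique a k n
        ; c = c ; k = k ; m = mult
        ; pairs-of-block = λ B∈ → ℕₚ.≤-reflexive (pairs-of-block B∈)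
        ; 𝒯-unique = λ C∈ → unique (proj₂ (proj₂ (∈𝒯⁻ C∈)))
        ; 𝒯-length = λ C∈ → listsUpTo-length k 𝔅 (proj₁ (∈𝒯⁻ C∈))
        ; 𝒯⊆𝔅 = λ C∈ → listsUpTo-⊆ k 𝔅 (proj₁ (∈𝒯⁻ C∈))
        ; 𝒟-unique = λ Q∈ → proj₁ (proj₂ (∈𝒟⁻ Q∈))
        ; 𝒟-length = λ Q∈ → listsUpTo-length (3 ℕ.* k) 𝔅 (proj₁ (∈𝒟⁻ Q∈))
        ; multiplicity = λ {Q} Q∈ → ℕₚ.≤-trans (count-sublists a k n {Q} (listsUpTo-length (3 ℕ.* k) 𝔅 (proj₁ (∈𝒟⁻ Q∈))) (λ C → all? (CS._∈? Q) C) id) (ℕₚ.≤-reflexive (sym mult≡))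
        ; closure = closure 2≤k }
        where
        module CS = ConflictSystem blockSystem
        pairs-of-block : ∀ {B} → B ∈ 𝔅 → length (filter (inc? B) 𝔓) ≡ c
        pairs-of-block {B} B∈ = ℕₚ.+-cancelʳ-≡ (2 ℕ.+ a) _ _ (trans (subst (λ v → length (filter (inc? B) 𝔓) ℕ.+ v ≡ v ℕ.* v) (size B∈) (pairs-in B))
          (trans (NS.solve 1 (λ a → (NS.con 2 NS.:+ a) NS.:* (NS.con 2 NS.:+ a) NS.:= (NS.con 2 NS.:+ a) NS.:* (NS.con 1 NS.:+ a) NS.:+ (NS.con 2 NS.:+ a)) refl a) (cong (ℕ._+ (2 ℕ.+ a)) (sym c≡))))

      module I = Iteration F blockSystem parameters

      conflictGrowth≡ : I.conflictGrowth ≡ ι c₁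
      conflictGrowth≡ = sym (trans (cong ι c₁≡) (trans (ι-+ (2 ℕ.^ k ℕ.* k) _) (cong₂ _+_ (trans (ι-* (2 ℕ.^ k) k) (cong (_* ι k) (ι-^ 2 k)))
        (trans (ι-* (2 ℕ.^ k) _) (cong₂ _*_ (ι-^ 2 k) (ι-* (k ℕ.* k) k))))))

      mainGrowth≡ : I.mainGrowth Λd ≡ ι c₂
      mainGrowth≡ = sym (trans (cong ι c₂≡) (trans (ι-+ (4 ℕ.* λd ℕ.+ pt ℕ.+ 3 ℕ.* k ℕ.+ ct) c₁) (cong₂ _+_ (trans (ι-+ (4 ℕ.* λd ℕ.+ pt ℕ.+ 3 ℕ.* k) ct) (cong₂ _+_ (trans (ι-+ (4 ℕ.* λd ℕ.+ pt) (3 ℕ.* k)) (cong (_+ ι (3 ℕ.* k))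
          (trans (ι-+ (4 ℕ.* λd) pt) (cong₂ _+_ (ι-* 4 λd) pt≡)))) ct≡)) (sym conflictGrowth≡))))
        where
        pt ct : ℕ
        pt = 2 ℕ.* (c ℕ.* (3 ℕ.* k ℕ.* (3 ℕ.* k ℕ.* (3 ℕ.* k))))
        ct = 2 ℕ.^ k ℕ.* (k ℕ.* k ℕ.* (mult ℕ.* (3 ℕ.* k)))
        pt≡ : ι pt ≡ I.pairTransfer
        pt≡ = trans (ι-* 2 (c ℕ.* (3 ℕ.* k ℕ.* (3 ℕ.* k ℕ.* (3 ℕ.* k))))) (cong (ι 2 *_) (trans (ι-* c (3 ℕ.* k ℕ.* (3 ℕ.* k ℕ.* (3 ℕ.* k)))) (cong (ι c *_) (trans (ι-* (3 ℕ.* k) (3 ℕ.* k ℕ.* (3 ℕ.* k))) (cong (ι (3 ℕ.* k) *_) (ι-* (3 ℕ.* k) (3 ℕ.* k)))))))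
        ct≡ : ι ct ≡ I.conflictTransfer
        ct≡ = trans (ι-* (2 ℕ.^ k) _) (cong₂ _*_ (ι-^ 2 k) (trans (ι-* (k ℕ.* k) _) (cong (ι (k ℕ.* k) *_) (ι-* mult (3 ℕ.* k)))))

      maxRate≡ : I.maxRate Λd (ι ℓ) ≡ Λ
      maxRate≡ = sym (trans (cong ι λΛ≡) (trans (ι-+ (c ℕ.* λd) ℓ) (cong (_+ ι ℓ) (ι-* c λd))))

      G₁ G₂ noise δ : Carrier
      G₁ = (1# + I.conflictGrowth * ν) ^ L
      G₂ = (1# + I.mainGrowth Λd * ν) ^ L
      noise = I.pairNoise Λd (ι ℓ) ν ρ
      δ = G₂ * (ι M * noise) + I.maxRate Λd (ι ℓ) * I.maxRate Λd (ι ℓ) * ν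

      G₁≤ : G₁ ≤ ι (μ ℕ.^ c₁)
      G₁≤ = ≤-trans (≤-reflexive (cong (λ v → (1# + v * ν) ^ L) conflictGrowth≡)) (growth≤ c₁)

      G₂≤ : G₂ ≤ ι (μ ℕ.^ c₂)
      G₂≤ = ≤-trans (≤-reflexive (cong (λ v → (1# + v * ν) ^ L) mainGrowth≡)) (growth≤ c₂)

      0≤G₁ : 0# ≤ G₁
      0≤G₁ = ^-nonneg (+-nonneg 0≤1 (*-nonneg (subst (0# ≤_) (sym conflictGrowth≡) (ι-nonneg c₁)) 0≤ν)) L

      0≤G₂ : 0# ≤ G₂
      0≤G₂ = ^-nonneg (+-nonneg 0≤1 (*-nonneg (subst (0# ≤_) (sym mainGrowth≡) (ι-nonneg c₂)) 0≤ν)) L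

      noise≡ : noise ≡ ν * (ν * ι P₁ + ρ * ι P₂)
      noise≡ = trans (cong (λ l → ι 2 * (Λd * Λd * (Λd * Λd * ν)) * ν + ι 2 * ((Λd * l * ν) * (Λd * l * ν) + (Λd * Λd * ν) * (Λd * Λd * ν)) + ι 2 * (ρ * (Λd * l)) * ν) maxRate≡)
        (trans (solve 4 (λ d l v r → con (2 , 0) :* (d :* d :* (d :* d :* v)) :* v :+ con (2 , 0) :* ((d :* l :* v) :* (d :* l :* v) :+ (d :* d :* v) :* (d :* d :* v)) :+ con (2 , 0) :* (r :* (d :* l)) :* v :=
            v :* (v :* (con (2 , 0) :* (d :* d :* (d :* d)) :+ con (2 , 0) :* (d :* l :* (d :* l) :+ d :* d :* (d :* d))) :+ r :* (con (2 , 0) :* (d :* l)))) refl Λd Λ ν ρ)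
          (cong₂ (λ p q → ν * (ν * p + ρ * q)) (sym ιP₁) (sym ιP₂)))
        where
        dd : ι (λd ℕ.* λd ℕ.* (λd ℕ.* λd)) ≡ Λd * Λd * (Λd * Λd)
        dd = trans (ι-* (λd ℕ.* λd) (λd ℕ.* λd)) (cong₂ _*_ (ι-* λd λd) (ι-* λd λd))
        ιP₁ : ι P₁ ≡ ι 2 * (Λd * Λd * (Λd * Λd)) + ι 2 * (Λd * Λ * (Λd * Λ) + Λd * Λd * (Λd * Λd))
        ιP₁ = trans (cong ι P₁≡) (trans (ι-+ (2 ℕ.* (λd ℕ.* λd ℕ.* (λd ℕ.* λd))) _) (cong₂ _+_ (trans (ι-* 2 (λd ℕ.* λd ℕ.* (λd ℕ.* λd))) (cong (ι 2 *_) dd))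
          (trans (ι-* 2 (λd ℕ.* λΛ ℕ.* (λd ℕ.* λΛ) ℕ.+ λd ℕ.* λd ℕ.* (λd ℕ.* λd))) (cong (ι 2 *_) (trans (ι-+ (λd ℕ.* λΛ ℕ.* (λd ℕ.* λΛ)) _)
            (cong₂ _+_ (trans (ι-* (λd ℕ.* λΛ) (λd ℕ.* λΛ)) (cong₂ _*_ (ι-* λd λΛ) (ι-* λd λΛ))) dd))))))
        ιP₂ : ι P₂ ≡ ι 2 * (Λd * Λ)
        ιP₂ = trans (cong ι P₂≡) (trans (ι-* 2 (λd ℕ.* λΛ)) (cong (ι 2 *_) (ι-* λd λΛ)))

      0≤noise : 0# ≤ noise
      0≤noise = subst (0# ≤_) (sym noise≡) (*-nonneg 0≤ν (+-nonneg (*-nonneg 0≤ν (ι-nonneg P₁)) (*-nonneg 0≤ρ (ι-nonneg P₂))))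

      0≤δ : 0# ≤ δ
      0≤δ = +-nonneg (*-nonneg 0≤G₂ (*-nonneg (ι-nonneg M) 0≤noise)) (*-nonneg (*-nonneg r r) 0≤ν)
        where
        r : 0# ≤ I.maxRate Λd (ι ℓ)
        r = subst (0# ≤_) (sym maxRate≡) (ι-nonneg λΛ)

      -- The products L ν, M ν and M ρ are all bounded, so the increments of all steps together are
      -- O(1).
      Lδ≤ : ι L * δ ≤ ι Kδ
      Lδ≤ = begin
        ι L * δ
          ≡⟨ cong₂ (λ p q → ι L * (G₂ * (ι M * p) + q * q * ν)) noise≡ maxRate≡ ⟩
        ι L * (G₂ * (ι M * (ν * (ν * ι P₁ + ρ * ι P₂))) + Λ * Λ * ν)
          ≡⟨ solve 8 (λ l g m v p r q L → l :* (g :* (m :* (v :* (v :* p :+ r :* q))) :+ L :* L :* v) :=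
               g :* ((l :* v) :* ((m :* v) :* p :+ (m :* r) :* q)) :+ L :* L :* (l :* v)) refl (ι L) G₂ (ι M) ν (ι P₁) ρ (ι P₂) Λ ⟩
        G₂ * ((ι L * ν) * ((ι M * ν) * ι P₁ + (ι M * ρ) * ι P₂)) + Λ * Λ * (ι L * ν)
          ≤⟨ +-mono-≤ (*-mono-≤ 0≤G₂ G₂≤ (*-nonneg 0≤Lν inner-nonneg) (*-mono-≤ 0≤Lν Lν≤1 inner-nonneg
               (+-mono-≤ (*-monoˡ-≤ (ι-nonneg P₁) Mν≤2c) (*-monoˡ-≤ (ι-nonneg P₂) Mρ≤R)))) (*-monoʳ-≤ (*-nonneg (ι-nonneg λΛ) (ι-nonneg λΛ)) Lν≤1) ⟩
        ι (μ ℕ.^ c₂) * (1# * (ι (2 ℕ.* c) * ι P₁ + ι R * ι P₂)) + Λ * Λ * 1#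
          ≡⟨ cong₂ _+_ (cong (ι (μ ℕ.^ c₂) *_) (*-identityˡ _)) (*-identityʳ _) ⟩
        ι (μ ℕ.^ c₂) * (ι (2 ℕ.* c) * ι P₁ + ι R * ι P₂) + Λ * Λ
          ≡⟨ sym (trans (cong ι Kδ≡) (trans (ι-+ (μ ℕ.^ c₂ ℕ.* (2 ℕ.* c ℕ.* P₁ ℕ.+ R ℕ.* P₂)) (λΛ ℕ.* λΛ)) (cong₂ _+_ (trans (ι-* (μ ℕ.^ c₂) _)
               (cong (ι (μ ℕ.^ c₂) *_) (trans (ι-+ (2 ℕ.* c ℕ.* P₁) _) (cong₂ _+_ (ι-* (2 ℕ.* c) P₁) (ι-* R P₂))))) (ι-* λΛ λΛ)))) ⟩
        ι Kδ ∎
        where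
        open ≤-Chain
        0≤Lν : 0# ≤ ι L * ν
        0≤Lν = *-nonneg (ι-nonneg L) 0≤ν
        inner-nonneg : 0# ≤ (ι M * ν) * ι P₁ + (ι M * ρ) * ι P₂
        inner-nonneg = +-nonneg (*-nonneg (*-nonneg (ι-nonneg M) 0≤ν) (ι-nonneg P₁)) (*-nonneg (*-nonneg (ι-nonneg M) 0≤ρ) (ι-nonneg P₂))
        Mρ≤R : ι M * ρ ≤ ι R
        Mρ≤R = ≤-trans (*-monoˡ-≤ 0≤ρ (ι-mono M≤n^a)) (≤-trans (≤-reflexive (*-comm _ _)) ρn^a≤R)

      W₀ : Carrier
      W₀ = ι (length 𝔅) * w₀

      -- Double counting of incidences: each block has `c` pairs, each pair lies in `g` blocks, and
      -- `w₀` is the reciprocal of `g`.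
      W₀c≡M : W₀ * ι c ≡ ι M
      W₀c≡M = begin
        ι (length 𝔅) * w₀ * ι c
          ≡⟨ solve 3 (λ b w c → b :* w :* c := (b :* c) :* w) refl (ι (length 𝔅)) w₀ (ι c) ⟩
        ι (length 𝔅) * ι c * w₀
          ≡⟨ cong (_* w₀) (trans (sym (∑-const 𝔅 (ι c))) (trans (∑-cong∈ 𝔅 (λ {B} B∈ → sym (pairs-sum B∈))) (trans (∑-swap 𝔅 𝔓 _)
               (trans (∑-cong∈ 𝔓 (λ e∈ → blocks-through e∈)) (∑-const 𝔓 (ι g)))))) ⟩
        ι M * ι g * w₀
          ≡⟨ trans (*-assoc _ _ _) (trans (cong (ι M *_) g*w₀) (*-identityʳ _)) ⟩
        ι M ∎
        where
        open ≡-Reasoning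
        pairs-sum : ∀ {B} → B ∈ 𝔅 → ∑ 𝔓 (λ e → [ inc? B e ]) ≡ ι c
        pairs-sum {B} B∈ = trans (sym (solve 2 (λ x y → x :+ y :- y := x) refl _ (ι (2 ℕ.+ a)))) (trans (cong (_- ι (2 ℕ.+ a))
            (subst (λ v → ∑ 𝔓 (λ e → [ inc? B e ]) + ι v ≡ ι v * ι v) (size B∈) (∑-inc B)))
          (trans (cong (λ v → v * v - v) (ι-suc (1 ℕ.+ a))) (trans (solve 1 (λ x → (con (1 , 0) :+ x) :* (con (1 , 0) :+ x) :- (con (1 , 0) :+ x) := (con (1 , 0) :+ x) :* x) refl (ι (1 ℕ.+ a)))
            (trans (cong (_* ι (1 ℕ.+ a)) (sym (ι-suc (1 ℕ.+ a)))) (trans (sym (ι-* (2 ℕ.+ a) (1 ℕ.+ a))) (cong ι (sym c≡)))))))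

      -- After multiplication by 4C the conflicts take at most n² by the choice of `ℓ`, the dense
      -- configurations and the increments O(n) ≤ n², and N takes 4Mt. The right side is 4Mμ = 4M +
      -- 4Mt, and n² ≤ 2M.
      initial : γ * G₁ * ∑ 𝒯 (λ C → w₀ ^ length C) + G₂ * ∑ 𝒟 (λ Q → ρ ^ length Q) + N + ι L * δ ≤ W₀
      initial = cancel-*-≤ (ι≰0 {4 ℕ.* C} (ℕₚ.*-mono-≤ {1} {4} (ℕ.s≤s ℕ.z≤n) 1≤C)) (begin
        ι (4 ℕ.* C) * (γ * G₁ * ∑𝒯 + G₂ * ∑𝒟 + N + ι L * δ)
          ≤⟨ *-monoʳ-≤ (ι-nonneg (4 ℕ.* C)) (+-mono-≤ (+-monoˡ-≤ N (+-mono-≤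
               (*-mono-≤ (*-nonneg 0≤γ 0≤G₁) (*-monoʳ-≤ 0≤γ G₁≤) (∑-nonneg 𝒯 (λ C → ^-nonneg 0≤w₀ (length C))) ∑𝒯≤)
               (*-mono-≤ 0≤G₂ G₂≤ (∑-nonneg 𝒟 (λ Q → ^-nonneg 0≤ρ (length Q))) ∑𝒟≤))) Lδ≤) ⟩
        ι (4 ℕ.* C) * (γ * m₁ * (ι (n ℕ.^ 2) * ι K𝒯) + m₂ * (ι (n ℕ.^ 1) * ι K𝒟) + N + ι Kδ)
          ≡⟨ trans (cong (_* (γ * m₁ * (ι (n ℕ.^ 2) * ι K𝒯) + m₂ * (ι (n ℕ.^ 1) * ι K𝒟) + N + ι Kδ)) (ι-* 4 C))
               (solve 9 (λ C γ m n² K m₂ nK N δ → con (4 , 0) :* C :* (γ :* m :* (n² :* K) :+ m₂ :* nK :+ N :+ δ) :=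
                 γ :* (con (4 , 0) :* (C :* (m :* K))) :* n² :+ con (4 , 0) :* (C :* (m₂ :* nK :+ δ)) :+ con (4 , 0) :* (C :* N)) refl
                 (ι C) γ m₁ (ι (n ℕ.^ 2)) (ι K𝒯) m₂ (ι (n ℕ.^ 1) * ι K𝒟) N (ι Kδ)) ⟩
        γ * (ι 4 * (ι C * (m₁ * ι K𝒯))) * ι (n ℕ.^ 2) + ι 4 * (ι C * (m₂ * (ι (n ℕ.^ 1) * ι K𝒟) + ι Kδ)) + ι 4 * (ι C * N)
          ≤⟨ +-mono-≤ (+-mono-≤ conflict-part error-part) (≤-reflexive (cong (ι 4 *_) C*N)) ⟩
        ι (n ℕ.* n) + ι (n ℕ.* n) + ι 4 * ι (M ℕ.* t)
          ≡⟨ sym (trans (ι-+ (n ℕ.* n ℕ.+ n ℕ.* n) _) (cong₂ _+_ (ι-+ (n ℕ.* n) _) (ι-* 4 (M ℕ.* t)))) ⟩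
        ι (n ℕ.* n ℕ.+ n ℕ.* n ℕ.+ 4 ℕ.* (M ℕ.* t))
          ≤⟨ ι-mono final-count ⟩
        ι (4 ℕ.* (μ ℕ.* M))
          ≡⟨ trans (ι-* 4 (μ ℕ.* M)) (trans (cong (ι 4 *_) (trans (ι-* μ M) (cong (ι μ *_) (sym W₀c≡M)))) (trans (solve 3 (λ m w c → con (4 , 0) :* (m :* (w :* c)) := con (4 , 0) :* (c :* m) :* w) refl (ι μ) W₀ (ι c))
               (cong (_* W₀) (trans (cong (ι 4 *_) (trans (sym (ι-* c μ)) (cong ι (sym C≡)))) (sym (ι-* 4 C)))))) ⟩
        ι (4 ℕ.* C) * W₀ ∎)
        where
        open ≤-Chain
        m₁ m₂ ∑𝒯 ∑𝒟 : Carrier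
        m₁ = ι (μ ℕ.^ c₁)
        m₂ = ι (μ ℕ.^ c₂)
        ∑𝒯 = ∑ 𝒯 (λ C → w₀ ^ length C)
        ∑𝒟 = ∑ 𝒟 (λ Q → ρ ^ length Q)
        ∑𝒯≤ : ∑𝒯 ≤ ι (n ℕ.^ 2) * ι K𝒯
        ∑𝒯≤ = subst (λ v → ∑𝒯 ≤ ι (n ℕ.^ 2) * ι v) (sym K𝒯≡) (moment a k n (ℕ.s≤s ℕ.z≤n) 2 k R₀ conflict? (λ (_ , mt) → tight mt) 0≤w₀ w₀n^a≤R₀)
        ∑𝒟≤ : ∑𝒟 ≤ ι (n ℕ.^ 1) * ι K𝒟
        ∑𝒟≤ = subst (λ v → ∑𝒟 ≤ ι (n ℕ.^ 1) * ι v) (sym K𝒟≡) (moment a k n (ℕ.s≤s ℕ.z≤n) 1 (3 ℕ.* k) R denseUnique? proj₂ 0≤ρ ρn^a≤R)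
        C*N : ι C * N ≡ ι (M ℕ.* t)
        C*N = trans (solve 3 (λ c m i → c :* (m :* i) := m :* (c :* i)) refl (ι C) (ι (M ℕ.* t)) iC) (trans (cong (ι (M ℕ.* t) *_) C*iC) (*-identityʳ _))
        conflict-part : γ * (ι 4 * (ι C * (m₁ * ι K𝒯))) * ι (n ℕ.^ 2) ≤ ι (n ℕ.* n)
        conflict-part = ≤-trans (*-monoˡ-≤ (ι-nonneg (n ℕ.^ 2)) (≤-trans (*-monoʳ-≤ 0≤γ (≤-trans (≤-reflexive (sym 4X≡)) (ι-mono 4X≤ℓ)))
            (≤-reflexive (trans (*-comm γ (ι ℓ)) ℓ*γ)))) (≤-reflexive (trans (*-identityˡ _) (cong (λ v → ι (n ℕ.* v)) (ℕₚ.*-identityʳ n))))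
          where
          4X≡ : ι (4 ℕ.* X) ≡ ι 4 * (ι C * (m₁ * ι K𝒯))
          4X≡ = trans (ι-* 4 X) (cong (ι 4 *_) (trans (cong ι X≡) (trans (ι-* C _) (cong (ι C *_) (ι-* (μ ℕ.^ c₁) K𝒯)))))
        E : ℕ
        E = μ ℕ.^ c₂ ℕ.* (n ℕ.^ 1 ℕ.* K𝒟) ℕ.+ Kδ
        error-part : ι 4 * (ι C * (m₂ * (ι (n ℕ.^ 1) * ι K𝒟) + ι Kδ)) ≤ ι (n ℕ.* n)
        error-part = ≤-trans (≤-reflexive (sym (trans (ι-* 4 (C ℕ.* E)) (cong (ι 4 *_) (trans (ι-* C E) (cong (ι C *_) (trans (ι-+ (μ ℕ.^ c₂ ℕ.* (n ℕ.^ 1 ℕ.* K𝒟)) Kδ)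
            (cong (_+ ι Kδ) (trans (ι-* (μ ℕ.^ c₂) _) (cong (m₂ *_) (ι-* (n ℕ.^ 1) K𝒟)))))))))))
          (ι-mono (ℕₚ.≤-trans (ℕₚ.*-monoʳ-≤ 4 (ℕₚ.*-monoʳ-≤ C (ℕₚ.+-mono-≤ (ℕₚ.≤-reflexive (NS.solve 3 (λ m n K → m NS.:* (n NS.:* NS.con 1 NS.:* K) NS.:= m NS.:* K NS.:* n) refl (μ ℕ.^ c₂) n K𝒟)) (ℕₚ.m≤m*n Kδ n))))
            (ℕₚ.≤-trans (ℕₚ.≤-reflexive (NS.solve 4 (λ C A D n → NS.con 4 NS.:* (C NS.:* (A NS.:* n NS.:+ D NS.:* n)) NS.:= NS.con 4 NS.:* (C NS.:* (A NS.:+ D)) NS.:* n) refl C (μ ℕ.^ c₂ ℕ.* K𝒟) Kδ n))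
              (ℕₚ.*-monoˡ-≤ n error≤n))))
        final-count : n ℕ.* n ℕ.+ n ℕ.* n ℕ.+ 4 ℕ.* (M ℕ.* t) ℕ.≤ 4 ℕ.* (μ ℕ.* M)
        final-count = ℕₚ.≤-trans (ℕₚ.+-monoˡ-≤ (4 ℕ.* (M ℕ.* t)) (ℕₚ.+-mono-≤ n²≤2M n²≤2M)) (ℕₚ.≤-reflexive
            (NS.solve 2 (λ M t → NS.con 2 NS.:* M NS.:+ NS.con 2 NS.:* M NS.:+ NS.con 4 NS.:* (M NS.:* t) NS.:= NS.con 4 NS.:* ((NS.con 1 NS.:+ t) NS.:* M)) refl M t))

      constants : I.Constants L
      constants = record
        { N = N ; ν = ν ; Λd = Λd ; Λc = ι ℓ ; γ = γ ; ρ = ρ ; δ = δ ; μ = ι μ ; w₀ = w₀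
        ; Nν≡1 = Nν≡1 ; 0≤ν = 0≤ν ; N≰0 = N≰0 ; ζμ≥1 = ζμ≥1 ; 0≤μ = ι-nonneg μ
        ; μ+1≤Λd = ≤-reflexive (sym (trans (cong ι λd≡) (ι-+ μ 1)))
        ; 0≤Λc = ι-nonneg ℓ ; γΛc≡1 = trans (*-comm γ (ι ℓ)) ℓ*γ ; 0≤γ = 0≤γ
        ; γ≤1 = ≤-trans (≤-trans (≤-reflexive (sym (*-identityˡ γ))) (*-monoˡ-≤ 0≤γ (1≤ι {ℓ} 1≤ℓ))) (≤-reflexive ℓ*γ)
        ; Λν≤1 = ≤-trans (≤-reflexive (cong (_* ν) maxRate≡)) (*ν≤ λΛ 1 (ℕₚ.≤-trans λC≤n (ℕₚ.≤-trans n≤M (ℕₚ.≤-trans (ℕₚ.m≤m*n M t) (ℕₚ.≤-reflexive (sym (ℕₚ.+-identityʳ _)))))))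
        ; 0≤ρ = 0≤ρ ; ρ≤1 = ρ≤1 ; 0≤w₀ = 0≤w₀
        ; w₀≤ρ = *-monoʳ-≤ 0≤w₀ (≤-trans (≤-reflexive (cong (λ v → (1# + v * ν) ^ L) maxRate≡)) (growth≤ λΛ))
        ; 0≤δ = 0≤δ ; noise≤δ = ≤-refl ; has-pair = has-pair
        ; 𝒯-long = λ C∈ → ℕₚ.≤-trans (ℕₚ.n≤1+n 2) (proj₁ (proj₂ (∈𝒯⁻ C∈)))
        ; degree₀ = λ e∈ → ≤-reflexive (trans (cong (_* w₀) (blocks-through e∈)) g*w₀)
        ; initial = initial }

      many-blocks : M ℕ.* s ℕ.< suc L ℕ.* C
      many-blocks = ℕₚ.≤-trans (ℕ.s≤s (ℕₚ.≤-reflexive (DivMod.m≡m%n+[m/n]*n (M ℕ.* s) C))) (ℕₚ.+-monoˡ-≤ (L ℕ.* C) (DivMod.m%n<n (M ℕ.* s) C))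

      configuration-free : (∃ λ S → Good S × length S ≡ L) → LargeConfigurationFree a k s n
      configuration-free (S , good-S , size-S) = S , distinct good-S , All.tabulate (λ p → size (selected-in𝔅 good-S p)) ,
        (λ Q Q⊆S uQ len → good⇒no-tight 2≤k good-S Q⊆S uQ len) , many
        where
        many : ∀ m → m ℕ.+ n ≡ n ℕ.* n → m ℕ.* s ℕ.< suc (length S) ℕ.* ((2 ℕ.+ a) ℕ.* (1 ℕ.+ a) ℕ.* (2 ℕ.+ s))
        many m m+n = subst₂ (λ m' l → m' ℕ.* s ℕ.< suc l ℕ.* ((2 ℕ.+ a) ℕ.* (1 ℕ.+ a) ℕ.* (2 ℕ.+ s)))
          (ℕₚ.+-cancelʳ-≡ n M m (trans M+n≡n² (sym m+n))) (sym size-S) (subst (λ v → M ℕ.* s ℕ.< suc L ℕ.* v) (trans C≡ (cong (ℕ._* μ) c≡)) many-blocks)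

      large-configuration-free : LargeConfigurationFree a k s n
      large-configuration-free = configuration-free (I.Process.large-good-set constants)

  eventually-large-configuration-free : OrderedField → ∀ a k s → 2 ℕ.≤ a → 2 ℕ.≤ k → ∃ λ N → ∀ n' → N ℕ.≤ 2 ℕ.+ n' → LargeConfigurationFree a k s (2 ℕ.+ n')
  eventually-large-configuration-free F a k s 2≤a 2≤k = L.threshold , L.large-configuration-free
    where module L = LowerBound F a k s 2≤a 2≤k

-- The upper bound.

module UpperBounds where
  open OrderedFields
  open TightConfigurations
  open WeightedLists
  open BlockConflicts
  open FirstMoment
  open import Data.Nat using (ℕ; zero; suc; _+_; _*_; _≤_; _<_; z≤n; s≤s; _≤?_; _<?_; _∸_)
  open import Data.Nat.Properties
  import Data.Nat.Solver as ℕSolver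
  open import Data.Fin using (Fin)
  import Data.Fin.Properties as Finₚ
  open import Data.Fin.Subset as Sub using (Subset; ⋃; ∣_∣; _∪_; _∩_; _─_; _⊆_; ⁅_⁆)
  import Data.Fin.Subset.Properties as Sub
  open import Data.List using (List; []; _∷_; _++_; filter; length; allFin; cartesianProduct; take)
  open import Data.List.Properties using (length-++; length-take)
  open import Data.List.Membership.Propositional using (_∈_; _∉_; find; lose)
  open import Data.List.Membership.Propositional.Properties
    using (∈-++⁺ˡ; ∈-++⁺ʳ; ∈-++⁻; ∈-filter⁺; ∈-filter⁻; ∈-cartesianProduct⁻)
  open import Data.List.Relation.Unary.Any using (Any; here; there; any?)
  open import Data.List.Relation.Unary.All as All using ([]; _∷_)
  open import Data.List.Relation.Unary.AllPairs using ([]; _∷_)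
  open import Data.List.Relation.Unary.Unique.Propositional using (Unique)
  import Data.List.Relation.Unary.Unique.Propositional.Properties as Unique
  import Data.List.Relation.Unary.Unique.DecPropositional as DecUnique
  open import Data.Product using (∃; _×_; _,_; proj₁; proj₂)
  open import Data.Sum using (_⊎_; inj₁; inj₂; [_,_]′)
  open import Data.Empty using (⊥; ⊥-elim)
  open import Function using (_∘_; id)
  open import Relation.Nullary using (¬_; Dec; yes; no; ¬?; _×-dec_)
  open import Relation.Binary.PropositionalEquality hiding ([_]; J)

  private module NS = ℕSolver.+-*-Solver

  ∣∪∣-disjoint : ∀ {n} (p q : Subset n) → (∀ {x} → x Sub.∈ p → x Sub.∉ q) → ∣ p ∪ q ∣ ≡ ∣ p ∣ + ∣ q ∣
  ∣∪∣-disjoint {n} p q h = trans (sym (+-identityʳ _)) (trans (cong (∣ p ∪ q ∣ +_) (sym (trans (cong ∣_∣ (Sub.Empty-unique empty)) (Sub.∣⊥∣≡0 n)))) (∣p∪q∣+∣p∩q∣ p q))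
    where
    empty : Sub.Empty (p ∩ q)
    empty (x , x∈) with Sub.x∈p∩q⁻ p q x∈
    ... | x∈p , x∈q = h x∈p x∈q

  ∈-─⁻ : ∀ {n} {x : Fin n} (p q : Subset n) → x Sub.∈ p ─ q → x Sub.∈ p × x Sub.∉ q
  ∈-─⁻ {x = x} p q x∈ = Sub.p─q⊆p p q x∈ , λ x∈q → absurd p q x∈ x∈q
    where
    open import Data.Vec using (_∷_; here; there)
    open import Data.Bool using (true; false)
    absurd : ∀ {n} {x : Fin n} (p q : Subset n) → x Sub.∈ p ─ q → x Sub.∈ q → ⊥
    absurd (_ ∷ p) (true ∷ q) () here
    absurd (_ ∷ p) (true ∷ q) (there x∈) (there x∈q) = absurd p q x∈ x∈q
    absurd (_ ∷ p) (false ∷ q) (there x∈) (there x∈q) = absurd p q x∈ x∈q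

  ∣─∣+∣∩∣ : ∀ {n} (p q : Subset n) → ∣ p ─ q ∣ + ∣ p ∩ q ∣ ≡ ∣ p ∣
  ∣─∣+∣∩∣ p q = trans (sym (∣∪∣-disjoint (p ─ q) (p ∩ q) (λ x∈ x∈' → proj₂ (∈-─⁻ p q x∈) (proj₂ (Sub.x∈p∩q⁻ p q x∈')))))
    (cong ∣_∣ (Sub.⊆-antisym to from))
    where
    to : (p ─ q) ∪ (p ∩ q) ⊆ p
    to x∈ = [ Sub.p─q⊆p p q , proj₁ ∘ Sub.x∈p∩q⁻ p q ]′ (Sub.x∈p∪q⁻ (p ─ q) (p ∩ q) x∈)
    from : p ⊆ (p ─ q) ∪ (p ∩ q)
    from {x} x∈ with x Sub.∈? q
    ... | yes x∈q = Sub.x∈p∪q⁺ (inj₂ (Sub.x∈p∩q⁺ (x∈ , x∈q)))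
    ... | no x∉q = Sub.x∈p∪q⁺ (inj₁ (Sub.x∈p∧x∉q⇒x∈p─q x∈ x∉q))

  ∪-adds : ∀ {n} (g V : Subset n) {s t b} → ∣ g ∣ ≡ s + t → t ≤ ∣ g ∩ V ∣ → ∣ V ∣ ≤ b → ∣ g ∪ V ∣ ≤ s + b
  ∪-adds g V {s} {t} {b} size meet V≤b = +-cancelʳ-≤ t _ _ (begin
    ∣ g ∪ V ∣ + t           ≤⟨ +-monoʳ-≤ ∣ g ∪ V ∣ meet ⟩
    ∣ g ∪ V ∣ + ∣ g ∩ V ∣   ≡⟨ ∣p∪q∣+∣p∩q∣ g V ⟩
    ∣ g ∣ + ∣ V ∣           ≤⟨ +-mono-≤ (≤-reflexive size) V≤b ⟩
    s + t + b               ≡⟨ NS.solve 3 (λ s t b → s NS.:+ t NS.:+ b NS.:= s NS.:+ b NS.:+ t) refl s t b ⟩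
    s + b + t ∎)
    where open ≤-Reasoning

  three-elements⁻ : ∀ {n} {p : Subset n} {x y z} → x Sub.∈ p → y Sub.∈ p → z Sub.∈ p → x ≢ y → x ≢ z → y ≢ z → 3 ≤ ∣ p ∣
  three-elements⁻ {p = p} x∈ y∈ z∈ x≢y x≢z y≢z = ≤-trans (s≤s (two-elements⁻ (Sub.x∈p∧x≢y⇒x∈p-y {p = p} y∈ (x≢y ∘ sym)) (Sub.x∈p∧x≢y⇒x∈p-y {p = p} z∈ (x≢z ∘ sym)) y≢z))
    (Sub.x∈p⇒∣p-x∣<∣p∣ x∈)

  take-⊆ : ∀ {A : Set} m {xs : List A} {x} → x ∈ take m xs → x ∈ xs
  take-⊆ (suc m) {x ∷ xs} (here p) = here p
  take-⊆ (suc m) {x ∷ xs} (there p) = there (take-⊆ m p)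

  take-unique : ∀ {A : Set} m {xs : List A} → Unique xs → Unique (take m xs)
  take-unique zero _ = []
  take-unique (suc m) [] = []
  take-unique (suc m) (x∉ ∷ u) = All.tabulate (λ p → All.lookup x∉ (take-⊆ m p)) ∷ take-unique m u

  -- With k = 2h, the last condition reads a² ≥ 3k/2 - 4.
  module UpperBound (F : OrderedField) (a h n : ℕ) (2≤h : 2 ≤ h) (1≤a : 1 ≤ a) (3h≤a²+4 : 3 * h ≤ a * a + 4) where

    open Configurations a n

    k c : ℕ
    k = 2 * h
    c = (2 + a) * (1 + a)

    4≤k : 4 ≤ k
    4≤k = *-monoʳ-≤ 2 2≤h

    Free : List Block → Set
    Free E = ∀ Q → (∀ {B} → B ∈ Q → B ∈ E) → Unique Q → length Q ≡ k → ¬ Tight Q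

    DenseIn : List Block → ℕ → Set
    DenseIn E m = ∃ λ S → (∀ {B} → B ∈ S → B ∈ E) × Unique S × 1 ≤ length S × length S ≤ m × Dense S

    dense-in? : ∀ E m → DenseIn E m ⊎ (∀ S → (∀ {B} → B ∈ S → B ∈ E) → Unique S → 1 ≤ length S → length S ≤ m → ¬ Dense S)
    dense-in? E m with any? (λ S → DecUnique.unique? _≟ˢ_ S ×-dec (1 ≤? length S) ×-dec dense? S) (listsUpTo m E)
    ... | yes p with find p
    ...   | S , S∈ , u , 1≤S , d = inj₁ (S , listsUpTo-⊆ m E S∈ , u , 1≤S , listsUpTo-length m E S∈ , d)
    dense-in? E m | no ¬p = inj₂ λ S S⊆ u 1≤S S≤m d → ¬p (lose (∈-listsUpTo m E (All.tabulate S⊆) S≤m) (u , 1≤S , d))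

    record FreeFamily : Set where
      field
        E : List Block
        uE : Unique E
        sE : ∀ {B} → B ∈ E → ∣ B ∣ ≡ 2 + a
        free : Free E

    module _ (family : FreeFamily) where
      open FreeFamily family

      -- Families without dense sets of at most three edges.

      module Sparse (X : Block) (E⊆X : ∀ {B} → B ∈ E → B ⊆ X)
        (sparse : ∀ S → (∀ {B} → B ∈ S → B ∈ E) → Unique S → 1 ≤ length S → length S ≤ 3 → ¬ Dense S) where

        Adj : Block → Block → Set
        Adj f f' = f ≢ f' × 2 ≤ ∣ f ∩ f' ∣

        adj? : ∀ f f' → Dec (Adj f f')
        adj? f f' = ¬? (f ≟ˢ f') ×-dec (2 ≤? ∣ f ∩ f' ∣)

        Cross : Block → Block → Fin n × Fin n → Set
        Cross f f' (u , v) = (u Sub.∈ f × u Sub.∉ f') × (v Sub.∈ f' × v Sub.∉ f)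

        cross? : ∀ f f' e → Dec (Cross f f' e)
        cross? f f' (u , v) = ((u Sub.∈? f) ×-dec ¬? (u Sub.∈? f')) ×-dec ((v Sub.∈? f') ×-dec ¬? (v Sub.∈? f))

        Cov : Fin n × Fin n → Set
        Cov e = Any (λ f → Inc f e) E

        cov? : ∀ e → Dec (Cov e)
        cov? e = any? (λ f → inc? f e) E

        ∪-pair : ∀ {f f'} → f ∈ E → f' ∈ E → Adj f f' → ∣ f ∪ f' ∣ ≤ 2 + a * 2
        ∪-pair {f} {f'} f∈ f'∈ (_ , h2) = ≤-trans (∪-adds f f' {a} {2} (trans (sE f∈) (+-comm 2 a)) h2 (≤-reflexive (sE f'∈)))
          (≤-reflexive (NS.solve 1 (λ a → a NS.:+ (NS.con 2 NS.:+ a) NS.:= NS.con 2 NS.:+ a NS.:* NS.con 2) refl a))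

        ∩≤2 : ∀ {f f'} → f ∈ E → f' ∈ E → f ≢ f' → ∣ f ∩ f' ∣ ≤ 2
        ∩≤2 {f} {f'} f∈ f'∈ f≢f' with ∣ f ∩ f' ∣ ≤? 2
        ... | yes le = le
        ... | no ≰2 = ⊥-elim (sparse (f ∷ f' ∷ []) (λ { (here refl) → f∈ ; (there (here refl)) → f'∈ }) ((f≢f' ∷ []) ∷ [] ∷ []) (s≤s z≤n) (s≤s (s≤s z≤n))
                (≤-trans (≤-reflexive (cong (λ p → ∣ f ∪ p ∣) (Sub.∪-identityʳ f'))) (≤-pred (≤-trans (s≤s (∪-adds-3 ≰2)) (≤-reflexive refl)))))
          where
          ∪-adds-3 : ¬ (∣ f ∩ f' ∣ ≤ 2) → ∣ f ∪ f' ∣ ≤ 1 + a * 2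
          ∪-adds-3 ≰2 = +-cancelʳ-≤ 3 _ _ (≤-trans (+-monoʳ-≤ ∣ f ∪ f' ∣ (≰⇒> ≰2)) (≤-reflexive (trans (∣p∪q∣+∣p∩q∣ f f')
            (trans (cong₂ _+_ (sE f∈) (sE f'∈)) (NS.solve 1 (λ a → NS.con 2 NS.:+ a NS.:+ (NS.con 2 NS.:+ a) NS.:= NS.con 1 NS.:+ a NS.:* NS.con 2 NS.:+ NS.con 3) refl a)))))

        -- Adjacent `f` and `f'` have defect at most 2; adding an edge with three vertices in their
        -- union would leave 2 + 2 - 3 = 1, a dense triple.
        third : ∀ {f f' g} → f ∈ E → f' ∈ E → g ∈ E → Adj f f' → g ≢ f → g ≢ f' → ¬ (3 ≤ ∣ g ∩ (f ∪ f') ∣)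
        third {f} {f'} {g} f∈ f'∈ g∈ adj g≢f g≢f' h3 = sparse (g ∷ f ∷ f' ∷ []) (λ { (here refl) → g∈ ; (there (here refl)) → f∈ ; (there (there (here refl))) → f'∈ })
          ((g≢f ∷ g≢f' ∷ []) ∷ (proj₁ adj ∷ []) ∷ [] ∷ []) (s≤s z≤n) ≤-refl
          (≤-trans (≤-reflexive (cong (λ p → ∣ g ∪ f ∪ p ∣) (Sub.∪-identityʳ f')))
            (+-cancelʳ-≤ 3 _ _ (≤-trans (+-monoʳ-≤ ∣ g ∪ (f ∪ f') ∣ h3) (≤-trans (≤-reflexive (∣p∪q∣+∣p∩q∣ g (f ∪ f')))
              (≤-trans (+-mono-≤ (≤-reflexive (sE g∈)) (∪-pair f∈ f'∈ adj)) (≤-reflexive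
                (NS.solve 1 (λ a → NS.con 2 NS.:+ a NS.:+ (NS.con 2 NS.:+ a NS.:* NS.con 2) NS.:= NS.con 1 NS.:+ a NS.:* NS.con 3 NS.:+ NS.con 3) refl a)))))))

        CrossEdge : Fin n × Fin n → Block × Block → Set
        CrossEdge e (f , f') = Adj f f' × Cross f f' e × ¬ Cov e

        cross-edge? : ∀ e p → Dec (CrossEdge e p)
        cross-edge? e (f , f') = adj? f f' ×-dec cross? f f' e ×-dec ¬? (cov? e)

        flat : List (Block × Block) → List Block
        flat [] = []
        flat ((f , f') ∷ ps) = f ∷ f' ∷ flat ps

        flat-length : ∀ ps → length (flat ps) ≡ 2 * length ps
        flat-length [] = refl
        flat-length (p ∷ ps) = trans (cong (2 +_) (flat-length ps)) (sym (*-suc 2 (length ps)))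

        ∈-flat⁻ : ∀ {B} ps → B ∈ flat ps → ∃ λ p → p ∈ ps × (B ≡ proj₁ p ⊎ B ≡ proj₂ p)
        ∈-flat⁻ (p ∷ ps) (here eq) = p , here refl , inj₁ eq
        ∈-flat⁻ (p ∷ ps) (there (here eq)) = p , here refl , inj₂ eq
        ∈-flat⁻ (p ∷ ps) (there (there q)) with ∈-flat⁻ ps q
        ... | p' , p'∈ , r = p' , there p'∈ , r

        module _ {e : Fin n × Fin n} where
          private
            u v : Fin n
            u = proj₁ e
            v = proj₂ e

          Good : Block × Block → Set
          Good (f , f') = (f ∈ E × f' ∈ E) × CrossEdge e (f , f')

          -- Otherwise `g'` has two vertices in common with `f` and contains `v`, which lies in `f'`
          -- but not in `f`: three vertices of `f ∪ f'`, against `third`.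
          same-first : ∀ {f f' g'} → Good (f , f') → Good (f , g') → f' ≡ g'
          same-first {f} {f'} {g'} ((f∈ , f'∈) , adj , ((u∈f , _) , (v∈f' , v∉f)) , _) ((_ , g'∈) , adj' , (_ , (v∈g' , _)) , _) with f' ≟ˢ g'
          ... | yes eq = eq
          ... | no f'≢g' with two-elements (f ∩ g') (proj₂ adj')
          ...   | x , y , x≢y , x∈ , y∈ with Sub.x∈p∩q⁻ f g' x∈ | Sub.x∈p∩q⁻ f g' y∈
          ...     | x∈f , x∈g | y∈f , y∈g = ⊥-elim (third f∈ f'∈ g'∈ adj (λ eq → proj₁ adj' (sym eq)) (λ eq → f'≢g' (sym eq))
                    (three-elements⁻ (Sub.x∈p∩q⁺ (x∈g , Sub.x∈p∪q⁺ (inj₁ x∈f))) (Sub.x∈p∩q⁺ (y∈g , Sub.x∈p∪q⁺ (inj₁ y∈f))) (Sub.x∈p∩q⁺ (v∈g' , Sub.x∈p∪q⁺ (inj₂ v∈f')))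
                      x≢y (λ { refl → v∉f x∈f }) (λ { refl → v∉f y∈f })))

          same-second : ∀ {f f' g} → Good (f , f') → Good (g , f') → f ≡ g
          same-second {f} {f'} {g} ((f∈ , f'∈) , adj , ((u∈f , u∉f') , (v∈f' , _)) , _) ((g∈ , _) , adj' , ((u∈g , _) , _) , _) with f ≟ˢ g
          ... | yes eq = eq
          ... | no f≢g with two-elements (g ∩ f') (proj₂ adj')
          ...   | x , y , x≢y , x∈ , y∈ with Sub.x∈p∩q⁻ g f' x∈ | Sub.x∈p∩q⁻ g f' y∈
          ...     | x∈g , x∈f' | y∈g , y∈f' = ⊥-elim (third f∈ f'∈ g∈ adj (λ eq → f≢g (sym eq)) (proj₁ adj')
                    (three-elements⁻ (Sub.x∈p∩q⁺ (x∈g , Sub.x∈p∪q⁺ (inj₂ x∈f'))) (Sub.x∈p∩q⁺ (y∈g , Sub.x∈p∪q⁺ (inj₂ y∈f'))) (Sub.x∈p∩q⁺ (u∈g , Sub.x∈p∪q⁺ (inj₁ u∈f)))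
                      x≢y (λ { refl → u∉f' x∈f' }) (λ { refl → u∉f' y∈f' })))

          -- Edges in first position contain `u`, those in second position do not, and within one
          -- position `same-first` and `same-second` apply.
          flat-unique : ∀ {ps} → Unique ps → (∀ {p} → p ∈ ps → Good p) → Unique (flat ps)
          flat-unique [] _ = []
          flat-unique {(f , f') ∷ ps} (p∉ ∷ uq) g = (proj₁ (proj₁ (proj₂ (g (here refl)))) ∷ All.tabulate first) ∷ All.tabulate second ∷ flat-unique uq (g ∘ there)
            where
            first : ∀ {B} → B ∈ flat ps → f ≢ B
            first B∈ refl with ∈-flat⁻ ps B∈
            ... | (f₁ , f₁') , p∈ , inj₁ refl = All.lookup p∉ p∈ (cong (f ,_) (same-first (g (here refl)) (g (there p∈))))
            ... | (f₁ , f₁') , p∈ , inj₂ refl with g (here refl) | g (there p∈)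
            ...   | _ , _ , ((u∈f , _) , _) , _ | _ , _ , ((_ , u∉f₁') , _) , _ = u∉f₁' u∈f
            second : ∀ {B} → B ∈ flat ps → f' ≢ B
            second B∈ refl with ∈-flat⁻ ps B∈
            ... | (f₁ , f₁') , p∈ , inj₂ refl = All.lookup p∉ p∈ (cong (_, f') (same-second (g (here refl)) (g (there p∈))))
            ... | (f₁ , f₁') , p∈ , inj₁ refl with g (here refl) | g (there p∈)
            ...   | _ , _ , (_ , (v∈f' , _)) , _ | _ , _ , (_ , (_ , v∉f₁)) , _ = v∉f₁ v∈f'

          core : Block
          core = ⁅ u ⁆ ∪ ⁅ v ⁆

          core≤2 : ∣ core ∣ ≤ 2
          core≤2 = ≤-trans (m≤m+n _ _) (≤-reflexive (trans (∣p∪q∣+∣p∩q∣ ⁅ u ⁆ ⁅ v ⁆) (cong₂ _+_ (Sub.∣⁅x⁆∣≡1 u) (Sub.∣⁅x⁆∣≡1 v))))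

          -- Each adjacent pair spans at most 2 + 2a vertices, among them `u` and `v`, so it adds at
          -- most 2a to the core.
          flat-span : ∀ ps → (∀ {p} → p ∈ ps → Good p) → u ≢ v → ∣ ⋃ (flat ps) ∪ core ∣ ≤ 2 + a * (2 * length ps)
          flat-span [] _ _ = ≤-trans (≤-reflexive (cong ∣_∣ (Sub.∪-identityˡ core))) (≤-trans core≤2 (m≤m+n 2 _))
          flat-span ((f , f') ∷ ps) g u≢v with g (here refl)
          ... | (f∈ , f'∈) , adj , ((u∈f , _) , (v∈f' , _)) , _ = ≤-trans
              (≤-reflexive (cong ∣_∣ (trans (cong (_∪ core) (sym (Sub.∪-assoc f f' (⋃ (flat ps))))) (Sub.∪-assoc (f ∪ f') (⋃ (flat ps)) core))))
              (≤-trans adds (≤-reflexive (NS.solve 2 (λ a l → a NS.:* NS.con 2 NS.:+ (NS.con 2 NS.:+ a NS.:* (NS.con 2 NS.:* l)) NS.:= NS.con 2 NS.:+ a NS.:* (NS.con 2 NS.:* (NS.con 1 NS.:+ l))) refl a (length ps))))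
            where
            V : Block
            V = ⋃ (flat ps) ∪ core
            meet : 2 ≤ ∣ (f ∪ f') ∩ V ∣
            meet = two-elements⁻ (Sub.x∈p∩q⁺ (Sub.x∈p∪q⁺ (inj₁ u∈f) , Sub.x∈p∪q⁺ (inj₂ (Sub.x∈p∪q⁺ (inj₁ (Sub.x∈⁅x⁆ u))))))
              (Sub.x∈p∩q⁺ (Sub.x∈p∪q⁺ (inj₂ v∈f') , Sub.x∈p∪q⁺ (inj₂ (Sub.x∈p∪q⁺ (inj₂ (Sub.x∈⁅x⁆ v)))))) u≢v
            adds : ∣ (f ∪ f') ∪ V ∣ ≤ a * 2 + (2 + a * (2 * length ps))
            adds = +-cancelʳ-≤ 2 _ _ (≤-trans (+-monoʳ-≤ ∣ (f ∪ f') ∪ V ∣ meet) (≤-trans (≤-reflexive (∣p∪q∣+∣p∩q∣ (f ∪ f') V))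
              (≤-trans (+-mono-≤ (∪-pair f∈ f'∈ adj) (flat-span ps (g ∘ there) u≢v)) (≤-reflexive
                (NS.solve 2 (λ x y → (NS.con 2 NS.:+ x) NS.:+ y NS.:= x NS.:+ y NS.:+ NS.con 2) refl (a * 2) (2 + a * (2 * length ps)))))))

          -- Otherwise `h` crossings would supply 2h = k distinct edges spanning at most 2 + ak
          -- vertices.
          few-crossings : u ≢ v → length (filter (cross-edge? e) (cartesianProduct E E)) < h
          few-crossings u≢v with length (filter (cross-edge? e) (cartesianProduct E E)) <? h
          ... | yes lt = lt
          ... | no ≮ = ⊥-elim (free (flat ps) flat-⊆ (flat-unique uq all-good) (trans (flat-length ps) (cong (2 *_) len))
                (≤-trans (Sub.∣p∣≤∣p∪q∣ (⋃ (flat ps)) core) (≤-trans (flat-span ps all-good u≢v) (≤-reflexive (cong (λ l → 2 + a * l) (sym (flat-length ps)))))))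
            where
            all-ps ps : List (Block × Block)
            all-ps = filter (cross-edge? e) (cartesianProduct E E)
            ps = take h all-ps
            len : length ps ≡ h
            len = trans (length-take h all-ps) (m≤n⇒m⊓n≡m (≮⇒≥ ≮))
            uq : Unique ps
            uq = take-unique h (Unique.filter⁺ (cross-edge? e) (Unique.cartesianProduct⁺ uE uE))
            all-good : ∀ {p} → p ∈ ps → Good p
            all-good p∈ with ∈-filter⁻ (cross-edge? e) {xs = cartesianProduct E E} (take-⊆ h p∈)
            ... | q , r = ∈-cartesianProduct⁻ E E q , r
            flat-⊆ : ∀ {B} → B ∈ flat ps → B ∈ E
            flat-⊆ B∈ with ∈-flat⁻ ps B∈
            ... | p , p∈ , inj₁ refl = proj₁ (proj₁ (all-good p∈))
            ... | p , p∈ , inj₂ refl = proj₂ (proj₁ (all-good p∈))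

        module _ {f f' : Block} (f∈ : f ∈ E) (f'∈ : f' ∈ E) (adj : Adj f f') where

          Covered : Fin n × Fin n → Set
          Covered e = Cross f f' e × Cov e

          covered? : ∀ e → Dec (Covered e)
          covered? e = cross? f f' e ×-dec cov? e

          record Fan (es : List (Fin n × Fin n)) : Set where
            constructor fan
            field
              gs : List Block
              gs-length : length gs ≡ length es
              gs-unique : Unique gs
              gs⊆E : ∀ {g} → g ∈ gs → g ∈ E
              source : ∀ {g} → g ∈ gs → ∃ λ e → e ∈ es × Inc g e
              span : ∣ ⋃ gs ∪ (f ∪ f') ∣ ≤ 2 + a * (2 + length es)

          not-end : ∀ {g e} → Cross f f' e → Inc g e → g ≢ f × g ≢ f'
          not-end ((_ , u∉f') , (_ , v∉f)) (u∈g , v∈g) = (λ { refl → v∉f v∈g }) , (λ { refl → u∉f' u∈g })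

          -- An edge through a crossing pair has two vertices in `f ∪ f'` and adds at most `a`. One
          -- edge cannot serve two crossing pairs: these have at least three end points, all in
          -- `f ∪ f'`, against `third`.
          make-fan : ∀ es → Unique es → (∀ {e} → e ∈ es → Covered e) → Fan es
          make-fan [] _ _ = fan [] refl [] (λ ()) (λ ()) (≤-trans (≤-reflexive (cong ∣_∣ (Sub.∪-identityˡ (f ∪ f')))) (∪-pair f∈ f'∈ adj))
          make-fan (e ∷ es) (e∉ ∷ ue) cv with make-fan es ue (cv ∘ there) | find (proj₂ (cv (here refl)))
          ... | fan gs len uq sub src sp | g , g∈ , (u∈g , v∈g) = fan (g ∷ gs) (cong suc len) (All.tabulate fresh ∷ uq)
                (λ { (here refl) → g∈ ; (there p) → sub p })
                (λ { (here refl) → e , here refl , (u∈g , v∈g) ; (there p) → let (e' , e'∈ , i) = src p in e' , there e'∈ , i })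
                (≤-trans (≤-reflexive (cong ∣_∣ (Sub.∪-assoc g (⋃ gs) (f ∪ f')))) (≤-trans
                  (∪-adds g (⋃ gs ∪ (f ∪ f')) {a} {2} (trans (sE g∈) (+-comm 2 a)) meet sp)
                  (≤-reflexive (NS.solve 2 (λ a l → a NS.:+ (NS.con 2 NS.:+ a NS.:* (NS.con 2 NS.:+ l)) NS.:= NS.con 2 NS.:+ a NS.:* (NS.con 2 NS.:+ (NS.con 1 NS.:+ l))) refl a (length es)))))
            where
            cross-e : Cross f f' e
            cross-e = proj₁ (cv (here refl))
            u∈f : proj₁ e Sub.∈ f
            u∈f = proj₁ (proj₁ cross-e)
            v∈f' : proj₂ e Sub.∈ f'
            v∈f' = proj₁ (proj₂ cross-e)
            v∉f : proj₂ e Sub.∉ f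
            v∉f = proj₂ (proj₂ cross-e)
            u≢v : proj₁ e ≢ proj₂ e
            u≢v eq = v∉f (subst (Sub._∈ f) eq u∈f)
            meet : 2 ≤ ∣ g ∩ (⋃ gs ∪ (f ∪ f')) ∣
            meet = two-elements⁻ (Sub.x∈p∩q⁺ (u∈g , Sub.x∈p∪q⁺ {p = ⋃ gs} (inj₂ (Sub.x∈p∪q⁺ (inj₁ u∈f)))))
              (Sub.x∈p∩q⁺ (v∈g , Sub.x∈p∪q⁺ {p = ⋃ gs} (inj₂ (Sub.x∈p∪q⁺ (inj₂ v∈f'))))) u≢v
            fresh : ∀ {g'} → g' ∈ gs → g ≢ g'
            fresh g'∈ refl with src g'∈
            ... | e' , e'∈ , (u'∈g , v'∈g) with proj₁ (cv (there e'∈))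
            ...   | (u'∈f , u'∉f') , (v'∈f' , v'∉f) = third f∈ f'∈ g∈ adj (proj₁ (not-end cross-e (u∈g , v∈g))) (proj₂ (not-end cross-e (u∈g , v∈g))) three
              where
              in-f : ∀ {x} → x Sub.∈ g → x Sub.∈ f → x Sub.∈ g ∩ (f ∪ f')
              in-f p q = Sub.x∈p∩q⁺ (p , Sub.x∈p∪q⁺ (inj₁ q))
              in-f' : ∀ {x} → x Sub.∈ g → x Sub.∈ f' → x Sub.∈ g ∩ (f ∪ f')
              in-f' p q = Sub.x∈p∩q⁺ (p , Sub.x∈p∪q⁺ (inj₂ q))
              three : 3 ≤ ∣ g ∩ (f ∪ f') ∣
              three with proj₁ e Finₚ.≟ proj₁ e'
              ... | no u≢u' = three-elements⁻ (in-f u∈g u∈f) (in-f u'∈g u'∈f) (in-f' v∈g v∈f') u≢u' u≢v (λ eq → v∉f (subst (Sub._∈ f) eq u'∈f))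
              ... | yes u≡u' = three-elements⁻ (in-f u∈g u∈f) (in-f' v∈g v∈f') (in-f' v'∈g v'∈f') u≢v (λ eq → v'∉f (subst (Sub._∈ f) eq u∈f))
                      (λ v≡v' → All.lookup e∉ e'∈ (cong₂ _,_ u≡u' v≡v'))

          -- A fan over k - 2 covered crossing pairs, together with `f` and `f'`, would be a tight
          -- set of `k` edges.
          few-covered : 3 + length (filter covered? (pairs n)) ≤ k
          few-covered with k ≤? 2 + length (filter covered? (pairs n))
          ... | no ≰ = ≰⇒> ≰
          ... | yes le with make-fan (take (k ∸ 2) (filter covered? (pairs n)))
                  (take-unique (k ∸ 2) (Unique.filter⁺ covered? (Unique.filter⁺ _ (Unique.cartesianProduct⁺ (Unique.allFin⁺ n) (Unique.allFin⁺ n)))))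
                  (λ p → proj₂ (∈-filter⁻ covered? {xs = pairs n} (take-⊆ (k ∸ 2) p)))
          ...   | fan gs len uq sub src sp = ⊥-elim (free (gs ++ f ∷ f' ∷ []) all-in (Unique.++⁺ uq ((proj₁ adj ∷ []) ∷ [] ∷ []) disj) total
                    (≤-trans (≤-reflexive (cong ∣_∣ (⋃-++ gs))) (≤-trans sp (≤-reflexive (cong (λ l → 2 + a * l) (trans (cong (2 +_) (sym len)) (trans (+-comm 2 (length gs)) (sym (length-++ gs)))))))))
            where
            2≤k : 2 ≤ k
            2≤k = ≤-trans (s≤s (s≤s z≤n)) 4≤k
            total : length (gs ++ f ∷ f' ∷ []) ≡ k
            total = trans (length-++ gs) (trans (+-comm (length gs) 2) (trans (cong (2 +_) (trans len (trans (length-take (k ∸ 2) (filter covered? (pairs n))) (m≤n⇒m⊓n≡m (≤-trans (∸-monoˡ-≤ 2 le) (≤-reflexive (m+n∸m≡n 2 (length (filter covered? (pairs n))))))))))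
              (m+[n∸m]≡n 2≤k)))
            all-in : ∀ {B} → B ∈ gs ++ f ∷ f' ∷ [] → B ∈ E
            all-in B∈ with ∈-++⁻ gs B∈
            ... | inj₁ p = sub p
            ... | inj₂ (here refl) = f∈
            ... | inj₂ (there (here refl)) = f'∈
            disj : ∀ {B} → ¬ (B ∈ gs × B ∈ f ∷ f' ∷ [])
            disj (p , q) with src p
            ... | e , e∈ , i with not-end (proj₁ (proj₂ (∈-filter⁻ covered? {xs = pairs n} (take-⊆ (k ∸ 2) e∈)))) i | q
            ...   | g≢f , _ | here eq = g≢f eq
            ...   | _ , g≢f' | there (here eq) = g≢f' eq
            ⋃-++ : ∀ gs → ⋃ (gs ++ f ∷ f' ∷ []) ≡ ⋃ gs ∪ (f ∪ f')
            ⋃-++ [] = trans (cong (f ∪_) (Sub.∪-identityʳ f')) (sym (Sub.∪-identityˡ (f ∪ f')))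
            ⋃-++ (g ∷ gs) = trans (cong (g ∪_) (⋃-++ gs)) (sym (Sub.∪-assoc g (⋃ gs) (f ∪ f')))

        module _ where
          open FieldTheory F renaming (_+_ to _⊕_; _*_ to _⊗_; _≤_ to _≼_; _-_ to _⊖_; +-mono-≤ to ⊕-mono; +-monoʳ-≤ to ⊕-monoʳ; +-monoˡ-≤ to ⊕-monoˡ;
              ≤-trans to ≼-trans; ≤-reflexive to ≼-reflexive; ≤-refl to ≼-refl; *-monoʳ-≤ to ⊗-monoʳ; *-monoˡ-≤ to ⊗-monoˡ; *-mono-≤ to ⊗-mono;
              *-identityˡ to ⊗-identityˡ; *-identityʳ to ⊗-identityʳ; zeroˡ to ⊗-zeroˡ; zeroʳ to ⊗-zeroʳ; +-identityˡ to ⊕-identityˡ; +-identityʳ to ⊕-identityʳ;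
              +-comm to ⊕-comm; *-comm to ⊗-comm; *-assoc to ⊗-assoc; +-assoc to ⊕-assoc)
            hiding (≤-antisym; ≤-total; _≤?_; _^_; ^-nonneg; ^-mono-≤; distribˡ; distribʳ; -‿inverseˡ; -‿inverseʳ; ι-cancel-≤; ∏-nonneg; -_; *-nonneg)
          open ListAlgebra F using (∑-indicator)
          open Counting F using (∑-∈ˢ; ∑-inc; ∑-cartesian; pairs-in)

          private module Field = FieldTheory F

          𝔓 : List (Fin n × Fin n)
          𝔓 = pairs n

          cross⇒∈𝔓 : ∀ {f f'} → ∑ 𝔓 (λ e → [ cross? f f' e ]) ≡ ι (∣ f ─ f' ∣ * ∣ f' ─ f ∣)
          cross⇒∈𝔓 {f} {f'} = begin
            ∑ 𝔓 (λ e → [ cross? f f' e ])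
              ≡⟨ trans (∑-filter (λ (u , v) → ¬? (u Finₚ.≟ v)) (cartesianProduct (allFin n) (allFin n)) _) (∑-cartesian (allFin n) (allFin n) _) ⟩
            ∑ (allFin n) (λ u → ∑ (allFin n) (λ v → [ ¬? (u Finₚ.≟ v) ] ⊗ [ cross? f f' (u , v) ]))
              ≡⟨ ∑-cong (allFin n) (λ u → trans (∑-cong (allFin n) (each u)) (∑-*ˡ (allFin n) _ _)) ⟩
            ∑ (allFin n) (λ u → [ u Sub.∈? (f ─ f') ] ⊗ ∑ (allFin n) (λ v → [ v Sub.∈? (f' ─ f) ]))
              ≡⟨ trans (∑-*ʳ (allFin n) _ _) (cong₂ _⊗_ (∑-∈ˢ (f ─ f')) (∑-∈ˢ (f' ─ f))) ⟩
            ι ∣ f ─ f' ∣ ⊗ ι ∣ f' ─ f ∣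
              ≡⟨ sym (ι-* ∣ f ─ f' ∣ ∣ f' ─ f ∣) ⟩
            ι (∣ f ─ f' ∣ * ∣ f' ─ f ∣) ∎
            where
            open ≡-Reasoning
            each : ∀ u v → [ ¬? (u Finₚ.≟ v) ] ⊗ [ cross? f f' (u , v) ] ≡ [ u Sub.∈? (f ─ f') ] ⊗ [ v Sub.∈? (f' ─ f) ]
            each u v = by-cases (cross? f f' (u , v))
              where
              by-cases : Dec (Cross f f' (u , v)) → [ ¬? (u Finₚ.≟ v) ] ⊗ [ cross? f f' (u , v) ] ≡ [ u Sub.∈? (f ─ f') ] ⊗ [ v Sub.∈? (f' ─ f) ]
              by-cases (yes cr@((u∈f , u∉f') , (v∈f' , v∉f))) = trans
                (cong₂ _⊗_ ([]-true (¬? (u Finₚ.≟ v)) (λ { refl → v∉f u∈f })) ([]-true (cross? f f' (u , v)) cr))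
                (sym (cong₂ _⊗_ ([]-true (u Sub.∈? (f ─ f')) (Sub.x∈p∧x∉q⇒x∈p─q u∈f u∉f')) ([]-true (v Sub.∈? (f' ─ f)) (Sub.x∈p∧x∉q⇒x∈p─q v∈f' v∉f))))
              by-cases (no ¬cr) = trans (trans (cong ([ ¬? (u Finₚ.≟ v) ] ⊗_) ([]-false (cross? f f' (u , v)) ¬cr)) (⊗-zeroʳ _)) (sym (zero-product (u Sub.∈? (f ─ f'))))
                where
                zero-product : (d : Dec (u Sub.∈ f ─ f')) → [ d ] ⊗ [ v Sub.∈? (f' ─ f) ] ≡ 0#
                zero-product (no _) = ⊗-zeroˡ _
                zero-product (yes p) = trans (⊗-identityˡ _) ([]-false (v Sub.∈? (f' ─ f)) (λ q → ¬cr (∈-─⁻ f f' p , ∈-─⁻ f' f q)))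

          cov unc : Fin n × Fin n → Carrier
          cov e = [ cov? e ]
          unc e = [ ¬? (cov? e) ×-dec inc? X e ]

          multiplicity : Fin n × Fin n → Carrier
          multiplicity e = ∑ E (λ f → [ inc? f e ])

          adjacencies : Carrier
          adjacencies = ∑ E (λ f → ∑ E (λ f' → [ adj? f f' ]))

          -- For a multiplicity m ≥ 1 this is (m - 1)(m - 2) ≥ 0, with equality at 1 and 2.
          bonferroni : ∀ e → ι 3 ⊗ multiplicity e ≼ ι 2 ⊗ cov e ⊕ multiplicity e ⊗ multiplicity e
          bonferroni e = subst (λ x → ι 3 ⊗ x ≼ ι 2 ⊗ cov e ⊕ x ⊗ x) (sym (∑-indicator (λ f → inc? f e) E)) (by-cases (cov? e) (length fs) refl)
            where
            fs : List Block
            fs = filter (λ f → inc? f e) E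
            small : ∀ m → 1 ≤ m → 3 * m ≤ 2 + m * m
            small 1 _ = ≤-refl
            small 2 _ = ≤-refl
            small (suc (suc (suc m))) _ = ≤-trans (*-monoˡ-≤ (3 + m) {3} {3 + m} (m≤m+n 3 m)) (m≤n+m _ 2)
            by-cases : Dec (Cov e) → ∀ m → m ≡ length fs → ι 3 ⊗ ι m ≼ ι 2 ⊗ cov e ⊕ ι m ⊗ ι m
            by-cases (yes p) m eq = ≼-trans (≼-reflexive (sym (ι-* 3 m))) (≼-trans (ι-mono (small m 1≤m)) (≼-reflexive (trans (ι-+ 2 (m * m))
                (cong₂ _⊕_ (trans (sym (⊗-identityʳ (ι 2))) (cong (ι 2 ⊗_) (sym ([]-true (cov? e) p)))) (ι-* m m)))))
              where
              1≤m : 1 ≤ m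
              1≤m with find p
              ... | f , f∈ , i with fs | ∈-filter⁺ (λ f → inc? f e) f∈ i
              ...   | _ ∷ _ | _ = subst (1 ≤_) (sym eq) (s≤s z≤n)
            by-cases (no ¬p) zero _ = ≼-trans (≼-reflexive (⊗-zeroʳ _)) (≼-reflexive (sym (trans (cong₂ _⊕_ (trans (cong (ι 2 ⊗_) ([]-false (cov? e) ¬p)) (⊗-zeroʳ _)) (⊗-zeroʳ _)) (⊕-identityʳ 0#))))
            by-cases (no ¬p) (suc m) eq = ⊥-elim (empty fs eq (λ f∈ → ¬p (let (f∈E , i) = ∈-filter⁻ (λ f → inc? f e) {xs = E} f∈ in lose f∈E i)))
              where
              empty : ∀ fs → suc m ≡ length fs → (∀ {f} → f ∈ fs → ⊥) → ⊥
              empty (f ∷ _) _ none = none (here refl)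

          ∑-pairs-in : ∀ p → ∑ 𝔓 (λ e → [ inc? p e ]) ≡ ι (length (filter (inc? p) 𝔓))
          ∑-pairs-in p = ∑-indicator (inc? p) 𝔓

          -- Adjacent edges share exactly two vertices, hence exactly two ordered pairs; nonadjacent
          -- distinct edges share no pair.
          common : ∀ {f f'} → f ∈ E → f' ∈ E → ∑ 𝔓 (λ e → [ inc? f e ] ⊗ [ inc? f' e ]) ≼ ι 2 ⊗ [ adj? f f' ] ⊕ [ f ≟ˢ f' ] ⊗ ι c
          common {f} {f'} f∈ f'∈ = ≼-trans (≼-reflexive (trans (∑-cong 𝔓 meet) (∑-pairs-in (f ∩ f')))) (by-cases (f ≟ˢ f') (2 ≤? ∣ f ∩ f' ∣))
            where
            meet : ∀ e → [ inc? f e ] ⊗ [ inc? f' e ] ≡ [ inc? (f ∩ f') e ]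
            meet (u , v) with inc? f (u , v) | inc? f' (u , v)
            ... | yes (p , q) | yes (p' , q') = trans (⊗-identityˡ 1#) (sym ([]-true (inc? (f ∩ f') (u , v)) (Sub.x∈p∩q⁺ (p , p') , Sub.x∈p∩q⁺ (q , q'))))
            ... | yes _ | no ¬i = trans (⊗-zeroʳ _) (sym ([]-false (inc? (f ∩ f') (u , v)) (λ (p , q) → ¬i (proj₂ (Sub.x∈p∩q⁻ f f' p) , proj₂ (Sub.x∈p∩q⁻ f f' q)))))
            ... | no ¬i | _ = trans (⊗-zeroˡ _) (sym ([]-false (inc? (f ∩ f') (u , v)) (λ (p , q) → ¬i (proj₁ (Sub.x∈p∩q⁻ f f' p) , proj₁ (Sub.x∈p∩q⁻ f f' q)))))
            ℓ q : ℕ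
            ℓ = length (filter (inc? (f ∩ f')) 𝔓)
            q = ∣ f ∩ f' ∣
            count : ℓ + q ≡ q * q
            count = pairs-in (f ∩ f')
            rhs : Carrier
            rhs = ι 2 ⊗ [ adj? f f' ] ⊕ [ f ≟ˢ f' ] ⊗ ι c
            by-cases : Dec (f ≡ f') → Dec (2 ≤ q) → ι ℓ ≼ rhs
            by-cases (yes refl) _ = ≼-trans (≼-reflexive (trans (cong ι ℓ≡c) (sym (trans (cong (_⊗ ι c) ([]-true (f ≟ˢ f) refl)) (⊗-identityˡ _)))))
                (x≤y+x _ (Field.*-nonneg (ι-nonneg 2) ([]-nonneg (adj? f f))))
              where
              ℓ≡c : ℓ ≡ c
              ℓ≡c = +-cancelʳ-≡ (2 + a) ℓ c (trans (subst (λ v → ℓ + v ≡ v * v) (trans (cong ∣_∣ (Sub.∩-idem f)) (sE f∈)) count)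
                (NS.solve 1 (λ a → (NS.con 2 NS.:+ a) NS.:* (NS.con 2 NS.:+ a) NS.:= (NS.con 2 NS.:+ a) NS.:* (NS.con 1 NS.:+ a) NS.:+ (NS.con 2 NS.:+ a)) refl a))
            by-cases (no f≢f') (yes 2≤q) = ≼-trans (≼-reflexive (cong ι ℓ≡2)) (≼-trans (≼-reflexive (trans (sym (⊗-identityʳ (ι 2))) (cong (ι 2 ⊗_) (sym ([]-true (adj? f f') (f≢f' , 2≤q))))))
                (x≤x+y _ (Field.*-nonneg ([]-nonneg (f ≟ˢ f')) (ι-nonneg c))))
              where
              ℓ≡2 : ℓ ≡ 2
              ℓ≡2 = +-cancelʳ-≡ 2 ℓ 2 (subst (λ v → ℓ + v ≡ v * v) (≤-antisym (∩≤2 f∈ f'∈ f≢f') 2≤q) count)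
            by-cases (no f≢f') (no ≱2) = ≼-trans (≼-reflexive (cong ι (ℓ≡0 q (≤-pred (≰⇒> ≱2)) count)))
                (Field.+-nonneg (Field.*-nonneg (ι-nonneg 2) ([]-nonneg (adj? f f'))) (Field.*-nonneg ([]-nonneg (f ≟ˢ f')) (ι-nonneg c)))
              where
              ℓ≡0 : ∀ q → q ≤ 1 → ℓ + q ≡ q * q → ℓ ≡ 0
              ℓ≡0 zero _ eq = trans (sym (+-identityʳ ℓ)) eq
              ℓ≡0 (suc zero) _ eq = +-cancelʳ-≡ 1 ℓ 0 eq
              ℓ≡0 (suc (suc _)) (s≤s ()) _

          ∑-multiplicity : ∑ 𝔓 multiplicity ≡ ι (length E) ⊗ ι c
          ∑-multiplicity = trans (∑-swap 𝔓 E _) (trans (∑-cong∈ E (λ {f} f∈ → trans (∑-pairs-in f) (cong ι (ℓ≡c f∈)))) (∑-const E (ι c)))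
            where
            ℓ≡c : ∀ {f} → f ∈ E → length (filter (inc? f) 𝔓) ≡ c
            ℓ≡c {f} f∈ = +-cancelʳ-≡ (2 + a) _ c (trans (subst (λ v → length (filter (inc? f) 𝔓) + v ≡ v * v) (sE f∈) (pairs-in f))
              (NS.solve 1 (λ a → (NS.con 2 NS.:+ a) NS.:* (NS.con 2 NS.:+ a) NS.:= (NS.con 2 NS.:+ a) NS.:* (NS.con 1 NS.:+ a) NS.:+ (NS.con 2 NS.:+ a)) refl a))

          ∑-multiplicity² : ∑ 𝔓 (λ e → multiplicity e ⊗ multiplicity e) ≼ ι 2 ⊗ adjacencies ⊕ ι (length E) ⊗ ι c
          ∑-multiplicity² = begin
            ∑ 𝔓 (λ e → multiplicity e ⊗ multiplicity e)
              ≡⟨ trans (∑-cong 𝔓 (λ e → trans (sym (∑-*ʳ E (multiplicity e) _)) (∑-cong E (λ f → sym (∑-*ˡ E [ inc? f e ] _))))) (trans (∑-swap 𝔓 E _) (∑-cong E (λ f → ∑-swap 𝔓 E _))) ⟩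
            ∑ E (λ f → ∑ E (λ f' → ∑ 𝔓 (λ e → [ inc? f e ] ⊗ [ inc? f' e ])))
              ≤⟨ ∑-mono∈ E (λ f∈ → ∑-mono∈ E (λ f'∈ → common f∈ f'∈)) ⟩
            ∑ E (λ f → ∑ E (λ f' → ι 2 ⊗ [ adj? f f' ] ⊕ [ f ≟ˢ f' ] ⊗ ι c))
              ≡⟨ trans (∑-cong E (λ f → trans (∑-+ E _ _) (cong₂ _⊕_ (∑-*ˡ E (ι 2) _) (∑-*ʳ E (ι c) _)))) (trans (∑-+ E _ _) (cong₂ _⊕_ (∑-*ˡ E (ι 2) _) (∑-*ʳ E (ι c) _))) ⟩
            ι 2 ⊗ adjacencies ⊕ ∑ E (λ f → ∑ E (λ f' → [ f ≟ˢ f' ])) ⊗ ι c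
              ≤⟨ ⊕-monoʳ _ (⊗-monoˡ (ι-nonneg c) (≼-trans (∑-mono E (λ f → ∑-single {xs = E} {f} {λ f' → [ f ≟ˢ f' ]} uE ([]-nonneg (f ≟ˢ f))
                   (λ {x} _ x≢f → ≼-reflexive ([]-false (f ≟ˢ x) (x≢f ∘ sym))) _≟ˢ_)) (≼-trans (∑-mono E (λ f → []≤1 (f ≟ˢ f))) (≼-reflexive (trans (∑-const E 1#) (⊗-identityʳ _)))))) ⟩
            ι 2 ⊗ adjacencies ⊕ ι (length E) ⊗ ι c ∎
            where open ≤-Chain

          -- Summing `bonferroni` over all pairs gives three times the left side below twice the
          -- covered pairs plus the squares, and by `∑-multiplicity²` the squares are at most twice
          -- the adjacencies plus the left side.
          edges≤ : ι (length E) ⊗ ι c ≼ ∑ 𝔓 cov ⊕ adjacencies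
          edges≤ = cancel-*-≤ {ι 2} (pos⇒≰0 (x≤x+y 1# 0≤1)) (cancel-+ˡ-≤ (ι (length E) ⊗ ι c) (≼-trans (≼-reflexive (trans (solve 1 (λ x → x :+ con (2 , 0) :* x := con (3 , 0) :* x) refl (ι (length E) ⊗ ι c))
              (trans (cong (ι 3 ⊗_) (sym ∑-multiplicity)) (sym (∑-*ˡ 𝔓 (ι 3) multiplicity)))))
            (≼-trans (∑-mono 𝔓 bonferroni) (≼-trans (≼-reflexive (trans (∑-+ 𝔓 _ _) (cong (_⊕ ∑ 𝔓 (λ e → multiplicity e ⊗ multiplicity e)) (∑-*ˡ 𝔓 (ι 2) cov))))
              (≼-trans (⊕-monoʳ _ ∑-multiplicity²) (≼-reflexive (solve 3 (λ x y z → con (2 , 0) :* x :+ (con (2 , 0) :* y :+ z) := z :+ con (2 , 0) :* (x :+ y)) refl (∑ 𝔓 cov) adjacencies (ι (length E) ⊗ ι c))))))))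

          crossEdges : Fin n × Fin n → Carrier
          crossEdges e = ∑ E (λ f → ∑ E (λ f' → [ cross-edge? e (f , f') ]))

          h' : ℕ
          h' = h ∸ 1

          -- Two adjacent edges have exactly `a` private vertices each, hence a² crossing pairs;
          -- `few-covered` limits those that are covered.
          many-crossings : ∀ {f f'} → f ∈ E → f' ∈ E → [ adj? f f' ] ⊗ ι h' ≼ ∑ 𝔓 (λ e → [ cross-edge? e (f , f') ])
          many-crossings {f} {f'} f∈ f'∈ = by-cases (adj? f f')
            where
            nonneg : 0# ≼ ∑ 𝔓 (λ e → [ cross-edge? e (f , f') ])
            nonneg = ∑-nonneg 𝔓 (λ e → []-nonneg (cross-edge? e (f , f')))
            by-cases : Dec (Adj f f') → [ adj? f f' ] ⊗ ι h' ≼ ∑ 𝔓 (λ e → [ cross-edge? e (f , f') ])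
            by-cases (no ¬adj) = ≼-trans (≼-reflexive (trans (cong (_⊗ ι h') ([]-false (adj? f f') ¬adj)) (⊗-zeroˡ _))) nonneg
            by-cases (yes adj) = ≼-trans (≼-reflexive (trans (cong (_⊗ ι h') ([]-true (adj? f f') adj)) (⊗-identityˡ _)))
                (cancel-+ˡ-≤ (ι m) (≼-trans (≼-reflexive (sym (ι-+ m h'))) (≼-trans (ι-mono enough) (≼-reflexive (trans (sym total) split)))))
              where
              m : ℕ
              m = length (filter (covered? f∈ f'∈ adj) 𝔓)
              2≤meet : ∣ f ∩ f' ∣ ≡ 2
              2≤meet = ≤-antisym (∩≤2 f∈ f'∈ (proj₁ adj)) (proj₂ adj)
              minus : ∀ p q → ∣ p ∣ ≡ 2 + a → ∣ p ∩ q ∣ ≡ 2 → ∣ p ─ q ∣ ≡ a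
              minus p q sp meet = +-cancelʳ-≡ 2 _ a (trans (trans (cong (∣ p ─ q ∣ +_) (sym meet)) (∣─∣+∣∩∣ p q)) (trans sp (+-comm 2 a)))
              total : ∑ 𝔓 (λ e → [ cross? f f' e ]) ≡ ι (a * a)
              total = trans cross⇒∈𝔓 (cong ι (cong₂ _*_ (minus f f' (sE f∈) 2≤meet) (minus f' f (sE f'∈) (trans (cong ∣_∣ (Sub.∩-comm f' f)) 2≤meet))))
              split : ∑ 𝔓 (λ e → [ cross? f f' e ]) ≡ ι m ⊕ ∑ 𝔓 (λ e → [ cross-edge? e (f , f') ])
              split = trans (∑-cong 𝔓 each) (trans (∑-+ 𝔓 _ _) (cong (_⊕ ∑ 𝔓 (λ e → [ cross-edge? e (f , f') ])) (∑-indicator (covered? f∈ f'∈ adj) 𝔓)))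
                where
                each : ∀ e → [ cross? f f' e ] ≡ [ covered? f∈ f'∈ adj e ] ⊕ [ cross-edge? e (f , f') ]
                each e = cases (cross? f f' e) (cov? e)
                  where
                  cases : Dec (Cross f f' e) → Dec (Cov e) → [ cross? f f' e ] ≡ [ covered? f∈ f'∈ adj e ] ⊕ [ cross-edge? e (f , f') ]
                  cases (no ¬cr) _ = trans ([]-false (cross? f f' e) ¬cr) (sym (trans (cong₂ _⊕_ ([]-false (covered? f∈ f'∈ adj e) (¬cr ∘ proj₁)) ([]-false (cross-edge? e (f , f')) (¬cr ∘ proj₁ ∘ proj₂))) (⊕-identityʳ 0#)))
                  cases (yes cr) (yes cv) = trans ([]-true (cross? f f' e) cr) (sym (trans (cong₂ _⊕_ ([]-true (covered? f∈ f'∈ adj e) (cr , cv)) ([]-false (cross-edge? e (f , f')) (λ (_ , _ , ¬cv) → ¬cv cv))) (⊕-identityʳ 1#)))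
                  cases (yes cr) (no ¬cv) = trans ([]-true (cross? f f' e) cr) (sym (trans (cong₂ _⊕_ ([]-false (covered? f∈ f'∈ adj e) (¬cv ∘ proj₂)) ([]-true (cross-edge? e (f , f')) (adj , cr , ¬cv))) (⊕-identityˡ 1#)))
              -- (3 + m) + (1 + h') ≤ 2h + h ≤ a² + 4: the one place where the condition relating
              -- `h` to `a` enters.
              enough : m + h' ≤ a * a
              enough = +-cancelʳ-≤ 4 _ _ (≤-trans (≤-reflexive (NS.solve 2 (λ m x → m NS.:+ x NS.:+ NS.con 4 NS.:= (NS.con 3 NS.:+ m) NS.:+ (NS.con 1 NS.:+ x)) refl m h'))
                (≤-trans (+-mono-≤ (few-covered f∈ f'∈ adj) (≤-reflexive (m+[n∸m]≡n (≤-trans (s≤s z≤n) 2≤h)))) (≤-trans (≤-reflexive (NS.solve 1 (λ h → NS.con 2 NS.:* h NS.:+ h NS.:= NS.con 3 NS.:* h) refl h)) 3h≤a²+4)))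

          crossings-bound : ∀ {e} → e ∈ 𝔓 → crossEdges e ≼ ι h' ⊗ unc e
          crossings-bound {e} e∈ = by-cases (¬? (cov? e) ×-dec inc? X e)
            where
            by-cases : Dec (¬ Cov e × Inc X e) → crossEdges e ≼ ι h' ⊗ unc e
            by-cases (yes p) = ≼-trans (≼-reflexive (trans (sym (∑-cartesian E E _)) (∑-indicator (cross-edge? e) (cartesianProduct E E))))
              (≼-trans (ι-mono (≤-pred (subst (length (filter (cross-edge? e) (cartesianProduct E E)) <_) (sym (m+[n∸m]≡n (≤-trans (s≤s z≤n) 2≤h))) (few-crossings (pairs-≢ e∈)))))
                (≼-reflexive (trans (sym (⊗-identityʳ _)) (cong (ι h' ⊗_) (sym ([]-true (¬? (cov? e) ×-dec inc? X e) p))))))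
            by-cases (no ¬p) = ≼-trans (≼-reflexive (trans (∑-cong∈ E (λ f∈ → trans (∑-cong∈ E (λ f'∈ → none f∈ f'∈)) (∑-zero E))) (∑-zero E)))
                (Field.*-nonneg (ι-nonneg h') ([]-nonneg (¬? (cov? e) ×-dec inc? X e)))
              where
              none : ∀ {f f'} → f ∈ E → f' ∈ E → [ cross-edge? e (f , f') ] ≡ 0#
              none {f} {f'} f∈ f'∈ = []-false (cross-edge? e (f , f')) (λ (_ , ((u∈f , _) , (v∈f' , _)) , ¬cv) → ¬p (¬cv , E⊆X f∈ u∈f , E⊆X f'∈ v∈f'))

          -- Crossings are counted in two ways with the same factor h - 1: at least so many per
          -- adjacency, at most so many per uncovered pair. The factor is positive and cancels.
          adjacencies≤ : adjacencies ≼ ∑ 𝔓 unc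
          adjacencies≤ = cancel-*-≤ (pos⇒≰0 (1≤ι {h'} (∸-monoˡ-≤ 1 2≤h))) (begin
            ι h' ⊗ adjacencies
              ≡⟨ trans (sym (∑-*ˡ E (ι h') _)) (∑-cong E (λ f → trans (sym (∑-*ˡ E (ι h') _)) (∑-cong E (λ f' → ⊗-comm (ι h') [ adj? f f' ])))) ⟩
            ∑ E (λ f → ∑ E (λ f' → [ adj? f f' ] ⊗ ι h'))
              ≤⟨ ∑-mono∈ E (λ f∈ → ∑-mono∈ E (λ f'∈ → many-crossings f∈ f'∈)) ⟩
            ∑ E (λ f → ∑ E (λ f' → ∑ 𝔓 (λ e → [ cross-edge? e (f , f') ])))
              ≡⟨ trans (∑-cong E (λ f → ∑-swap E 𝔓 _)) (∑-swap E 𝔓 _) ⟩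
            ∑ 𝔓 crossEdges
              ≤⟨ ∑-mono∈ 𝔓 crossings-bound ⟩
            ∑ 𝔓 (λ e → ι h' ⊗ unc e)
              ≡⟨ ∑-*ˡ 𝔓 (ι h') unc ⟩
            ι h' ⊗ ∑ 𝔓 unc ∎)
            where open ≤-Chain

          sparse-bound : c * length E ≤ ∣ X ∣ * ∣ X ∣
          sparse-bound = Field.ι-cancel-≤ _ _ (begin
            ι (c * length E)               ≡⟨ trans (cong ι (*-comm c (length E))) (ι-* (length E) c) ⟩
            ι (length E) ⊗ ι c             ≤⟨ edges≤ ⟩
            ∑ 𝔓 cov ⊕ adjacencies          ≤⟨ ⊕-monoʳ _ adjacencies≤ ⟩
            ∑ 𝔓 cov ⊕ ∑ 𝔓 unc              ≡⟨ sym (∑-+ 𝔓 cov unc) ⟩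
            ∑ 𝔓 (λ e → cov e ⊕ unc e)      ≤⟨ ∑-mono 𝔓 inside ⟩
            ∑ 𝔓 (λ e → [ inc? X e ])       ≤⟨ x≤x+y _ (ι-nonneg ∣ X ∣) ⟩
            ∑ 𝔓 (λ e → [ inc? X e ]) ⊕ ι ∣ X ∣ ≡⟨ trans (∑-inc X) (sym (ι-* ∣ X ∣ ∣ X ∣)) ⟩
            ι (∣ X ∣ * ∣ X ∣) ∎)
            where
            open ≤-Chain
            inside : ∀ e → cov e ⊕ unc e ≼ [ inc? X e ]
            inside e = cases (cov? e)
              where
              cases : Dec (Cov e) → cov e ⊕ unc e ≼ [ inc? X e ]
              cases (yes p) = ≼-trans (≼-reflexive (trans (cong₂ _⊕_ ([]-true (cov? e) p) ([]-false (¬? (cov? e) ×-dec inc? X e) (λ (¬p , _) → ¬p p))) (⊕-identityʳ 1#)))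
                (≼-reflexive (sym ([]-true (inc? X e) (let (f , f∈ , (u∈ , v∈)) = find p in E⊆X f∈ u∈ , E⊆X f∈ v∈))))
              cases (no ¬p) = ≼-trans (≼-reflexive (trans (cong (_⊕ unc e) ([]-false (cov? e) ¬p)) (⊕-identityˡ _)))
                ([]-mono (¬? (cov? e) ×-dec inc? X e) (inc? X e) proj₂)

      -- Maximal dense sets and the edges that touch them.

      Extends : List Block → List Block → Set
      Extends S A = Unique (A ++ S) × 1 ≤ length A × length A + length S < k × ∣ ⋃ (A ++ S) ∣ ≤ ∣ ⋃ S ∣ + a * length A

      extends? : ∀ S A → Dec (Extends S A)
      extends? S A = DecUnique.unique? _≟ˢ_ (A ++ S) ×-dec (1 ≤? length A) ×-dec (length A + length S <? k) ×-dec (∣ ⋃ (A ++ S) ∣ ≤? ∣ ⋃ S ∣ + a * length A)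

      record MaximalDense : Set where
        constructor maximalDense
        field
          S : List Block
          S⊆E : ∀ {B} → B ∈ S → B ∈ E
          uS : Unique S
          1≤S : 1 ≤ length S
          S<k : length S < k
          dS : Dense S
          maximal : ∀ A → (∀ {B} → B ∈ A → B ∈ E) → ¬ Extends S A

      -- An extension adds at most `a` vertices per edge and so keeps density. Lengths stay below
      -- `k`, and `m` bounds how many edges can still be added.
      enlarge : ∀ m S → (∀ {B} → B ∈ S → B ∈ E) → Unique S → 1 ≤ length S → length S < k → Dense S → k ≤ m + length S → MaximalDense
      enlarge zero S _ _ _ S<k _ le = ⊥-elim (<⇒≱ S<k le)
      enlarge (suc m) S S⊆E uS 1≤S S<k dS le with any? (extends? S) (listsUpTo k E)
      ... | no none = maximalDense S S⊆E uS 1≤S S<k dS λ A A⊆E ext → none (lose (∈-listsUpTo k E (All.tabulate A⊆E)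
              (≤-trans (m≤m+n (length A) (length S)) (<⇒≤ (proj₁ (proj₂ (proj₂ ext)))))) ext)
      ... | yes some with find some
      ...   | A , A∈ , u , 1≤A , short , span = enlarge m (A ++ S) (λ p → [ listsUpTo-⊆ k E A∈ , S⊆E ]′ (∈-++⁻ A p)) u
                (subst (1 ≤_) (sym (length-++ A)) (≤-trans 1≤A (m≤m+n (length A) (length S)))) (subst (_< k) (sym (length-++ A)) short)
                (≤-trans span (≤-trans (+-monoˡ-≤ (a * length A) dS) (≤-reflexive (trans (NS.solve 3 (λ a x y → NS.con 1 NS.:+ a NS.:* y NS.:+ a NS.:* x NS.:= NS.con 1 NS.:+ a NS.:* (x NS.:+ y)) refl a (length A) (length S))
                  (cong (λ l → 1 + a * l) (sym (length-++ A)))))))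
                (≤-trans le (≤-trans (≤-reflexive (sym (+-suc m (length S)))) (≤-trans (+-monoʳ-≤ m (+-monoˡ-≤ (length S) 1≤A)) (≤-reflexive (cong (m +_) (sym (length-++ A)))))))

      module Remove (md : MaximalDense) where
        open MaximalDense md

        V : Block
        V = ⋃ S

        Meets : Block → Block → Set
        Meets f p = Sub.Nonempty (f ∩ p)

        meets? : ∀ f p → Dec (Meets f p)
        meets? f p = Sub.nonempty? (f ∩ p)

        out : List Block → Block
        out L = ⋃ L ─ V

        Touching : Block → Set
        Touching f = f ∈ E × f ∉ S × Meets f V

        -- The span may exceed `a` new vertices per edge by 1: the first edge is only known to meet
        -- `V` in one vertex.
        Grown : List Block → Set
        Grown A = Unique (A ++ S) × (∀ {f} → f ∈ A → Touching f) × 1 ≤ length A × length A + length S ≤ k × ∣ ⋃ (A ++ S) ∣ ≤ ∣ V ∣ + a * length A + 1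

        ⋃-++ : ∀ (A B : List Block) → ⋃ (A ++ B) ≡ ⋃ A ∪ ⋃ B
        ⋃-++ [] B = sym (Sub.∪-identityˡ (⋃ B))
        ⋃-++ (x ∷ A) B = trans (cong (x ∪_) (⋃-++ A B)) (sym (Sub.∪-assoc x (⋃ A) (⋃ B)))

        -- With exactly `k` edges the union of `A` and `S` would span at most 1 + 1 + ak vertices
        -- and be tight. Growth therefore never leaves the range in which `S` is maximal.
        grown-short : ∀ {A} → Grown A → length A + length S < k
        grown-short {A} (u , T , _ , le , span) with length A + length S <? k
        ... | yes lt = lt
        ... | no ≮ = ⊥-elim (free (A ++ S) (λ p → [ proj₁ ∘ T , S⊆E ]′ (∈-++⁻ A p)) u (trans (length-++ A) (≤-antisym le (≮⇒≥ ≮)))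
              (≤-trans span (≤-trans (+-monoˡ-≤ 1 (+-monoˡ-≤ (a * length A) dS)) (≤-reflexive (trans
                (NS.solve 3 (λ a x y → NS.con 1 NS.:+ a NS.:* y NS.:+ a NS.:* x NS.:+ NS.con 1 NS.:= NS.con 2 NS.:+ a NS.:* (x NS.:+ y)) refl a (length A) (length S)) (cong (λ l → 2 + a * l) (sym (length-++ A))))))))

        -- A span of at most `∣ V ∣ + a * length A` would be an extension of `S`, against
        -- maximality.
        grown-out : ∀ {A} → Grown A → a * length A ≤ ∣ out A ∣
        grown-out {A} g@(u , T , 1≤A , _ , _) = <⇒≤ (+-cancelˡ-< ∣ V ∣ _ _ (<-≤-trans (≰⇒> (λ span → maximal A (proj₁ ∘ T) (u , 1≤A , grown-short g , span)))
          (≤-trans (Sub.p⊆q⇒∣p∣≤∣q∣ sub) (≤-trans (m≤m+n _ _) (≤-reflexive (∣p∪q∣+∣p∩q∣ V (out A)))))))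
          where
          sub : ⋃ (A ++ S) ⊆ V ∪ out A
          sub {x} x∈ with x Sub.∈? V
          ... | yes p = Sub.x∈p∪q⁺ (inj₁ p)
          ... | no p with Sub.x∈p∪q⁻ (⋃ A) V (subst (x Sub.∈_) (⋃-++ A S) x∈)
          ...   | inj₁ q = Sub.x∈p∪q⁺ (inj₂ (Sub.x∈p∧x∉q⇒x∈p─q q p))
          ...   | inj₂ q = ⊥-elim (p q)

        single : ∀ {f} → Touching f → Grown (f ∷ [])
        single {f} t@(f∈E , f∉S , (x , x∈)) = (All.tabulate (λ p eq → f∉S (subst (_∈ S) (sym eq) p)) ∷ uS) , (λ { (here refl) → t }) , ≤-refl , S<k ,
          ≤-trans (∪-adds f V {a + 1} {1} (trans (sE f∈E) (NS.solve 1 (λ a → NS.con 2 NS.:+ a NS.:= a NS.:+ NS.con 1 NS.:+ NS.con 1) refl a)) (x∈p⇒1≤∣p∣ x∈) ≤-refl)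
            (≤-reflexive (NS.solve 2 (λ a v → a NS.:+ NS.con 1 NS.:+ v NS.:= v NS.:+ a NS.:* NS.con 1 NS.:+ NS.con 1) refl a ∣ V ∣))

        -- The new edge has one vertex in `V` and another in `⋃ A` outside `V`, so it adds at most
        -- `a`.
        attach : ∀ {A g} → Grown A → Touching g → g ∉ A → Meets g (out A) → Grown (g ∷ A)
        attach {A} {g} gr@(u , T , 1≤A , _ , span) t@(g∈E , g∉S , (x , x∈)) g∉A (y , y∈) =
          (All.tabulate (λ {B} p eq → [ (λ q → g∉A (subst (_∈ A) (sym eq) q)) , (λ q → g∉S (subst (_∈ S) (sym eq) q)) ]′ (∈-++⁻ A p)) ∷ u) ,
          (λ { (here refl) → t ; (there p) → T p }) , s≤s z≤n , grown-short gr ,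
          ≤-trans (∪-adds g (⋃ (A ++ S)) {a} {2} (trans (sE g∈E) (+-comm 2 a)) meet span)
            (≤-reflexive (NS.solve 3 (λ a v l → a NS.:+ (v NS.:+ a NS.:* l NS.:+ NS.con 1) NS.:= v NS.:+ a NS.:* (NS.con 1 NS.:+ l) NS.:+ NS.con 1) refl a ∣ V ∣ (length A)))
          where
          x∈g : x Sub.∈ g × x Sub.∈ V
          x∈g = Sub.x∈p∩q⁻ g V x∈
          y∈g : y Sub.∈ g × y Sub.∈ out A
          y∈g = Sub.x∈p∩q⁻ g (out A) y∈
          y∈A : y Sub.∈ ⋃ A × y Sub.∉ V
          y∈A = ∈-─⁻ (⋃ A) V (proj₂ y∈g)
          meet : 2 ≤ ∣ g ∩ ⋃ (A ++ S) ∣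
          meet = two-elements⁻ (Sub.x∈p∩q⁺ (proj₁ x∈g , subst (x Sub.∈_) (sym (⋃-++ A S)) (Sub.x∈p∪q⁺ (inj₂ (proj₂ x∈g)))))
            (Sub.x∈p∩q⁺ (proj₁ y∈g , subst (y Sub.∈_) (sym (⋃-++ A S)) (Sub.x∈p∪q⁺ (inj₁ (proj₁ y∈A))))) (λ { refl → proj₂ y∈A (proj₂ x∈g) })

        -- The touching edges split into classes connected outside V, and each class is wide by maximality.
        spread : ∀ m L → length L ≤ m → Unique L → (∀ {f} → f ∈ L → Touching f) → a * length L ≤ ∣ out L ∣
        grow : ∀ m A L → length L ≤ m → Grown A → Unique L → (∀ {f} → f ∈ L → Touching f × f ∉ A) → a * (length A + length L) ≤ ∣ out A ∪ out L ∣

        spread m [] _ _ _ = ≤-trans (≤-reflexive (*-zeroʳ a)) z≤n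
        spread (suc m) (f ∷ L) (s≤s le) (f∉ ∷ u) T = ≤-trans (grow m (f ∷ []) L le (single (T (here refl))) u
            (λ p → T (there p) , λ { (here refl) → All.lookup f∉ p refl }))
          (Sub.p⊆q⇒∣p∣≤∣q∣ sub)
          where
          sub : out (f ∷ []) ∪ out L ⊆ out (f ∷ L)
          sub x∈ with Sub.x∈p∪q⁻ (out (f ∷ [])) (out L) x∈
          ... | inj₁ p with ∈-─⁻ (f ∪ Sub.⊥) V p
          ...   | q , x∉V = Sub.x∈p∧x∉q⇒x∈p─q (Sub.x∈p∪q⁺ (inj₁ ([ id , ⊥-elim ∘ Sub.∉⊥ ]′ (Sub.x∈p∪q⁻ f Sub.⊥ q)))) x∉V
          sub x∈ | inj₂ p with ∈-─⁻ (⋃ L) V p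
          ...   | q , x∉V = Sub.x∈p∧x∉q⇒x∈p─q (Sub.x∈p∪q⁺ (inj₂ q)) x∉V

        grow m A L le gr u T with any? (λ g → meets? g (out A)) L
        -- No remaining edge meets the outside part of `A`: this class is complete, and the outside
        -- parts of the two lists are disjoint.
        grow m A L le gr u T | no none = begin
            a * (length A + length L)          ≡⟨ *-distribˡ-+ a (length A) (length L) ⟩
            a * length A + a * length L        ≤⟨ +-mono-≤ (grown-out gr) (spread m L le u (proj₁ ∘ T)) ⟩
            ∣ out A ∣ + ∣ out L ∣              ≡⟨ sym (∣∪∣-disjoint (out A) (out L) disj) ⟩
            ∣ out A ∪ out L ∣ ∎
            where
            open ≤-Reasoning
            disj : ∀ {x} → x Sub.∈ out A → x Sub.∉ out L
            disj p q with x∈⋃⁻ L (proj₁ (∈-─⁻ (⋃ L) V q))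
            ... | g , g∈ , x∈g = none (lose g∈ (_ , Sub.x∈p∩q⁺ (x∈g , p)))
        grow zero A (_ ∷ _) () _ _ _ | yes _
        grow zero A [] _ _ _ _ | yes ()
        grow (suc m) A L le gr u T | yes some with find some
        ... | g , g∈ , meets = begin
            a * (length A + length L)          ≤⟨ *-monoʳ-≤ a (≤-trans (+-monoʳ-≤ (length A) L≤) (≤-reflexive (+-suc (length A) (length L')))) ⟩
            a * (length (g ∷ A) + length L')   ≤⟨ grow m (g ∷ A) L' (≤-pred (≤-trans L'< le)) (attach gr (proj₁ (T g∈)) (proj₂ (T g∈)) meets) (Unique.filter⁺ (λ x → ¬? (x ≟ˢ g)) u)
                                                    (λ p → proj₁ (T (proj₁ (L'⁻ p))) , λ { (here eq) → proj₂ (L'⁻ p) eq ; (there q) → proj₂ (T (proj₁ (L'⁻ p))) q }) ⟩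
            ∣ out (g ∷ A) ∪ out L' ∣           ≤⟨ Sub.p⊆q⇒∣p∣≤∣q∣ sub ⟩
            ∣ out A ∪ out L ∣ ∎
            where
            open ≤-Reasoning
            L' : List Block
            L' = filter (λ x → ¬? (x ≟ˢ g)) L
            L'⁻ : ∀ {f} → f ∈ L' → f ∈ L × f ≢ g
            L'⁻ = ∈-filter⁻ (λ x → ¬? (x ≟ˢ g)) {xs = L}
            L≤ : length L ≤ suc (length L')
            L≤ = unique-⊆-length {ys = g ∷ L'} u place
              where
              place : ∀ {x} → x ∈ L → x ∈ g ∷ L'
              place {x} p with x ≟ˢ g
              ... | yes refl = here refl
              ... | no x≢g = there (∈-filter⁺ (λ x → ¬? (x ≟ˢ g)) p x≢g)
            L'< : suc (length L') ≤ length L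
            L'< = unique-⊆-length {xs = g ∷ L'} (All.tabulate (λ p eq → proj₂ (L'⁻ p) (sym eq)) ∷ Unique.filter⁺ (λ x → ¬? (x ≟ˢ g)) u) (λ { (here refl) → g∈ ; (there p) → proj₁ (L'⁻ p) })
            sub : out (g ∷ A) ∪ out L' ⊆ out A ∪ out L
            sub x∈ with Sub.x∈p∪q⁻ (out (g ∷ A)) (out L') x∈
            ... | inj₂ p with ∈-─⁻ (⋃ L') V p
            ...   | q , x∉V = Sub.x∈p∪q⁺ (inj₂ (Sub.x∈p∧x∉q⇒x∈p─q (⋃-mono (proj₁ ∘ L'⁻) q) x∉V))
            sub x∈ | inj₁ p with ∈-─⁻ (g ∪ ⋃ A) V p
            ...   | q , x∉V with Sub.x∈p∪q⁻ g (⋃ A) q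
            ...     | inj₁ r = Sub.x∈p∪q⁺ (inj₂ (Sub.x∈p∧x∉q⇒x∈p─q (x∈⋃⁺ g∈ r) x∉V))
            ...     | inj₂ r = Sub.x∈p∪q⁺ (inj₁ (Sub.x∈p∧x∉q⇒x∈p─q r x∉V))

        touching? : ∀ f → Dec (f ∉ S × Meets f V)
        touching? f = ¬? (f ∈? S) ×-dec meets? f V

        T E' : List Block
        T = filter touching? E
        E' = filter (λ f → ¬? (meets? f V)) E

        few-touching : ∀ X → (∀ {B} → B ∈ E → B ⊆ X) → a * length T ≤ ∣ X ∣
        few-touching X E⊆X = ≤-trans (spread (length T) T ≤-refl (Unique.filter⁺ touching? uE) (∈-filter⁻ touching? {xs = E}))
          (Sub.p⊆q⇒∣p∣≤∣q∣ λ x∈ → sub (proj₁ (∈-─⁻ (⋃ T) V x∈)))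
          where
          sub : ⋃ T ⊆ X
          sub x∈ with x∈⋃⁻ T x∈
          ... | f , f∈ , x∈f = E⊆X (proj₁ (∈-filter⁻ touching? {xs = E} f∈)) x∈f

        few-removed : length E ≤ length E' + (length T + length S)
        few-removed = ≤-trans (unique-⊆-length {ys = E' ++ (T ++ S)} uE place) (≤-reflexive (trans (length-++ E') (cong (length E' +_) (length-++ T))))
          where
          place : ∀ {f} → f ∈ E → f ∈ E' ++ (T ++ S)
          place {f} f∈ with meets? f V | f ∈? S
          ... | no ¬m | _ = ∈-++⁺ˡ (∈-filter⁺ (λ f → ¬? (meets? f V)) f∈ ¬m)
          ... | yes _ | yes f∈S = ∈-++⁺ʳ E' (∈-++⁺ʳ T f∈S)
          ... | yes m | no f∉S = ∈-++⁺ʳ E' (∈-++⁺ˡ (∈-filter⁺ touching? f∈ (f∉S , m)))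

        V⊆ : ∀ X → (∀ {B} → B ∈ E → B ⊆ X) → V ⊆ X
        V⊆ X E⊆X x∈ with x∈⋃⁻ S x∈
        ... | f , f∈ , x∈f = E⊆X (S⊆E f∈) x∈f

        r≤V : 2 + a ≤ ∣ V ∣
        r≤V = large S 1≤S (λ p → p)
          where
          large : ∀ S' → 1 ≤ length S' → (∀ {B} → B ∈ S' → B ∈ S) → 2 + a ≤ ∣ V ∣
          large (f ∷ _) _ sub = subst (_≤ ∣ V ∣) (sE (S⊆E (sub (here refl)))) (Sub.p⊆q⇒∣p∣≤∣q∣ (B⊆⋃ {f} {S} (sub (here refl))))

    -- The first summand pays for the edges touching the removed set, the second for the fewer than
    -- `k` edges of the set itself.
    slack : ℕ
    slack = 2 * (2 + a) + c * k

    -- Removing the span of a maximal dense set, v ≥ 2 + a vertices, costs at most 2(2 + a)|X| + ck.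
    -- With x' vertices left, the bound itself drops by at least 2vx' + slack * v, which covers
    -- this.
    bound-on : ∀ m (X : Block) → ∣ X ∣ ≤ m → ∀ (family : FreeFamily) → (∀ {B} → B ∈ FreeFamily.E family → B ⊆ X) →
      c * length (FreeFamily.E family) ≤ ∣ X ∣ * ∣ X ∣ + slack * ∣ X ∣
    bound-on m X X≤m family E⊆X with dense-in? (FreeFamily.E family) 3
    ... | inj₂ sparse = ≤-trans (Sparse.sparse-bound family X E⊆X sparse) (m≤m+n _ _)
    bound-on zero X X≤0 family E⊆X | inj₁ (S , S⊆E , uS , 1≤S , S≤3 , dS) = ⊥-elim (absurd S 1≤S S⊆E)
      where
      open FreeFamily family
      absurd : ∀ S → 1 ≤ length S → (∀ {B} → B ∈ S → B ∈ E) → ⊥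
      absurd (f ∷ _) _ sub = <⇒≱ (≤-trans (s≤s z≤n) (subst (_≤ ∣ X ∣) (sE (sub (here refl))) (Sub.p⊆q⇒∣p∣≤∣q∣ (E⊆X (sub (here refl)))))) X≤0
    bound-on (suc m) X X≤m family E⊆X | inj₁ (S₀ , S₀⊆E , uS₀ , 1≤S₀ , S₀≤3 , dS₀) = begin
        c * length E                                     ≤⟨ *-monoʳ-≤ c few-removed ⟩
        c * (length E' + (length T + length S))          ≡⟨ NS.solve 4 (λ c e t s → c NS.:* (e NS.:+ (t NS.:+ s)) NS.:= c NS.:* e NS.:+ (c NS.:* t NS.:+ c NS.:* s)) refl c (length E') (length T) (length S) ⟩
        c * length E' + (c * length T + c * length S)    ≤⟨ +-mono-≤ smaller (+-mono-≤ touching (*-monoʳ-≤ c (<⇒≤ S<k))) ⟩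
        (x' * x' + slack * x') + (2 * (2 + a) * (x' + v) + c * k) ≤⟨ +-monoʳ-≤ (x' * x' + slack * x') arithmetic ⟩
        (x' * x' + slack * x') + (2 * v * x' + slack * v) ≤⟨ ≤-trans (m≤m+n _ (v * v)) (≤-reflexive (NS.solve 3 (λ x v K → (x NS.:* x NS.:+ K NS.:* x) NS.:+ (NS.con 2 NS.:* v NS.:* x NS.:+ K NS.:* v) NS.:+ v NS.:* v NS.:= (x NS.:+ v) NS.:* (x NS.:+ v) NS.:+ K NS.:* (x NS.:+ v)) refl x' v slack)) ⟩
        (x' + v) * (x' + v) + slack * (x' + v)           ≡⟨ cong (λ y → y * y + slack * y) x'+v ⟩
        ∣ X ∣ * ∣ X ∣ + slack * ∣ X ∣ ∎
        where
        open ≤-Reasoning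
        open FreeFamily family
        md : MaximalDense family
        md = enlarge family k S₀ S₀⊆E uS₀ 1≤S₀ (≤-trans (s≤s S₀≤3) 4≤k) dS₀ (m≤m+n k (length S₀))
        open MaximalDense md using (S; S<k)
        open Remove family md
        X' : Block
        X' = X ─ V
        x' v : ℕ
        x' = ∣ X' ∣
        v = ∣ V ∣
        x'+v : x' + v ≡ ∣ X ∣
        x'+v = trans (cong (λ p → x' + ∣ p ∣) (sym (Sub.⊆-antisym (Sub.p∩q⊆q X V) (λ x∈ → Sub.x∈p∩q⁺ (V⊆ X E⊆X x∈ , x∈))))) (∣─∣+∣∩∣ X V)
        E'⊆E : ∀ {f} → f ∈ E' → f ∈ E × ¬ Meets f V
        E'⊆E = ∈-filter⁻ (λ f → ¬? (meets? f V)) {xs = E}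
        smaller : c * length E' ≤ x' * x' + slack * x'
        smaller = bound-on m X' (≤-pred (≤-trans (≤-trans (≤-reflexive (+-comm 1 x')) (+-monoʳ-≤ x' (≤-trans (s≤s z≤n) r≤V))) (≤-trans (≤-reflexive x'+v) X≤m))) 
          (record { E = E' ; uE = Unique.filter⁺ (λ f → ¬? (meets? f V)) uE ; sE = sE ∘ proj₁ ∘ E'⊆E ; free = λ Q Q⊆ → free Q (proj₁ ∘ E'⊆E ∘ Q⊆) })
          (λ f∈ x∈ → Sub.x∈p∧x∉q⇒x∈p─q (E⊆X (proj₁ (E'⊆E f∈)) x∈) (λ x∈V → proj₂ (E'⊆E f∈) (_ , Sub.x∈p∩q⁺ (x∈ , x∈V))))
        touching : c * length T ≤ 2 * (2 + a) * (x' + v)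
        touching = begin
          c * length T                    ≤⟨ *-monoˡ-≤ (length T) (*-monoʳ-≤ (2 + a) (≤-trans (+-monoˡ-≤ a 1≤a) (≤-reflexive (cong (a +_) (sym (+-identityʳ a)))))) ⟩
          (2 + a) * (2 * a) * length T    ≡⟨ NS.solve 2 (λ a t → (NS.con 2 NS.:+ a) NS.:* (NS.con 2 NS.:* a) NS.:* t NS.:= NS.con 2 NS.:* (NS.con 2 NS.:+ a) NS.:* (a NS.:* t)) refl a (length T) ⟩
          2 * (2 + a) * (a * length T)    ≤⟨ *-monoʳ-≤ (2 * (2 + a)) (few-touching X E⊆X) ⟩
          2 * (2 + a) * ∣ X ∣             ≡⟨ cong (2 * (2 + a) *_) (sym x'+v) ⟩
          2 * (2 + a) * (x' + v) ∎
        arithmetic : 2 * (2 + a) * (x' + v) + c * k ≤ 2 * v * x' + slack * v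
        arithmetic = begin
          2 * (2 + a) * (x' + v) + c * k             ≡⟨ NS.solve 4 (λ a x v z → NS.con 2 NS.:* (NS.con 2 NS.:+ a) NS.:* (x NS.:+ v) NS.:+ z NS.:= NS.con 2 NS.:* (NS.con 2 NS.:+ a) NS.:* x NS.:+ (NS.con 2 NS.:* (NS.con 2 NS.:+ a) NS.:* v NS.:+ z)) refl a x' v (c * k) ⟩
          2 * (2 + a) * x' + (2 * (2 + a) * v + c * k) ≤⟨ +-mono-≤ (*-monoˡ-≤ x' (*-monoʳ-≤ 2 r≤V)) (+-monoʳ-≤ (2 * (2 + a) * v) (≤-trans (≤-reflexive (sym (*-identityʳ (c * k)))) (*-monoʳ-≤ (c * k) (≤-trans (s≤s z≤n) r≤V)))) ⟩
          2 * v * x' + (2 * (2 + a) * v + c * k * v) ≡⟨ cong (2 * v * x' +_) (sym (*-distribʳ-+ v (2 * (2 + a)) (c * k))) ⟩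
          2 * v * x' + slack * v ∎

    edges-bound : ∀ E → Unique E → (∀ {B} → B ∈ E → ∣ B ∣ ≡ 2 + a) → Free E → c * length E ≤ n * n + slack * n
    edges-bound E uE sE free = subst (λ x → c * length E ≤ x * x + slack * x) (Sub.∣⊤∣≡n n)
      (bound-on ∣ Sub.⊤ {n} ∣ Sub.⊤ ≤-refl (record { E = E ; uE = uE ; sE = sE ; free = free }) (λ _ _ → Sub.∈⊤))

-- From the two bounds to the limit in ℚ.

module DensityLimit where
  open import Defs
  open OrderedFields
  open TightConfigurations
  open LowerBounds
  open UpperBounds
  open import Data.Nat as ℕ using (ℕ; zero; suc; _+_; _*_; _∸_; _≤_; _≥_; z≤n; s≤s)
  import Data.Nat.Properties as ℕₚ
  import Data.Nat.Solver as ℕSolver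
  open import Data.Nat.Divisibility using (_∣_; divides)
  import Data.Integer as ℤ
  open import Data.Integer using (+_; +[1+_])
  import Data.Integer.Properties as ℤₚ
  open import Data.Fin as Fin using (Fin)
  open import Data.Fin.Subset as Sub using (Subset; ⋃)
  import Data.Fin.Subset.Properties as Sub
  open import Data.List using (List; _∷_; length; lookup; map; allFin)
  open import Data.List.Properties using (length-map; length-tabulate)
  open import Data.List.Membership.Propositional using (_∈_)
  open import Data.List.Membership.Propositional.Properties using (∈-map⁻; ∈-lookup)
  import Data.List.Relation.Unary.Any as Any
  open import Data.List.Relation.Unary.Any.Properties using (lookup-index)
  import Data.List.Relation.Unary.All as All
  open import Data.List.Relation.Unary.AllPairs using (_∷_)
  open import Data.List.Relation.Unary.Unique.Propositional using (Unique)
  import Data.List.Relation.Unary.Unique.Propositional.Properties as Unique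
  open import Data.Product using (∃; ∃-syntax; _×_; _,_; proj₁; proj₂)
  open import Data.Sum using (inj₁; inj₂)
  open import Data.Empty using (⊥-elim)
  open import Data.Rational as ℚ using (ℚ; 0ℚ; 1ℚ; mkℚ; toℚᵘ; _<_; _-_; ∣_∣)
  import Data.Rational.Properties as ℚₚ
  import Data.Rational.Unnormalised as ℚᵘ
  open import Data.Rational.Unnormalised using (mkℚᵘ; *≡*; _≃_)
  import Data.Rational.Unnormalised.Properties as ℚᵘₚ
  open import Function using (id)
  open import Relation.Nullary using (¬_)
  open import Relation.Binary.PropositionalEquality hiding ([_]; J)

  private module NS = ℕSolver.+-*-Solver

  ℚ-orderedField : OrderedField
  ℚ-orderedField = record
    { Carrier = ℚ ; _+_ = ℚ._+_ ; _*_ = ℚ._*_ ; -_ = ℚ.-_ ; 0# = 0ℚ ; 1# = 1ℚ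
    ; isCommutativeRing = ℚₚ.+-*-isCommutativeRing
    ; _≤_ = ℚ._≤_ ; isTotalOrder = ℚₚ.≤-isTotalOrder ; _≤?_ = ℚ._≤?_
    ; +-monoʳ-≤ = λ x → ℚₚ.+-monoʳ-≤ x
    ; *-nonneg = λ {x} {y} hx hy → ℚₚ.nonNegative⁻¹ (x ℚ.* y) {{ℚₚ.nonNeg*nonNeg⇒nonNeg x {{ℚ.nonNegative hx}} y {{ℚ.nonNegative hy}}}}
    ; 1≰0 = λ { (ℚ.*≤* (ℤ.+≤+ ())) }
    ; inverse = λ {x} h → let instance nz = ℚₚ.pos⇒nonZero x {{ℚ.positive (ℚₚ.≰⇒> h)}} in ℚ.1/ x , ℚₚ.*-inverseʳ x }

  open FieldTheory ℚ-orderedField using (ι; ι-suc; ι-+; ι-*; ι-mono; ι-cancel-≤; ι-nonneg)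

  toℚᵘ-ι : ∀ n → toℚᵘ (ι n) ≃ mkℚᵘ (+ n) 0
  toℚᵘ-ι zero = ℚᵘₚ.≃-refl
  toℚᵘ-ι (suc n) = ℚᵘₚ.≃-trans (ℚₚ.toℚᵘ-cong (ι-suc n)) (ℚᵘₚ.≃-trans (ℚₚ.toℚᵘ-homo-+ 1ℚ (ι n))
    (ℚᵘₚ.≃-trans (ℚᵘₚ.+-congʳ (toℚᵘ 1ℚ) (toℚᵘ-ι n)) (*≡* (cong (ℤ._* + 1) (cong (λ v → (+ 1) ℤ.+ v) (ℤₚ.*-identityʳ (+ n)))))))

  frac-* : ∀ a d → frac a (suc d) ℚ.* ι (suc d) ≡ ι a
  frac-* a d = ℚₚ.toℚᵘ-injective (ℚᵘₚ.≃-trans (ℚₚ.toℚᵘ-homo-* (frac a (suc d)) (ι (suc d)))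
    (ℚᵘₚ.≃-trans (ℚᵘₚ.*-cong (ℚₚ.toℚᵘ-fromℚᵘ (mkℚᵘ (+ a) d)) (toℚᵘ-ι (suc d))) (ℚᵘₚ.≃-trans (*≡* eq) (ℚᵘₚ.≃-sym (toℚᵘ-ι a)))))
    where
    eq : (+ a ℤ.* + suc d) ℤ.* + 1 ≡ + a ℤ.* + (suc d * 1)
    eq = trans (ℤₚ.*-identityʳ _) (cong (λ v → + a ℤ.* + v) (sym (ℕₚ.*-identityʳ (suc d))))

  archimedean : ∀ ε → 0ℚ < ε → ∃ λ D → 1 ≤ D × 1ℚ ℚ.≤ ε ℚ.* ι D
  archimedean (mkℚ (+ zero) d _) (ℚ.*<* (ℤ.+<+ ()))
  archimedean ε@(mkℚ +[1+ p ] d _) _ = suc d , s≤s z≤n ,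
    ℚₚ.≤-trans (ι-mono {1} {suc p} (s≤s z≤n)) (ℚₚ.≤-reflexive (trans (sym (frac-* (suc p) d)) (cong (ℚ._* ι (suc d)) (ℚₚ.↥p/↧p≡p ε))))
  archimedean (mkℚ ℤ.-[1+ _ ] d _) (ℚ.*<* ())

  module Fractions where
    open FieldTheory ℚ-orderedField using (≤-trans; ≤-reflexive; +-monoˡ-≤; *-monoʳ-≤; *-monoˡ-≤; *-identityʳ; *-nonneg; solve; _:=_; _:+_; _:*_; _:-_)

    -- A deviation of at least ε is at least 1/D; multiplied by the denominators it becomes an
    -- inequality between natural numbers.
    clear-denominators : ∀ {x y ε} {p q N M D} → x ℚ.* ι N ≡ ι p → y ℚ.* ι M ≡ ι q → 1ℚ ℚ.≤ ε ℚ.* ι D → ε ℚ.≤ x ℚ.- y →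
      N * M + D * (q * N) ≤ D * (p * M)
    clear-denominators {x} {y} {ε} {p} {q} {N} {M} {D} xN yM 1≤εD ε≤ = ι-cancel-≤ (N * M + D * (q * N)) (D * (p * M)) (≤-trans (≤-reflexive lhs) (≤-trans
        (+-monoˡ-≤ (ι D ℚ.* (ι q ℚ.* ι N)) {ι N ℚ.* ι M} {ι N ℚ.* ι M ℚ.* ((x ℚ.- y) ℚ.* ι D)} (≤-trans (≤-reflexive (sym (*-identityʳ (ι N ℚ.* ι M)))) (≤-trans (*-monoʳ-≤ NM-nonneg 1≤εD) (*-monoʳ-≤ NM-nonneg (*-monoˡ-≤ (ι-nonneg D) ε≤)))))
        (≤-reflexive rhs)))
      where
      NM-nonneg : 0ℚ ℚ.≤ ι N ℚ.* ι M
      NM-nonneg = *-nonneg (ι-nonneg N) (ι-nonneg M)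
      lhs : ι (N * M + D * (q * N)) ≡ ι N ℚ.* ι M ℚ.+ ι D ℚ.* (ι q ℚ.* ι N)
      lhs = trans (ι-+ (N * M) _) (cong₂ ℚ._+_ (ι-* N M) (trans (ι-* D (q * N)) (cong (ι D ℚ.*_) (ι-* q N))))
      rhs : ι N ℚ.* ι M ℚ.* ((x ℚ.- y) ℚ.* ι D) ℚ.+ ι D ℚ.* (ι q ℚ.* ι N) ≡ ι (D * (p * M))
      rhs = trans (cong (λ v → ι N ℚ.* ι M ℚ.* ((x ℚ.- y) ℚ.* ι D) ℚ.+ ι D ℚ.* (v ℚ.* ι N)) (sym yM))
        (trans (solve 5 (λ x y N M D → N :* M :* ((x :- y) :* D) :+ D :* (y :* M :* N) := D :* (x :* N :* M)) refl x y (ι N) (ι M) (ι D))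
          (trans (cong (λ v → ι D ℚ.* (v ℚ.* ι M)) xN) (trans (cong (ι D ℚ.*_) (sym (ι-* p M))) (sym (ι-* D (p * M))))))

  open Fractions using (clear-denominators)

  module _ {n r : ℕ} (H : Hypergraph r n) where

    lookup-injective : ∀ {E : List (Subset n)} → Unique E → ∀ {i j} → lookup E i ≡ lookup E j → i ≡ j
    lookup-injective {_ ∷ _} _ {Fin.zero} {Fin.zero} _ = refl
    lookup-injective {x ∷ E} (x∉ ∷ _) {Fin.zero} {Fin.suc j} eq = ⊥-elim (All.lookup x∉ (∈-lookup {xs = E} j) eq)
    lookup-injective {x ∷ E} (x∉ ∷ _) {Fin.suc i} {Fin.zero} eq = ⊥-elim (All.lookup x∉ (∈-lookup {xs = E} i) (sym eq))
    lookup-injective {_ ∷ _} (_ ∷ u) {Fin.suc i} {Fin.suc j} eq = cong Fin.suc (lookup-injective u eq)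

    -- A list without repetition yields an injective choice of positions; `free⇒spanMore` goes back,
    -- as the edges of `H` do not repeat.
    spanMore⇒free : ∀ {s k} → KSpanMore s k H → ∀ Q → (∀ {B} → B ∈ Q → B ∈ edges H) → Unique Q → length Q ≡ k → s ℕ.< Sub.∣ ⋃ Q ∣
    spanMore⇒free {s} sm Q Q⊆ uQ refl = ℕₚ.<-≤-trans (sm g g-injective) (Sub.p⊆q⇒∣p∣≤∣q∣ sub)
      where
      position : ∀ i → lookup Q i ∈ edges H
      position i = Q⊆ (∈-lookup {xs = Q} i)
      g : Fin (length Q) → Fin (numEdges H)
      g i = Any.index (position i)
      g-lookup : ∀ i → lookup Q i ≡ lookup (edges H) (g i)
      g-lookup i = lookup-index (position i)
      g-injective : ∀ {i j} → g i ≡ g j → i ≡ j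
      g-injective {i} {j} eq = lookup-injective uQ (trans (g-lookup i) (trans (cong (lookup (edges H)) eq) (sym (g-lookup j))))
      sub : span H g Sub.⊆ ⋃ Q
      sub x∈ with x∈⋃⁻ (map (λ i → lookup (edges H) (g i)) (allFin (length Q))) x∈
      ... | B , B∈ , x∈B with ∈-map⁻ (λ i → lookup (edges H) (g i)) B∈
      ...   | i , _ , refl = x∈⋃⁺ (∈-lookup {xs = Q} i) (subst (_ Sub.∈_) (sym (g-lookup i)) x∈B)

    free⇒spanMore : ∀ {s k} → (∀ Q → (∀ {B} → B ∈ Q → B ∈ edges H) → Unique Q → length Q ≡ k → s ℕ.< Sub.∣ ⋃ Q ∣) → KSpanMore s k H
    free⇒spanMore {k = k} free g g-injective = free (map (λ i → lookup (edges H) (g i)) (allFin k)) inside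
      (Unique.map⁺ (λ eq → g-injective (lookup-injective (simple H) eq)) (Unique.allFin⁺ k))
      (trans (length-map (λ i → lookup (edges H) (g i)) (allFin k)) (length-tabulate {n = k} id))
      where
      inside : ∀ {B} → B ∈ map (λ i → lookup (edges H) (g i)) (allFin k) → B ∈ edges H
      inside B∈ with ∈-map⁻ (λ i → lookup (edges H) (g i)) B∈
      ... | i , _ , refl = ∈-lookup {xs = edges H} (g i)

  -- A deviation of 1/D upwards would put c f above n² by at least n²/D, whereas the upper bound
  -- leaves only K n.
  too-many : ∀ {c f K D n} → 1 ≤ c → c * f ≤ n * n + K * n → D * K ℕ.< n → ¬ (n * n * c + D * (1 * (n * n)) ≤ D * (f * c))
  too-many {c} {f} {K} {D} {n} 1≤c upper large h = ℕₚ.<⇒≱ (ℕₚ.*-monoˡ-< n {{ℕ.>-nonZero (ℕₚ.≤-trans (s≤s z≤n) large)}} large) (ℕₚ.+-cancelʳ-≤ (D * (n * n)) _ _ (begin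
    n * n + D * (n * n)              ≤⟨ ℕₚ.+-mono-≤ (ℕₚ.≤-trans (ℕₚ.≤-reflexive (sym (ℕₚ.*-identityʳ (n * n)))) (ℕₚ.*-monoʳ-≤ (n * n) 1≤c)) (ℕₚ.≤-reflexive (cong (D *_) (sym (ℕₚ.*-identityˡ (n * n))))) ⟩
    n * n * c + D * (1 * (n * n))    ≤⟨ h ⟩
    D * (f * c)                      ≤⟨ ℕₚ.*-monoʳ-≤ D (ℕₚ.≤-trans (ℕₚ.≤-reflexive (ℕₚ.*-comm f c)) upper) ⟩
    D * (n * n + K * n)              ≡⟨ NS.solve 3 (λ D n K → D NS.:* (n NS.:* n NS.:+ K NS.:* n) NS.:= D NS.:* K NS.:* n NS.:+ D NS.:* (n NS.:* n)) refl D n K ⟩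
    D * K * n + D * (n * n) ∎))
    where open ℕₚ.≤-Reasoning

  -- Precision s = 2D yields the fraction 2D / (2D + 2) = 1 - 1/(D + 1), strictly better than 1 -
  -- 1/D. The difference beats the terms of lower order once n is large.
  too-few : ∀ {c f D n M} → 1 ≤ c → M + n ≡ n * n → M * (2 * D) ℕ.< suc f * (c * (2 + 2 * D)) → D * c * (2 + 2 * D) + 2 * D * D ℕ.< n →
    ¬ (c * (n * n) + D * (f * c) ≤ D * (1 * (n * n)))
  too-few {c} {f} {D} {n} {M} 1≤c M+n lower large h = ℕₚ.<⇒≱ big (ℕₚ.+-cancelʳ-≤ (2 * D * N) _ _ (begin
    2 * N + 2 * D * N                                  ≡⟨ NS.solve 2 (λ D N → NS.con 2 NS.:* N NS.:+ NS.con 2 NS.:* D NS.:* N NS.:= N NS.:* NS.con 1 NS.:* (NS.con 2 NS.:+ NS.con 2 NS.:* D)) refl D N ⟩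
    N * 1 * t                                          ≤⟨ ℕₚ.*-monoˡ-≤ t (ℕₚ.*-monoʳ-≤ N 1≤c) ⟩
    N * c * t                                          ≤⟨ ℕₚ.+-cancelʳ-≤ (D * (f * c) * t + D * N * s) _ _ collected ⟩
    D * c * t + 2 * D * D * n + 2 * D * N ∎))
    where
    open ℕₚ.≤-Reasoning
    N s t : ℕ
    N = n * n
    s = 2 * D
    t = 2 + 2 * D
    n-nonZero : ℕ.NonZero n
    n-nonZero = ℕ.>-nonZero (ℕₚ.≤-trans (s≤s z≤n) large)
    collected : N * c * t + (D * (f * c) * t + D * N * s) ≤ D * c * t + 2 * D * D * n + 2 * D * N + (D * (f * c) * t + D * N * s)
    collected = begin
      N * c * t + (D * (f * c) * t + D * N * s)
        ≡⟨ NS.solve 6 (λ N c t D f s → N NS.:* c NS.:* t NS.:+ (D NS.:* (f NS.:* c) NS.:* t NS.:+ D NS.:* N NS.:* s) NS.:= (c NS.:* N NS.:+ D NS.:* (f NS.:* c)) NS.:* t NS.:+ D NS.:* N NS.:* s) refl N c t D f s ⟩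
      (c * N + D * (f * c)) * t + D * N * s
        ≤⟨ ℕₚ.+-mono-≤ (ℕₚ.*-monoˡ-≤ t h) (ℕₚ.≤-reflexive (cong (λ v → D * v * s) (sym M+n))) ⟩
      D * (1 * N) * t + D * (M + n) * s
        ≡⟨ NS.solve 5 (λ D N M n s → D NS.:* (NS.con 1 NS.:* N) NS.:* (NS.con 2 NS.:+ s) NS.:+ D NS.:* (M NS.:+ n) NS.:* s NS.:= D NS.:* (M NS.:* s) NS.:+ (D NS.:* n NS.:* s NS.:+ NS.con 2 NS.:* D NS.:* N NS.:+ D NS.:* N NS.:* s)) refl D N M n s ⟩
      D * (M * s) + (D * n * s + 2 * D * N + D * N * s)
        ≤⟨ ℕₚ.+-monoˡ-≤ _ (ℕₚ.*-monoʳ-≤ D (ℕₚ.<⇒≤ lower)) ⟩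
      D * (suc f * (c * t)) + (D * n * s + 2 * D * N + D * N * s)
        ≡⟨ NS.solve 6 (λ D f c t n N → D NS.:* ((NS.con 1 NS.:+ f) NS.:* (c NS.:* t)) NS.:+ (D NS.:* n NS.:* (NS.con 2 NS.:* D) NS.:+ NS.con 2 NS.:* D NS.:* N NS.:+ D NS.:* N NS.:* (NS.con 2 NS.:* D)) NS.:=
             D NS.:* c NS.:* t NS.:+ NS.con 2 NS.:* D NS.:* D NS.:* n NS.:+ NS.con 2 NS.:* D NS.:* N NS.:+ (D NS.:* (f NS.:* c) NS.:* t NS.:+ D NS.:* N NS.:* (NS.con 2 NS.:* D))) refl D f c t n N ⟩
      D * c * t + 2 * D * D * n + 2 * D * N + (D * (f * c) * t + D * N * s) ∎
    big : D * c * t + 2 * D * D * n ℕ.< 2 * N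
    big = begin-strict
      D * c * t + 2 * D * D * n        ≤⟨ ℕₚ.+-monoˡ-≤ (2 * D * D * n) (ℕₚ.m≤m*n (D * c * t) n {{n-nonZero}}) ⟩
      D * c * t * n + 2 * D * D * n    ≡⟨ sym (ℕₚ.*-distribʳ-+ n (D * c * t) (2 * D * D)) ⟩
      (D * c * t + 2 * D * D) * n      <⟨ ℕₚ.*-monoˡ-< n {{n-nonZero}} large ⟩
      N                                ≤⟨ ℕₚ.m≤m+n N (N + 0) ⟩
      2 * N ∎

  abs-< : ∀ {x y ε} → ¬ (ε ℚ.≤ x - y) → ¬ (ε ℚ.≤ y - x) → ∣ x - y ∣ < ε
  abs-< {x} {y} {ε} h₁ h₂ with ℚₚ.∣p∣≡p∨∣p∣≡-p (x - y)
  ... | inj₁ eq = subst (_< ε) (sym eq) (ℚₚ.≰⇒> h₁)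
  ... | inj₂ eq = subst (_< ε) (sym (trans eq (swap x y))) (ℚₚ.≰⇒> h₂)
    where
    open FieldTheory ℚ-orderedField using (solve; _:=_; _:-_; :-_)
    swap : ∀ x y → ℚ.- (x - y) ≡ y - x
    swap = solve 2 (λ x y → :- (x :- y) := y :- x) refl

  module _ (a h : ℕ) (2≤h : 2 ≤ h) (2≤a : 2 ≤ a) (3h≤a²+4 : 3 * h ≤ a * a + 4) (f : ℕ → ℕ)
    (f-max : ∀ n → n ≥ 1 → IsMaxEdges (2 + a) n (a * (2 * h) + 2) (2 * h) (f n)) where

    private
      k c : ℕ
      k = 2 * h
      c = (2 + a) * (1 + a)

    2≤k : 2 ≤ k
    2≤k = ℕₚ.≤-trans 2≤h (ℕₚ.m≤m+n h _)

    density-limit : (ε : ℚ) → 0ℚ < ε → ∃[ N ] (∀ n → n ≥ N → n ≥ 1 → ∣ frac (f n) (n * n) - frac 1 c ∣ < ε)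
    density-limit ε 0<ε with archimedean ε 0<ε
    ... | D , 1≤D , 1≤εD = from-free (eventually-large-configuration-free ℚ-orderedField a k (2 * D) 2≤a 2≤k)
      where
      K rest : ℕ
      K = 2 * (2 + a) + c * k
      rest = suc (D * K) + suc (D * c * (2 + 2 * D) + 2 * D * D)
      1≤c : 1 ≤ c
      1≤c = s≤s z≤n
      threshold-form : ∀ l m → l ≡ k → (a * k + 2 ℕ.< m → ¬ (m ≤ 2 + a * l)) × (¬ (m ≤ 2 + a * l) → a * k + 2 ℕ.< m)
      threshold-form l m refl = (λ lt le → ℕₚ.<⇒≱ lt (ℕₚ.≤-trans le (ℕₚ.≤-reflexive (ℕₚ.+-comm 2 (a * k))))) ,
        (λ nle → subst (ℕ._< m) (ℕₚ.+-comm 2 (a * k)) (ℕₚ.≰⇒> nle))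
      upper : ∀ n → n ≥ 1 → c * f n ≤ n * n + K * n
      upper n n≥1 with f-max n n≥1
      ... | (H , sm , eq) , _ = subst (λ e → c * e ≤ n * n + K * n) eq
        (UpperBound.edges-bound ℚ-orderedField a h n 2≤h (ℕₚ.≤-trans (s≤s z≤n) 2≤a) 3h≤a²+4 (edges H) (simple H) (All.lookup (uniform H))
          (λ Q Q⊆ uQ len → proj₁ (threshold-form (length Q) Sub.∣ ⋃ Q ∣ len) (spanMore⇒free H sm Q Q⊆ uQ len)))
      lower : ∀ n M → n ≥ 1 → M + n ≡ n * n → LargeConfigurationFree a k (2 * D) n → M * (2 * D) ℕ.< suc (f n) * (c * (2 + 2 * D))
      lower n M n≥1 M+n (S , uS , sS , free , many) = ℕₚ.<-≤-trans (many M M+n) (ℕₚ.*-monoˡ-≤ (c * (2 + 2 * D)) (s≤s (proj₂ (f-max n n≥1) H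
          (free⇒spanMore H (λ Q Q⊆ uQ len → proj₂ (threshold-form (length Q) Sub.∣ ⋃ Q ∣ len) (free Q Q⊆ uQ len))))))
        where
        H : Hypergraph (2 + a) n
        H = record { edges = S ; uniform = sS ; simple = uS }
      near : ∀ n' → (n : ℕ) → n ≡ 2 + n' → rest ≤ n → LargeConfigurationFree a k (2 * D) n → ∣ frac (f n) (n * n) - frac 1 c ∣ < ε
      near n' n refl rest≤n free = abs-< {frac (f n) (n * n)} {frac 1 c}
          (λ le → too-many {c} {f n} {K} {D} {n} 1≤c (upper n (s≤s z≤n)) (ℕₚ.≤-trans (ℕₚ.m≤m+n (suc (D * K)) _) rest≤n)
            (clear-denominators {frac (f n) (n * n)} {frac 1 c} {ε} {f n} {1} {n * n} {c} {D} (frac-* (f n) (suc (n' + suc n' * n))) (frac-* 1 (a + suc a * (1 + a))) 1≤εD le))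
          (λ le → too-few {c} {f n} {D} {n} {M} 1≤c M+n (lower n M (s≤s z≤n) M+n free) (ℕₚ.≤-trans (ℕₚ.m≤n+m _ (suc (D * K))) rest≤n)
            (clear-denominators {frac 1 c} {frac (f n) (n * n)} {ε} {1} {f n} {c} {n * n} {D} (frac-* 1 (a + suc a * (1 + a))) (frac-* (f n) (suc (n' + suc n' * n))) 1≤εD le))
        where
        M : ℕ
        -- This is n(n - 1), since n is `2 + n'`.
        M = suc n' * n
        M+n : M + n ≡ n * n
        M+n = ℕₚ.+-comm M n
      from-free : (∃ λ N → ∀ n' → N ≤ 2 + n' → LargeConfigurationFree a k (2 * D) (2 + n')) → ∃[ N ] (∀ n → n ≥ N → n ≥ 1 → ∣ frac (f n) (n * n) - frac 1 c ∣ < ε)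
      from-free (N , free) = 2 + (N + rest) , λ
        { (suc zero) (s≤s ()) _
        ; (suc (suc n')) n≥ _ → near n' (2 + n') refl (ℕₚ.≤-trans (ℕₚ.≤-trans (ℕₚ.m≤n+m rest N) (ℕₚ.m≤n+m (N + rest) 2)) n≥)
            (free n' (ℕₚ.≤-trans (ℕₚ.≤-trans (ℕₚ.m≤m+n N rest) (ℕₚ.m≤n+m (N + rest) 2)) n≥)) }

open import Defs
open import Data.Nat using (ℕ; _+_; _*_; _∸_; _≤_; _≥_)
open import Data.Nat.Divisibility using (_∣_)
open import Data.Product using (∃-syntax)
open import Data.Rational using (ℚ; _<_; _-_; ∣_∣; 0ℚ)
open import Data.Nat using (zero; suc; s≤s; z≤n)
import Data.Nat.Properties as ℕₚ
import Data.Nat.Solver as ℕSolver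
open import Data.Nat.Divisibility using (divides)
open import Relation.Binary.PropositionalEquality using (_≡_; refl; sym; trans; cong; subst)
open DensityLimit using (density-limit)

private module NS = ℕSolver.+-*-Solver

theorem1p2 : (k r : ℕ) → k ≥ 4 → 2 ∣ k → r ≥ 3
    → 3 * k ≤ 2 * ((r ∸ 2) * (r ∸ 2)) + 8
    → (f : ℕ → ℕ) → (∀ n → n ≥ 1 → IsMaxEdges r n ((r ∸ 2) * k + 2) k (f n))
    → (ε : ℚ) → 0ℚ < ε
    → ∃[ N ] (∀ n → n ≥ N → n ≥ 1
    → ∣ frac (f n) (n * n) - frac 1 (r * r ∸ r) ∣ < ε)
theorem1p2 k zero _ _ () _
theorem1p2 k (suc zero) _ _ (s≤s ()) _
theorem1p2 k (suc (suc a)) k≥4 (divides h k≡h*2) _ 3k≤ f f-max = subst Claim c≡ (density-limit a h 2≤h 2≤a 3h≤ f (subst Maximal k≡2h f-max))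
  where
  Claim Maximal : ℕ → Set
  Claim d = (ε : ℚ) → 0ℚ < ε → ∃[ N ] (∀ n → n ≥ N → n ≥ 1 → ∣ frac (f n) (n * n) - frac 1 d ∣ < ε)
  Maximal k = ∀ n → n ≥ 1 → IsMaxEdges (2 + a) n (a * k + 2) k (f n)
  k≡2h : k ≡ 2 * h
  k≡2h = trans k≡h*2 (ℕₚ.*-comm h 2)
  c≡ : (2 + a) * (1 + a) ≡ (2 + a) * (2 + a) ∸ (2 + a)
  c≡ = sym (trans (cong (_∸ (2 + a)) (NS.solve 1 (λ a → (NS.con 2 NS.:+ a) NS.:* (NS.con 2 NS.:+ a) NS.:= (NS.con 2 NS.:+ a) NS.:* (NS.con 1 NS.:+ a) NS.:+ (NS.con 2 NS.:+ a)) refl a))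
    (ℕₚ.m+n∸n≡m ((2 + a) * (1 + a)) (2 + a)))
  2≤h : 2 ≤ h
  2≤h = ℕₚ.*-cancelˡ-≤ 2 (subst (4 ≤_) k≡2h k≥4)
  -- Half of the hypothesis on `r`, which is r - 2 ≥ √(3k/2 - 4) squared and cleared of fractions.
  3h≤ : 3 * h ≤ a * a + 4
  3h≤ = ℕₚ.*-cancelˡ-≤ 2 (ℕₚ.≤-trans (ℕₚ.≤-reflexive (trans (NS.solve 1 (λ h → NS.con 2 NS.:* (NS.con 3 NS.:* h) NS.:= NS.con 3 NS.:* (NS.con 2 NS.:* h)) refl h) (cong (3 *_) (sym k≡2h))))
    (ℕₚ.≤-trans 3k≤ (ℕₚ.≤-reflexive (NS.solve 1 (λ x → NS.con 2 NS.:* x NS.:+ NS.con 8 NS.:= NS.con 2 NS.:* (x NS.:+ NS.con 4)) refl (a * a)))))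
  -- From 6 ≤ 3h ≤ a² + 4.
  2≤a : 2 ≤ a
  2≤a = at-least-two a (ℕₚ.+-cancelʳ-≤ 4 2 (a * a) (ℕₚ.≤-trans (ℕₚ.*-monoʳ-≤ 3 2≤h) 3h≤))
    where
    at-least-two : ∀ a → 2 ≤ a * a → 2 ≤ a
    at-least-two (suc zero) (s≤s ())
    at-least-two (suc (suc a)) _ = s≤s (s≤s z≤n)
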